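{- Let $R$ be a finite valuation ring with residue field of odd size $q$ and with uniformizer of nilpotency degree $\ell$. For $n\geq 2$, \[ \mathrm{iso}(\mathrm{Um}(R^n))=\tfrac12 q^{(n-1)\ell}\big(1-q^{ -(n-1)/2}\big)\ \text{ if } n\text{ is odd},\qquad \tfrac12 q^{(n-1)\ell}\big(1-q^{ -n/2}\big)\geq \mathrm{iso}(\mathrm{Um}(R^n))\geq \tfrac12 q^{(n-1)\ell}\big(1-q^{ -(n-1)/2}\big)\ \text{ if } n\text{ is even}. \] For $n\geq 3$, \[ \mathrm{iso}(\mathrm{Um}_0(R^n))\geq \tfrac12 q^{(n-2)(\ell-1)}\Big(\tfrac{q^{n-1}-1}{q-1}-q^{n/2-1}\Big)\ \text{ if } n\text{ is odd},\qquad \mathrm{iso}(\mathrm{Um}_0(R^n))= \tfrac12 q^{(n-2)(\ell-1)}\Big(\tfrac{q^{n-1}-1}{q-1}-q^{n/2-1}\Big)\ \text{ if } n\text{ is even}. \]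
   Context: Rings are commutative with identity. A finite valuation ring is a finite local principal ring; its maximal ideal is $(\pi)$, $q=|R/(\pi)|$, and $\ell$ is the smallest positive integer with $\pi^\ell=0$. $R^{n,u}$ is the set of $n$-tuples whose entries generate $R$ as an ideal; $R^\times$ is the unit group. Dot product: $a\cdot b=\sum_i a_ib_i$. $\mathrm{Um}(R^n)$ ($n\geq2$) is the bipartite graph on two copies $\{a_\bullet\},\{b_\circ\}$ of $R^{n,u}$ with $a_\bullet\sim b_\circ$ iff $a\cdot b=1$; $\mathrm{Um}_0(R^n)$ ($n\geq3$) is the bipartite graph on two copies of $R^{n,u}/R^\times$ with $[a]_\bullet\sim[b]_\circ$ iff $a\cdot b=0$. For a connected graph $X$, $\mathrm{iso}(X)=\min e(U,W)/\min\{|U|,|W|\}$ over all partitions of the vertex set into two non-empty sets $U,W$, where $e(U,W)$ counts edges between $U$ and $W$. -}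

module Defs where

open import Data.Nat as ℕ using (ℕ; zero; suc)
open import Data.Fin as Fin using (Fin; toℕ)
open import Data.Fin.Properties using () renaming (_≟_ to _≟ᶠ_)
open import Data.Bool using (Bool; true; false; not; _∧_; _∨_; if_then_else_)
open import Data.List using (List; []; _∷_; map; concatMap; filterᵇ; length; allFin; foldr; zip; [_])
open import Data.Bool.ListAction using (any; all)
open import Data.Vec.Functional as VF using () renaming (_∷_ to _∷ᶠ_)
open import Data.Product using (Σ; ∃; _×_; _,_; proj₁; proj₂)
open import Data.Integer using (+_)
open import Data.Rational using (ℚ; 0ℚ; _⊓_) renaming (_/_ to _/ℚ_)
open import Relation.Nullary using (¬_; does)
open import Relation.Binary.PropositionalEquality using (_≡_)
open import Algebra.Structures using (IsCommutativeRing)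
open import Function using (_⇔_)

-- A finite commutative ring with identity, presented (up to isomorphism)
-- on the carrier Fin N with propositional equality.

_<ᵇ_ : ∀ {N} → Fin N → Fin N → Bool
x <ᵇ y = toℕ x ℕ.<ᵇ toℕ y

record FinCommRing : Set where
  infixl 7 _*_
  infixl 6 _+_
  field
    N      : ℕ
    _+_    : Fin N → Fin N → Fin N
    _*_    : Fin N → Fin N → Fin N
    -_     : Fin N → Fin N
    0#     : Fin N
    1#     : Fin N
    isCommutativeRing : IsCommutativeRing _≡_ _+_ _*_ -_ 0# 1#

  Elt : Set
  Elt = Fin N

  elems : List Elt
  elems = allFin N

  _≟_ : (x y : Elt) → Bool
  x ≟ y = does (x ≟ᶠ y)

  _^ᴿ_ : Elt → ℕ → Elt
  x ^ᴿ zero  = 1#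
  x ^ᴿ suc k = x * (x ^ᴿ k)

  IsUnit : Elt → Set
  IsUnit x = ∃ λ y → x * y ≡ 1#

  isUnitᵇ : Elt → Bool
  isUnitᵇ x = any (λ y → (x * y) ≟ 1#) elems

  record IsIdeal (I : Elt → Set) : Set where
    field
      zero∈ : I 0#
      +-closed : ∀ {x y} → I x → I y → I (x + y)
      *-closed : ∀ r {x} → I x → I (r * x)

  _∈⟨_⟩ : Elt → Elt → Set
  x ∈⟨ g ⟩ = ∃ λ y → x ≡ g * y

  _∈⟨_⟩ᵇ : Elt → Elt → Bool
  x ∈⟨ g ⟩ᵇ = any (λ y → x ≟ (g * y)) elems

  -- local: 1 ≠ 0 and the non-units are closed under addition
  -- (equivalently, the non-units form the unique maximal ideal)
  IsLocal : Set
  IsLocal = ¬ (0# ≡ 1#) × (∀ x y → ¬ IsUnit x → ¬ IsUnit y → ¬ IsUnit (x + y))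

  IsPrincipal : Set₁
  IsPrincipal = (I : Elt → Set) → IsIdeal I → ∃ λ g → ∀ x → I x ⇔ (x ∈⟨ g ⟩)

  -- π generates the maximal ideal (= the set of non-units)
  IsUniformizer : Elt → Set
  IsUniformizer π = ∀ x → (¬ IsUnit x) ⇔ (x ∈⟨ π ⟩)

  IsNilpotencyDegree : Elt → ℕ → Set
  IsNilpotencyDegree π ℓ =
    (1 ℕ.≤ ℓ) × (π ^ᴿ ℓ ≡ 0#) × (∀ k → 1 ℕ.≤ k → k ℕ.< ℓ → ¬ (π ^ᴿ k ≡ 0#))

  -- |R/(π)| : number of cosets x + (π); counted by the least (in the
  -- order of Fin N) element of each coset.
  residueSize : Elt → ℕ
  residueSize π =
    length (filterᵇ (λ x → all (λ y → not ((y <ᵇ x) ∧ ((x + (- y)) ∈⟨ π ⟩ᵇ))) elems) elems)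

  IsFiniteValuationRing : Set₁
  IsFiniteValuationRing = IsLocal × IsPrincipal

  Tup : ℕ → Set
  Tup n = Fin n → Elt

  allTups : (n : ℕ) → List (Tup n)
  allTups zero    = [ (λ ()) ]
  allTups (suc n) = concatMap (λ a → map (λ v → a ∷ᶠ v) (allTups n)) elems

  dot : ∀ {n} → Tup n → Tup n → Elt
  dot {zero}  a b = 0#
  dot {suc n} a b = (a Fin.zero * b Fin.zero) + dot (VF.tail a) (VF.tail b)

  isUnimodularᵇ : ∀ {n} → Tup n → Bool
  isUnimodularᵇ {n} a = any (λ c → dot c a ≟ 1#) (allTups n)

  unimodular : (n : ℕ) → List (Tup n)
  unimodular n = filterᵇ isUnimodularᵇ (allTups n)

  scale : ∀ {n} → Elt → Tup n → Tup n
  scale u a i = u * a i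

  lexLt : ∀ {n} → Tup n → Tup n → Bool
  lexLt {zero}  a b = false
  lexLt {suc n} a b =
    (a Fin.zero <ᵇ b Fin.zero) ∨
    ((a Fin.zero ≟ b Fin.zero) ∧ lexLt (VF.tail a) (VF.tail b))

  -- R^{n,u}/R^× : one representative (the lexicographically least) per
  -- orbit of the unit group
  unimodularModUnits : (n : ℕ) → List (Tup n)
  unimodularModUnits n =
    filterᵇ (λ a → all (λ u → not (isUnitᵇ u ∧ lexLt (scale u a) a)) elems)
           (unimodular n)

  -- bipartite graphs: vertex (true , a) = a_•, (false , b) = b_∘
  Vtx : ℕ → Set
  Vtx n = Bool × Tup n

  bip : ∀ {n} → List (Tup n) → List (Vtx n)
  bip vs = map (true ,_) vs Data.List.++ map (false ,_) vs

  UmAdj : ∀ {n} → Vtx n → Vtx n → Bool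
  UmAdj (true  , a) (false , b) = dot a b ≟ 1#
  UmAdj (false , b) (true  , a) = dot a b ≟ 1#
  UmAdj _ _ = false

  Um0Adj : ∀ {n} → Vtx n → Vtx n → Bool
  Um0Adj (true  , a) (false , b) = dot a b ≟ 0#
  Um0Adj (false , b) (true  , a) = dot a b ≟ 0#
  Um0Adj _ _ = false

-- Isoperimetric number of a finite graph given by a duplicate-free vertex
-- list and a symmetric Bool-valued adjacency.

-- a / d as a rational (d = 0 never occurs below; it is sent to 0)
_/ᵣ_ : ℕ → ℕ → ℚ
a /ᵣ zero  = 0ℚ
a /ᵣ suc d = (+ a) /ℚ (suc d)

ℕ→ℚ : ℕ → ℚ
ℕ→ℚ a = (+ a) /ℚ 1

allBools : ℕ → List (List Bool)
allBools zero    = [ [] ]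
allBools (suc m) = concatMap (λ b → map (b ∷_) (allBools m)) (true ∷ false ∷ [])

count : ∀ {A : Set} → (A → Bool) → List A → ℕ
count p xs = length (filterᵇ p xs)

module _ {V : Set} (vs : List V) (adj : V → V → Bool) where

  -- for a labelling p (true = U, false = W): the ratio e(U,W)/min(|U|,|W|),
  -- or nothing if U or W is empty
  ratio : List Bool → List ℚ
  ratio p with count (λ x → x) p ℕ.⊓ count not p
  ... | zero  = []
  ... | suc k =
    let tagged = zip p vs
        Us = map proj₂ (filterᵇ proj₁ tagged)
        Ws = map proj₂ (filterᵇ (λ t → not (proj₁ t)) tagged)
        e  = length (concatMap (λ u → filterᵇ (adj u) Ws) Us)
    in [ e /ᵣ suc k ]

  minList : List ℚ → ℚ
  minList []       = 0ℚ
  minList (x ∷ xs) = foldr _⊓_ x xs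

  iso : ℚ
  iso = minList (concatMap ratio (allBools (length vs)))

{-# OPTIONS --safe #-}
module Submission where

-- For ±1-labellings the edge count e(U,W) is a quadratic form, so a bound |A g|² ≤ μ|g|² for functions g of
-- sum zero on one side of the d-regular bipartite graph gives iso ≥ (d - √μ)/2, with equality exactly when
-- some pair of ±1-valued functions f, g satisfies A f = √μ g.
--
-- The bound comes from the matrix C = AᵀA of common neighbours: two vectors b, b′ that are independent modulo
-- π have a constant number t of common neighbours, and the remaining part of C is a nonnegative kernel of
-- known row sum, to which the Schur test applies.
--
-- Extremal functions: let F be the residue field, identify F^n with the field K of degree n over F, and let
-- f(b) = χ(b mod π) with χ the quadratic character of K.  Every hyperplane a·b = x is {b : λ(a′b) = x} for a
-- fixed functional λ, so by multiplicativity the hyperplane sums of f are ± a constant, which is found from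
-- C.  On F^* the character χ is trivial if n is even and nontrivial if n is odd, because the parity of the
-- number of points of the projective space of K is that of n and also that of the number of its points
-- fixed by inversion.  The field K exists because the number N_d of monic irreducible polynomials of
-- degree d over F satisfies ∑_{d ∣ n} d N_d = q^n.

-- The parity split comes from whether χ is trivial on F^*. On `Um` the nonnegative kernel is E = C
-- - t(J - P), where J is the all-ones matrix and P the relation of being parallel modulo π. J
-- vanishes on functions of sum zero and P is positive semidefinite, so neither weakens the bound,
-- but P acts on f. If χ is nontrivial on F^* (n odd), f sums to zero along every line, P f = 0 and
-- √μ is attained. If χ is trivial there (n even), f is constant on lines and P lowers the
-- eigenvalue of C from μ to μ/q, which gives only the weaker upper bound. On `Um₀` the kernel C -
-- tJ is already nonnegative, and f descends to orbits of units when χ is trivial on F^*, so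
-- equality appears for n even.
--
-- A point of the projective space of K is fixed by inversion if its square lies in F^*. As u in F^*
-- has 1 + χ(u) square roots, there is one such point in the nontrivial case and there are two in
-- the trivial case.
--
-- For the remaining parities √μ is irrational in general. The lower bounds are therefore proved
-- with any rational at least √μ in its place, and the expansion of a single square with integer
-- coefficients serves as Cauchy-Schwarz.

open import Defs
open import Algebra.Bundles using (CommutativeRing)
import Algebra.Properties.Ring as RingProperties
import Algebra.Properties.Semiring.Mult.TCOptimised as MultProperties
import Algebra.Solver.Ring as RingSolver
open import Algebra.Solver.Ring.AlmostCommutativeRing using (_-Raw-AlmostCommutative⟶_; fromCommutativeRing)
open import Algebra.Structures using (IsCommutativeRing)
open import Data.Bool using (Bool; true; false; not; _∧_; _∨_; T)
open import Data.Bool.ListAction using (any; all)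
open import Data.Empty using (⊥; ⊥-elim)
open import Data.Fin as Fin using (Fin; toℕ)
import Data.Fin.Properties as FinP
open import Data.Integer as ℤ using (ℤ; 0ℤ; 1ℤ; -1ℤ; _+_; _*_; _-_; -_) renaming (+_ to pos)
import Data.Integer.Properties as ℤP
open import Data.Integer.Tactic.RingSolver using (solve-∀)
open import Data.List as List using (List; []; _∷_; [_]; _++_; map; concatMap; filterᵇ; length; allFin; tabulate; zip; foldr)
open import Data.List.Membership.Propositional using (_∈_; lose)
import Data.List.Membership.Propositional.Properties as MemP
import Data.List.Properties as ListP
open import Data.List.Relation.Unary.All as All using (All; []; _∷_)
import Data.List.Relation.Unary.All.Properties as AllP
open import Data.List.Relation.Unary.Any as Any using (Any; here; there)
import Data.List.Relation.Unary.Any.Properties as AnyP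
import Data.Maybe as Maybe
open import Data.Nat as ℕ using (ℕ; zero; suc; z≤n; s≤s; _≤_; _∸_; _^_)
open import Data.Nat.DivMod using (_%_; _/_; m≡m%n+[m/n]*n; m*n/n≡m)
import Data.Nat.Properties as ℕP
open import Data.Product using (Σ; ∃; _×_; _,_; proj₁; proj₂)
import Data.Product.Properties as ProdP
open import Data.Rational as ℚ using (ℚ; mkℚ; ↥_; ↧_; ½; 0ℚ; 1ℚ; toℚᵘ) renaming (_≤_ to _≤ℚ_; _*_ to _*ℚ_; _-_ to _-ℚ_)
import Data.Rational.Properties as ℚP
open import Data.Rational.Unnormalised as ℚᵘ using (mkℚᵘ; *≡*)
open import Data.Sum as Sum using (_⊎_; inj₁; inj₂)
open import Data.Vec as Vec using (Vec; []; _∷_; zipWith; replicate; head)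
open import Data.Vec.Functional as VF using () renaming (_∷_ to _∷ᶠ_)
import Data.Vec.Properties as VecP
open import Function using (_∘_; id; Equivalence; _⇔_)
open import Level using (0ℓ)
open import Relation.Binary.Definitions using (DecidableEquality; tri<; tri≈; tri>)
open import Relation.Binary.PropositionalEquality using (_≡_; _≢_; _≗_; refl; sym; trans; cong; cong₂; subst; subst₂; module ≡-Reasoning; isEquivalence)
open import Relation.Nullary using (¬_; Dec; yes; no; does; contradiction)
open import Relation.Nullary.Decidable using (dec-true; dec-false; map′; _×-dec_; ¬?; decidable-stable; dec⇒maybe)

-- Finite sums

variable
  A B : Set

∑ : List A → (A → ℤ) → ℤ
∑ []       f = 0ℤ
∑ (x ∷ xs) f = f x + ∑ xs f

⟦_⟧ : Bool → ℤ
⟦ true ⟧  = 1ℤ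
⟦ false ⟧ = 0ℤ

iff⇒≡ : ∀ {a b} → (a ≡ true → b ≡ true) → (b ≡ true → a ≡ true) → a ≡ b
iff⇒≡ {true}  {b}     f g = sym (f refl)
iff⇒≡ {false} {true}  f g = g refl
iff⇒≡ {false} {false} f g = refl

does-true : ∀ {P : Set} (d : Dec P) → does d ≡ true → P
does-true (yes p) _ = p

does-cong : ∀ {P P′ : Set} (d : Dec P) (d′ : Dec P′) → (P → P′) → (P′ → P) → does d ≡ does d′
does-cong d d′ f g = iff⇒≡ (λ e → dec-true d′ (f (does-true d e))) (λ e → dec-true d (g (does-true d′ e)))

⟦⟧-∧ : ∀ a b → ⟦ a ∧ b ⟧ ≡ ⟦ a ⟧ * ⟦ b ⟧
⟦⟧-∧ true  b = sym (ℤP.*-identityˡ ⟦ b ⟧)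
⟦⟧-∧ false b = refl

⟦⟧-not : ∀ a → ⟦ not a ⟧ ≡ 1ℤ - ⟦ a ⟧
⟦⟧-not true  = refl
⟦⟧-not false = refl

⟦⟧-nonneg : ∀ a → 0ℤ ℤ.≤ ⟦ a ⟧
⟦⟧-nonneg true  = ℤ.+≤+ z≤n
⟦⟧-nonneg false = ℤ.+≤+ z≤n

⟦⟧-idem : ∀ a → ⟦ a ⟧ * ⟦ a ⟧ ≡ ⟦ a ⟧
⟦⟧-idem true  = refl
⟦⟧-idem false = refl

⟦⟧*-cong : ∀ b {x y} → (b ≡ true → x ≡ y) → ⟦ b ⟧ * x ≡ ⟦ b ⟧ * y
⟦⟧*-cong true  h = cong (1ℤ *_) (h refl)
⟦⟧*-cong false h = refl

∑-cong : ∀ (xs : List A) {f g : A → ℤ} → (∀ x → f x ≡ g x) → ∑ xs f ≡ ∑ xs g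
∑-cong []       h = refl
∑-cong (x ∷ xs) h = cong₂ _+_ (h x) (∑-cong xs h)

∑-0 : ∀ (xs : List A) → ∑ xs (λ _ → 0ℤ) ≡ 0ℤ
∑-0 []       = refl
∑-0 (x ∷ xs) = trans (ℤP.+-identityˡ _) (∑-0 xs)

∑-+ : ∀ (xs : List A) f g → ∑ xs (λ x → f x + g x) ≡ ∑ xs f + ∑ xs g
∑-+ []       f g = refl
∑-+ (x ∷ xs) f g = trans (cong ((f x + g x) +_) (∑-+ xs f g)) (lem (f x) (g x) _ _)
  where
  lem : ∀ a b c d → (a + b) + (c + d) ≡ (a + c) + (b + d)
  lem = solve-∀

∑-*ˡ : ∀ (xs : List A) c f → ∑ xs (λ x → c * f x) ≡ c * ∑ xs f
∑-*ˡ []       c f = sym (ℤP.*-zeroʳ c)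
∑-*ˡ (x ∷ xs) c f = trans (cong (c * f x +_) (∑-*ˡ xs c f)) (sym (ℤP.*-distribˡ-+ c (f x) _))

∑-*ʳ : ∀ (xs : List A) c f → ∑ xs (λ x → f x * c) ≡ ∑ xs f * c
∑-*ʳ xs c f = trans (∑-cong xs (λ x → ℤP.*-comm (f x) c)) (trans (∑-*ˡ xs c f) (ℤP.*-comm c _))

∑-neg : ∀ (xs : List A) f → ∑ xs (λ x → - f x) ≡ - ∑ xs f
∑-neg []       f = refl
∑-neg (x ∷ xs) f = trans (cong (- f x +_) (∑-neg xs f)) (sym (ℤP.neg-distrib-+ (f x) _))

∑-- : ∀ (xs : List A) f g → ∑ xs (λ x → f x - g x) ≡ ∑ xs f - ∑ xs g
∑-- xs f g = trans (∑-+ xs f (λ x → - g x)) (cong (∑ xs f +_) (∑-neg xs g))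

∑-swap : ∀ (xs : List A) (ys : List B) (f : A → B → ℤ) →
         ∑ xs (λ x → ∑ ys (f x)) ≡ ∑ ys (λ y → ∑ xs (λ x → f x y))
∑-swap []       ys f = sym (∑-0 ys)
∑-swap (x ∷ xs) ys f = trans (cong (∑ ys (f x) +_) (∑-swap xs ys f)) (sym (∑-+ ys (f x) _))

∑-++ : ∀ (xs ys : List A) f → ∑ (xs ++ ys) f ≡ ∑ xs f + ∑ ys f
∑-++ []       ys f = sym (ℤP.+-identityˡ _)
∑-++ (x ∷ xs) ys f = trans (cong (f x +_) (∑-++ xs ys f)) (sym (ℤP.+-assoc (f x) _ _))

∑-map : ∀ (h : A → B) xs f → ∑ (map h xs) f ≡ ∑ xs (f ∘ h)
∑-map h []       f = refl
∑-map h (x ∷ xs) f = cong (f (h x) +_) (∑-map h xs f)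

∑-concatMap : ∀ (h : A → List B) xs f → ∑ (concatMap h xs) f ≡ ∑ xs (λ x → ∑ (h x) f)
∑-concatMap h []       f = refl
∑-concatMap h (x ∷ xs) f = trans (∑-++ (h x) (concatMap h xs) f) (cong (∑ (h x) f +_) (∑-concatMap h xs f))

∑-filter : ∀ (p : A → Bool) xs f → ∑ (filterᵇ p xs) f ≡ ∑ xs (λ x → ⟦ p x ⟧ * f x)
∑-filter p []       f = refl
∑-filter p (x ∷ xs) f with p x
... | true  = cong₂ _+_ (sym (ℤP.*-identityˡ (f x))) (∑-filter p xs f)
... | false = trans (∑-filter p xs f) (sym (ℤP.+-identityˡ _))

∑-length : ∀ (xs : List A) → pos (length xs) ≡ ∑ xs (λ _ → 1ℤ)
∑-length []       = refl
∑-length (x ∷ xs) = trans (ℤP.pos-+ 1 (length xs)) (cong (1ℤ +_) (∑-length xs))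

∑-const : ∀ (xs : List A) c → ∑ xs (λ _ → c) ≡ pos (length xs) * c
∑-const xs c = trans (∑-cong xs (λ _ → sym (ℤP.*-identityˡ c))) (trans (∑-*ʳ xs c _) (cong (_* c) (sym (∑-length xs))))

∑-mono : ∀ (xs : List A) {f g : A → ℤ} → (∀ x → f x ℤ.≤ g x) → ∑ xs f ℤ.≤ ∑ xs g
∑-mono []       h = ℤP.≤-refl
∑-mono (x ∷ xs) h = ℤP.+-mono-≤ (h x) (∑-mono xs h)

∑-nonneg : ∀ (xs : List A) {f : A → ℤ} → (∀ x → 0ℤ ℤ.≤ f x) → 0ℤ ℤ.≤ ∑ xs f
∑-nonneg xs h = subst (ℤ._≤ ∑ xs _) (∑-0 xs) (∑-mono xs h)

∑-*∑ : ∀ (xs : List A) (ys : List B) f g →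
       ∑ xs f * ∑ ys g ≡ ∑ xs (λ x → ∑ ys (λ y → f x * g y))
∑-*∑ xs ys f g = trans (sym (∑-*ʳ xs _ f)) (∑-cong xs (λ x → sym (∑-*ˡ ys (f x) g)))

i²≥0 : ∀ i → 0ℤ ℤ.≤ i * i
i²≥0 i with ℤP.≤-total 0ℤ i
... | inj₁ p = subst (ℤ._≤ i * i) (ℤP.*-zeroʳ i) (ℤP.*-monoˡ-≤-nonNeg i ⦃ ℤ.nonNegative p ⦄ p)
... | inj₂ p = subst (ℤ._≤ i * i) (ℤP.*-zeroʳ i) (ℤP.*-monoˡ-≤-nonPos i ⦃ ℤ.nonPositive p ⦄ p)

i*j≥0 : ∀ {i j} → 0ℤ ℤ.≤ i → 0ℤ ℤ.≤ j → 0ℤ ℤ.≤ i * j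
i*j≥0 {i} {j} p q = subst (ℤ._≤ i * j) (ℤP.*-zeroʳ i) (ℤP.*-monoˡ-≤-nonNeg i ⦃ ℤ.nonNegative p ⦄ q)

>0⇒≢0 : ∀ {a} → 0ℤ ℤ.< a → a ≢ 0ℤ
>0⇒≢0 p refl = ℤP.<-irrefl refl p

*>0 : ∀ {a b} → 0ℤ ℤ.< a → 0ℤ ℤ.< b → 0ℤ ℤ.< a * b
*>0 {a} {b} p q = subst (ℤ._< a * b) (ℤP.*-zeroʳ a) (ℤP.*-monoˡ-<-pos a ⦃ ℤ.positive p ⦄ q)

+ℤ-cancelˡ : ∀ a {b c} → a + b ≡ a + c → b ≡ c
+ℤ-cancelˡ a {b} {c} e = trans (sym (lem a b)) (trans (cong (- a +_) e) (lem a c))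
  where
  lem : ∀ a b → - a + (a + b) ≡ b
  lem = solve-∀

-- Vanishing of every term is expressed by a vanishing sum of squares, which makes sense for a bare
-- list; on an enumeration `∑≡0⇒` turns it into vanishing at each element.
∑-nonpos-zero : ∀ (xs : List A) (f : A → ℤ) → (∀ x → f x ℤ.≤ 0ℤ) → 0ℤ ℤ.≤ ∑ xs f →
                ∑ xs (λ x → f x * f x) ≡ 0ℤ
∑-nonpos-zero []       f h p = refl
∑-nonpos-zero (x ∷ xs) f h p = trans (cong₂ _+_ (cong (λ z → z * z) fx≡0) (∑-nonpos-zero xs f h rest≥0)) refl
  where
  rest≤0 : ∑ xs f ℤ.≤ 0ℤ
  rest≤0 = subst (∑ xs f ℤ.≤_) (∑-0 xs) (∑-mono xs h)
  fx≡0 : f x ≡ 0ℤ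
  fx≡0 = ℤP.≤-antisym (h x) (ℤP.≤-trans p (subst (f x + ∑ xs f ℤ.≤_) (ℤP.+-identityʳ (f x)) (ℤP.+-monoʳ-≤ (f x) rest≤0)))
  rest≥0 : 0ℤ ℤ.≤ ∑ xs f
  rest≥0 = subst (0ℤ ℤ.≤_) (trans (cong (_+ ∑ xs f) fx≡0) (ℤP.+-identityˡ _)) p

-- Off-diagonal terms come in equal pairs. With S the graph of an involution this says that the
-- number of points and the number of fixed points have the same parity.
∑∑-sym-parity : ∀ (xs : List A) (S : A → A → ℤ) → (∀ x y → S x y ≡ S y x) →
                ∃ λ k → ∑ xs (λ x → ∑ xs (S x)) ≡ ∑ xs (λ x → S x x) + (k + k)
∑∑-sym-parity []       S h = 0ℤ , refl
∑∑-sym-parity (x ∷ xs) S h with ∑∑-sym-parity xs S h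
... | k , eq = ∑ xs (S x) + k , (begin
    (S x x + ∑ xs (S x)) + ∑ xs (λ y → S y x + ∑ xs (S y))
      ≡⟨ cong ((S x x + ∑ xs (S x)) +_) (trans (∑-+ xs _ _) (cong₂ _+_ (∑-cong xs (λ y → h y x)) eq)) ⟩
    (S x x + ∑ xs (S x)) + (∑ xs (S x) + (∑ xs (λ y → S y y) + (k + k)))
      ≡⟨ lem (S x x) (∑ xs (S x)) (∑ xs (λ y → S y y)) k ⟩
    (S x x + ∑ xs (λ y → S y y)) + ((∑ xs (S x) + k) + (∑ xs (S x) + k)) ∎)
  where
  open ≡-Reasoning
  lem : ∀ a b c k → (a + b) + (b + (c + (k + k))) ≡ (a + c) + ((b + k) + (b + k))
  lem = solve-∀

-- One equation, `once`, expresses both that the list is complete and that it has no repetitions, in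
-- a form that can be inserted into sums.
record Enum (A : Set) : Set where
  infix 4 _≟_
  field
    list : List A
    _≟_  : DecidableEquality A

  δ : A → A → ℤ
  δ x y = ⟦ does (x ≟ y) ⟧

  field
    once : ∀ x → ∑ list (δ x) ≡ 1ℤ

  ∑ᴱ : (A → ℤ) → ℤ
  ∑ᴱ = ∑ list

  size : ℕ
  size = length list

  δ-refl : ∀ x → δ x x ≡ 1ℤ
  δ-refl x = cong ⟦_⟧ (dec-true (x ≟ x) refl)

  δ-≢ : ∀ {x y} → x ≢ y → δ x y ≡ 0ℤ
  δ-≢ {x} {y} n = cong ⟦_⟧ (dec-false (x ≟ y) n)

  δ-subst : ∀ x y (f : A → ℤ) → δ x y * f y ≡ δ x y * f x
  δ-subst x y f = ⟦⟧*-cong (does (x ≟ y)) (λ e → cong f (sym (does-true (x ≟ y) e)))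

  ∑-δ : ∀ x (f : A → ℤ) → ∑ᴱ (λ y → δ x y * f y) ≡ f x
  ∑-δ x f = begin
    ∑ᴱ (λ y → δ x y * f y) ≡⟨ ∑-cong list (λ y → δ-subst x y f) ⟩
    ∑ᴱ (λ y → δ x y * f x) ≡⟨ ∑-*ʳ list (f x) (δ x) ⟩
    ∑ᴱ (δ x) * f x         ≡⟨ cong (_* f x) (once x) ⟩
    1ℤ * f x               ≡⟨ ℤP.*-identityˡ (f x) ⟩
    f x ∎
    where open ≡-Reasoning

  ∑-1 : ∑ᴱ (λ _ → 1ℤ) ≡ pos size
  ∑-1 = sym (∑-length list)

  ∑-lower : ∀ (f : A → ℤ) → (∀ x → 0ℤ ℤ.≤ f x) → ∀ x → f x ℤ.≤ ∑ᴱ f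
  ∑-lower f h x = subst (ℤ._≤ ∑ᴱ f) (∑-δ x f) (∑-mono list lem)
    where
    lem : ∀ y → δ x y * f y ℤ.≤ f y
    lem y with does (x ≟ y)
    ... | true  = ℤP.≤-reflexive (ℤP.*-identityˡ (f y))
    ... | false = h y

  ∑≡0⇒ : ∀ (f : A → ℤ) → (∀ x → 0ℤ ℤ.≤ f x) → ∑ᴱ f ≡ 0ℤ → ∀ x → f x ≡ 0ℤ
  ∑≡0⇒ f h e x = ℤP.≤-antisym (subst (f x ℤ.≤_) e (∑-lower f h x)) (h x)

  -- The negative answer is recorded as a vanishing δ-sum over the part of the list already
  -- inspected; for the whole list it contradicts `once`.
  search : ∀ {P : A → Set} → (∀ x → Dec (P x)) → (xs : List A) →
           (∃ P) ⊎ (∀ x → P x → ∑ xs (δ x) ≡ 0ℤ)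
  search d []       = inj₂ (λ _ _ → refl)
  search d (y ∷ ys) with d y | search d ys
  ... | yes py | _      = inj₁ (y , py)
  ... | no _   | inj₁ p = inj₁ p
  ... | no ¬py | inj₂ h = inj₂ λ x px →
    cong₂ _+_ (δ-≢ λ { refl → ¬py px }) (h x px)

  decide : ∀ {P : A → Set} → (∀ x → Dec (P x)) → (∃ P) ⊎ (∀ x → ¬ P x)
  decide d with search d list
  ... | inj₁ p = inj₁ p
  ... | inj₂ h = inj₂ λ x px → contradiction (trans (sym (once x)) (h x px)) λ ()

  any? : ∀ {P : A → Set} → (∀ x → Dec (P x)) → Dec (∃ P)
  any? d with decide d
  ... | inj₁ p = yes p
  ... | inj₂ h = no λ { (x , px) → h x px }

  ∑-bij : (φ ψ : A → A) → (∀ x → φ (ψ x) ≡ x) → (∀ x → ψ (φ x) ≡ x) →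
          ∀ f → ∑ᴱ (f ∘ φ) ≡ ∑ᴱ f
  ∑-bij φ ψ φψ ψφ f = begin
    ∑ᴱ (λ x → f (φ x))
      ≡⟨ ∑-cong list (λ x → sym (∑-δ (φ x) f)) ⟩
    ∑ᴱ (λ x → ∑ᴱ (λ y → δ (φ x) y * f y))
      ≡⟨ ∑-swap list list _ ⟩
    ∑ᴱ (λ y → ∑ᴱ (λ x → δ (φ x) y * f y))
      ≡⟨ ∑-cong list (λ y → trans (∑-*ʳ list (f y) _) (cong (_* f y) (fibre y))) ⟩
    ∑ᴱ (λ y → 1ℤ * f y)
      ≡⟨ ∑-cong list (λ y → ℤP.*-identityˡ (f y)) ⟩
    ∑ᴱ f ∎
    where
    open ≡-Reasoning
    fibre : ∀ y → ∑ᴱ (λ x → δ (φ x) y) ≡ 1ℤ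
    fibre y = trans (∑-cong list (λ x → cong ⟦_⟧ (does-cong (φ x ≟ y) (ψ y ≟ x)
      (λ { refl → ψφ x }) (λ { refl → φψ y })))) (once (ψ y))

  -- The fibre sizes `c z` are at most 1 and sum to the size of the set, so the nonpositive numbers
  -- `c z - 1` sum to zero and all vanish; an empty fibre would give -1.
  injective⇒surjective : (φ : A → A) → (∀ {x y} → φ x ≡ φ y → x ≡ y) → ∀ y → ∃ λ x → φ x ≡ y
  injective⇒surjective φ inj y with decide (λ x → φ x ≟ y)
  ... | inj₁ p = p
  ... | inj₂ none = contradiction (trans (sym gap) (square-zero (c y - 1ℤ) (∑≡0⇒ (λ z → (c z - 1ℤ) * (c z - 1ℤ)) (λ z → i²≥0 (c z - 1ℤ)) (∑-nonpos-zero list (λ z → c z - 1ℤ) nonpos total) y))) λ ()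
    where
    c : A → ℤ
    c z = ∑ᴱ (λ x → δ (φ x) z)
    c≤1 : ∀ z → c z ℤ.≤ 1ℤ
    c≤1 z with decide (λ x → φ x ≟ z)
    ... | inj₁ (x₀ , refl) = ℤP.≤-reflexive (trans (∑-cong list (λ x → cong ⟦_⟧ (does-cong (φ x ≟ φ x₀) (x₀ ≟ x)
                               (λ e → sym (inj e)) (λ e → cong φ (sym e))))) (once x₀))
    ... | inj₂ h = ℤP.≤-trans (ℤP.≤-reflexive (trans (∑-cong list (λ x → δ-≢ (h x))) (∑-0 list))) (ℤ.+≤+ z≤n)
    nonpos : ∀ z → c z - 1ℤ ℤ.≤ 0ℤ
    nonpos z = ℤP.i≤j⇒i-j≤0 (c≤1 z)
    total : 0ℤ ℤ.≤ ∑ᴱ (λ z → c z - 1ℤ)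
    total = ℤP.≤-reflexive (sym (trans (∑-- list c _) (trans (cong (_- ∑ᴱ (λ _ → 1ℤ))
      (trans (∑-swap list list _) (∑-cong list (λ x → once (φ x))))) (ℤP.+-inverseʳ (∑ᴱ (λ _ → 1ℤ))))))
    gap : c y - 1ℤ ≡ 0ℤ - 1ℤ
    gap = cong (_- 1ℤ) (trans (∑-cong list (λ x → δ-≢ (none x))) (∑-0 list))
    square-zero : ∀ i → i * i ≡ 0ℤ → i ≡ 0ℤ
    square-zero i e with ℤP.i*j≡0⇒i≡0∨j≡0 i e
    ... | inj₁ p = p
    ... | inj₂ p = p

enumFin : ∀ n → Enum (Fin n)
enumFin n = record { list = allFin n ; _≟_ = FinP._≟_ ; once = once n }
  where
  ∑-tabulate : ∀ {n} {B : Set} (g : Fin n → B) (f : B → ℤ) → ∑ (tabulate g) f ≡ ∑ (allFin n) (f ∘ g)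
  ∑-tabulate {zero}  g f = refl
  ∑-tabulate {suc n} g f = cong (f (g Fin.zero) +_)
    (trans (∑-tabulate (g ∘ Fin.suc) f) (sym (∑-tabulate Fin.suc (f ∘ g))))
  once : ∀ n (x : Fin n) → ∑ (allFin n) (λ y → ⟦ does (x FinP.≟ y) ⟧) ≡ 1ℤ
  once (suc n) Fin.zero    = trans (cong (1ℤ +_) (trans (∑-tabulate {n} Fin.suc _)
    (trans (∑-cong (allFin n) (λ y → refl)) (∑-0 (allFin n))))) refl
  once (suc n) (Fin.suc x) = trans (ℤP.+-identityˡ _) (trans (∑-tabulate {n} Fin.suc _)
    (trans (∑-cong (allFin n) (λ y → cong ⟦_⟧ (does-cong (Fin.suc x FinP.≟ Fin.suc y) (x FinP.≟ y)
      FinP.suc-injective (cong Fin.suc)))) (once n x)))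

module _ {A : Set} (E : Enum A) where
  open Enum E

  vecs : ∀ n → List (Vec A n)
  vecs zero    = [] ∷ []
  vecs (suc n) = concatMap (λ a → map (a ∷_) (vecs n)) list

  ∑-vecs : ∀ n (f : Vec A (suc n) → ℤ) → ∑ (vecs (suc n)) f ≡ ∑ᴱ (λ a → ∑ (vecs n) (λ v → f (a ∷ v)))
  ∑-vecs n f = trans (∑-concatMap _ list f) (∑-cong list (λ a → ∑-map (a ∷_) (vecs n) f))

  vec≟ : ∀ {n} → DecidableEquality (Vec A n)
  vec≟ = VecP.≡-dec _≟_

  enumVec : ∀ n → Enum (Vec A n)
  enumVec n = record { list = vecs n ; _≟_ = vec≟ ; once = onceV n }
    where
    onceV : ∀ n (v : Vec A n) → ∑ (vecs n) (λ w → ⟦ does (vec≟ v w) ⟧) ≡ 1ℤ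
    onceV zero    []      = refl
    onceV (suc n) (a ∷ v) = begin
      ∑ (vecs (suc n)) (λ w → ⟦ does (vec≟ (a ∷ v) w) ⟧)
        ≡⟨ ∑-vecs n _ ⟩
      ∑ᴱ (λ b → ∑ (vecs n) (λ w → ⟦ does (vec≟ (a ∷ v) (b ∷ w)) ⟧))
        ≡⟨ ∑-cong list (λ b → trans (∑-cong (vecs n) (λ w → ⟦⟧-∧ (does (a ≟ b)) _))
             (trans (∑-*ˡ (vecs n) (δ a b) _) (cong (δ a b *_) (onceV n v)))) ⟩
      ∑ᴱ (λ b → δ a b * 1ℤ)
        ≡⟨ ∑-δ a (λ _ → 1ℤ) ⟩
      1ℤ ∎
      where open ≡-Reasoning

  size-vecs : ∀ n → pos (length (vecs n)) ≡ pos (size ℕ.^ n)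
  size-vecs zero    = refl
  size-vecs (suc n) = begin
    pos (length (vecs (suc n)))             ≡⟨ ∑-length (vecs (suc n)) ⟩
    ∑ (vecs (suc n)) (λ _ → 1ℤ)             ≡⟨ ∑-vecs n _ ⟩
    ∑ᴱ (λ _ → ∑ (vecs n) (λ _ → 1ℤ))        ≡⟨ ∑-const list _ ⟩
    pos size * ∑ (vecs n) (λ _ → 1ℤ)        ≡⟨ cong (pos size *_) (trans (sym (∑-length (vecs n))) (size-vecs n)) ⟩
    pos size * pos (size ℕ.^ n)             ≡⟨ sym (ℤP.pos-* size _) ⟩
    pos (size ℕ.^ suc n) ∎
    where open ≡-Reasoning

-- Finite fields and their quadratic character

module CRing {C : Set} {_⊕_ _⊗_ : C → C → C} {⊖_ : C → C} {0C 1C : C}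
             (isCR : IsCommutativeRing _≡_ _⊕_ _⊗_ ⊖_ 0C 1C) where

  open IsCommutativeRing isCR public
    using (+-assoc; +-comm; *-assoc; *-comm; +-identityˡ; +-identityʳ; *-identityˡ; *-identityʳ;
           zeroˡ; zeroʳ; distribˡ; distribʳ) renaming (-‿inverseˡ to ⊖-inverseˡ; -‿inverseʳ to ⊖-inverseʳ)

  commutativeRing : CommutativeRing 0ℓ 0ℓ
  commutativeRing = record { isCommutativeRing = isCR }

  open RingProperties (CommutativeRing.ring commutativeRing) public
    using () renaming (-‿distribˡ-* to ⊖-distribˡ; -‿distribʳ-* to ⊖-distribʳ; -0#≈0# to ⊖0≡0;
                       -‿involutive to ⊖-involutive; -‿+-comm to ⊖-⊕)

  private
    open MultProperties (CommutativeRing.semiring commutativeRing) renaming (_×_ to _·_)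
    open ≡-Reasoning

    -- The canonical homomorphism from ℤ: with integer coefficients the solver cancels opposite
    -- terms without testing equality in `C`.
    ι : ℤ → C
    ι (pos n)      = n · 1C
    ι ℤ.-[1+ n ]   = ⊖ (suc n · 1C)

    cancel : ∀ x a b → (x ⊕ a) ⊕ (⊖ (x ⊕ b)) ≡ a ⊕ (⊖ b)
    cancel x a b = begin
      (x ⊕ a) ⊕ (⊖ (x ⊕ b))          ≡⟨ cong₂ _⊕_ (+-comm x a) (sym (⊖-⊕ x b)) ⟩
      (a ⊕ x) ⊕ ((⊖ x) ⊕ (⊖ b))      ≡⟨ +-assoc a x _ ⟩
      a ⊕ (x ⊕ ((⊖ x) ⊕ (⊖ b)))      ≡⟨ cong (a ⊕_) (sym (+-assoc x (⊖ x) (⊖ b))) ⟩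
      a ⊕ ((x ⊕ (⊖ x)) ⊕ (⊖ b))      ≡⟨ cong (λ z → a ⊕ (z ⊕ (⊖ b))) (⊖-inverseʳ x) ⟩
      a ⊕ (0C ⊕ (⊖ b))               ≡⟨ cong (a ⊕_) (+-identityˡ (⊖ b)) ⟩
      a ⊕ (⊖ b) ∎

    ι-⊖ : ∀ m n → ι (m ℤ.⊖ n) ≡ (m · 1C) ⊕ (⊖ (n · 1C))
    ι-⊖ zero    zero    = sym (⊖-inverseʳ 0C)
    ι-⊖ zero    (suc n) = sym (+-identityˡ _)
    ι-⊖ (suc m) zero    = sym (trans (cong ((suc m · 1C) ⊕_) ⊖0≡0) (+-identityʳ _))
    ι-⊖ (suc m) (suc n) = begin
      ι (suc m ℤ.⊖ suc n)                          ≡⟨ cong ι (ℤP.[1+m]⊖[1+n]≡m⊖n m n) ⟩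
      ι (m ℤ.⊖ n)                                  ≡⟨ ι-⊖ m n ⟩
      (m · 1C) ⊕ (⊖ (n · 1C))                      ≡⟨ sym (cancel 1C _ _) ⟩
      (1C ⊕ (m · 1C)) ⊕ (⊖ (1C ⊕ (n · 1C)))        ≡⟨ sym (cong₂ (λ a b → a ⊕ (⊖ b)) (1+× m 1C) (1+× n 1C)) ⟩
      (suc m · 1C) ⊕ (⊖ (suc n · 1C)) ∎

    ι-+ : ∀ i j → ι (i + j) ≡ ι i ⊕ ι j
    ι-+ (pos m)    (pos n)    = ×-homo-+ 1C m n
    ι-+ (pos m)    ℤ.-[1+ n ] = ι-⊖ m (suc n)
    ι-+ ℤ.-[1+ m ] (pos n)    = trans (ι-⊖ n (suc m)) (+-comm _ _)
    ι-+ ℤ.-[1+ m ] ℤ.-[1+ n ] = trans (cong (⊖_) (trans (cong (λ k → suc k · 1C) (sym (ℕP.+-suc m n)))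
      (×-homo-+ 1C (suc m) (suc n)))) (sym (⊖-⊕ _ _))

    ι-neg : ∀ i → ι (- i) ≡ ⊖ ι i
    ι-neg (pos zero)    = sym ⊖0≡0
    ι-neg (pos (suc n)) = refl
    ι-neg ℤ.-[1+ n ]    = sym (⊖-involutive _)

    ι-pos* : ∀ m j → ι (pos m * j) ≡ ι (pos m) ⊗ ι j
    ι-pos* m (pos n) = trans (cong ι (sym (ℤP.pos-* m n))) (×1-homo-* m n)
    ι-pos* m ℤ.-[1+ n ] = begin
      ι (pos m * ℤ.-[1+ n ])          ≡⟨ cong ι (sym (ℤP.neg-distribʳ-* (pos m) (pos (suc n)))) ⟩
      ι (- (pos m * pos (suc n)))     ≡⟨ ι-neg (pos m * pos (suc n)) ⟩
      ⊖ ι (pos m * pos (suc n))       ≡⟨ cong (⊖_) (ι-pos* m (pos (suc n))) ⟩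
      ⊖ (ι (pos m) ⊗ ι (pos (suc n))) ≡⟨ ⊖-distribʳ _ _ ⟩
      ι (pos m) ⊗ ι ℤ.-[1+ n ] ∎
    ι-* : ∀ i j → ι (i * j) ≡ ι i ⊗ ι j
    ι-* (pos m)    j = ι-pos* m j
    ι-* ℤ.-[1+ m ] j = begin
      ι (ℤ.-[1+ m ] * j)              ≡⟨ cong ι (sym (ℤP.neg-distribˡ-* (pos (suc m)) j)) ⟩
      ι (- (pos (suc m) * j))         ≡⟨ ι-neg (pos (suc m) * j) ⟩
      ⊖ ι (pos (suc m) * j)           ≡⟨ cong (⊖_) (ι-pos* (suc m) j) ⟩
      ⊖ (ι (pos (suc m)) ⊗ ι j)       ≡⟨ ⊖-distribˡ _ _ ⟩
      ι ℤ.-[1+ m ] ⊗ ι j ∎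

    morphism : ℤ.+-*-rawRing -Raw-AlmostCommutative⟶ fromCommutativeRing commutativeRing
    morphism = record { ⟦_⟧ = ι ; +-homo = ι-+ ; *-homo = ι-* ; -‿homo = ι-neg ; 0-homo = refl ; 1-homo = refl }

  module Solver = RingSolver ℤ.+-*-rawRing (fromCommutativeRing commutativeRing) morphism
    (λ i j → Maybe.map (cong ι) (dec⇒maybe (i ℤP.≟ j)))
    using (solve; _:=_; _:+_; _:*_; :-_; con)

  x-y≡0⇒x≡y : ∀ x y → x ⊕ (⊖ y) ≡ 0C → x ≡ y
  x-y≡0⇒x≡y x y e = trans (sym (trans (+-assoc x (⊖ y) y) (trans (cong (x ⊕_) (⊖-inverseˡ y)) (+-identityʳ x))))
    (trans (cong (_⊕ y) e) (+-identityˡ y))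

record FiniteField : Set₁ where
  infixl 7 _⊗_
  infixl 6 _⊕_
  infix  8 ⊖_
  field
    Carrier : Set
    _⊕_ _⊗_ : Carrier → Carrier → Carrier
    ⊖_      : Carrier → Carrier
    0F 1F   : Carrier
    isCommutativeRing : IsCommutativeRing _≡_ _⊕_ _⊗_ ⊖_ 0F 1F
    0≢1     : 0F ≢ 1F
    inverse : ∀ x → x ≢ 0F → ∃ λ y → x ⊗ y ≡ 1F
    enum    : Enum Carrier

  open CRing isCommutativeRing public
  open Enum enum public

  ⊗-≡0 : ∀ {x y} → x ≢ 0F → x ⊗ y ≡ 0F → y ≡ 0F
  ⊗-≡0 {x} {y} x≢0 e with inverse x x≢0
  ... | x⁻¹ , p = begin
    y               ≡⟨ sym (*-identityˡ y) ⟩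
    1F ⊗ y          ≡⟨ cong (_⊗ y) (trans (sym p) (*-comm x x⁻¹)) ⟩
    (x⁻¹ ⊗ x) ⊗ y   ≡⟨ *-assoc x⁻¹ x y ⟩
    x⁻¹ ⊗ (x ⊗ y)   ≡⟨ cong (x⁻¹ ⊗_) e ⟩
    x⁻¹ ⊗ 0F        ≡⟨ zeroʳ x⁻¹ ⟩
    0F ∎
    where open ≡-Reasoning

  ⊗-≢0 : ∀ {x y} → x ≢ 0F → y ≢ 0F → x ⊗ y ≢ 0F
  ⊗-≢0 x≢0 y≢0 e = y≢0 (⊗-≡0 x≢0 e)

  ⊗-cancelˡ : ∀ {x y z} → x ≢ 0F → x ⊗ y ≡ x ⊗ z → y ≡ z
  ⊗-cancelˡ {x} {y} {z} x≢0 e = x-y≡0⇒x≡y y z (⊗-≡0 x≢0 (begin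
    x ⊗ (y ⊕ ⊖ z)       ≡⟨ Solver.solve 3 (λ x y z → x :* (y :+ :- z) := x :* y :+ :- (x :* z)) refl x y z ⟩
    x ⊗ y ⊕ ⊖ (x ⊗ z)   ≡⟨ cong (_⊕ ⊖ (x ⊗ z)) e ⟩
    x ⊗ z ⊕ ⊖ (x ⊗ z)   ≡⟨ ⊖-inverseʳ (x ⊗ z) ⟩
    0F ∎))
    where
    open ≡-Reasoning
    open Solver

  ∑-scale : ∀ {x} → x ≢ 0F → ∀ f → ∑ᴱ (λ y → f (x ⊗ y)) ≡ ∑ᴱ f
  ∑-scale {x} x≢0 f with inverse x x≢0
  ... | x⁻¹ , p = ∑-bij (x ⊗_) (x⁻¹ ⊗_) (cancel x x⁻¹ p) (cancel x⁻¹ x (trans (*-comm x⁻¹ x) p)) f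
    where
    cancel : ∀ a b → a ⊗ b ≡ 1F → ∀ y → a ⊗ (b ⊗ y) ≡ y
    cancel a b e y = trans (sym (*-assoc a b y)) (trans (cong (_⊗ y) e) (*-identityˡ y))

  ∑-translate : ∀ x f → ∑ᴱ (λ y → f (y ⊕ x)) ≡ ∑ᴱ f
  ∑-translate x f = ∑-bij (_⊕ x) (_⊕ ⊖ x)
    (λ y → trans (+-assoc y (⊖ x) x) (trans (cong (y ⊕_) (⊖-inverseˡ x)) (+-identityʳ y)))
    (λ y → trans (+-assoc y x (⊖ x)) (trans (cong (y ⊕_) (⊖-inverseʳ x)) (+-identityʳ y))) f

  -- In characteristic 2 the involution x ↦ x + 1 has no fixed point, so the order is even.
  odd⇒2≢0 : (∀ k → pos size ≢ k + k) → 1F ⊕ 1F ≢ 0F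
  odd⇒2≢0 odd 2≡0 with ∑∑-sym-parity list (λ x y → δ (x ⊕ 1F) y) symm
    where
    flip : ∀ {x y} → x ⊕ 1F ≡ y → y ⊕ 1F ≡ x
    flip {x} refl = trans (+-assoc x 1F 1F) (trans (cong (x ⊕_) 2≡0) (+-identityʳ x))
    symm : ∀ x y → δ (x ⊕ 1F) y ≡ δ (y ⊕ 1F) x
    symm x y = cong ⟦_⟧ (does-cong (x ⊕ 1F ≟ y) (y ⊕ 1F ≟ x) flip flip)
  ... | k , e = odd k (begin
    pos size                              ≡⟨ sym ∑-1 ⟩
    ∑ᴱ (λ _ → 1ℤ)                         ≡⟨ ∑-cong list (λ x → sym (once (x ⊕ 1F))) ⟩
    ∑ᴱ (λ x → ∑ᴱ (δ (x ⊕ 1F)))            ≡⟨ e ⟩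
    ∑ᴱ (λ x → δ (x ⊕ 1F) x) + (k + k)     ≡⟨ cong (_+ (k + k)) (trans (∑-cong list (λ x → δ-≢ (moves x))) (∑-0 list)) ⟩
    0ℤ + (k + k)                          ≡⟨ ℤP.+-identityˡ (k + k) ⟩
    k + k ∎)
    where
    open ≡-Reasoning
    moves : ∀ x → x ⊕ 1F ≢ x
    moves x e = 0≢1 (sym (begin
      1F                  ≡⟨ sym (+-identityˡ 1F) ⟩
      0F ⊕ 1F             ≡⟨ cong (_⊕ 1F) (sym (⊖-inverseˡ x)) ⟩
      (⊖ x ⊕ x) ⊕ 1F      ≡⟨ +-assoc (⊖ x) x 1F ⟩
      ⊖ x ⊕ (x ⊕ 1F)      ≡⟨ cong (⊖ x ⊕_) e ⟩
      ⊖ x ⊕ x             ≡⟨ ⊖-inverseˡ x ⟩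
      0F ∎))

module QuadraticCharacter (K : FiniteField) (2≢0 : FiniteField._⊕_ K (FiniteField.1F K) (FiniteField.1F K) ≢ FiniteField.0F K) where
  open FiniteField K
  open ≡-Reasoning

  private
    open Solver

    double : ∀ y → y ⊕ y ≡ (1F ⊕ 1F) ⊗ y
    double y = sym (trans (distribʳ y 1F 1F) (cong₂ _⊕_ (*-identityˡ y) (*-identityˡ y)))

    y≢⊖y : ∀ {y} → y ≢ 0F → y ≢ ⊖ y
    y≢⊖y {y} y≢0 e = ⊗-≢0 2≢0 y≢0 (trans (sym (double y)) (trans (cong (_⊕ y) e) (⊖-inverseˡ y)))

    ⊖⊗⊖ : ∀ y → ⊖ y ⊗ ⊖ y ≡ y ⊗ y
    ⊖⊗⊖ = solve 1 (λ y → :- y :* :- y := y :* y) refl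

    sqrt-unique : ∀ {y z} → z ⊗ z ≡ y ⊗ y → z ≢ y → z ≡ ⊖ y
    sqrt-unique {y} {z} e z≢y = x-y≡0⇒x≡y z (⊖ y) (⊗-≡0 (λ p → z≢y (x-y≡0⇒x≡y z y p)) (begin
      (z ⊕ ⊖ y) ⊗ (z ⊕ ⊖ (⊖ y)) ≡⟨ solve 2 (λ z y → (z :+ :- y) :* (z :+ :- (:- y)) := z :* z :+ :- (y :* y)) refl z y ⟩
      z ⊗ z ⊕ ⊖ (y ⊗ y)         ≡⟨ cong (_⊕ ⊖ (y ⊗ y)) e ⟩
      y ⊗ y ⊕ ⊖ (y ⊗ y)         ≡⟨ ⊖-inverseʳ (y ⊗ y) ⟩
      0F ∎))

  roots : Carrier → ℤ
  roots x = ∑ᴱ (λ y → δ (y ⊗ y) x)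

  -- The number of square roots less one is 0 at zero, 1 at nonzero squares and -1 at nonsquares, so
  -- this is the quadratic character. In this form its sum over the field is visibly zero, since
  -- each y is a root of exactly one x.
  χ : Carrier → ℤ
  χ x = roots x - 1ℤ

  roots-0 : roots 0F ≡ 1ℤ
  roots-0 = trans (∑-cong list (λ y → cong ⟦_⟧ (does-cong (y ⊗ y ≟ 0F) (0F ≟ y) (λ e → to y e) (λ { refl → zeroˡ 0F })))) (once 0F)
    where
    to : ∀ y → y ⊗ y ≡ 0F → 0F ≡ y
    to y e with y ≟ 0F
    ... | yes p = sym p
    ... | no ¬p = sym (⊗-≡0 ¬p e)

  roots-square : ∀ y → y ≢ 0F → roots (y ⊗ y) ≡ 1ℤ + 1ℤ
  roots-square y y≢0 = trans (∑-cong list split) (trans (∑-+ list (δ y) (δ (⊖ y))) (cong₂ _+_ (once y) (once (⊖ y))))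
    where
    split : ∀ z → δ (z ⊗ z) (y ⊗ y) ≡ δ y z + δ (⊖ y) z
    split z with y ≟ z
    ... | yes refl = trans (δ-refl (y ⊗ y)) (sym (cong (1ℤ +_) (δ-≢ (λ e → y≢⊖y y≢0 (sym e)))))
    ... | no y≢z with ⊖ y ≟ z
    ... | yes refl = trans (cong (λ w → δ w (y ⊗ y)) (⊖⊗⊖ y)) (δ-refl (y ⊗ y))
    ... | no ⊖y≢z = δ-≢ (λ e → ⊖y≢z (sym (sqrt-unique e (λ p → y≢z (sym p)))))

  data Case (x : Carrier) : Set where
    isZero    : x ≡ 0F → χ x ≡ 0ℤ → Case x
    square    : ∀ y → y ≢ 0F → x ≡ y ⊗ y → χ x ≡ 1ℤ → Case x
    nonsquare : x ≢ 0F → χ x ≡ -1ℤ → Case x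

  case : ∀ x → Case x
  case x with x ≟ 0F
  ... | yes refl = isZero refl (cong (_- 1ℤ) roots-0)
  ... | no x≢0 with decide (λ y → y ⊗ y ≟ x)
  ... | inj₁ (y , refl) = square y y≢0 refl (cong (_- 1ℤ) (roots-square y y≢0))
    where
    y≢0 : y ≢ 0F
    y≢0 refl = x≢0 (zeroˡ 0F)
  ... | inj₂ none = nonsquare x≢0 (cong (_- 1ℤ) (trans (∑-cong list (λ y → δ-≢ (none y))) (∑-0 list)))

  χ-0 : χ 0F ≡ 0ℤ
  χ-0 = cong (_- 1ℤ) roots-0

  χ-±1 : ∀ x → x ≢ 0F → χ x ≡ 1ℤ ⊎ χ x ≡ -1ℤ
  χ-±1 x x≢0 with case x
  ... | isZero e _       = contradiction e x≢0
  ... | square _ _ _ e   = inj₁ e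
  ... | nonsquare _ e    = inj₂ e

  ∑χ≡0 : ∑ᴱ χ ≡ 0ℤ
  ∑χ≡0 = begin
    ∑ᴱ χ                                   ≡⟨ ∑-- list roots _ ⟩
    ∑ᴱ roots - ∑ᴱ (λ _ → 1ℤ)               ≡⟨ cong (_- ∑ᴱ (λ _ → 1ℤ)) (trans (∑-swap list list _) (∑-cong list (λ y → once (y ⊗ y)))) ⟩
    ∑ᴱ (λ _ → 1ℤ) - ∑ᴱ (λ _ → 1ℤ)          ≡⟨ ℤP.+-inverseʳ (∑ᴱ (λ _ → 1ℤ)) ⟩
    0ℤ ∎

  -- The substitution y ↦ z y matches the square roots of x with those of z² x.
  χ-*square : ∀ z → z ≢ 0F → ∀ x → χ (z ⊗ z ⊗ x) ≡ χ x
  χ-*square z z≢0 x = cong (_- 1ℤ) (begin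
    ∑ᴱ (λ y → δ (y ⊗ y) (z ⊗ z ⊗ x))               ≡⟨ sym (∑-scale z≢0 (λ y → δ (y ⊗ y) (z ⊗ z ⊗ x))) ⟩
    ∑ᴱ (λ y → δ ((z ⊗ y) ⊗ (z ⊗ y)) (z ⊗ z ⊗ x))   ≡⟨ ∑-cong list (λ y → cong ⟦_⟧ (does-cong ((z ⊗ y) ⊗ (z ⊗ y) ≟ z ⊗ z ⊗ x) (y ⊗ y ≟ x)
                                                       (λ e → ⊗-cancelˡ (⊗-≢0 z≢0 z≢0) (trans (sym (rearrange y)) e))
                                                       (λ { refl → rearrange y }))) ⟩
    ∑ᴱ (λ y → δ (y ⊗ y) x) ∎)
    where
    rearrange : ∀ y → (z ⊗ y) ⊗ (z ⊗ y) ≡ z ⊗ z ⊗ (y ⊗ y)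
    rearrange y = solve 2 (λ z y → (z :* y) :* (z :* y) := z :* z :* (y :* y)) refl z y

  -- For a nonsquare x the terms χ(xy) + χ(y) are nonpositive and sum to zero.
  χ-nonsquare : ∀ x → x ≢ 0F → χ x ≡ -1ℤ → ∀ y → χ (x ⊗ y) ≡ -1ℤ * χ y
  χ-nonsquare x x≢0 e y = begin
    χ (x ⊗ y)                          ≡⟨ lem (χ (x ⊗ y)) (χ y) ⟩
    (χ (x ⊗ y) + χ y) + -1ℤ * χ y      ≡⟨ cong (_+ -1ℤ * χ y) h≡0 ⟩
    0ℤ + -1ℤ * χ y                     ≡⟨ ℤP.+-identityˡ (-1ℤ * χ y) ⟩
    -1ℤ * χ y ∎
    where
    lem : ∀ a b → a ≡ (a + b) + -1ℤ * b
    lem = solve-∀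
    h : Carrier → ℤ
    h z = χ (x ⊗ z) + χ z
    h≤0 : ∀ z → h z ℤ.≤ 0ℤ
    h≤0 z with case z
    ... | isZero refl p = ℤP.≤-reflexive (cong₂ _+_ (trans (cong χ (zeroʳ x)) χ-0) p)
    ... | square w w≢0 refl p = ℤP.≤-reflexive (cong₂ _+_ (trans (cong χ (*-comm x (w ⊗ w))) (trans (χ-*square w w≢0 x) e)) p)
    ... | nonsquare z≢0 p with χ-±1 (x ⊗ z) (⊗-≢0 x≢0 z≢0)
    ...   | inj₁ q = ℤP.≤-reflexive (cong₂ _+_ q p)
    ...   | inj₂ q = ℤP.≤-trans (ℤP.≤-reflexive (cong₂ _+_ q p)) ℤ.-≤+
    ∑h : 0ℤ ℤ.≤ ∑ᴱ h
    ∑h = ℤP.≤-reflexive (sym (trans (∑-+ list _ χ) (cong₂ _+_ (trans (∑-scale x≢0 χ) ∑χ≡0) ∑χ≡0)))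
    h≡0 : h y ≡ 0ℤ
    h≡0 with ℤP.i*j≡0⇒i≡0∨j≡0 (h y) (∑≡0⇒ (λ z → h z * h z) (λ z → i²≥0 (h z)) (∑-nonpos-zero list h h≤0 ∑h) y)
    ... | inj₁ p = p
    ... | inj₂ p = p

  χ-* : ∀ x y → χ (x ⊗ y) ≡ χ x * χ y
  χ-* x y with case x
  ... | isZero refl p      = trans (cong χ (zeroˡ y)) (trans χ-0 (sym (cong (_* χ y) p)))
  ... | square z z≢0 refl p = trans (χ-*square z z≢0 y) (sym (trans (cong (_* χ y) p) (ℤP.*-identityˡ (χ y))))
  ... | nonsquare x≢0 p    = trans (χ-nonsquare x x≢0 p y) (sym (cong (_* χ y) p))

-- Irreducible polynomials over a finite field

module Polynomials (F : FiniteField) where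
  open FiniteField F
  open Solver
  open ≡-Reasoning

  -- Coefficient sequences; a polynomial is a sequence with a degree bound.
  Series : Set
  Series = ℕ → Carrier

  tl : Series → Series
  tl f i = f (suc i)

  zeroS oneS : Series
  zeroS _ = 0F
  oneS zero    = 1F
  oneS (suc _) = 0F

  infixl 6 _+ˢ_
  infixl 7 _∙_ _*ˢ_

  _+ˢ_ : Series → Series → Series
  (f +ˢ g) i = f i ⊕ g i

  negS : Series → Series
  negS f i = ⊖ f i

  _∙_ : Carrier → Series → Series
  (c ∙ f) i = c ⊗ f i

  _*ˢ_ : Series → Series → Series
  (f *ˢ g) zero    = f 0 ⊗ g 0
  (f *ˢ g) (suc i) = f 0 ⊗ g (suc i) ⊕ (tl f *ˢ g) i

  *ˢ-cong : ∀ {f f′ g g′} → f ≗ f′ → g ≗ g′ → f *ˢ g ≗ f′ *ˢ g′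
  *ˢ-cong p q zero    = cong₂ _⊗_ (p 0) (q 0)
  *ˢ-cong p q (suc i) = cong₂ _⊕_ (cong₂ _⊗_ (p 0) (q (suc i))) (*ˢ-cong (p ∘ suc) q i)

  *ˢ-congʳ : ∀ {f g g′} → g ≗ g′ → f *ˢ g ≗ f *ˢ g′
  *ˢ-congʳ = *ˢ-cong (λ _ → refl)

  *ˢ-congˡ : ∀ {f f′ g} → f ≗ f′ → f *ˢ g ≗ f′ *ˢ g
  *ˢ-congˡ p = *ˢ-cong p (λ _ → refl)

  *ˢ-distribʳ : ∀ f g h → (f +ˢ g) *ˢ h ≗ f *ˢ h +ˢ g *ˢ h
  *ˢ-distribʳ f g h zero    = distribʳ (h 0) (f 0) (g 0)
  *ˢ-distribʳ f g h (suc i) = trans (cong ((f 0 ⊕ g 0) ⊗ h (suc i) ⊕_) (*ˢ-distribʳ (tl f) (tl g) h i))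
    (solve 5 (λ a b c x y → (a :+ b) :* c :+ (x :+ y) := (a :* c :+ x) :+ (b :* c :+ y)) refl
      (f 0) (g 0) (h (suc i)) ((tl f *ˢ h) i) ((tl g *ˢ h) i))

  ∙-*ˢ : ∀ c f g → (c ∙ f) *ˢ g ≗ c ∙ (f *ˢ g)
  ∙-*ˢ c f g zero    = *-assoc c (f 0) (g 0)
  ∙-*ˢ c f g (suc i) = trans (cong (c ⊗ f 0 ⊗ g (suc i) ⊕_) (∙-*ˢ c (tl f) g i))
    (solve 4 (λ c a b x → c :* a :* b :+ c :* x := c :* (a :* b :+ x)) refl c (f 0) (g (suc i)) ((tl f *ˢ g) i))

  *ˢ-suc : ∀ f g i → (f *ˢ g) (suc i) ≡ (f *ˢ tl g) i ⊕ f (suc i) ⊗ g 0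
  *ˢ-suc f g zero    = refl
  *ˢ-suc f g (suc i) = trans (cong (f 0 ⊗ g (suc (suc i)) ⊕_) (*ˢ-suc (tl f) g i)) (sym (+-assoc _ _ _))

  *ˢ-comm : ∀ f g → f *ˢ g ≗ g *ˢ f
  *ˢ-comm f g zero    = *-comm (f 0) (g 0)
  *ˢ-comm f g (suc i) = begin
    f 0 ⊗ g (suc i) ⊕ (tl f *ˢ g) i   ≡⟨ cong₂ _⊕_ (*-comm _ _) (*ˢ-comm (tl f) g i) ⟩
    g (suc i) ⊗ f 0 ⊕ (g *ˢ tl f) i   ≡⟨ +-comm _ _ ⟩
    (g *ˢ tl f) i ⊕ g (suc i) ⊗ f 0   ≡⟨ sym (*ˢ-suc g f i) ⟩
    (g *ˢ f) (suc i) ∎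

  *ˢ-assoc : ∀ f g h → (f *ˢ g) *ˢ h ≗ f *ˢ (g *ˢ h)
  *ˢ-assoc f g h zero    = *-assoc _ _ _
  *ˢ-assoc f g h (suc i) = begin
    f 0 ⊗ g 0 ⊗ h (suc i) ⊕ ((f 0 ∙ tl g +ˢ tl f *ˢ g) *ˢ h) i
      ≡⟨ cong (f 0 ⊗ g 0 ⊗ h (suc i) ⊕_) (*ˢ-distribʳ (f 0 ∙ tl g) (tl f *ˢ g) h i) ⟩
    f 0 ⊗ g 0 ⊗ h (suc i) ⊕ (((f 0 ∙ tl g) *ˢ h) i ⊕ ((tl f *ˢ g) *ˢ h) i)
      ≡⟨ cong (f 0 ⊗ g 0 ⊗ h (suc i) ⊕_) (cong₂ _⊕_ (∙-*ˢ (f 0) (tl g) h i) (*ˢ-assoc (tl f) g h i)) ⟩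
    f 0 ⊗ g 0 ⊗ h (suc i) ⊕ (f 0 ⊗ (tl g *ˢ h) i ⊕ (tl f *ˢ (g *ˢ h)) i)
      ≡⟨ solve 5 (λ a b c x y → a :* b :* c :+ (a :* x :+ y) := a :* (b :* c :+ x) :+ y) refl
           (f 0) (g 0) (h (suc i)) ((tl g *ˢ h) i) ((tl f *ˢ (g *ˢ h)) i) ⟩
    (f *ˢ (g *ˢ h)) (suc i) ∎

  *ˢ-distribˡ : ∀ f g h → f *ˢ (g +ˢ h) ≗ f *ˢ g +ˢ f *ˢ h
  *ˢ-distribˡ f g h i = trans (*ˢ-comm f (g +ˢ h) i) (trans (*ˢ-distribʳ g h f i)
    (cong₂ _⊕_ (*ˢ-comm g f i) (*ˢ-comm h f i)))

  *ˢ-zeroˡ : ∀ f → zeroS *ˢ f ≗ zeroS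
  *ˢ-zeroˡ f zero    = zeroˡ (f 0)
  *ˢ-zeroˡ f (suc i) = trans (cong₂ _⊕_ (zeroˡ (f (suc i))) (*ˢ-zeroˡ f i)) (+-identityˡ 0F)

  *ˢ-zeroʳ : ∀ f → f *ˢ zeroS ≗ zeroS
  *ˢ-zeroʳ f i = trans (*ˢ-comm f zeroS i) (*ˢ-zeroˡ f i)

  *ˢ-oneˡ : ∀ f → oneS *ˢ f ≗ f
  *ˢ-oneˡ f zero    = *-identityˡ (f 0)
  *ˢ-oneˡ f (suc i) = trans (cong₂ _⊕_ (*-identityˡ (f (suc i))) (*ˢ-zeroˡ f i)) (+-identityʳ (f (suc i)))

  *ˢ-oneʳ : ∀ f → f *ˢ oneS ≗ f
  *ˢ-oneʳ f i = trans (*ˢ-comm f oneS i) (*ˢ-oneˡ f i)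

  *ˢ-∙ : ∀ c f g → f *ˢ (c ∙ g) ≗ c ∙ (f *ˢ g)
  *ˢ-∙ c f g i = trans (*ˢ-comm f (c ∙ g) i) (trans (∙-*ˢ c g f i) (cong (c ⊗_) (*ˢ-comm g f i)))

  *ˢ-negʳ : ∀ f g → f *ˢ negS g ≗ negS (f *ˢ g)
  *ˢ-negʳ f g zero    = sym (⊖-distribʳ _ _)
  *ˢ-negʳ f g (suc i) = trans (cong₂ _⊕_ (sym (⊖-distribʳ _ _)) (*ˢ-negʳ (tl f) g i)) (⊖-⊕ _ _)

  Deg< : ℕ → Series → Set
  Deg< k f = ∀ i → k ≤ i → f i ≡ 0F

  Monic : ℕ → Series → Set
  Monic k f = f k ≡ 1F × Deg< (suc k) f

  Deg<-≗ : ∀ {k f g} → f ≗ g → Deg< k f → Deg< k g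
  Deg<-≗ e d i p = trans (sym (e i)) (d i p)

  Deg<-+ : ∀ {k f g} → Deg< k f → Deg< k g → Deg< k (f +ˢ g)
  Deg<-+ d e i p = trans (cong₂ _⊕_ (d i p) (e i p)) (+-identityˡ 0F)

  Deg<-neg : ∀ {k f} → Deg< k f → Deg< k (negS f)
  Deg<-neg d i p = trans (cong ⊖_ (d i p)) ⊖0≡0

  Deg<-∙ : ∀ {k f} c → Deg< k f → Deg< k (c ∙ f)
  Deg<-∙ c d i p = trans (cong (c ⊗_) (d i p)) (zeroʳ c)

  Deg<-weaken : ∀ {k l f} → k ≤ l → Deg< k f → Deg< l f
  Deg<-weaken q d i p = d i (ℕP.≤-trans q p)

  Deg<-pred : ∀ {k f} → Deg< (suc k) f → f k ≡ 0F → Deg< k f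
  Deg<-pred {k} d e i p with ℕP.m≤n⇒m<n∨m≡n p
  ... | inj₁ q    = d i q
  ... | inj₂ refl = e

  *ˢ-deg : ∀ a b {f g} → Deg< (suc a) f → Deg< (suc b) g → Deg< (suc (a ℕ.+ b)) (f *ˢ g)
  *ˢ-deg a b {f} {g} df dg (suc i) (s≤s p) = trans (cong₂ _⊕_
      (trans (cong (f 0 ⊗_) (dg (suc i) (s≤s (ℕP.≤-trans (ℕP.m≤n+m b a) p)))) (zeroʳ (f 0)))
      (rest a df p)) (+-identityˡ 0F)
    where
    rest : ∀ a → Deg< (suc a) f → a ℕ.+ b ≤ i → (tl f *ˢ g) i ≡ 0F
    rest zero    df p = trans (*ˢ-congˡ (λ j → df (suc j) (s≤s z≤n)) i) (*ˢ-zeroˡ g i)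
    rest (suc a) df p = *ˢ-deg a b (λ j q → df (suc j) (s≤s q)) dg i p

  *ˢ-top : ∀ a b {f g} → Deg< (suc a) f → Deg< (suc b) g → (f *ˢ g) (a ℕ.+ b) ≡ f a ⊗ g b
  *ˢ-top zero    zero    df dg = refl
  *ˢ-top zero    (suc b) {f} {g} df dg = trans (cong (f 0 ⊗ g (suc b) ⊕_)
    (trans (*ˢ-congˡ (λ j → df (suc j) (s≤s z≤n)) b) (*ˢ-zeroˡ g b))) (+-identityʳ _)
  *ˢ-top (suc a) b {f} {g} df dg = trans (cong₂ _⊕_
    (trans (cong (f 0 ⊗_) (dg (suc (a ℕ.+ b)) (s≤s (ℕP.m≤n+m b a)))) (zeroʳ (f 0)))
    (*ˢ-top a b (λ j q → df (suc j) (s≤s q)) dg)) (+-identityˡ _)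

  *ˢ-Deg< : ∀ a b {f g} → Deg< a f → Deg< b g → Deg< (a ℕ.+ b) (f *ˢ g)
  *ˢ-Deg< zero    b {f} {g} df dg i p = trans (*ˢ-congˡ (λ j → df j z≤n) i) (*ˢ-zeroˡ g i)
  *ˢ-Deg< (suc a) zero {f} {g} df dg i p = trans (*ˢ-congʳ {f} (λ j → dg j z≤n) i) (*ˢ-zeroʳ f i)
  *ˢ-Deg< (suc a) (suc b) df dg = Deg<-weaken (s≤s (ℕP.+-monoʳ-≤ a (ℕP.n≤1+n b))) (*ˢ-deg a b df dg)

  Monic-* : ∀ {a b f g} → Monic a f → Monic b g → Monic (a ℕ.+ b) (f *ˢ g)
  Monic-* {a} {b} (ta , da) (tb , db) =
    trans (*ˢ-top a b da db) (trans (cong₂ _⊗_ ta tb) (*-identityˡ 1F)) , *ˢ-deg a b da db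

  shift : ℕ → Series → Series
  shift zero    f         = f
  shift (suc j) f zero    = 0F
  shift (suc j) f (suc i) = shift j f i

  shift-top : ∀ j f k → shift j f (j ℕ.+ k) ≡ f k
  shift-top zero    f k = refl
  shift-top (suc j) f k = shift-top j f k

  shift-deg : ∀ j {f k} → Deg< k f → Deg< (j ℕ.+ k) (shift j f)
  shift-deg zero    d i p             = d i p
  shift-deg (suc j) d (suc i) (s≤s p) = shift-deg j d i p

  shift-* : ∀ j f g → f *ˢ shift j g ≗ shift j (f *ˢ g)
  shift-* zero    f g i       = refl
  shift-* (suc j) f g zero    = zeroʳ (f 0)
  shift-* (suc j) f g (suc i) = trans (*ˢ-suc f (shift (suc j) g) i)
    (trans (cong₂ _⊕_ (shift-* j f g i) (zeroʳ (f (suc i)))) (+-identityʳ _))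

  Monic-shift : ∀ j {k f} → Monic k f → Monic (j ℕ.+ k) (shift j f)
  Monic-shift j {k} {f} (t , d) = trans (shift-top j f k) t , subst (λ m → Deg< m (shift j f)) (ℕP.+-suc j k) (shift-deg j d)

  Monic-one : Monic 0 oneS
  Monic-one = refl , λ { (suc i) _ → refl }

  record Division (g : Series) (k j : ℕ) (f : Series) : Set where
    field
      quot rem : Series
      quot-deg : Deg< j quot
      rem-deg  : Deg< k rem
      eqn      : f ≗ g *ˢ quot +ˢ rem

  divide : ∀ {g k} → Monic k g → ∀ j f → Deg< (j ℕ.+ k) f → Division g k j f
  divide {g} mg zero f d = record
    { quot = zeroS ; rem = f ; quot-deg = λ _ _ → refl ; rem-deg = d
    ; eqn = λ i → sym (trans (cong (_⊕ f i) (*ˢ-zeroʳ g i)) (+-identityˡ (f i))) }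
  divide {g} {k} mg (suc j) f d = record
    { quot = D.quot +ˢ c ∙ shift j oneS ; rem = D.rem
    ; quot-deg = Deg<-+ (Deg<-weaken (ℕP.n≤1+n j) D.quot-deg)
        (Deg<-∙ c (subst (λ m → Deg< m (shift j oneS)) (ℕP.+-comm j 1) (shift-deg j (proj₂ Monic-one))))
    ; rem-deg = D.rem-deg
    ; eqn = λ i → begin
        f i
          ≡⟨ solve 2 (λ x y → x := (x :+ :- y) :+ y) refl (f i) (c ⊗ shift j g i) ⟩
        f′ i ⊕ c ⊗ shift j g i
          ≡⟨ cong₂ _⊕_ (D.eqn i) (sym (trans (*ˢ-∙ c g (shift j oneS) i)
               (cong (c ⊗_) (trans (shift-* j g oneS i) (shift-cong j (*ˢ-oneʳ g) i))))) ⟩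
        ((g *ˢ D.quot) i ⊕ D.rem i) ⊕ (g *ˢ (c ∙ shift j oneS)) i
          ≡⟨ solve 3 (λ x y z → (x :+ y) :+ z := (x :+ z) :+ y) refl ((g *ˢ D.quot) i) (D.rem i) ((g *ˢ (c ∙ shift j oneS)) i) ⟩
        ((g *ˢ D.quot) i ⊕ (g *ˢ (c ∙ shift j oneS)) i) ⊕ D.rem i
          ≡⟨ cong (_⊕ D.rem i) (sym (*ˢ-distribˡ g D.quot (c ∙ shift j oneS) i)) ⟩
        (g *ˢ (D.quot +ˢ c ∙ shift j oneS) +ˢ D.rem) i ∎ }
    where
    shift-cong : ∀ j {f g} → f ≗ g → shift j f ≗ shift j g
    shift-cong zero    e i       = e i
    shift-cong (suc j) e zero    = refl
    shift-cong (suc j) e (suc i) = shift-cong j e i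
    -- The only index at or above j + k where f may be nonzero is j + k itself, so subtracting c x^j
    -- g lowers the degree bound by one.
    c : Carrier
    c = f (j ℕ.+ k)
    f′ : Series
    f′ = f +ˢ negS (c ∙ shift j g)
    msh = Monic-shift j mg
    f′-deg : Deg< (j ℕ.+ k) f′
    f′-deg = Deg<-pred (Deg<-+ d (Deg<-neg (Deg<-∙ c (proj₂ msh))))
      (trans (cong (λ z → c ⊕ ⊖ (c ⊗ z)) (proj₁ msh)) (trans (cong (λ z → c ⊕ ⊖ z) (*-identityʳ c)) (⊖-inverseʳ c)))
    module D = Division (divide mg j f′ f′-deg)

  -- Multiplication by a monic g of degree k carries the top coefficient of h unchanged from index m
  -- to k + m, where g h is zero. This is the uniqueness of remainders.
  *ˢ-small : ∀ {g k} → Monic k g → ∀ m {h} → Deg< m h → Deg< k (g *ˢ h) → h ≗ zeroS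
  *ˢ-small mg zero dh dgh i = dh i z≤n
  *ˢ-small {g} {k} mg (suc m) {h} dh dgh = *ˢ-small mg m (Deg<-pred dh top) dgh
    where
    top : h m ≡ 0F
    top = begin
      h m                ≡⟨ sym (*-identityˡ (h m)) ⟩
      1F ⊗ h m           ≡⟨ cong (_⊗ h m) (sym (proj₁ mg)) ⟩
      g k ⊗ h m          ≡⟨ sym (*ˢ-top k m (proj₂ mg) dh) ⟩
      (g *ˢ h) (k ℕ.+ m) ≡⟨ dgh (k ℕ.+ m) (ℕP.m≤m+n k m) ⟩
      0F ∎

  *ˢ-cancelˡ : ∀ {g k} → Monic k g → ∀ m {h h′} → Deg< m h → Deg< m h′ → g *ˢ h ≗ g *ˢ h′ → h ≗ h′
  *ˢ-cancelˡ {g} {k} mg m {h} {h′} dh dh′ e i = x-y≡0⇒x≡y (h i) (h′ i)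
    (*ˢ-small mg m (Deg<-+ dh (Deg<-neg dh′)) (λ j _ → begin
      (g *ˢ (h +ˢ negS h′)) j          ≡⟨ *ˢ-distribˡ g h (negS h′) j ⟩
      (g *ˢ h) j ⊕ (g *ˢ negS h′) j    ≡⟨ cong₂ _⊕_ (e j) (*ˢ-negʳ g h′ j) ⟩
      (g *ˢ h′) j ⊕ ⊖ (g *ˢ h′) j      ≡⟨ ⊖-inverseʳ _ ⟩
      0F ∎) i)

  infix 4 _∣ˢ_
  -- The degree bound m keeps the cofactor a polynomial: among power series, every g with nonzero
  -- constant term divides everything.
  _∣ˢ_ : Series → Series → Set
  g ∣ˢ f = ∃ λ m → ∃ λ h → Deg< m h × f ≗ g *ˢ h

  ∣ˢ-≗ : ∀ {g f f′} → f ≗ f′ → g ∣ˢ f → g ∣ˢ f′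
  ∣ˢ-≗ e (m , h , d , p) = m , h , d , λ i → trans (sym (e i)) (p i)

  ∣ˢ-+ : ∀ {g f f′} → g ∣ˢ f → g ∣ˢ f′ → g ∣ˢ f +ˢ f′
  ∣ˢ-+ {g} (m , h , d , p) (m′ , h′ , d′ , p′) = m ℕ.⊔ m′ , h +ˢ h′
    , Deg<-+ (Deg<-weaken (ℕP.m≤m⊔n m m′) d) (Deg<-weaken (ℕP.m≤n⊔m m m′) d′)
    , λ i → trans (cong₂ _⊕_ (p i) (p′ i)) (sym (*ˢ-distribˡ g h h′ i))

  ∣ˢ-neg : ∀ {g f} → g ∣ˢ f → g ∣ˢ negS f
  ∣ˢ-neg {g} (m , h , d , p) = m , negS h , Deg<-neg d , λ i → trans (cong ⊖_ (p i)) (sym (*ˢ-negʳ g h i))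

  ∣ˢ-∙ : ∀ {g f} c → g ∣ˢ f → g ∣ˢ c ∙ f
  ∣ˢ-∙ {g} c (m , h , d , p) = m , c ∙ h , Deg<-∙ c d , λ i → trans (cong (c ⊗_) (p i)) (sym (*ˢ-∙ c g h i))

  ∣ˢ-*ʳ : ∀ {g f} b k → Deg< k b → g ∣ˢ f → g ∣ˢ f *ˢ b
  ∣ˢ-*ʳ {g} b k db (m , h , d , p) = m ℕ.+ k , h *ˢ b , *ˢ-Deg< m k d db
    , λ i → trans (*ˢ-congˡ p i) (*ˢ-assoc g h b i)

  Irreducible : ℕ → Series → Set
  Irreducible n p = Monic n p × (∀ a b {f g} → Monic a f → Monic b g → p ≗ f *ˢ g → a ≡ 0 ⊎ b ≡ 0)

  decZero : ∀ k f → Deg< k f → (f ≗ zeroS) ⊎ (∃ λ i → i ℕ.< k × f i ≢ 0F × Deg< (suc i) f)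
  decZero zero    f d = inj₁ (λ i → d i z≤n)
  decZero (suc k) f d with f k ≟ 0F
  ... | no n = inj₂ (k , ℕP.≤-refl , n , d)
  ... | yes e with decZero k f (Deg<-pred d e)
  ...   | inj₁ z = inj₁ z
  ...   | inj₂ (i , i<k , n , d′) = inj₂ (i , ℕP.m<n⇒m<1+n i<k , n , d′)

  module _ {n p} (irr : Irreducible n p) {m b} (db : Deg< m b) where

    private
      mp : Monic n p
      mp = proj₁ irr

    module Step {k j c} (mc : Monic k c) (k<n : k ℕ.< n) (j+k≡n : j ℕ.+ k ≡ n)
                (D : Division c k (suc j) p) (pcb : p ∣ˢ c *ˢ b) where
      open Division D

      -- From p = c q + r one gets r b = p b - q (c b), and p divides both terms.
      p∣rem*b : p ∣ˢ rem *ˢ b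
      p∣rem*b = ∣ˢ-≗ eq (∣ˢ-+ (m , b , db , λ _ → refl) (∣ˢ-neg (∣ˢ-*ʳ quot (suc j) quot-deg pcb)))
        where
        cqb : (c *ˢ b) *ˢ quot ≗ (c *ˢ quot) *ˢ b
        cqb i = trans (*ˢ-assoc c b quot i) (trans (*ˢ-congʳ {c} (*ˢ-comm b quot) i) (sym (*ˢ-assoc c quot b i)))
        eq : p *ˢ b +ˢ negS ((c *ˢ b) *ˢ quot) ≗ rem *ˢ b
        eq i = trans (cong₂ (λ x y → x ⊕ ⊖ y) (trans (*ˢ-congˡ eqn i) (*ˢ-distribʳ (c *ˢ quot) rem b i)) (cqb i))
          (solve 2 (λ x y → (x :+ y) :+ :- x := y) refl (((c *ˢ quot) *ˢ b) i) ((rem *ˢ b) i))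

      module _ (z : rem ≗ zeroS) where

        p≗c*quot : p ≗ c *ˢ quot
        p≗c*quot i = trans (eqn i) (trans (cong ((c *ˢ quot) i ⊕_) (z i)) (+-identityʳ _))

        quot-top : quot j ≡ 1F
        quot-top = begin
          quot j                   ≡⟨ sym (*-identityˡ _) ⟩
          1F ⊗ quot j              ≡⟨ cong (_⊗ quot j) (sym (proj₁ mc)) ⟩
          c k ⊗ quot j             ≡⟨ sym (*ˢ-top k j (proj₂ mc) quot-deg) ⟩
          (c *ˢ quot) (k ℕ.+ j)    ≡⟨ sym (p≗c*quot (k ℕ.+ j)) ⟩
          p (k ℕ.+ j)              ≡⟨ cong p (trans (ℕP.+-comm k j) j+k≡n) ⟩
          p n                      ≡⟨ proj₁ mp ⟩
          1F ∎

        -- A zero remainder factors p as c times a monic quotient of degree j = n - k > 0.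
        -- Irreducibility then makes c constant, hence 1, and p ∣ c b is already p ∣ b.
        k≡0 : k ≡ 0
        k≡0 with proj₂ irr k j mc (quot-top , quot-deg) p≗c*quot
        ... | inj₁ e   = e
        ... | inj₂ j≡0 = contradiction (trans (sym (cong (ℕ._+ k) j≡0)) j+k≡n) (ℕP.<⇒≢ k<n)

        c≗1 : c ≗ oneS
        c≗1 zero    = subst (λ z → c z ≡ 1F) k≡0 (proj₁ mc)
        c≗1 (suc i) = proj₂ mc (suc i) (subst (λ z → suc z ≤ suc i) (sym k≡0) (s≤s z≤n))

        p∣b : p ∣ˢ b
        p∣b = ∣ˢ-≗ (λ i → trans (*ˢ-congˡ c≗1 i) (*ˢ-oneˡ b i)) pcb

    step : ∀ {k c} → Monic k c → k ℕ.< n → p ∣ˢ c *ˢ b →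
           p ∣ˢ b ⊎ (∃ λ r → Deg< k r × (∃ λ i → r i ≢ 0F) × p ∣ˢ r *ˢ b)
    step {k} {c} mc k<n pcb = conclude (decZero k (Division.rem D) (Division.rem-deg D))
      where
      j+k≡n : n ℕ.∸ k ℕ.+ k ≡ n
      j+k≡n = ℕP.m∸n+n≡m (ℕP.<⇒≤ k<n)
      D : Division c k (suc (n ℕ.∸ k)) p
      D = divide mc (suc (n ℕ.∸ k)) p (subst (λ z → Deg< (suc z) p) (sym j+k≡n) (proj₂ mp))
      open Step mc k<n j+k≡n D pcb
      open Division D
      conclude : (rem ≗ zeroS) ⊎ (∃ λ i → i ℕ.< k × rem i ≢ 0F × Deg< (suc i) rem) →
                 p ∣ˢ b ⊎ (∃ λ r → Deg< k r × (∃ λ i → r i ≢ 0F) × p ∣ˢ r *ˢ b)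
      conclude (inj₁ z)                 = inj₁ (p∣b z)
      conclude (inj₂ (i , _ , r≢0 , _)) = inj₂ (rem , rem-deg , (i , r≢0) , p∣rem*b)

    -- Replacing c by the remainder of p modulo c keeps p ∣ c b and lowers the degree of c.
    euclid : ∀ k c → k ≤ n → Deg< k c → (∃ λ i → c i ≢ 0F) → p ∣ˢ c *ˢ b → p ∣ˢ b
    euclid zero    c _   dc (i , c≢0) _ = contradiction (dc i z≤n) c≢0
    euclid (suc k) c k<n dc nz pcb with c k ≟ 0F
    ... | yes e = euclid k c (ℕP.<⇒≤ k<n) (Deg<-pred dc e) nz pcb
    ... | no ck≢0 with inverse (c k) ck≢0
    ... | u , cu≡1 with step (trans (*-comm u (c k)) cu≡1 , Deg<-∙ u dc) k<n (∣ˢ-≗ (λ i → sym (∙-*ˢ u c b i)) (∣ˢ-∙ u pcb))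
    ... | inj₁ p∣b                 = p∣b
    ... | inj₂ (r , dr , nz′ , prb) = euclid k r (ℕP.<⇒≤ k<n) dr nz′ prb

range : ℕ → List ℕ
range zero    = []
range (suc n) = n ∷ range n

∑-range-cong : ∀ n {f g : ℕ → ℤ} → (∀ i → i ℕ.< n → f i ≡ g i) → ∑ (range n) f ≡ ∑ (range n) g
∑-range-cong zero    h = refl
∑-range-cong (suc n) h = cong₂ _+_ (h n ℕP.≤-refl) (∑-range-cong n (λ i p → h i (ℕP.m<n⇒m<1+n p)))

∑-range-zero : ∀ n {f : ℕ → ℤ} → (∀ i → i ℕ.< n → f i ≡ 0ℤ) → ∑ (range n) f ≡ 0ℤ
∑-range-zero n h = trans (∑-range-cong n h) (∑-0 (range n))

∑-range-single : ∀ n {f : ℕ → ℤ} k → k ℕ.< n → (∀ i → i ≢ k → f i ≡ 0ℤ) → ∑ (range n) f ≡ f k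
∑-range-single (suc n) {f} k (s≤s k≤n) h with k ℕP.≟ n
... | yes refl = trans (cong (f k +_) (∑-range-zero k (λ i p → h i (ℕP.<⇒≢ p)))) (ℤP.+-identityʳ (f k))
... | no k≢n   = trans (cong₂ _+_ (h n (k≢n ∘ sym)) (∑-range-single n k (ℕP.≤∧≢⇒< k≤n k≢n) h)) (ℤP.+-identityˡ (f k))

∑-range-shift : ∀ n (f : ℕ → ℤ) → f n + ∑ (range n) f ≡ f 0 + ∑ (range n) (f ∘ suc)
∑-range-shift zero    f = refl
∑-range-shift (suc n) f = begin
  f (suc n) + (f n + ∑ (range n) f)               ≡⟨ cong (f (suc n) +_) (∑-range-shift n f) ⟩
  f (suc n) + (f 0 + ∑ (range n) (f ∘ suc))       ≡⟨ lem (f (suc n)) (f 0) _ ⟩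
  f 0 + (f (suc n) + ∑ (range n) (f ∘ suc)) ∎
  where
  open ≡-Reasoning
  lem : ∀ a b c → a + (b + c) ≡ b + (a + c)
  lem = solve-∀

module MonicPolynomials (F : FiniteField) where
  open FiniteField F
  open Polynomials F public
  open ≡-Reasoning

  toS : ∀ {k} → Vec Carrier k → Series
  toS []      = zeroS
  toS (a ∷ v) zero    = a
  toS (a ∷ v) (suc i) = toS v i

  -- The vector holds only the coefficients below the leading 1, so `Vec Carrier k` enumerates the
  -- monic polynomials of degree k.
  mon : ∀ {k} → Vec Carrier k → Series
  mon []      = oneS
  mon (a ∷ v) zero    = a
  mon (a ∷ v) (suc i) = mon v i

  take : ∀ k → Series → Vec Carrier k
  take zero    f = []
  take (suc k) f = f 0 ∷ take k (tl f)

  take-cong : ∀ k {f g} → f ≗ g → take k f ≡ take k g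
  take-cong zero    e = refl
  take-cong (suc k) e = cong₂ _∷_ (e 0) (take-cong k (e ∘ suc))

  take-mon : ∀ {k} (v : Vec Carrier k) → take k (mon v) ≡ v
  take-mon []      = refl
  take-mon (a ∷ v) = cong (a ∷_) (take-mon v)

  take-toS : ∀ {k} (v : Vec Carrier k) → take k (toS v) ≡ v
  take-toS []      = refl
  take-toS (a ∷ v) = cong (a ∷_) (take-toS v)

  mon-take : ∀ k {f} → Monic k f → mon (take k f) ≗ f
  mon-take zero    (t , d) zero    = sym t
  mon-take zero    (t , d) (suc i) = sym (d (suc i) (s≤s z≤n))
  mon-take (suc k) (t , d) zero    = refl
  mon-take (suc k) (t , d) (suc i) = mon-take k (t , λ j p → d (suc j) (s≤s p)) i

  toS-take : ∀ k {f} → Deg< k f → toS (take k f) ≗ f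
  toS-take zero    d i       = sym (d i z≤n)
  toS-take (suc k) d zero    = refl
  toS-take (suc k) d (suc i) = toS-take k (λ j p → d (suc j) (s≤s p)) i

  Monic-mon : ∀ {k} (v : Vec Carrier k) → Monic k (mon v)
  Monic-mon []      = Monic-one
  Monic-mon (a ∷ v) = proj₁ (Monic-mon v) , λ { (suc i) (s≤s p) → proj₂ (Monic-mon v) i p }

  toS-deg : ∀ {k} (v : Vec Carrier k) → Deg< k (toS v)
  toS-deg []      i       p       = refl
  toS-deg (a ∷ v) (suc i) (s≤s p) = toS-deg v i p

  Monic-≗ : ∀ {k f g} → f ≗ g → Monic k f → Monic k g
  Monic-≗ {k} e (t , d) = trans (sym (e k)) t , Deg<-≗ e d

  top-unique : ∀ {k l f} → Monic k f → f l ≢ 0F → Deg< (suc l) f → k ≡ l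
  top-unique {k} {l} (t , d) n d′ with ℕP.<-cmp k l
  ... | tri< k<l _ _ = contradiction (d l k<l) n
  ... | tri≈ _ e _   = e
  ... | tri> _ _ l<k = contradiction (trans (sym (d′ k l<k)) t) 0≢1

  Monic-unique : ∀ {k l f} → Monic k f → Monic l f → k ≡ l
  Monic-unique m (t , d) = top-unique m (λ e → 0≢1 (trans (sym e) t)) d

  Mon : Set
  Mon = Σ ℕ (Vec Carrier)

  deg : Mon → ℕ
  deg = proj₁

  ser : Mon → Series
  ser x = mon (proj₂ x)

  Monic-ser : ∀ x → Monic (deg x) (ser x)
  Monic-ser x = Monic-mon (proj₂ x)

  Mon-ext : ∀ {x y} → deg x ≡ deg y → ser x ≗ ser y → x ≡ y
  Mon-ext {k , u} {_ , v} refl e = cong (k ,_) (trans (sym (take-mon u)) (trans (take-cong k e) (take-mon v)))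

  fromMonic : ∀ {k f} → Monic k f → Mon
  fromMonic {k} {f} _ = k , take k f

  infixl 7 _*ᴹ_
  _*ᴹ_ : Mon → Mon → Mon
  x *ᴹ y = deg x ℕ.+ deg y , take (deg x ℕ.+ deg y) (ser x *ˢ ser y)

  ser-* : ∀ x y → ser (x *ᴹ y) ≗ ser x *ˢ ser y
  ser-* x y = mon-take (deg x ℕ.+ deg y) (Monic-* (Monic-ser x) (Monic-ser y))

  1ᴹ : Mon
  1ᴹ = 0 , []

  *ᴹ-comm : ∀ x y → x *ᴹ y ≡ y *ᴹ x
  *ᴹ-comm x y = Mon-ext (ℕP.+-comm (deg x) (deg y))
    (λ i → trans (ser-* x y i) (trans (*ˢ-comm (ser x) (ser y) i) (sym (ser-* y x i))))

  *ᴹ-assoc : ∀ x y z → (x *ᴹ y) *ᴹ z ≡ x *ᴹ (y *ᴹ z)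
  *ᴹ-assoc x y z = Mon-ext (ℕP.+-assoc (deg x) (deg y) (deg z)) (λ i → begin
    ser ((x *ᴹ y) *ᴹ z) i          ≡⟨ ser-* (x *ᴹ y) z i ⟩
    (ser (x *ᴹ y) *ˢ ser z) i      ≡⟨ *ˢ-congˡ (ser-* x y) i ⟩
    ((ser x *ˢ ser y) *ˢ ser z) i  ≡⟨ *ˢ-assoc (ser x) (ser y) (ser z) i ⟩
    (ser x *ˢ (ser y *ˢ ser z)) i  ≡⟨ *ˢ-congʳ {ser x} (λ j → sym (ser-* y z j)) i ⟩
    (ser x *ˢ ser (y *ᴹ z)) i      ≡⟨ sym (ser-* x (y *ᴹ z) i) ⟩
    ser (x *ᴹ (y *ᴹ z)) i ∎)

  *ᴹ-identityʳ : ∀ x → x *ᴹ 1ᴹ ≡ x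
  *ᴹ-identityʳ x = Mon-ext (ℕP.+-identityʳ (deg x)) (λ i → trans (ser-* x 1ᴹ i) (*ˢ-oneʳ (ser x) i))

  deg≡0⇒1 : ∀ x → deg x ≡ 0 → x ≡ 1ᴹ
  deg≡0⇒1 (0 , []) refl = refl

  *ᴹ-cancelˡ : ∀ x {y z} → x *ᴹ y ≡ x *ᴹ z → y ≡ z
  *ᴹ-cancelˡ x {y} {z} e = Mon-ext dy≡dz (*ˢ-cancelˡ (Monic-ser x) (suc (deg y)) (proj₂ (Monic-ser y))
      (subst (λ k → Deg< (suc k) (ser z)) (sym dy≡dz) (proj₂ (Monic-ser z)))
      (λ i → trans (sym (ser-* x y i)) (trans (cong (λ w → ser w i) e) (ser-* x z i))))
    where
    dy≡dz : deg y ≡ deg z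
    dy≡dz = ℕP.+-cancelˡ-≡ (deg x) (deg y) (deg z) (cong deg e)

  infix 4 _∣ᴹ_
  _∣ᴹ_ : Mon → Mon → Set
  x ∣ᴹ y = ∃ λ z → y ≡ x *ᴹ z

  ∣ˢ⇒∣ᴹ : ∀ x y → ser x ∣ˢ ser y → x ∣ᴹ y
  ∣ˢ⇒∣ᴹ x y (m , h , dh , e) with decZero m h dh
  ... | inj₁ z = contradiction (trans (sym (trans (e (deg y)) (trans (*ˢ-congʳ {ser x} z (deg y)) (*ˢ-zeroʳ (ser x) (deg y)))))
                   (proj₁ (Monic-ser y))) 0≢1
  ... | inj₂ (i , _ , hi≢0 , dh′) = fromMonic mh , Mon-ext dy (λ j → trans (e j)
          (trans (*ˢ-congʳ {ser x} (λ l → sym (mon-take i mh l)) j) (sym (ser-* x (fromMonic mh) j))))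
    where
    top : ser y (deg x ℕ.+ i) ≡ h i
    top = trans (e _) (trans (*ˢ-top (deg x) i (proj₂ (Monic-ser x)) dh′)
      (trans (cong (_⊗ h i) (proj₁ (Monic-ser x))) (*-identityˡ (h i))))
    dy : deg y ≡ deg x ℕ.+ i
    dy = top-unique (Monic-ser y) (λ z → hi≢0 (trans (sym top) z))
      (Deg<-≗ (λ j → sym (e j)) (*ˢ-deg (deg x) i (proj₂ (Monic-ser x)) dh′))
    mh : Monic i h
    mh = trans (sym top) (trans (cong (ser y) (sym dy)) (proj₁ (Monic-ser y))) , dh′

  Irr : Mon → Set
  Irr p = 1 ≤ deg p × (∀ a b → p ≡ a *ᴹ b → deg a ≡ 0 ⊎ deg b ≡ 0)

  Irr⇒Irreducible : ∀ p → Irr p → Irreducible (deg p) (ser p)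
  Irr⇒Irreducible p (_ , red) = Monic-ser p , λ a b {f} {g} mf mg e →
    red (fromMonic mf) (fromMonic mg) (Mon-ext (Monic-unique (Monic-ser p) (Monic-≗ (λ i → sym (e i)) (Monic-* mf mg)))
      (λ i → trans (e i) (trans (*ˢ-cong (λ j → sym (mon-take a mf j)) (λ j → sym (mon-take b mg j)) i)
        (sym (ser-* (fromMonic mf) (fromMonic mg) i)))))

  -- `euclid` treats a nonzero factor of degree below deg p. Hence a is first reduced modulo p; a
  -- zero remainder is the case in which p divides a.
  euclidᴹ : ∀ {p} → Irr p → ∀ a b → p ∣ᴹ a *ᴹ b → p ∣ᴹ a ⊎ p ∣ᴹ b
  euclidᴹ {p} irr a b (z , e) = conclude (decZero (deg p) rem rem-deg)
    where
    open Division (divide (Monic-ser p) (suc (deg a)) (ser a)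
      (Deg<-weaken (ℕP.m≤m+n (suc (deg a)) (deg p)) (proj₂ (Monic-ser a))))
    ab : ser a *ˢ ser b ≗ ser p *ˢ ser z
    ab i = trans (sym (ser-* a b i)) (trans (cong (λ w → ser w i) e) (ser-* p z i))
    open Solver using (solve; _:=_; _:+_; :-_)
    p∣rem*b : ser p ∣ˢ rem *ˢ ser b
    p∣rem*b = ∣ˢ-≗ eq (∣ˢ-+ (suc (deg z) , ser z , proj₂ (Monic-ser z) , ab)
        (∣ˢ-neg (∣ˢ-*ʳ (ser b) (suc (deg b)) (proj₂ (Monic-ser b)) (suc (deg a) , quot , quot-deg , λ _ → refl))))
      where
      eq : ser a *ˢ ser b +ˢ negS ((ser p *ˢ quot) *ˢ ser b) ≗ rem *ˢ ser b
      eq i = trans (cong (_⊕ ⊖ ((ser p *ˢ quot) *ˢ ser b) i)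
          (trans (*ˢ-congˡ eqn i) (*ˢ-distribʳ (ser p *ˢ quot) rem (ser b) i)))
        (solve 2 (λ x y → (x :+ y) :+ :- x := y) refl (((ser p *ˢ quot) *ˢ ser b) i) ((rem *ˢ ser b) i))
    conclude : (rem ≗ zeroS) ⊎ (∃ λ i → i ℕ.< deg p × rem i ≢ 0F × Deg< (suc i) rem) → p ∣ᴹ a ⊎ p ∣ᴹ b
    conclude (inj₁ r≗0) = inj₁ (∣ˢ⇒∣ᴹ p a (suc (deg a) , quot , quot-deg , λ i →
      trans (eqn i) (trans (cong ((ser p *ˢ quot) i ⊕_) (r≗0 i)) (+-identityʳ _))))
    conclude (inj₂ (i , _ , r≢0 , _)) = inj₂ (∣ˢ⇒∣ᴹ p b (euclid (Irr⇒Irreducible p irr) (proj₂ (Monic-ser b))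
      (deg p) rem ℕP.≤-refl rem-deg (i , r≢0) p∣rem*b))

-- Counting irreducible polynomials by degree

module IrreducibleCount (F : FiniteField) where
  open FiniteField F
  open MonicPolynomials F public
  open ≡-Reasoning

  private
    module V k = Enum (enumVec enum k)

  infix 4 _≟ᴹ_ _∣?_

  _≟ᴹ_ : DecidableEquality Mon
  _≟ᴹ_ = ProdP.≡-dec ℕP._≟_ (vec≟ enum)

  private
    ofDegree : ∀ {P : Mon → Set} {k} z → deg z ≡ k → P z → ∃ λ (w : Vec Carrier k) → P (k , w)
    ofDegree (_ , w) refl p = w , p

  -- The degree of the cofactor is forced to be deg y - deg x, which leaves a finite search.
  _∣?_ : ∀ x y → Dec (x ∣ᴹ y)
  x ∣? y with deg x ℕP.≤? deg y
  ... | no n  = no λ { (z , e) → n (subst (deg x ≤_) (sym (cong deg e)) (ℕP.m≤m+n (deg x) (deg z))) }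
  ... | yes _ = map′ (λ { (w , e) → (deg y ℕ.∸ deg x , w) , e }) back
                     (V.any? (deg y ℕ.∸ deg x) (λ w → y ≟ᴹ x *ᴹ (deg y ℕ.∸ deg x , w)))
    where
    back : x ∣ᴹ y → ∃ λ w → y ≡ x *ᴹ (deg y ℕ.∸ deg x , w)
    back (z , e) = ofDegree {λ z → y ≡ x *ᴹ z} z (sym (trans (cong (λ w → deg w ℕ.∸ deg x) e) (ℕP.m+n∸m≡n (deg x) (deg z)))) e

  ∣ᴹ-deg : ∀ x y → x ∣ᴹ y → deg x ≤ deg y
  ∣ᴹ-deg x y (z , e) = subst (deg x ≤_) (sym (cong deg e)) (ℕP.m≤m+n (deg x) (deg z))

  Proper : Mon → ℕ → Set
  Proper p k = 1 ≤ k × ∃ λ (v : Vec Carrier k) → (k , v) ∣ᴹ p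

  proper? : ∀ p → Dec (∃ λ k → k ℕ.< deg p × Proper p k)
  proper? p = ℕP.anyUpTo? (λ k → (1 ℕP.≤? k) ×-dec (V.any? k (λ v → (k , v) ∣? p))) (deg p)

  irr-noProper : ∀ p → Irr p → ¬ (∃ λ k → k ℕ.< deg p × Proper p k)
  irr-noProper p (_ , red) (k , k<d , 1≤k , v , z , e) with red (k , v) z e
  ... | inj₁ refl = contradiction 1≤k λ ()
  ... | inj₂ dz≡0 = ℕP.<⇒≢ k<d (sym (trans (cong deg e) (trans (cong (k ℕ.+_) dz≡0) (ℕP.+-identityʳ k))))

  noProper-irr : ∀ p → 1 ≤ deg p → ¬ (∃ λ k → k ℕ.< deg p × Proper p k) → Irr p
  noProper-irr p 1≤d h = 1≤d , red
    where
    red : ∀ a b → p ≡ a *ᴹ b → deg a ≡ 0 ⊎ deg b ≡ 0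
    red (zero  , u) b e = inj₁ refl
    red (suc k , u) (zero  , w) e = inj₂ refl
    red (suc k , u) (suc l , w) e = ⊥-elim (h (suc k , subst (suc k ℕ.<_) (sym (cong deg e)) (ℕP.m<m+n (suc k) (s≤s z≤n)) , s≤s z≤n , u , (suc l , w) , e))

  irr? : ∀ p → Dec (Irr p)
  irr? p with 1 ℕP.≤? deg p | proper? p
  ... | no n    | _     = no (n ∘ proj₁)
  ... | yes 1≤d | yes h = no λ i → irr-noProper p i h
  ... | yes 1≤d | no h  = yes (noProper-irr p 1≤d h)

  irreducibleFactor : ∀ D f → deg f ≤ D → 1 ≤ deg f → ∃ λ p → Irr p × p ∣ᴹ f
  irreducibleFactor zero    f d≤D 1≤d = contradiction (ℕP.≤-trans 1≤d d≤D) λ ()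
  irreducibleFactor (suc D) f d≤D 1≤d with proper? f
  ... | no h = f , noProper-irr f 1≤d h , 1ᴹ , sym (*ᴹ-identityʳ f)
  ... | yes (k , k<d , 1≤k , v , z , e) with irreducibleFactor D (k , v) (ℕP.≤-pred (ℕP.≤-trans k<d d≤D)) 1≤k
  ... | p , irr , w , e′ = p , irr , w *ᴹ z , trans e (trans (cong (_*ᴹ z) e′) (*ᴹ-assoc p w z))

  -- Cancellation makes w ↦ g w injective, so each multiple of g of degree deg g + m arises from
  -- exactly one of the `size ^ m` monic cofactors.
  countMultiples : ∀ g m → ∑ (vecs enum (deg g ℕ.+ m)) (λ v → ⟦ does (g ∣? (deg g ℕ.+ m , v)) ⟧) ≡ pos (size ℕ.^ m)
  countMultiples g m = begin
    ∑ (vecs enum (deg g ℕ.+ m)) (λ v → ⟦ does (g ∣? (deg g ℕ.+ m , v)) ⟧)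
      ≡⟨ ∑-cong (vecs enum (deg g ℕ.+ m)) asSum ⟩
    ∑ (vecs enum (deg g ℕ.+ m)) (λ v → ∑ (vecs enum m) (λ w → V.δ _ (φ w) v))
      ≡⟨ ∑-swap (vecs enum (deg g ℕ.+ m)) (vecs enum m) _ ⟩
    ∑ (vecs enum m) (λ w → ∑ (vecs enum (deg g ℕ.+ m)) (V.δ _ (φ w)))
      ≡⟨ ∑-cong (vecs enum m) (λ w → V.once _ (φ w)) ⟩
    ∑ (vecs enum m) (λ _ → 1ℤ)
      ≡⟨ sym (∑-length (vecs enum m)) ⟩
    pos (length (vecs enum m))
      ≡⟨ size-vecs enum m ⟩
    pos (size ℕ.^ m) ∎
    where
    φ : Vec Carrier m → Vec Carrier (deg g ℕ.+ m)
    φ w = proj₂ (g *ᴹ (m , w))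
    same : ∀ {k} {u v : Vec Carrier k} → _≡_ {A = Mon} (k , u) (k , v) → u ≡ v
    same {k} {u} {v} e = trans (sym (take-mon u)) (trans (take-cong k (λ i → cong (λ x → ser x i) e)) (take-mon v))
    asSum : ∀ v → ⟦ does (g ∣? (deg g ℕ.+ m , v)) ⟧ ≡ ∑ (vecs enum m) (λ w → V.δ _ (φ w) v)
    asSum v with g ∣? (deg g ℕ.+ m , v)
    ... | no n = sym (trans (∑-cong (vecs enum m) (λ w → V.δ-≢ _ λ e → n ((m , w) , cong (deg g ℕ.+ m ,_) (sym e)))) (∑-0 (vecs enum m)))
    ... | yes (z , e) with ofDegree {λ z → (deg g ℕ.+ m , v) ≡ g *ᴹ z} z (ℕP.+-cancelˡ-≡ (deg g) (deg z) m (sym (cong deg e))) e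
    ...   | w₀ , e₀ = sym (trans (∑-cong (vecs enum m) (λ w → cong ⟦_⟧ (does-cong (vec≟ enum (φ w) v) (vec≟ enum w₀ w)
              (λ p → sym (same (*ᴹ-cancelˡ g (trans (cong (deg g ℕ.+ m ,_) p) e₀))))
              (λ { refl → sym (same e₀) })))) (V.once m w₀))

  -- q^(n-k) for k ≤ n and 0 otherwise, with q the size of the field: the number of monic multiples
  -- of degree n of a polynomial of degree k.
  W : ℕ → ℕ → ℤ
  W n       zero    = pos (size ℕ.^ n)
  W zero    (suc k) = 0ℤ
  W (suc n) (suc k) = W n k

  W-small : ∀ n k → n ℕ.< k → W n k ≡ 0ℤ
  W-small zero    (suc k) _       = refl
  W-small (suc n) (suc k) (s≤s p) = W-small n k p

  W-+ : ∀ k m → W (k ℕ.+ m) k ≡ pos (size ℕ.^ m)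
  W-+ zero    m = refl
  W-+ (suc k) m = W-+ k m

  ε : ℕ → ℕ → ℤ
  ε a b = ⟦ does (a ℕP.≟ b) ⟧

  -- Passing from n to n + 1 multiplies `W` by q, except that a new term 1 appears at k = n + 1.
  -- This correction is what singles out the divisors of n + 1 in `divisorSum`.
  W-suc : ∀ n k → W (suc n) k ≡ pos size * W n k + ε k (suc n)
  W-suc n       zero          = trans (ℤP.pos-* size (size ℕ.^ n)) (sym (ℤP.+-identityʳ _))
  W-suc zero    (suc zero)    = cong (_+ 1ℤ) (sym (ℤP.*-zeroʳ (pos size)))
  W-suc zero    (suc (suc k)) = cong (_+ 0ℤ) (sym (ℤP.*-zeroʳ (pos size)))
  W-suc (suc n) (suc k)       = trans (W-suc n k) (cong (λ b → pos size * W n k + ⟦ b ⟧)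
    (does-cong (k ℕP.≟ suc n) (suc k ℕP.≟ suc (suc n)) (cong suc) ℕP.suc-injective))

  countDivisible : ∀ g n → ∑ (vecs enum n) (λ v → ⟦ does (g ∣? (n , v)) ⟧) ≡ W n (deg g)
  countDivisible g n with ℕP.≤-<-connex (deg g) n
  ... | inj₁ d≤n with ℕP.m≤n⇒∃[o]m+o≡n d≤n
  ...   | m , refl = trans (countMultiples g m) (sym (W-+ (deg g) m))
  countDivisible g n | inj₂ n<d = trans (trans (∑-cong (vecs enum n) (λ v → cong ⟦_⟧ (dec-false (g ∣? (n , v))
    (λ d → ℕP.<⇒≱ n<d (∣ᴹ-deg g (n , v) d))))) (∑-0 (vecs enum n))) (sym (W-small n (deg g) n<d))

  pow : Mon → ℕ → Mon
  pow p zero    = 1ᴹ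
  pow p (suc j) = p *ᴹ pow p j

  deg-pow : ∀ p j → deg (pow p j) ≡ j ℕ.* deg p
  deg-pow p zero    = refl
  deg-pow p (suc j) = cong (deg p ℕ.+_) (deg-pow p j)

  -- The multiplicity of p in f, as the number of powers p, p², ... dividing f; for deg p ≥ 1 the
  -- cutoff B loses nothing once B ≥ deg f.
  val : ℕ → Mon → Mon → ℤ
  val B p f = ∑ (range B) (λ j → ⟦ does (pow p (suc j) ∣? f) ⟧)

  val-one : ∀ B p f → 1 ≤ deg p → deg f ≡ 0 → val B p f ≡ 0ℤ
  val-one B p f 1≤d e = ∑-range-zero B (λ j _ → cong ⟦_⟧ (dec-false (pow p (suc j) ∣? f)
    (λ d → ℕP.<⇒≱ (ℕP.≤-trans 1≤d (ℕP.m≤m+n (deg p) _)) (subst (deg (pow p (suc j)) ≤_) e (∣ᴹ-deg (pow p (suc j)) f d)))))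

  -- p^(j+1) divides p h exactly when p^j divides h, so the sum is shifted by one: the term j = 0
  -- contributes 1, and the term j = B is zero because p^B has degree greater than deg h.
  val-self : ∀ B p h → 1 ≤ deg p → deg (p *ᴹ h) ≤ B → val B p (p *ᴹ h) ≡ 1ℤ + val B p h
  val-self B p h 1≤d d≤B = begin
    val B p (p *ᴹ h)                   ≡⟨ ∑-cong (range B) (λ j → cong ⟦_⟧ (does-cong (pow p (suc j) ∣? p *ᴹ h) (pow p j ∣? h) (to j) (from j))) ⟩
    ∑ (range B) dv                      ≡⟨ sym (ℤP.+-identityˡ _) ⟩
    0ℤ + ∑ (range B) dv                 ≡⟨ cong (_+ ∑ (range B) dv) (sym last≡0) ⟩
    dv B + ∑ (range B) dv                ≡⟨ ∑-range-shift B dv ⟩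
    dv 0 + ∑ (range B) (dv ∘ suc)        ≡⟨ cong (_+ val B p h) (cong ⟦_⟧ (dec-true (1ᴹ ∣? h) (h , trans (sym (*ᴹ-identityʳ h)) (*ᴹ-comm h 1ᴹ)))) ⟩
    1ℤ + val B p h ∎
    where
    dv : ℕ → ℤ
    dv j = ⟦ does (pow p j ∣? h) ⟧
    to : ∀ j → pow p (suc j) ∣ᴹ p *ᴹ h → pow p j ∣ᴹ h
    to j (w , e) = w , *ᴹ-cancelˡ p (trans e (*ᴹ-assoc p (pow p j) w))
    from : ∀ j → pow p j ∣ᴹ h → pow p (suc j) ∣ᴹ p *ᴹ h
    from j (w , e) = w , trans (cong (p *ᴹ_) e) (sym (*ᴹ-assoc p (pow p j) w))
    last≡0 : dv B ≡ 0ℤ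
    last≡0 = cong ⟦_⟧ (dec-false (pow p B ∣? h) (λ d → ℕP.<⇒≱ (ℕP.≤-trans (ℕP.+-monoˡ-≤ (deg h) 1≤d) d≤B)
      (ℕP.≤-trans (ℕP.≤-trans (ℕP.≤-reflexive (sym (ℕP.*-identityʳ B))) (ℕP.*-monoʳ-≤ B 1≤d))
        (subst (_≤ deg h) (deg-pow p B) (∣ᴹ-deg (pow p B) h d)))))

  -- Two different monic irreducible polynomials do not divide each other, so Euclid's lemma moves
  -- the factors p of r h into h one at a time.
  val-other : ∀ B p r h → Irr p → Irr r → p ≢ r → val B p (r *ᴹ h) ≡ val B p h
  val-other B p r h ip ir p≢r = ∑-cong (range B) (λ j → cong ⟦_⟧ (does-cong (pow p (suc j) ∣? r *ᴹ h) (pow p (suc j) ∣? h)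
      (to (suc j) h) (λ { (w , e) → r *ᴹ w , trans (cong (r *ᴹ_) e) (swap₁ r (pow p (suc j)) w) })))
    where
    swap₁ : ∀ a b c → a *ᴹ (b *ᴹ c) ≡ b *ᴹ (a *ᴹ c)
    swap₁ a b c = trans (sym (*ᴹ-assoc a b c)) (trans (cong (_*ᴹ c) (*ᴹ-comm a b)) (*ᴹ-assoc b a c))
    p∤r : ¬ p ∣ᴹ r
    p∤r (w , e) with proj₂ ir p w e
    ... | inj₁ z = contradiction (subst (1 ≤_) z (proj₁ ip)) λ ()
    ... | inj₂ z = p≢r (sym (trans e (trans (cong (p *ᴹ_) (deg≡0⇒1 w z)) (*ᴹ-identityʳ p))))
    to : ∀ j h → pow p j ∣ᴹ r *ᴹ h → pow p j ∣ᴹ h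
    to zero    h _ = h , trans (sym (*ᴹ-identityʳ h)) (*ᴹ-comm h 1ᴹ)
    to (suc j) h (w , e) with euclidᴹ ip r h (pow p j *ᴹ w , trans e (*ᴹ-assoc p (pow p j) w))
    ... | inj₁ d = ⊥-elim (p∤r d)
    ... | inj₂ (h′ , refl) with to j h′ (w , *ᴹ-cancelˡ p (trans (swap₁ p r h′) (trans e (*ᴹ-assoc p (pow p j) w))))
    ...   | w′ , e′ = w′ , trans (cong (p *ᴹ_) e′) (sym (*ᴹ-assoc p (pow p j) w′))

  ∑ᴹ : ℕ → (Mon → ℤ) → ℤ
  ∑ᴹ B G = ∑ (range B) (λ i → ∑ (vecs enum (suc i)) (λ v → G (suc i , v)))

  ∑ᴹ-cong : ∀ B {G H} → (∀ x → 1 ≤ deg x → G x ≡ H x) → ∑ᴹ B G ≡ ∑ᴹ B H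
  ∑ᴹ-cong B h = ∑-cong (range B) (λ i → ∑-cong (vecs enum (suc i)) (λ v → h (suc i , v) (s≤s z≤n)))

  ∑ᴹ-+ : ∀ B G H → ∑ᴹ B (λ x → G x + H x) ≡ ∑ᴹ B G + ∑ᴹ B H
  ∑ᴹ-+ B G H = trans (∑-cong (range B) (λ i → ∑-+ (vecs enum (suc i)) _ _)) (∑-+ (range B) _ _)

  ∑ᴹ-pick : ∀ B (G : Mon → ℤ) r → 1 ≤ deg r → deg r ≤ B → ∑ᴹ B (λ x → ⟦ does (x ≟ᴹ r) ⟧ * G x) ≡ G r
  ∑ᴹ-pick B G (suc k , v₀) _ k<B = trans (∑-range-single B k k<B
      (λ i i≢k → trans (∑-cong (vecs enum (suc i)) (λ v → cong (_* G (suc i , v)) (cong ⟦_⟧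
        (dec-false ((suc i , v) ≟ᴹ (suc k , v₀)) (λ e → i≢k (ℕP.suc-injective (cong deg e))))))) (∑-0 (vecs enum (suc i)))))
    (trans (∑-cong (vecs enum (suc k)) (λ v → cong (λ b → ⟦ b ⟧ * G (suc k , v))
        (does-cong ((suc k , v) ≟ᴹ (suc k , v₀)) (vec≟ enum v₀ v) (λ { refl → refl }) (λ { refl → refl }))))
      (V.∑-δ (suc k) v₀ (λ v → G (suc k , v))))

  -- Unique factorisation enters only through degrees. Splitting off one irreducible factor r adds
  -- deg r on both sides; D bounds the depth of this induction while the cutoff B of the valuations
  -- stays fixed.
  uniqueFactorisation : ∀ B D f → deg f ≤ D → deg f ≤ B →
    ∑ᴹ B (λ p → ⟦ does (irr? p) ⟧ * (pos (deg p) * val B p f)) ≡ pos (deg f)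
  uniqueFactorisation B D f d≤D d≤B with 1 ℕP.≤? deg f
  ... | no n = trans (∑ᴹ-cong B (λ p 1≤d → trans (cong (λ z → ⟦ does (irr? p) ⟧ * (pos (deg p) * z)) (val-one B p f 1≤d d≡0))
                 (trans (cong (⟦ does (irr? p) ⟧ *_) (ℤP.*-zeroʳ (pos (deg p)))) (ℤP.*-zeroʳ ⟦ does (irr? p) ⟧))))
                 (trans (trans (∑-cong (range B) (λ i → ∑-0 (vecs enum (suc i)))) (∑-0 (range B))) (cong pos (sym d≡0)))
    where
    d≡0 : deg f ≡ 0
    d≡0 = ℕP.n<1⇒n≡0 (ℕP.≰⇒> n)
  uniqueFactorisation B zero f d≤D d≤B | yes 1≤d = contradiction (ℕP.≤-trans 1≤d d≤D) λ ()
  uniqueFactorisation B (suc D) f d≤D d≤B | yes 1≤d with irreducibleFactor (deg f) f ℕP.≤-refl 1≤d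
  ... | r , ir , h , refl = begin
    ∑ᴹ B (λ p → ⟦ does (irr? p) ⟧ * (pos (deg p) * val B p (r *ᴹ h)))
      ≡⟨ ∑ᴹ-cong B term ⟩
    ∑ᴹ B (λ p → ⟦ does (p ≟ᴹ r) ⟧ * pos (deg p) + ⟦ does (irr? p) ⟧ * (pos (deg p) * val B p h))
      ≡⟨ ∑ᴹ-+ B (λ p → ⟦ does (p ≟ᴹ r) ⟧ * pos (deg p)) (λ p → ⟦ does (irr? p) ⟧ * (pos (deg p) * val B p h)) ⟩
    ∑ᴹ B (λ p → ⟦ does (p ≟ᴹ r) ⟧ * pos (deg p)) + ∑ᴹ B (λ p → ⟦ does (irr? p) ⟧ * (pos (deg p) * val B p h))
      ≡⟨ cong₂ _+_ (∑ᴹ-pick B (pos ∘ deg) r (proj₁ ir) (ℕP.≤-trans (ℕP.m≤m+n (deg r) (deg h)) d≤B))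
           (uniqueFactorisation B D h (ℕP.≤-pred (ℕP.≤-trans (ℕP.+-monoˡ-≤ (deg h) (proj₁ ir)) d≤D))
             (ℕP.≤-trans (ℕP.m≤n+m (deg h) (deg r)) d≤B)) ⟩
    pos (deg r) + pos (deg h)
      ≡⟨ sym (ℤP.pos-+ (deg r) (deg h)) ⟩
    pos (deg (r *ᴹ h)) ∎
    where
    term : ∀ p → 1 ≤ deg p → ⟦ does (irr? p) ⟧ * (pos (deg p) * val B p (r *ᴹ h)) ≡
                             ⟦ does (p ≟ᴹ r) ⟧ * pos (deg p) + ⟦ does (irr? p) ⟧ * (pos (deg p) * val B p h)
    term p 1≤p with p ≟ᴹ r
    ... | yes refl = trans (cong₂ (λ b z → ⟦ b ⟧ * (pos (deg p) * z)) (dec-true (irr? p) ir) (val-self B p h 1≤p d≤B))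
            (trans (lem (pos (deg p)) (val B p h)) (cong (λ b → 1ℤ * pos (deg p) + ⟦ b ⟧ * (pos (deg p) * val B p h)) (sym (dec-true (irr? p) ir))))
      where
      lem : ∀ a b → 1ℤ * (a * (1ℤ + b)) ≡ 1ℤ * a + 1ℤ * (a * b)
      lem = solve-∀
    ... | no p≢r with irr? p
    ...   | yes ip = trans (cong (λ z → 1ℤ * (pos (deg p) * z)) (val-other B p r h ip ir p≢r)) (sym (ℤP.+-identityˡ _))
    ...   | no _   = refl

  N : ℕ → ℤ
  N d = ∑ (vecs enum d) (λ v → ⟦ does (irr? (d , v)) ⟧)

  -- The total multiplicity of one fixed irreducible polynomial of degree d in all monic polynomials
  -- of degree n.
  G : ℕ → ℕ → ℤ
  G n d = ∑ (range n) (λ j → W n (suc j ℕ.* d))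

  -- For n, d ≥ 1 this is the indicator of d ∣ n.
  E : ℕ → ℕ → ℤ
  E n d = ∑ (range n) (λ j → ε (suc j ℕ.* d) n)

  -- Both sides are the sum of the degrees of all monic polynomials of degree n, the right one grouped by prime factors.
  degreeSum : ∀ n → pos n * pos (size ℕ.^ n) ≡ ∑ (range n) (λ i → pos (suc i) * N (suc i) * G n (suc i))
  degreeSum n = begin
    pos n * pos (size ℕ.^ n)
      ≡⟨ trans (ℤP.*-comm (pos n) _) (cong (_* pos n) (sym (size-vecs enum n))) ⟩
    pos (length (vecs enum n)) * pos n
      ≡⟨ sym (∑-const (vecs enum n) (pos n)) ⟩
    ∑ (vecs enum n) (λ _ → pos n)
      ≡⟨ ∑-cong (vecs enum n) (λ v → sym (uniqueFactorisation n n (n , v) ℕP.≤-refl ℕP.≤-refl)) ⟩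
    ∑ (vecs enum n) (λ v → ∑ᴹ n (λ p → ⟦ does (irr? p) ⟧ * (pos (deg p) * val n p (n , v))))
      ≡⟨ ∑-swap (vecs enum n) (range n) _ ⟩
    ∑ (range n) (λ i → ∑ (vecs enum n) (λ v → ∑ (vecs enum (suc i)) (λ u →
      ⟦ does (irr? (suc i , u)) ⟧ * (pos (suc i) * val n (suc i , u) (n , v)))))
      ≡⟨ ∑-cong (range n) perDegree ⟩
    ∑ (range n) (λ i → pos (suc i) * N (suc i) * G n (suc i)) ∎
    where
    ∑val : ∀ p → ∑ (vecs enum n) (λ v → val n p (n , v)) ≡ G n (deg p)
    ∑val p = trans (∑-swap (vecs enum n) (range n) _) (∑-cong (range n) (λ j →
      trans (countDivisible (pow p (suc j)) n) (cong (W n) (deg-pow p (suc j)))))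
    perDegree : ∀ i → _ ≡ pos (suc i) * N (suc i) * G n (suc i)
    perDegree i = begin
      ∑ (vecs enum n) (λ v → ∑ (vecs enum (suc i)) (λ u → ⟦ does (irr? (suc i , u)) ⟧ * (pos (suc i) * val n (suc i , u) (n , v))))
        ≡⟨ ∑-swap (vecs enum n) (vecs enum (suc i)) _ ⟩
      ∑ (vecs enum (suc i)) (λ u → ∑ (vecs enum n) (λ v → ⟦ does (irr? (suc i , u)) ⟧ * (pos (suc i) * val n (suc i , u) (n , v))))
        ≡⟨ ∑-cong (vecs enum (suc i)) (λ u → trans (∑-*ˡ (vecs enum n) ⟦ does (irr? (suc i , u)) ⟧ (λ v → pos (suc i) * val n (suc i , u) (n , v))) (cong (⟦ does (irr? (suc i , u)) ⟧ *_)
             (trans (∑-*ˡ (vecs enum n) (pos (suc i)) (λ v → val n (suc i , u) (n , v))) (cong (pos (suc i) *_) (∑val (suc i , u)))))) ⟩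
      ∑ (vecs enum (suc i)) (λ u → ⟦ does (irr? (suc i , u)) ⟧ * (pos (suc i) * G n (suc i)))
        ≡⟨ ∑-*ʳ (vecs enum (suc i)) _ _ ⟩
      N (suc i) * (pos (suc i) * G n (suc i))
        ≡⟨ lem (N (suc i)) (pos (suc i)) (G n (suc i)) ⟩
      pos (suc i) * N (suc i) * G n (suc i) ∎
      where
      lem : ∀ a b c → a * (b * c) ≡ b * a * c
      lem = solve-∀

  G-suc : ∀ n i → G (suc n) (suc i) ≡ pos size * G n (suc i) + E (suc n) (suc i)
  G-suc n i = begin
    ∑ (range (suc n)) (λ j → W (suc n) (suc j ℕ.* suc i))
      ≡⟨ ∑-cong (range (suc n)) (λ j → W-suc n (suc j ℕ.* suc i)) ⟩
    ∑ (range (suc n)) (λ j → pos size * W n (suc j ℕ.* suc i) + ε (suc j ℕ.* suc i) (suc n))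
      ≡⟨ ∑-+ (range (suc n)) (λ j → pos size * W n (suc j ℕ.* suc i)) (λ j → ε (suc j ℕ.* suc i) (suc n)) ⟩
    ∑ (range (suc n)) (λ j → pos size * W n (suc j ℕ.* suc i)) + E (suc n) (suc i)
      ≡⟨ cong (_+ E (suc n) (suc i)) (trans (∑-*ˡ (range (suc n)) (pos size) _) (cong (pos size *_)
           (trans (cong (_+ G n (suc i)) (W-small n (suc n ℕ.* suc i) (ℕP.m≤m*n (suc n) (suc i)))) (ℤP.+-identityˡ _)))) ⟩
    pos size * G n (suc i) + E (suc n) (suc i) ∎

  G-self : ∀ n → G n (suc n) ≡ 0ℤ
  G-self n = ∑-range-zero n (λ j _ → W-small n (suc j ℕ.* suc n) (ℕP.m≤m+n (suc n) _))

  -- `degreeSum` at n + 1 minus q times `degreeSum` at n: the left sides differ by q^(n+1), and by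
  -- `G-suc` the right sides differ by the terms whose degree divides n + 1.
  divisorSum : ∀ n → ∑ (range (suc n)) (λ i → pos (suc i) * N (suc i) * E (suc n) (suc i)) ≡ pos (size ℕ.^ suc n)
  divisorSum n = +ℤ-cancelˡ (q * (pos n * Q)) (begin
    q * (pos n * Q) + ∑ (range (suc n)) (λ i → c i * E (suc n) (suc i))
      ≡⟨ cong (λ z → q * z + ∑ (range (suc n)) (λ i → c i * E (suc n) (suc i))) (trans (degreeSum n) (sym extend)) ⟩
    q * ∑ (range (suc n)) (λ i → c i * G n (suc i)) + ∑ (range (suc n)) (λ i → c i * E (suc n) (suc i))
      ≡⟨ cong (_+ ∑ (range (suc n)) (λ i → c i * E (suc n) (suc i))) (sym (∑-*ˡ (range (suc n)) q _)) ⟩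
    ∑ (range (suc n)) (λ i → q * (c i * G n (suc i))) + ∑ (range (suc n)) (λ i → c i * E (suc n) (suc i))
      ≡⟨ sym (∑-+ (range (suc n)) (λ i → q * (c i * G n (suc i))) (λ i → c i * E (suc n) (suc i))) ⟩
    ∑ (range (suc n)) (λ i → q * (c i * G n (suc i)) + c i * E (suc n) (suc i))
      ≡⟨ ∑-cong (range (suc n)) (λ i → trans (lem q (c i) (G n (suc i)) (E (suc n) (suc i))) (cong (c i *_) (sym (G-suc n i)))) ⟩
    ∑ (range (suc n)) (λ i → c i * G (suc n) (suc i))
      ≡⟨ sym (degreeSum (suc n)) ⟩
    pos (suc n) * pos (size ℕ.^ suc n)
      ≡⟨ cong₂ _*_ (ℤP.pos-+ 1 n) (ℤP.pos-* size (size ℕ.^ n)) ⟩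
    (1ℤ + pos n) * (q * Q)
      ≡⟨ lem₂ q (pos n) Q ⟩
    q * (pos n * Q) + q * Q
      ≡⟨ cong (q * (pos n * Q) +_) (sym (ℤP.pos-* size (size ℕ.^ n))) ⟩
    q * (pos n * Q) + pos (size ℕ.^ suc n) ∎)
    where
    q = pos size
    Q = pos (size ℕ.^ n)
    c : ℕ → ℤ
    c i = pos (suc i) * N (suc i)
    extend : ∑ (range (suc n)) (λ i → c i * G n (suc i)) ≡ ∑ (range n) (λ i → c i * G n (suc i))
    extend = trans (cong (_+ ∑ (range n) (λ i → c i * G n (suc i))) (trans (cong (c n *_) (G-self n)) (ℤP.*-zeroʳ (c n)))) (ℤP.+-identityˡ _)
    lem : ∀ q c g e → q * (c * g) + c * e ≡ c * (q * g + e)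
    lem = solve-∀
    lem₂ : ∀ q n Q → (1ℤ + n) * (q * Q) ≡ q * (n * Q) + q * Q
    lem₂ = solve-∀

  N-nonneg : ∀ d → 0ℤ ℤ.≤ N d
  N-nonneg d = ∑-nonneg (vecs enum d) (λ v → ⟦⟧-nonneg (does (irr? (d , v))))

  E-nonneg : ∀ n d → 0ℤ ℤ.≤ E n d
  E-nonneg n d = ∑-nonneg (range n) (λ j → ⟦⟧-nonneg _)

  E-self : ∀ n → E (suc n) (suc n) ≡ 1ℤ
  E-self n = trans (∑-range-single (suc n) 0 (s≤s z≤n) λ i i≢0 → cong ⟦_⟧ (dec-false (suc i ℕ.* suc n ℕP.≟ suc n)
      (λ e → i≢0 (ℕP.suc-injective (ℕP.*-cancelʳ-≡ (suc i) 1 (suc n) (trans e (sym (ℕP.*-identityˡ (suc n)))))))))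
    (cong ⟦_⟧ (dec-true (1 ℕ.* suc n ℕP.≟ suc n) (ℕP.*-identityˡ (suc n))))

  E≤1 : ∀ n d → E n (suc d) ℤ.≤ 1ℤ
  E≤1 n d = go n
    where
    go : ∀ m → ∑ (range m) (λ j → ε (suc j ℕ.* suc d) n) ℤ.≤ 1ℤ
    go zero    = ℤ.+≤+ z≤n
    go (suc m) with suc m ℕ.* suc d ℕP.≟ n
    ... | yes e = ℤP.≤-reflexive (cong₂ _+_ (cong ⟦_⟧ (dec-true (suc m ℕ.* suc d ℕP.≟ n) e)) (∑-range-zero m (λ j j<m → cong ⟦_⟧ (dec-false (suc j ℕ.* suc d ℕP.≟ n)
                    (λ e′ → ℕP.<⇒≢ j<m (ℕP.suc-injective (ℕP.*-cancelʳ-≡ (suc j) (suc m) (suc d) (trans e′ (sym e)))))))))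
    ... | no ne = subst (ℤ._≤ 1ℤ) (sym (trans (cong (_+ ∑ (range m) (λ j → ε (suc j ℕ.* suc d) n))
                    (cong ⟦_⟧ (dec-false (suc m ℕ.* suc d ℕP.≟ n) ne))) (ℤP.+-identityˡ _))) (go m)

  d*N≤q^d : ∀ n → pos (suc n) * N (suc n) ℤ.≤ pos (size ℕ.^ suc n)
  d*N≤q^d n = subst (pos (suc n) * N (suc n) ℤ.≤_) (divisorSum n)
    (subst (ℤ._≤ c n * E (suc n) (suc n) + rest) (trans (ℤP.+-identityʳ _) (trans (cong (c n *_) (E-self n)) (ℤP.*-identityʳ (c n))))
      (ℤP.+-monoʳ-≤ (c n * E (suc n) (suc n)) (∑-nonneg (range n) λ i → i*j≥0 {c i} {E (suc n) (suc i)} (i*j≥0 {pos (suc i)} {N (suc i)} (ℤ.+≤+ z≤n) (N-nonneg (suc i))) (E-nonneg (suc n) (suc i)))))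
    where
    c : ℕ → ℤ
    c i = pos (suc i) * N (suc i)
    rest = ∑ (range n) (λ i → c i * E (suc n) (suc i))

  2≤size : 2 ≤ size
  2≤size = ℤP.drop‿+≤+ (subst (pos 2 ℤ.≤_) ∑-1 (ℤP.≤-trans (ℤP.≤-reflexive (sym two)) (∑-mono list le)))
    where
    two : ∑ᴱ (λ x → δ 0F x + δ 1F x) ≡ pos 2
    two = trans (∑-+ list (δ 0F) (δ 1F)) (cong₂ _+_ (once 0F) (once 1F))
    le : ∀ x → δ 0F x + δ 1F x ℤ.≤ 1ℤ
    le x with 0F ≟ x
    ... | yes refl = ℤP.≤-reflexive (cong (1ℤ +_) (δ-≢ (0≢1 ∘ sym)))
    ... | no _ with does (1F ≟ x)
    ...   | true  = ℤP.≤-refl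
    ...   | false = ℤ.+≤+ z≤n

  geometric : ∀ n → 1ℤ + ∑ (range n) (λ i → pos (size ℕ.^ suc i)) ℤ.≤ pos (size ℕ.^ suc n)
  geometric zero    = ℤ.+≤+ (ℕP.≤-trans (ℕP.≤-trans (s≤s z≤n) 2≤size) (ℕP.≤-reflexive (sym (ℕP.*-identityʳ size))))
  geometric (suc n) = ℤP.≤-trans (ℤP.≤-reflexive (lem (pos (size ℕ.^ suc n)) (∑ (range n) (λ i → pos (size ℕ.^ suc i)))))
    (ℤP.≤-trans (ℤP.+-monoʳ-≤ (pos (size ℕ.^ suc n)) (geometric n)) (ℤ.+≤+ (ℕP.≤-trans
      (ℕP.≤-reflexive (cong (size ℕ.^ suc n ℕ.+_) (sym (ℕP.+-identityʳ _)))) (ℕP.*-monoˡ-≤ (size ℕ.^ suc n) 2≤size))))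
    where
    lem : ∀ a b → 1ℤ + (a + b) ≡ a + (1ℤ + b)
    lem = solve-∀

  -- If there were no irreducible polynomial of degree n + 1, `divisorSum` would bound q^(n+1) by
  -- the sum of d N_d ≤ q^d over d ≤ n, and a geometric series of ratio at least 2 is too small for
  -- that.
  N≢0 : ∀ n → N (suc n) ≢ 0ℤ
  N≢0 n N≡0 = ℤP.<⇒≱ (ℤP.suc[i]≤j⇒i<j (geometric n)) (ℤP.≤-trans (ℤP.≤-reflexive (sym (divisorSum n)))
    (ℤP.≤-trans (ℤP.≤-reflexive (trans (cong (_+ rest) (trans (cong (λ z → pos (suc n) * z * E (suc n) (suc n)) N≡0)
        (cong (_* E (suc n) (suc n)) (ℤP.*-zeroʳ (pos (suc n)))))) (ℤP.+-identityˡ rest)))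
      (∑-mono (range n) bound)))
    where
    rest = ∑ (range n) (λ i → pos (suc i) * N (suc i) * E (suc n) (suc i))
    bound : ∀ i → pos (suc i) * N (suc i) * E (suc n) (suc i) ℤ.≤ pos (size ℕ.^ suc i)
    bound i = ℤP.≤-trans (subst (c * E (suc n) (suc i) ℤ.≤_) (ℤP.*-identityʳ c)
        (ℤP.*-monoˡ-≤-nonNeg c ⦃ ℤ.nonNegative (i*j≥0 {pos (suc i)} {N (suc i)} (ℤ.+≤+ z≤n) (N-nonneg (suc i))) ⦄ (E≤1 (suc n) i)))
      (d*N≤q^d i)
      where
      c : ℤ
      c = pos (suc i) * N (suc i)

  irreducibleOfDegree : ∀ n → ∃ λ (v : Vec Carrier (suc n)) → Irr (suc n , v)
  irreducibleOfDegree n with V.decide (suc n) (λ v → irr? (suc n , v))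
  ... | inj₁ p    = p
  ... | inj₂ none = contradiction (trans (∑-cong (vecs enum (suc n)) (λ v → cong ⟦_⟧ (dec-false (irr? (suc n , v)) (none v))))
                      (∑-0 (vecs enum (suc n)))) (N≢0 n)

-- The extension of degree n of a finite field

module VectorSpace (F : FiniteField) where
  open FiniteField F
  open ≡-Reasoning

  infixl 6 _⊕ⱽ_
  infixr 8 _·ⱽ_

  _⊕ⱽ_ : ∀ {n} → Vec Carrier n → Vec Carrier n → Vec Carrier n
  _⊕ⱽ_ = zipWith _⊕_

  ⊖ⱽ_ : ∀ {n} → Vec Carrier n → Vec Carrier n
  ⊖ⱽ_ = Vec.map ⊖_

  0ⱽ : ∀ {n} → Vec Carrier n
  0ⱽ = replicate _ 0F

  _·ⱽ_ : ∀ {n} → Carrier → Vec Carrier n → Vec Carrier n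
  u ·ⱽ v = Vec.map (u ⊗_) v

  dotF : ∀ {n} → Vec Carrier n → Vec Carrier n → Carrier
  dotF []      []      = 0F
  dotF (a ∷ u) (b ∷ v) = a ⊗ b ⊕ dotF u v

  dotF-·ʳ : ∀ {n} u (α β : Vec Carrier n) → dotF α (Vec.map (u ⊗_) β) ≡ u ⊗ dotF α β
  dotF-·ʳ u []      []      = sym (zeroʳ u)
  dotF-·ʳ u (a ∷ α) (b ∷ β) = trans (cong₂ _⊕_ (Solver.solve 3 (λ a u b → a :* (u :* b) := u :* (a :* b)) refl a u b) (dotF-·ʳ u α β))
      (sym (distribˡ u (a ⊗ b) (dotF α β)))
    where open Solver

  ·ⱽ-zeroʳ : ∀ n u → u ·ⱽ 0ⱽ {n} ≡ 0ⱽ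
  ·ⱽ-zeroʳ zero    u = refl
  ·ⱽ-zeroʳ (suc n) u = cong₂ _∷_ (zeroʳ u) (·ⱽ-zeroʳ n u)

  ·ⱽ-zeroˡ : ∀ {n} (v : Vec Carrier n) → 0F ·ⱽ v ≡ 0ⱽ
  ·ⱽ-zeroˡ []      = refl
  ·ⱽ-zeroˡ (a ∷ v) = cong₂ _∷_ (zeroˡ a) (·ⱽ-zeroˡ v)

  ·ⱽ-identity : ∀ {n} (v : Vec Carrier n) → 1F ·ⱽ v ≡ v
  ·ⱽ-identity []      = refl
  ·ⱽ-identity (a ∷ v) = cong₂ _∷_ (*-identityˡ a) (·ⱽ-identity v)

  ·ⱽ-assoc : ∀ {n} x y (v : Vec Carrier n) → (x ⊗ y) ·ⱽ v ≡ x ·ⱽ y ·ⱽ v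
  ·ⱽ-assoc x y []      = refl
  ·ⱽ-assoc x y (a ∷ v) = cong₂ _∷_ (*-assoc x y a) (·ⱽ-assoc x y v)

  ·ⱽ-cancel : ∀ {n} u w (v : Vec Carrier n) → u ⊗ w ≡ 1F → u ·ⱽ w ·ⱽ v ≡ v
  ·ⱽ-cancel u w v e = trans (sym (·ⱽ-assoc u w v)) (trans (cong (_·ⱽ v) e) (·ⱽ-identity v))

  ·ⱽ-≢0 : ∀ {n} u (v : Vec Carrier n) → u ≢ 0F → v ≢ 0ⱽ → u ·ⱽ v ≢ 0ⱽ
  ·ⱽ-≢0 {n} u v u≢0 v≢0 e with inverse u u≢0
  ... | w , p = v≢0 (trans (sym (·ⱽ-cancel w u v (trans (*-comm w u) p))) (trans (cong (w ·ⱽ_) e) (·ⱽ-zeroʳ n w)))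

  ·ⱽ-injective : ∀ {n} x y (v : Vec Carrier n) → v ≢ 0ⱽ → x ·ⱽ v ≡ y ·ⱽ v → x ≡ y
  ·ⱽ-injective x y []      v≢0 e = contradiction refl v≢0
  ·ⱽ-injective x y (a ∷ v) v≢0 e with a ≟ 0F
  ... | no a≢0 = ⊗-cancelˡ a≢0 (trans (*-comm a x) (trans (cong head e) (*-comm y a)))
  ... | yes refl = ·ⱽ-injective x y v (λ z → v≢0 (cong (0F ∷_) z)) (VecP.∷-injectiveʳ e)

  functional : ∀ n → (Vec Carrier n → Carrier) → Vec Carrier n
  functional zero    ρ = []
  functional (suc n) ρ = ρ (1F ∷ 0ⱽ) ∷ functional n (λ v → ρ (0F ∷ v))

  ⊕ⱽ-identityˡ : ∀ {n} (v : Vec Carrier n) → 0ⱽ ⊕ⱽ v ≡ v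
  ⊕ⱽ-identityˡ = VecP.zipWith-identityˡ +-identityˡ

  functional-dot : ∀ n ρ → (∀ u v → ρ (u ⊕ⱽ v) ≡ ρ u ⊕ ρ v) → (∀ x v → ρ (x ·ⱽ v) ≡ x ⊗ ρ v) →
                   ∀ v → dotF (functional n ρ) v ≡ ρ v
  functional-dot zero    ρ add hom []      = sym (trans (hom 0F []) (zeroˡ (ρ [])))
  functional-dot (suc n) ρ add hom (a ∷ v) = begin
    ρ (1F ∷ 0ⱽ) ⊗ a ⊕ dotF (functional n (λ w → ρ (0F ∷ w))) v
      ≡⟨ cong₂ _⊕_ (*-comm _ a) (functional-dot n (λ w → ρ (0F ∷ w))
           (λ u w → trans (cong (λ z → ρ (z ∷ (u ⊕ⱽ w))) (sym (+-identityˡ 0F))) (add (0F ∷ u) (0F ∷ w)))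
           (λ x w → trans (cong (λ z → ρ (z ∷ (x ·ⱽ w))) (sym (zeroʳ x))) (hom x (0F ∷ w))) v) ⟩
    a ⊗ ρ (1F ∷ 0ⱽ) ⊕ ρ (0F ∷ v)
      ≡⟨ cong (_⊕ ρ (0F ∷ v)) (sym (hom a (1F ∷ 0ⱽ))) ⟩
    ρ (a ·ⱽ (1F ∷ 0ⱽ)) ⊕ ρ (0F ∷ v)
      ≡⟨ sym (add _ _) ⟩
    ρ (a ·ⱽ (1F ∷ 0ⱽ) ⊕ⱽ (0F ∷ v))
      ≡⟨ cong ρ (cong₂ _∷_ (trans (+-identityʳ _) (*-identityʳ a)) (trans (cong (_⊕ⱽ v) (·ⱽ-zeroʳ n a)) (⊕ⱽ-identityˡ v))) ⟩
    ρ (a ∷ v) ∎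

module Extension (F : FiniteField) (m : ℕ) (P : ℕ → FiniteField.Carrier F)
                 (P-irr : Polynomials.Irreducible F (suc m) P) where
  open FiniteField F
  open MonicPolynomials F hiding (_*ᴹ_)
  open VectorSpace F
  open Solver
  open ≡-Reasoning

  n : ℕ
  n = suc m

  KVec : Set
  KVec = Vec Carrier n

  P-monic : Monic n P
  P-monic = proj₁ P-irr

  infix 4 _≈_
  _≈_ : Series → Series → Set
  f ≈ g = P ∣ˢ f +ˢ negS g

  ≗⇒≈ : ∀ {f g} → f ≗ g → f ≈ g
  ≗⇒≈ {f} {g} e = 0 , zeroS , (λ _ _ → refl) , λ i →
    trans (trans (cong (_⊕ ⊖ g i) (e i)) (⊖-inverseʳ (g i))) (sym (*ˢ-zeroʳ P i))

  ≈-sym : ∀ {f g} → f ≈ g → g ≈ f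
  ≈-sym {f} {g} p = ∣ˢ-≗ (λ i → solve 2 (λ x y → :- (x :+ :- y) := y :+ :- x) refl (f i) (g i)) (∣ˢ-neg p)

  ≈-trans : ∀ {f g h} → f ≈ g → g ≈ h → f ≈ h
  ≈-trans {f} {g} {h} p q = ∣ˢ-≗ (λ i → solve 3 (λ x y z → (x :+ :- y) :+ (y :+ :- z) := x :+ :- z) refl (f i) (g i) (h i)) (∣ˢ-+ p q)

  ≈-+ : ∀ {f f′ g g′} → f ≈ f′ → g ≈ g′ → f +ˢ g ≈ f′ +ˢ g′
  ≈-+ {f} {f′} {g} {g′} p q = ∣ˢ-≗ (λ i → solve 4 (λ x x′ y y′ → (x :+ :- x′) :+ (y :+ :- y′) := (x :+ y) :+ :- (x′ :+ y′)) refl (f i) (f′ i) (g i) (g′ i)) (∣ˢ-+ p q)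

  ≈-*ʳ : ∀ {f f′} g k → Deg< k g → f ≈ f′ → f *ˢ g ≈ f′ *ˢ g
  ≈-*ʳ {f} {f′} g k dg p = ∣ˢ-≗ (λ i → trans (*ˢ-distribʳ f (negS f′) g i) (cong ((f *ˢ g) i ⊕_)
      (trans (*ˢ-comm (negS f′) g i) (trans (*ˢ-negʳ g f′ i) (cong ⊖_ (*ˢ-comm g f′ i)))))) (∣ˢ-*ʳ g k dg p)

  ≈-*ˡ : ∀ {f f′} g k → Deg< k g → f ≈ f′ → g *ˢ f ≈ g *ˢ f′
  ≈-*ˡ {f} {f′} g k dg p = ≈-trans (≗⇒≈ (*ˢ-comm g f)) (≈-trans (≈-*ʳ g k dg p) (≗⇒≈ (*ˢ-comm f′ g)))

  toS-injective : ∀ {k} {u v : Vec Carrier k} → toS u ≗ toS v → u ≡ v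
  toS-injective {k} {u} {v} e = trans (sym (take-toS u)) (trans (take-cong k e) (take-toS v))

  -- The difference of two representatives has degree below n, so it is a multiple of P only if it
  -- is zero.
  ≈⇒≡ : ∀ {u v : KVec} → toS u ≈ toS v → u ≡ v
  ≈⇒≡ {u} {v} (k , h , dh , e) = toS-injective λ i → x-y≡0⇒x≡y (toS u i) (toS v i)
      (trans (e i) (trans (*ˢ-congʳ {P} h≗0 i) (*ˢ-zeroʳ P i)))
    where
    h≗0 : h ≗ zeroS
    h≗0 = *ˢ-small P-monic k dh (Deg<-≗ e (Deg<-+ (toS-deg u) (Deg<-neg (toS-deg v))))

  toS-⊕ : ∀ {k} (u v : Vec Carrier k) → toS (u ⊕ⱽ v) ≗ toS u +ˢ toS v
  toS-⊕ []      []      i       = sym (+-identityˡ 0F)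
  toS-⊕ (a ∷ u) (b ∷ v) zero    = refl
  toS-⊕ (a ∷ u) (b ∷ v) (suc i) = toS-⊕ u v i

  toS-· : ∀ {k} c (u : Vec Carrier k) → toS (c ·ⱽ u) ≗ c ∙ toS u
  toS-· c []      i       = sym (zeroʳ c)
  toS-· c (a ∷ u) zero    = refl
  toS-· c (a ∷ u) (suc i) = toS-· c u i

  toS-0 : ∀ k → toS (0ⱽ {k}) ≗ zeroS
  toS-0 zero    i       = refl
  toS-0 (suc k) zero    = refl
  toS-0 (suc k) (suc i) = toS-0 k i

  1ⱽ : KVec
  1ⱽ = 1F ∷ 0ⱽ

  toS-1 : toS 1ⱽ ≗ oneS
  toS-1 zero    = refl
  toS-1 (suc i) = toS-0 m i

  infixl 7 _⋆_

  -- All ring laws follow from the congruence `⋆-≈` and the uniqueness of representatives; the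
  -- division itself stays hidden.
  opaque
    division : ∀ (u v : KVec) → Division P n n (toS u *ˢ toS v)
    division u v = divide P-monic n (toS u *ˢ toS v) (*ˢ-Deg< n n (toS-deg u) (toS-deg v))

    _⋆_ : KVec → KVec → KVec
    u ⋆ v = take n (Division.rem (division u v))

    ⋆-≈ : ∀ u v → toS (u ⋆ v) ≈ toS u *ˢ toS v
    ⋆-≈ u v = ≈-sym (n , quot , quot-deg , λ i → trans (cong₂ (λ x y → x ⊕ ⊖ y) (eqn i) (toS-take n rem-deg i))
        (solve 2 (λ x y → (x :+ y) :+ :- y := x) refl ((P *ˢ quot) i) (rem i)))
      where open Division (division u v)

  ⋆-comm : ∀ u v → u ⋆ v ≡ v ⋆ u
  ⋆-comm u v = ≈⇒≡ (≈-trans (⋆-≈ u v) (≈-trans (≗⇒≈ (*ˢ-comm (toS u) (toS v))) (≈-sym (⋆-≈ v u))))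

  ⋆-assoc : ∀ u v w → (u ⋆ v) ⋆ w ≡ u ⋆ (v ⋆ w)
  ⋆-assoc u v w = ≈⇒≡ (≈-trans (⋆-≈ (u ⋆ v) w) (≈-trans (≈-*ʳ (toS w) n (toS-deg w) (⋆-≈ u v))
    (≈-trans (≗⇒≈ (*ˢ-assoc (toS u) (toS v) (toS w))) (≈-trans (≈-*ˡ (toS u) n (toS-deg u) (≈-sym (⋆-≈ v w)))
      (≈-sym (⋆-≈ u (v ⋆ w)))))))

  ⋆-identityˡ : ∀ u → 1ⱽ ⋆ u ≡ u
  ⋆-identityˡ u = ≈⇒≡ (≈-trans (⋆-≈ 1ⱽ u) (≗⇒≈ (λ i → trans (*ˢ-congˡ toS-1 i) (*ˢ-oneˡ (toS u) i))))

  ⋆-distribʳ : ∀ w u v → (u ⊕ⱽ v) ⋆ w ≡ u ⋆ w ⊕ⱽ v ⋆ w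
  ⋆-distribʳ w u v = ≈⇒≡ (≈-trans (⋆-≈ (u ⊕ⱽ v) w) (≈-trans (≗⇒≈ (λ i → trans (*ˢ-congˡ (toS-⊕ u v) i) (*ˢ-distribʳ (toS u) (toS v) (toS w) i)))
    (≈-trans (≈-+ (≈-sym (⋆-≈ u w)) (≈-sym (⋆-≈ v w))) (≗⇒≈ (λ i → sym (toS-⊕ (u ⋆ w) (v ⋆ w) i))))))

  ·ⱽ-⋆ : ∀ c u v → (c ·ⱽ u) ⋆ v ≡ c ·ⱽ (u ⋆ v)
  ·ⱽ-⋆ c u v = ≈⇒≡ (≈-trans (⋆-≈ (c ·ⱽ u) v) (≈-trans (≗⇒≈ (λ i → trans (*ˢ-congˡ (toS-· c u) i) (∙-*ˢ c (toS u) (toS v) i)))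
      (≈-trans scaled (≗⇒≈ (λ i → sym (toS-· c (u ⋆ v) i))))))
    where
    scaled : c ∙ (toS u *ˢ toS v) ≈ c ∙ toS (u ⋆ v)
    scaled = ∣ˢ-≗ (λ i → solve 3 (λ c x y → c :* (x :+ :- y) := c :* x :+ :- (c :* y)) refl c ((toS u *ˢ toS v) i) (toS (u ⋆ v) i))
      (∣ˢ-∙ c (≈-sym (⋆-≈ u v)))

  -- P divides the product of the representatives, and that of u is nonzero of degree below deg P,
  -- so `euclid` makes P divide that of v.
  ⋆-domain : ∀ u v → u ≢ 0ⱽ → u ⋆ v ≡ 0ⱽ → v ≡ 0ⱽ
  ⋆-domain u v u≢0 e with decZero n (toS u) (toS-deg u)
  ... | inj₁ z = contradiction (toS-injective (λ i → trans (z i) (sym (toS-0 n i)))) u≢0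
  ... | inj₂ (i , _ , ui≢0 , _) = ≈⇒≡ (∣ˢ-≗ (λ j → sym (trans (cong (λ z → toS v j ⊕ ⊖ z) (toS-0 n j)) (trans (cong (toS v j ⊕_) ⊖0≡0) (+-identityʳ _))))
      (euclid P-irr (toS-deg v) n (toS u) ℕP.≤-refl (toS-deg u) (i , ui≢0) P∣uv))
    where
    P∣uv : P ∣ˢ toS u *ˢ toS v
    P∣uv = ∣ˢ-≗ (λ j → trans (cong (λ z → (toS u *ˢ toS v) j ⊕ ⊖ z) (trans (cong (λ w → toS w j) e) (toS-0 n j)))
      (trans (cong ((toS u *ˢ toS v) j ⊕_) ⊖0≡0) (+-identityʳ _))) (≈-sym (⋆-≈ u v))

  isCR : IsCommutativeRing _≡_ _⊕ⱽ_ _⋆_ ⊖ⱽ_ 0ⱽ 1ⱽ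
  isCR = record
    { isRing = record
      { +-isAbelianGroup = record
        { isGroup = record
          { isMonoid = record
            { isSemigroup = record
              { isMagma = record { isEquivalence = isEquivalence ; ∙-cong = cong₂ _⊕ⱽ_ }
              ; assoc = VecP.zipWith-assoc +-assoc }
            ; identity = VecP.zipWith-identityˡ +-identityˡ , VecP.zipWith-identityʳ +-identityʳ }
          ; inverse = VecP.zipWith-inverseˡ ⊖-inverseˡ , VecP.zipWith-inverseʳ ⊖-inverseʳ
          ; ⁻¹-cong = cong ⊖ⱽ_ }
        ; comm = VecP.zipWith-comm +-comm }
      ; *-cong = cong₂ _⋆_
      ; *-assoc = ⋆-assoc
      ; *-identity = ⋆-identityˡ , λ u → trans (⋆-comm u 1ⱽ) (⋆-identityˡ u)
      ; distrib = (λ w u v → trans (⋆-comm w (u ⊕ⱽ v)) (trans (⋆-distribʳ w u v) (cong₂ _⊕ⱽ_ (⋆-comm u w) (⋆-comm v w)))) , ⋆-distribʳ }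
    ; *-comm = ⋆-comm }

  private
    module KR = CRing isCR

  -- Multiplication by u is injective on a finite set, hence onto, and reaches 1.
  ⋆-inverse : ∀ u → u ≢ 0ⱽ → ∃ λ v → u ⋆ v ≡ 1ⱽ
  ⋆-inverse u u≢0 = Enum.injective⇒surjective (enumVec enum n) (u ⋆_) (λ {x} {y} e → KR.x-y≡0⇒x≡y x y (⋆-domain u _ u≢0
    (trans (KR.distribˡ u x (⊖ⱽ y)) (trans (cong (u ⋆ x ⊕ⱽ_) (sym (KR.⊖-distribʳ u y)))
      (trans (cong (_⊕ⱽ ⊖ⱽ (u ⋆ y)) e) (KR.⊖-inverseʳ (u ⋆ y))))))) 1ⱽ

  K : FiniteField
  K = record
    { Carrier = KVec ; _⊕_ = _⊕ⱽ_ ; _⊗_ = _⋆_ ; ⊖_ = ⊖ⱽ_ ; 0F = 0ⱽ ; 1F = 1ⱽ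
    ; isCommutativeRing = isCR ; 0≢1 = λ e → 0≢1 (cong head e)
    ; inverse = ⋆-inverse ; enum = enumVec enum n }

  ⋆-·ⱽ : ∀ c u v → u ⋆ (c ·ⱽ v) ≡ c ·ⱽ (u ⋆ v)
  ⋆-·ⱽ c u v = trans (⋆-comm u (c ·ⱽ v)) (trans (·ⱽ-⋆ c v u) (cong (c ·ⱽ_) (⋆-comm v u)))

  head-· : ∀ c (v : KVec) → head (c ·ⱽ v) ≡ c ⊗ head v
  head-· c (a ∷ v) = refl

  head-⊕ : ∀ (u v : KVec) → head (u ⊕ⱽ v) ≡ head u ⊕ head v
  head-⊕ (a ∷ u) (b ∷ v) = refl

  -- The fixed functional λ is the constant coefficient `head`, and this is β ↦ λ(aβ) written as a
  -- coordinate vector.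
  pairing : KVec → KVec
  pairing a = functional n (λ β → head (a ⋆ β))

  pairing-dot : ∀ a β → dotF (pairing a) β ≡ head (a ⋆ β)
  pairing-dot a = functional-dot n (λ β → head (a ⋆ β))
    (λ u v → trans (cong head (KR.distribˡ a u v)) (head-⊕ (a ⋆ u) (a ⋆ v)))
    (λ c v → trans (cong head (⋆-·ⱽ c a v)) (head-· c (a ⋆ v)))

  head-⊖ : ∀ (v : KVec) → ⊖ head v ≡ head (⊖ⱽ v)
  head-⊖ (a ∷ v) = refl

  -- If a ≠ b, let c be the inverse of a - b. Then λ(ac) - λ(bc) = λ(1) = 1, so the two functionals
  -- differ at c.
  pairing-injective : ∀ {a b} → pairing a ≡ pairing b → a ≡ b
  pairing-injective {a} {b} e = decidable-stable (vec≟ enum a b) λ a≢b →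
      separate (⋆-inverse (a ⊕ⱽ ⊖ⱽ b) (λ z → a≢b (KR.x-y≡0⇒x≡y a b z)))
    where
    separate : (∃ λ c → (a ⊕ⱽ ⊖ⱽ b) ⋆ c ≡ 1ⱽ) → ⊥
    separate (c , ac≡1) = 0≢1 (begin
      0F                                   ≡⟨ sym (⊖-inverseʳ (head (b ⋆ c))) ⟩
      head (b ⋆ c) ⊕ ⊖ head (b ⋆ c)        ≡⟨ cong (_⊕ ⊖ head (b ⋆ c)) (trans (sym (pairing-dot b c)) (trans (cong (λ r → dotF r c) (sym e)) (pairing-dot a c))) ⟩
      head (a ⋆ c) ⊕ ⊖ head (b ⋆ c)        ≡⟨ cong (head (a ⋆ c) ⊕_) (head-⊖ (b ⋆ c)) ⟩
      head (a ⋆ c) ⊕ head (⊖ⱽ (b ⋆ c))     ≡⟨ sym (head-⊕ (a ⋆ c) (⊖ⱽ (b ⋆ c))) ⟩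
      head (a ⋆ c ⊕ⱽ ⊖ⱽ (b ⋆ c))           ≡⟨ cong (λ z → head (a ⋆ c ⊕ⱽ z)) (KR.⊖-distribˡ b c) ⟩
      head (a ⋆ c ⊕ⱽ (⊖ⱽ b) ⋆ c)           ≡⟨ cong head (sym (⋆-distribʳ c a (⊖ⱽ b))) ⟩
      head ((a ⊕ⱽ ⊖ⱽ b) ⋆ c)               ≡⟨ cong head ac≡1 ⟩
      1F ∎)

  -- There are as many functionals as elements of K, so injectivity of `pairing` makes each of them
  -- β ↦ λ(α′β).
  represent : ∀ α → ∃ λ α′ → ∀ β → dotF α β ≡ head (α′ ⋆ β)
  represent α = proj₁ found , λ β → trans (cong (λ r → dotF r β) (sym (proj₂ found))) (pairing-dot (proj₁ found) β)
    where
    found : ∃ λ α′ → pairing α′ ≡ α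
    found = Enum.injective⇒surjective (enumVec enum n) pairing pairing-injective α

-- Lines in a vector space over a finite field

module Projective (F : FiniteField) where
  open FiniteField F
  open VectorSpace F
  open ≡-Reasoning

  nz : Carrier → ℤ
  nz x = 1ℤ - δ 0F x

  nzⱽ : ∀ {k} → Vec Carrier k → ℤ
  nzⱽ v = 1ℤ - ⟦ does (vec≟ enum 0ⱽ v) ⟧

  nz-* : ∀ x {a b} → (x ≢ 0F → a ≡ b) → nz x * a ≡ nz x * b
  nz-* x h with 0F ≟ x
  ... | yes _ = refl
  ... | no n  = cong (1ℤ *_) (h (n ∘ sym))

  nz-≢ : ∀ x → x ≢ 0F → nz x ≡ 1ℤ
  nz-≢ x n = cong (λ z → 1ℤ - z) (δ-≢ (n ∘ sym))

  ∑nz : ∑ᴱ nz ≡ pos size - 1ℤ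
  ∑nz = trans (∑-- list _ (δ 0F)) (cong₂ _-_ ∑-1 (once 0F))

  nz-scale : ∀ {u} → u ≢ 0F → ∀ x → nz (u ⊗ x) ≡ nz x
  nz-scale {u} u≢0 x = cong (λ b → 1ℤ - ⟦ b ⟧) (does-cong (0F ≟ u ⊗ x) (0F ≟ x)
    (λ e → sym (⊗-≡0 u≢0 (sym e))) (λ { refl → sym (zeroʳ u) }))

  ∑-·ⱽ : ∀ k {u} → u ≢ 0F → ∀ (f : Vec Carrier k → ℤ) → ∑ (vecs enum k) (λ v → f (u ·ⱽ v)) ≡ ∑ (vecs enum k) f
  ∑-·ⱽ k {u} u≢0 f with inverse u u≢0
  ... | w , e = Enum.∑-bij (enumVec enum k) (u ·ⱽ_) (w ·ⱽ_) (λ v → ·ⱽ-cancel u w v e)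
                  (λ v → ·ⱽ-cancel w u v (trans (*-comm w u) e)) f

  -- One representative per line: the vectors whose first nonzero coordinate is 1.
  normals : ∀ k → List (Vec Carrier k)
  normals zero    = []
  normals (suc k) = map (1F ∷_) (vecs enum k) ++ map (0F ∷_) (normals k)

  ∑-normals : ∀ k (G : Vec Carrier (suc k) → ℤ) →
              ∑ (normals (suc k)) G ≡ ∑ (vecs enum k) (λ v → G (1F ∷ v)) + ∑ (normals k) (λ v → G (0F ∷ v))
  ∑-normals k G = trans (∑-++ (map (1F ∷_) (vecs enum k)) (map (0F ∷_) (normals k)) G)
    (cong₂ _+_ (∑-map (1F ∷_) (vecs enum k) G) (∑-map (0F ∷_) (normals k) G))

  -- Every line has `size` - 1 nonzero vectors, on which G is constant. The induction separates the
  -- first coordinate a: for a ≠ 0, scaling by a carries the vectors starting with 1 onto those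
  -- starting with a.
  ∑-projective : ∀ k (G : Vec Carrier k → ℤ) → (∀ u v → u ≢ 0F → G (u ·ⱽ v) ≡ G v) →
                 ∑ (vecs enum k) (λ v → nzⱽ v * G v) ≡ (pos size - 1ℤ) * ∑ (normals k) G
  ∑-projective zero    G inv = sym (ℤP.*-zeroʳ (pos size - 1ℤ))
  ∑-projective (suc k) G inv = begin
    ∑ (vecs enum (suc k)) (λ v → nzⱽ v * G v)
      ≡⟨ ∑-vecs enum k _ ⟩
    ∑ᴱ f
      ≡⟨ ∑-cong list split ⟩
    ∑ᴱ (λ a → δ 0F a * X + nz a * Y)
      ≡⟨ trans (∑-+ list (λ a → δ 0F a * X) (λ a → nz a * Y)) (cong₂ _+_ (∑-δ 0F (λ _ → X)) (trans (∑-*ʳ list Y nz) (cong (_* Y) ∑nz))) ⟩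
    X + (pos size - 1ℤ) * Y
      ≡⟨ cong (_+ (pos size - 1ℤ) * Y) (∑-projective k (λ v → G (0F ∷ v))
           (λ u v u≢0 → trans (cong (λ z → G (z ∷ (u ·ⱽ v))) (sym (zeroʳ u))) (inv u (0F ∷ v) u≢0))) ⟩
    (pos size - 1ℤ) * ∑ (normals k) (λ v → G (0F ∷ v)) + (pos size - 1ℤ) * Y
      ≡⟨ lem (pos size - 1ℤ) (∑ (normals k) (λ v → G (0F ∷ v))) Y ⟩
    (pos size - 1ℤ) * (Y + ∑ (normals k) (λ v → G (0F ∷ v)))
      ≡⟨ cong ((pos size - 1ℤ) *_) (sym (∑-normals k G)) ⟩
    (pos size - 1ℤ) * ∑ (normals (suc k)) G ∎
    where
    lem : ∀ a b c → a * b + a * c ≡ a * (c + b)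
    lem = solve-∀
    f : Carrier → ℤ
    f a = ∑ (vecs enum k) (λ v → nzⱽ (a ∷ v) * G (a ∷ v))
    X Y : ℤ
    X = ∑ (vecs enum k) (λ v → nzⱽ v * G (0F ∷ v))
    Y = ∑ (vecs enum k) (λ v → G (1F ∷ v))
    at0 : f 0F ≡ X
    at0 = ∑-cong (vecs enum k) (λ v → cong (λ b → (1ℤ - ⟦ b ⟧) * G (0F ∷ v))
      (does-cong (vec≟ enum 0ⱽ (0F ∷ v)) (vec≟ enum 0ⱽ v) VecP.∷-injectiveʳ (cong (0F ∷_))))
    at≢0 : ∀ a → a ≢ 0F → f a ≡ Y
    at≢0 a a≢0 = begin
      f a
        ≡⟨ ∑-cong (vecs enum k) (λ v → trans (cong (λ b → (1ℤ - ⟦ b ⟧) * G (a ∷ v))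
             (dec-false (vec≟ enum 0ⱽ (a ∷ v)) (λ e → a≢0 (sym (cong head e))))) (ℤP.*-identityˡ (G (a ∷ v)))) ⟩
      ∑ (vecs enum k) (λ v → G (a ∷ v))
        ≡⟨ sym (∑-·ⱽ k a≢0 (λ v → G (a ∷ v))) ⟩
      ∑ (vecs enum k) (λ v → G (a ∷ (a ·ⱽ v)))
        ≡⟨ ∑-cong (vecs enum k) (λ v → trans (cong (λ z → G (z ∷ (a ·ⱽ v))) (sym (*-identityʳ a))) (inv a (1F ∷ v) a≢0)) ⟩
      Y ∎
    lem₁ : ∀ X Y → X ≡ 1ℤ * X + (1ℤ - 1ℤ) * Y
    lem₁ = solve-∀
    lem₀ : ∀ X Y → Y ≡ 0ℤ * X + (1ℤ - 0ℤ) * Y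
    lem₀ = solve-∀
    splitBy : ∀ a → Dec (0F ≡ a) → f a ≡ δ 0F a * X + nz a * Y
    splitBy a (yes refl) = trans at0 (trans (lem₁ X Y) (cong (λ d → d * X + (1ℤ - d) * Y) (sym (δ-refl 0F))))
    splitBy a (no n)     = trans (at≢0 a (n ∘ sym)) (trans (lem₀ X Y) (cong (λ d → d * X + (1ℤ - d) * Y) (sym (δ-≢ n))))
    split : ∀ a → f a ≡ δ 0F a * X + nz a * Y
    split a = splitBy a (0F ≟ a)

  Odd : ℤ → Set
  Odd x = ∃ λ k → x ≡ 1ℤ + (k + k)

  Even : ℤ → Set
  Even x = ∃ λ k → x ≡ k + k

  Odd-* : ∀ {x y} → Odd x → Odd y → Odd (x * y)
  Odd-* {x} {y} (k , e) (l , f) = k + l + (k * l + k * l) , trans (cong₂ _*_ e f) (lem k l)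
    where
    lem : ∀ k l → (1ℤ + (k + k)) * (1ℤ + (l + l)) ≡ 1ℤ + ((k + l + (k * l + k * l)) + (k + l + (k * l + k * l)))
    lem = solve-∀

  module _ (odd : Odd (pos size)) where

    odd-vecs : ∀ k → Odd (∑ (vecs enum k) (λ _ → 1ℤ))
    odd-vecs zero    = 0ℤ , refl
    odd-vecs (suc k) = subst Odd (sym (trans (∑-vecs enum k (λ _ → 1ℤ)) (∑-const list _))) (Odd-* {pos size} odd (odd-vecs k))

    -- There are 1 + q + ... + q^(k-1) lines, a sum of k odd numbers.
    normals-parity : ∀ k → ∃ λ j → ∑ (normals k) (λ _ → 1ℤ) ≡ pos k + (j + j)
    normals-parity zero    = 0ℤ , refl
    normals-parity (suc k) with odd-vecs k | normals-parity k
    ... | i , e | j , f = i + j , trans (∑-normals k (λ _ → 1ℤ)) (trans (cong₂ _+_ e f)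
        (trans (lem i (pos k) j) (cong (_+ ((i + j) + (i + j))) (sym (ℤP.pos-+ 1 k)))))
      where
      lem : ∀ i k j → (1ℤ + (i + i)) + (k + (j + j)) ≡ (1ℤ + k) + ((i + j) + (i + j))
      lem = solve-∀

  size-1≢0 : pos size - 1ℤ ≢ 0ℤ
  size-1≢0 e = contradiction (∑≡0⇒ nz nz≥0 (trans ∑nz e) 1F) (λ z → contradiction (trans (sym (nz-≢ 1F (0≢1 ∘ sym))) z) λ ())
    where
    nz≥0 : ∀ x → 0ℤ ℤ.≤ nz x
    nz≥0 x with does (0F ≟ x)
    ... | true  = ℤP.≤-refl
    ... | false = ℤ.+≤+ z≤n

cancel-≢0 : ∀ {a b c} → a ≢ 0ℤ → a * b ≡ a * c → b ≡ c
cancel-≢0 {a} {b} {c} a≢0 e = ℤP.*-cancelˡ-≡ a b c ⦃ ℤ.≢-nonZero a≢0 ⦄ e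

module Parallels (F : FiniteField) where
  open FiniteField F
  open VectorSpace F
  open Projective F
  open ≡-Reasoning

  Parallel : ∀ {n} → Vec Carrier n → Vec Carrier n → Set
  Parallel α β = ∃ λ u → u ≢ 0F × u ·ⱽ α ≡ β

  parallel? : ∀ {n} (α β : Vec Carrier n) → Dec (Parallel α β)
  parallel? α β = any? (λ u → ¬? (u ≟ 0F) ×-dec vec≟ enum (u ·ⱽ α) β)

  module _ {n : ℕ} where

    private
      ∑V : (Vec Carrier n → ℤ) → ℤ
      ∑V = ∑ (vecs enum n)
      module VE = Enum (enumVec enum n)

    par : Vec Carrier n → Vec Carrier n → ℤ
    par α β = ⟦ does (parallel? α β) ⟧

    parallel-sym : ∀ {α β : Vec Carrier n} → Parallel α β → Parallel β α
    parallel-sym {α} (u , u≢0 , refl) with inverse u u≢0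
    ... | w , e = w , (λ { refl → 0≢1 (trans (sym (zeroʳ u)) e) }) , ·ⱽ-cancel w u α (trans (*-comm w u) e)

    parallel-scale : ∀ {u} {α β : Vec Carrier n} → u ≢ 0F → Parallel α β → Parallel (u ·ⱽ α) β
    parallel-scale {u} {α} u≢0 (x , x≢0 , refl) with inverse u u≢0
    ... | w , e = x ⊗ w , ⊗-≢0 x≢0 (λ { refl → 0≢1 (trans (sym (zeroʳ u)) e) }) ,
                  trans (·ⱽ-assoc x w (u ·ⱽ α)) (cong (x ·ⱽ_) (·ⱽ-cancel w u α (trans (*-comm w u) e)))

    par-sym : ∀ α β → par α β ≡ par β α
    par-sym α β = cong ⟦_⟧ (does-cong (parallel? α β) (parallel? β α) parallel-sym parallel-sym)

    par-scale : ∀ u α β → u ≢ 0F → par (u ·ⱽ α) β ≡ par α β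
    par-scale u α β u≢0 = cong ⟦_⟧ (does-cong (parallel? (u ·ⱽ α) β) (parallel? α β)
      (λ p → parallel-sym (unscale (parallel-sym p))) (parallel-scale u≢0))
      where
      unscale : Parallel β (u ·ⱽ α) → Parallel β α
      unscale (x , x≢0 , e) with inverse u u≢0
      ... | w , uw = w ⊗ x , ⊗-≢0 (λ { refl → 0≢1 (trans (sym (zeroʳ u)) uw) }) x≢0 ,
                     trans (·ⱽ-assoc w x β) (trans (cong (w ·ⱽ_) e) (·ⱽ-cancel w u α (trans (*-comm w u) uw)))

    -- A nonzero α is carried to β by at most one scalar, so the sum over scalars counts either one
    -- or none.
    par-sum : ∀ α β → α ≢ 0ⱽ → par α β ≡ ∑ᴱ (λ u → nz u * VE.δ (u ·ⱽ α) β)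
    par-sum α β α≢0 = by (parallel? α β)
      where
      by : (d : Dec (Parallel α β)) → ⟦ does d ⟧ ≡ ∑ᴱ (λ u → nz u * VE.δ (u ·ⱽ α) β)
      by (no ¬p) = sym (trans (∑-cong list (λ u → trans (nz-* u (λ u≢0 → VE.δ-≢ (λ e → ¬p (u , u≢0 , e)))) (ℤP.*-zeroʳ (nz u)))) (∑-0 list))
      by (yes (u₀ , u₀≢0 , refl)) = sym (trans (∑-cong list (λ u → trans (ℤP.*-comm (nz u) _) (cong (λ b → ⟦ b ⟧ * nz u)
          (does-cong (vec≟ enum (u ·ⱽ α) (u₀ ·ⱽ α)) (u₀ ≟ u) (λ e → sym (·ⱽ-injective u u₀ α α≢0 e)) (λ { refl → refl })))))
        (trans (∑-δ u₀ nz) (nz-≢ u₀ u₀≢0)))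

    ∑-line : ∀ α → α ≢ 0ⱽ → ∀ (G : Vec Carrier n → ℤ) → ∑V (λ β → par α β * G β) ≡ ∑ᴱ (λ u → nz u * G (u ·ⱽ α))
    ∑-line α α≢0 G = begin
      ∑V (λ β → par α β * G β)
        ≡⟨ ∑-cong (vecs enum n) (λ β → trans (cong (_* G β) (par-sum α β α≢0)) (sym (∑-*ʳ list (G β) (λ u → nz u * VE.δ (u ·ⱽ α) β)))) ⟩
      ∑V (λ β → ∑ᴱ (λ u → nz u * VE.δ (u ·ⱽ α) β * G β))
        ≡⟨ ∑-swap (vecs enum n) list _ ⟩
      ∑ᴱ (λ u → ∑V (λ β → nz u * VE.δ (u ·ⱽ α) β * G β))
        ≡⟨ ∑-cong list (λ u → trans (∑-cong (vecs enum n) (λ β → ℤP.*-assoc (nz u) (VE.δ (u ·ⱽ α) β) (G β)))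
             (trans (∑-*ˡ (vecs enum n) (nz u) (λ β → VE.δ (u ·ⱽ α) β * G β)) (cong (nz u *_) (VE.∑-δ (u ·ⱽ α) G)))) ⟩
      ∑ᴱ (λ u → nz u * G (u ·ⱽ α)) ∎

    -- On nonzero vectors the matrix of `par` is, up to the factor `size` - 1, its own square. This
    -- exhibits it as a Gram matrix and so as positive semidefinite.
    par-square : ∀ α β → α ≢ 0ⱽ → ∑V (λ γ → par γ α * par γ β) ≡ (pos size - 1ℤ) * par α β
    par-square α β α≢0 = begin
      ∑V (λ γ → par γ α * par γ β)                ≡⟨ ∑-cong (vecs enum n) (λ γ → cong (_* par γ β) (par-sym γ α)) ⟩
      ∑V (λ γ → par α γ * par γ β)                ≡⟨ ∑-line α α≢0 (λ γ → par γ β) ⟩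
      ∑ᴱ (λ u → nz u * par (u ·ⱽ α) β)          ≡⟨ ∑-cong list (λ u → nz-* u (par-scale u α β)) ⟩
      ∑ᴱ (λ u → nz u * par α β)                 ≡⟨ trans (∑-*ʳ list (par α β) nz) (cong (_* par α β) ∑nz) ⟩
      (pos size - 1ℤ) * par α β ∎

-- The quadratic character of the extension field on hyperplanes and scalars

odd≢even : ∀ k l → 1ℤ + (k + k) ≢ l + l
odd≢even k l e = double≢1 (l - k) (trans (lem k l) (trans (cong (_- (k + k)) (sym e)) (lem′ k)))
  where
  lem : ∀ k l → (l - k) + (l - k) ≡ (l + l) - (k + k)
  lem = solve-∀
  lem′ : ∀ k → (1ℤ + (k + k)) - (k + k) ≡ 1ℤ
  lem′ = solve-∀
  double≢1 : ∀ z → z + z ≢ 1ℤ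
  double≢1 (pos zero)    ()
  double≢1 (pos (suc n)) e = contradiction (trans (sym (ℕP.+-suc n n)) (ℕP.suc-injective (ℤP.+-injective e))) λ ()
  double≢1 ℤ.-[1+ n ]    ()

±1² : ∀ {x} → x ≡ 1ℤ ⊎ x ≡ -1ℤ → x * x ≡ 1ℤ
±1² (inj₁ e) = cong₂ _*_ e e
±1² (inj₂ e) = cong₂ _*_ e e

self-neg : ∀ x → x ≡ - x → x ≡ 0ℤ
self-neg (pos zero)    e = refl
self-neg (pos (suc n)) ()
self-neg ℤ.-[1+ n ]    ()

module Character (F : FiniteField) (m : ℕ) (P : ℕ → FiniteField.Carrier F)
                 (P-irr : Polynomials.Irreducible F (suc m) P)
                 (odd : Projective.Odd F (pos (FiniteField.size F))) where
  open FiniteField F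
  open VectorSpace F
  open Projective F
  open Extension F m P P-irr public
  open ≡-Reasoning

  private
    module KF = FiniteField K
    ∑K : (KVec → ℤ) → ℤ
    ∑K = ∑ (vecs enum n)

  2≢0 : 1F ⊕ 1F ≢ 0F
  2≢0 = odd⇒2≢0 (λ k e → odd≢even (proj₁ odd) k (trans (sym (proj₂ odd)) e))

  open QuadraticCharacter K (λ e → 2≢0 (cong head e)) public using (χ; χ-0; χ-±1; ∑χ≡0; χ-*; roots)

  χ-scalar : ∀ u v → χ (u ·ⱽ v) ≡ χ (u ·ⱽ 1ⱽ) * χ v
  χ-scalar u v = trans (cong χ (sym (trans (·ⱽ-⋆ u 1ⱽ v) (cong (u ·ⱽ_) (⋆-identityˡ v))))) (χ-* (u ·ⱽ 1ⱽ) v)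

  χ² : ∀ v → v ≢ 0ⱽ → χ v * χ v ≡ 1ℤ
  χ² v v≢0 = ±1² (χ-±1 v v≢0)

  nzⱽ-χ : ∀ v → nzⱽ v * χ v ≡ χ v
  nzⱽ-χ v = by (vec≟ enum 0ⱽ v)
    where
    by : (d : Dec (0ⱽ ≡ v)) → (1ℤ - ⟦ does d ⟧) * χ v ≡ χ v
    by (yes e) = sym (trans (cong χ (sym e)) χ-0)
    by (no _)  = ℤP.*-identityˡ (χ v)

  conj : KVec → KVec
  conj α = proj₁ (represent α)

  conj≢0 : ∀ α → α ≢ 0ⱽ → conj α ≢ 0ⱽ
  conj≢0 α α≢0 e = α≢0 (dot-zero α λ β → trans (proj₂ (represent α) β) (trans (cong (λ z → head (z ⋆ β)) e) (cong head (KF.zeroˡ β))))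
    where
    dot-0 : ∀ {k} (u : Vec Carrier k) → dotF u 0ⱽ ≡ 0F
    dot-0 []      = refl
    dot-0 (a ∷ u) = trans (cong₂ _⊕_ (zeroʳ a) (dot-0 u)) (+-identityˡ 0F)
    dot-zero : ∀ {k} (u : Vec Carrier k) → (∀ β → dotF u β ≡ 0F) → u ≡ 0ⱽ
    dot-zero []      h = refl
    dot-zero (a ∷ u) h = cong₂ _∷_
      (trans (sym (trans (cong₂ _⊕_ (*-identityʳ a) (dot-0 u)) (+-identityʳ a))) (h (1F ∷ 0ⱽ)))
      (dot-zero u (λ β → trans (sym (trans (cong (_⊕ dotF u β) (zeroʳ a)) (+-identityˡ _))) (h (0F ∷ β))))

  hyperplaneSum : ∀ x α → α ≢ 0ⱽ →
    ∑K (λ β → δ (dotF α β) x * χ β) ≡ χ (conj α) * ∑K (λ γ → δ (head γ) x * χ γ)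
  hyperplaneSum x α α≢0 = (begin
    ∑K (λ β → δ (dotF α β) x * χ β)
      ≡⟨ ∑-cong (vecs enum n) term ⟩
    ∑K (λ β → χ α′ * (δ (head (α′ ⋆ β)) x * χ (α′ ⋆ β)))
      ≡⟨ ∑-*ˡ (vecs enum n) (χ α′) (λ β → δ (head (α′ ⋆ β)) x * χ (α′ ⋆ β)) ⟩
    χ α′ * ∑K (λ β → δ (head (α′ ⋆ β)) x * χ (α′ ⋆ β))
      ≡⟨ cong (χ α′ *_) (KF.∑-scale α′≢0 (λ γ → δ (head γ) x * χ γ)) ⟩
    χ α′ * ∑K (λ γ → δ (head γ) x * χ γ) ∎)
    where
    α′ : KVec
    α′ = proj₁ (represent α)
    spec : ∀ β → dotF α β ≡ head (α′ ⋆ β)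
    spec = proj₂ (represent α)
    α′≢0 : α′ ≢ 0ⱽ
    α′≢0 = conj≢0 α α≢0
    lem : ∀ a b c → a * (b * (a * c)) ≡ (a * a) * (b * c)
    lem = solve-∀
    -- As χ(α′)² = 1, the value χ(β) equals χ(α′) χ(α′β), which depends on β through α′β alone.
    term : ∀ β → δ (dotF α β) x * χ β ≡ χ α′ * (δ (head (α′ ⋆ β)) x * χ (α′ ⋆ β))
    term β = sym (begin
      χ α′ * (δ (head (α′ ⋆ β)) x * χ (α′ ⋆ β))     ≡⟨ cong₂ (λ y z → χ α′ * (δ y x * z)) (sym (spec β)) (χ-* α′ β) ⟩
      χ α′ * (δ (dotF α β) x * (χ α′ * χ β))        ≡⟨ lem (χ α′) (δ (dotF α β) x) (χ β) ⟩
      (χ α′ * χ α′) * (δ (dotF α β) x * χ β)        ≡⟨ cong (_* (δ (dotF α β) x * χ β)) (χ² α′ α′≢0) ⟩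
      1ℤ * (δ (dotF α β) x * χ β)                   ≡⟨ ℤP.*-identityˡ _ ⟩
      δ (dotF α β) x * χ β ∎)

  δK : KVec → KVec → ℤ
  δK = KF.δ

  -- The indicator of F^* inside K.
  scalar : KVec → ℤ
  scalar γ = ∑ᴱ (λ u → nz u * δK (u ·ⱽ 1ⱽ) γ)

  scalar-0 : scalar 0ⱽ ≡ 0ℤ
  scalar-0 = trans (∑-cong list (λ u → trans (nz-* u (λ u≢0 → KF.δ-≢ (·ⱽ-≢0 u 1ⱽ u≢0 (λ e → 0≢1 (sym (cong head e)))))) (ℤP.*-zeroʳ (nz u)))) (∑-0 list)

  scalar-· : ∀ c γ → c ≢ 0F → scalar (c ·ⱽ γ) ≡ scalar γ
  scalar-· c γ c≢0 = trans (sym (∑-scale c≢0 (λ u → nz u * δK (u ·ⱽ 1ⱽ) (c ·ⱽ γ))))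
    (∑-cong list (λ u → cong₂ _*_ (nz-scale c≢0 u) (cong ⟦_⟧ (does-cong (KF._≟_ ((c ⊗ u) ·ⱽ 1ⱽ) (c ·ⱽ γ)) (KF._≟_ (u ·ⱽ 1ⱽ) γ)
      (λ e → inj (trans (sym (·ⱽ-assoc c u 1ⱽ)) e)) (λ { refl → ·ⱽ-assoc c u 1ⱽ })))))
    where
    inj : ∀ {a b : KVec} → c ·ⱽ a ≡ c ·ⱽ b → a ≡ b
    inj {a} {b} e with inverse c c≢0
    ... | w , p = trans (sym (·ⱽ-cancel w c a wc)) (trans (cong (w ·ⱽ_) e) (·ⱽ-cancel w c b wc))
      where
      wc : w ⊗ c ≡ 1F
      wc = trans (*-comm w c) p

  ∑scalar : ∑K scalar ≡ pos size - 1ℤ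
  ∑scalar = trans (∑-swap (vecs enum n) list _) (trans (∑-cong list (λ u → trans (∑-*ˡ (vecs enum n) (nz u) (δK (u ·ⱽ 1ⱽ)))
    (trans (cong (nz u *_) (KF.once (u ·ⱽ 1ⱽ))) (ℤP.*-identityʳ (nz u))))) ∑nz)

  drop-nz : ∀ (f : KVec → KVec) → f 0ⱽ ≡ 0ⱽ → ∀ v → nzⱽ v * scalar (f v) ≡ scalar (f v)
  drop-nz f f0 v = by (vec≟ enum 0ⱽ v)
    where
    by : (d : Dec (0ⱽ ≡ v)) → (1ℤ - ⟦ does d ⟧) * scalar (f v) ≡ scalar (f v)
    by (yes 0≡v) = sym (trans (cong (scalar ∘ f) (sym 0≡v)) (trans (cong scalar f0) scalar-0))
    by (no _)    = ℤP.*-identityˡ (scalar (f v))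

  normal≢0 : ∀ {k} (G H : Vec Carrier k → ℤ) → (∀ v → v ≢ 0ⱽ → G v ≡ H v) → ∑ (normals k) G ≡ ∑ (normals k) H
  normal≢0 {zero}  G H h = refl
  normal≢0 {suc k} G H h = trans (∑-normals k G) (trans (cong₂ _+_
    (∑-cong (vecs enum k) (λ v → h (1F ∷ v) (λ e → 0≢1 (sym (cong head e)))))
    (normal≢0 (λ v → G (0F ∷ v)) (λ v → H (0F ∷ v)) (λ v n → h (0F ∷ v) (n ∘ VecP.∷-injectiveʳ)))) (sym (∑-normals k H)))

  -- Multiplication by x permutes K, so exactly `size` - 1 vectors y have x y in F^*. They make up a
  -- single line, that of the inverse of x.
  row : ∀ x → x ≢ 0ⱽ → ∑ (normals n) (λ y → scalar (x ⋆ y)) ≡ 1ℤ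
  row x x≢0 = cancel-≢0 size-1≢0 (begin
    (pos size - 1ℤ) * ∑ (normals n) (λ y → scalar (x ⋆ y))
      ≡⟨ sym (∑-projective n (λ y → scalar (x ⋆ y)) (λ u v u≢0 → trans (cong scalar (⋆-·ⱽ u x v)) (scalar-· u (x ⋆ v) u≢0))) ⟩
    ∑K (λ y → nzⱽ y * scalar (x ⋆ y))
      ≡⟨ ∑-cong (vecs enum n) (drop-nz (x ⋆_) (KF.zeroʳ x)) ⟩
    ∑K (λ y → scalar (x ⋆ y))
      ≡⟨ trans (KF.∑-scale x≢0 scalar) ∑scalar ⟩
    pos size - 1ℤ
      ≡⟨ sym (ℤP.*-identityʳ _) ⟩
    (pos size - 1ℤ) * 1ℤ ∎)

  restricted : ℤ
  restricted = ∑ᴱ (λ u → nz u * χ (u ·ⱽ 1ⱽ))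

  -- The number of points of the projective space of K that are fixed by inversion.
  diagonal : ℤ
  diagonal = ∑ (normals n) (λ x → scalar (x ⋆ x))

  -- The vectors with square in F^* are counted in two ways: `size` - 1 for each fixed point, and 1
  -- + χ(u) for each u in F^*.
  diagonal-eq : (pos size - 1ℤ) * diagonal ≡ restricted + (pos size - 1ℤ)
  diagonal-eq = begin
    (pos size - 1ℤ) * diagonal
      ≡⟨ sym (∑-projective n (λ x → scalar (x ⋆ x)) (λ u v u≢0 → trans (cong scalar (trans (·ⱽ-⋆ u v (u ·ⱽ v)) (cong (u ·ⱽ_) (⋆-·ⱽ u v v))))
           (trans (scalar-· u (u ·ⱽ (v ⋆ v)) u≢0) (scalar-· u (v ⋆ v) u≢0)))) ⟩
    ∑K (λ x → nzⱽ x * scalar (x ⋆ x))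
      ≡⟨ ∑-cong (vecs enum n) (drop-nz (λ x → x ⋆ x) (KF.zeroʳ 0ⱽ)) ⟩
    ∑K (λ x → scalar (x ⋆ x))
      ≡⟨ ∑-swap (vecs enum n) list _ ⟩
    ∑ᴱ (λ u → ∑K (λ x → nz u * δK (u ·ⱽ 1ⱽ) (x ⋆ x)))
      ≡⟨ ∑-cong list (λ u → trans (∑-*ˡ (vecs enum n) (nz u) (λ x → δK (u ·ⱽ 1ⱽ) (x ⋆ x))) (trans (cong (nz u *_)
           (trans (∑-cong (vecs enum n) (λ x → cong ⟦_⟧ (does-cong (KF._≟_ (u ·ⱽ 1ⱽ) (x ⋆ x)) (KF._≟_ (x ⋆ x) (u ·ⱽ 1ⱽ)) sym sym)))
             (lem₁ (roots (u ·ⱽ 1ⱽ))))) (ℤP.*-distribˡ-+ (nz u) (χ (u ·ⱽ 1ⱽ)) 1ℤ))) ⟩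
    ∑ᴱ (λ u → nz u * χ (u ·ⱽ 1ⱽ) + nz u * 1ℤ)
      ≡⟨ ∑-+ list (λ u → nz u * χ (u ·ⱽ 1ⱽ)) (λ u → nz u * 1ℤ) ⟩
    restricted + ∑ᴱ (λ u → nz u * 1ℤ)
      ≡⟨ cong (restricted +_) (trans (∑-cong list (λ u → ℤP.*-identityʳ (nz u))) ∑nz) ⟩
    restricted + (pos size - 1ℤ) ∎
    where
    lem₁ : ∀ r → r ≡ (r - 1ℤ) + 1ℤ
    lem₁ = solve-∀

  -- On points, `scalar (x ⋆ y)` is the permutation matrix of inversion: symmetric, with row sums 1.
  -- So its trace `diagonal` has the parity of the number of points, which is the parity of n.
  degree-parity : ∃ λ j → pos n ≡ diagonal + (j + j)
  degree-parity = k - j , (begin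
    pos n                                        ≡⟨ lem₁ (pos n) j ⟩
    (pos n + (j + j)) - (j + j)                  ≡⟨ cong (_- (j + j)) (trans (sym (proj₂ points)) (trans (sym rows) (proj₂ symm))) ⟩
    (diagonal + (k + k)) - (j + j)               ≡⟨ lem₂ diagonal k j ⟩
    diagonal + ((k - j) + (k - j)) ∎)
    where
    symm : ∃ λ k → ∑ (normals n) (λ x → ∑ (normals n) (λ y → scalar (x ⋆ y))) ≡ diagonal + (k + k)
    symm = ∑∑-sym-parity (normals n) (λ x y → scalar (x ⋆ y)) (λ x y → cong scalar (⋆-comm x y))
    points : ∃ λ j → ∑ (normals n) (λ _ → 1ℤ) ≡ pos n + (j + j)
    points = normals-parity odd n
    k j : ℤ
    k = proj₁ symm
    j = proj₁ points
    rows : ∑ (normals n) (λ x → ∑ (normals n) (λ y → scalar (x ⋆ y))) ≡ ∑ (normals n) (λ _ → 1ℤ)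
    rows = normal≢0 (λ x → ∑ (normals n) (λ y → scalar (x ⋆ y))) (λ _ → 1ℤ) row
    lem₁ : ∀ a j → a ≡ (a + (j + j)) - (j + j)
    lem₁ = solve-∀
    lem₂ : ∀ a k j → (a + (k + k)) - (j + j) ≡ a + ((k - j) + (k - j))
    lem₂ = solve-∀

  module Nontrivial (ν : Carrier) (ν≢0 : ν ≢ 0F) (e : χ (ν ·ⱽ 1ⱽ) ≡ -1ℤ) where

    χ-ν : ∀ v → χ (ν ·ⱽ v) ≡ - χ v
    χ-ν v = trans (χ-scalar ν v) (trans (cong (_* χ v) e) (ℤP.-1*i≡-i (χ v)))

    -- The substitution u ↦ ν u permutes F^* and reverses the sign of every term.
    restricted≡0 : restricted ≡ 0ℤ
    restricted≡0 = self-neg restricted (begin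
      restricted                                     ≡⟨ sym (∑-scale ν≢0 (λ u → nz u * χ (u ·ⱽ 1ⱽ))) ⟩
      ∑ᴱ (λ u → nz (ν ⊗ u) * χ ((ν ⊗ u) ·ⱽ 1ⱽ))      ≡⟨ ∑-cong list (λ u → trans (cong₂ _*_ (nz-scale ν≢0 u)
                                                          (trans (cong χ (·ⱽ-assoc ν u 1ⱽ)) (χ-ν (u ·ⱽ 1ⱽ))))
                                                          (sym (ℤP.neg-distribʳ-* (nz u) (χ (u ·ⱽ 1ⱽ))))) ⟩
      ∑ᴱ (λ u → - (nz u * χ (u ·ⱽ 1ⱽ)))              ≡⟨ ∑-neg list (λ u → nz u * χ (u ·ⱽ 1ⱽ)) ⟩
      - restricted ∎)

    diagonal≡1 : diagonal ≡ 1ℤ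
    diagonal≡1 = cancel-≢0 size-1≢0 (trans diagonal-eq (trans (cong (_+ (pos size - 1ℤ)) restricted≡0)
      (trans (ℤP.+-identityˡ (pos size - 1ℤ)) (sym (ℤP.*-identityʳ (pos size - 1ℤ))))))

    n-odd : Odd (pos n)
    n-odd = proj₁ degree-parity , trans (proj₂ degree-parity) (cong (_+ (proj₁ degree-parity + proj₁ degree-parity)) diagonal≡1)

  module Trivial (none : ∀ u → ¬ (u ≢ 0F × χ (u ·ⱽ 1ⱽ) ≡ -1ℤ)) where

    trivial : ∀ u → u ≢ 0F → χ (u ·ⱽ 1ⱽ) ≡ 1ℤ
    trivial u u≢0 = Sum.[ id , (λ e → contradiction (u≢0 , e) (none u)) ]′
      (χ-±1 (u ·ⱽ 1ⱽ) (·ⱽ-≢0 u 1ⱽ u≢0 (λ e → 0≢1 (sym (cong head e)))))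

    χ-u : ∀ u v → u ≢ 0F → χ (u ·ⱽ v) ≡ χ v
    χ-u u v u≢0 = trans (χ-scalar u v) (trans (cong (_* χ v) (trivial u u≢0)) (ℤP.*-identityˡ (χ v)))

    restricted≡ : restricted ≡ pos size - 1ℤ
    restricted≡ = trans (∑-cong list (λ u → trans (nz-* u (trivial u)) (ℤP.*-identityʳ (nz u)))) ∑nz

    diagonal≡2 : diagonal ≡ 1ℤ + 1ℤ
    diagonal≡2 = cancel-≢0 size-1≢0 (trans diagonal-eq (trans (cong (_+ (pos size - 1ℤ)) restricted≡) (lem (pos size - 1ℤ))))
      where
      lem : ∀ a → a + a ≡ a * (1ℤ + 1ℤ)
      lem = solve-∀

    n-even : Even (pos n)
    n-even = 1ℤ + j , trans (proj₂ degree-parity) (trans (cong (_+ (j + j)) diagonal≡2) (lem j))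
      where
      j : ℤ
      j = proj₁ degree-parity
      lem : ∀ j → (1ℤ + 1ℤ) + (j + j) ≡ (1ℤ + j) + (1ℤ + j)
      lem = solve-∀

  scalarCharacter :
    (Odd (pos n) × ∃ λ ν → ν ≢ 0F × (∀ v → χ (ν ·ⱽ v) ≡ - χ v)) ⊎
    (Even (pos n) × (∀ u v → u ≢ 0F → χ (u ·ⱽ v) ≡ χ v))
  scalarCharacter = Sum.map
    (λ { (ν , ν≢0 , e) → let open Nontrivial ν ν≢0 e in n-odd , ν , ν≢0 , χ-ν })
    (λ none → let open Trivial none in n-even , χ-u)
    (decide (λ u → ¬? (u ≟ 0F) ×-dec (χ (u ·ⱽ 1ⱽ) ℤP.≟ -1ℤ)))

-- Finite local rings and tuples over them

any-elim : ∀ (p : A → Bool) xs → any p xs ≡ true → ∃ λ x → p x ≡ true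
any-elim p (x ∷ xs) e with p x in eq
... | true  = x , eq
... | false = any-elim p xs e

all-intro : ∀ (p : A → Bool) xs → (∀ x → p x ≡ true) → all p xs ≡ true
all-intro p []       h = refl
all-intro p (x ∷ xs) h = cong₂ _∧_ (h x) (all-intro p xs h)

not-≡true : ∀ {b} → not b ≡ true → b ≢ true
not-≡true {false} _ ()

≢true⇒not : ∀ {b} → b ≢ true → not b ≡ true
≢true⇒not {true}  n = contradiction refl n
≢true⇒not {false} n = refl

∧-elimˡ : ∀ {a b} → a ∧ b ≡ true → a ≡ true
∧-elimˡ {true} _ = refl

∧-elimʳ : ∀ {a b} → a ∧ b ≡ true → b ≡ true
∧-elimʳ {true} e = e

module _ {A : Set} (E : Enum A) where
  open Enum E

  any-intro : ∀ p x → p x ≡ true → any p list ≡ true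
  any-intro p x px = go list λ z → contradiction (trans (sym (once x)) z) λ ()
    where
    go : ∀ xs → ∑ xs (δ x) ≢ 0ℤ → any p xs ≡ true
    go []       h = contradiction refl h
    go (y ∷ ys) h with p y in eq
    ... | true  = refl
    ... | false = go ys λ z → h (cong₂ _+_ (δ-≢ λ { refl → contradiction (trans (sym px) eq) λ () }) z)

  all-elim : ∀ p → all p list ≡ true → ∀ x → p x ≡ true
  all-elim p e x = go list e λ z → contradiction (trans (sym (once x)) z) λ ()
    where
    go : ∀ xs → all p xs ≡ true → ∑ xs (δ x) ≢ 0ℤ → p x ≡ true
    go []       _ h = contradiction refl h
    go (y ∷ ys) e h with x ≟ y
    ... | yes refl = ∧-elimˡ e
    ... | no n     = go ys (∧-elimʳ {p y} e) λ z → h (trans (cong (0ℤ +_) z) refl)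

  any-does : ∀ {P : A → Set} p (d : Dec (∃ P)) → (∀ x → p x ≡ true → P x) → (∀ x → P x → p x ≡ true) → any p list ≡ does d
  any-does p d f g = iff⇒≡ (λ e → let x , px = any-elim p list e in dec-true d (x , f x px))
    (λ e → let x , q = does-true d e in any-intro p x (g x q))

  module Sub (p : A → Bool) where

    B′ : Set
    B′ = Σ A (λ x → p x ≡ true)

    consIf : ∀ x b → p x ≡ b → List B′ → List B′
    consIf x true  e ys = (x , e) ∷ ys
    consIf x false e ys = ys

    subset : List A → List B′
    subset []       = []
    subset (x ∷ xs) = consIf x (p x) refl (subset xs)

    ∑-subset : ∀ xs (f : A → ℤ) → ∑ (subset xs) (f ∘ proj₁) ≡ ∑ xs (λ x → ⟦ p x ⟧ * f x)
    ∑-subset []       f = refl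
    ∑-subset (x ∷ xs) f = trans (by (p x) refl) (cong (⟦ p x ⟧ * f x +_) (∑-subset xs f))
      where
      by : ∀ b e → ∑ (consIf x b e (subset xs)) (f ∘ proj₁) ≡ ⟦ b ⟧ * f x + ∑ (subset xs) (f ∘ proj₁)
      by true  e = cong (_+ ∑ (subset xs) (f ∘ proj₁)) (sym (ℤP.*-identityˡ (f x)))
      by false e = sym (ℤP.+-identityˡ _)

    length-subset : ∀ xs → length (subset xs) ≡ length (filterᵇ p xs)
    length-subset xs = ℤP.+-injective (begin
      pos (length (subset xs))        ≡⟨ ∑-length (subset xs) ⟩
      ∑ (subset xs) (λ _ → 1ℤ)        ≡⟨ ∑-subset xs (λ _ → 1ℤ) ⟩
      ∑ xs (λ x → ⟦ p x ⟧ * 1ℤ)       ≡⟨ sym (∑-filter p xs (λ _ → 1ℤ)) ⟩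
      ∑ (filterᵇ p xs) (λ _ → 1ℤ)     ≡⟨ sym (∑-length (filterᵇ p xs)) ⟩
      pos (length (filterᵇ p xs)) ∎)
      where open ≡-Reasoning

    sub-≡ : ∀ {x y : B′} → proj₁ x ≡ proj₁ y → x ≡ y
    sub-≡ {x , d} {.x , e} refl = cong (x ,_) (uip d e)
      where
      uip : ∀ {b c : Bool} (q r : b ≡ c) → q ≡ r
      uip refl refl = refl

    enumSub : Enum B′
    enumSub = record
      { list = subset list
      ; _≟_ = λ x y → map′ sub-≡ (cong proj₁) (proj₁ x ≟ proj₁ y)
      ; once = λ { (x , px) → trans (∑-subset list (δ x)) (trans (∑-cong list (λ y → ℤP.*-comm ⟦ p y ⟧ (δ x y)))
                     (trans (∑-δ x (λ y → ⟦ p y ⟧)) (cong ⟦_⟧ px))) } }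

-- When a smaller y replaces the current candidate x, transitivity preserves what was excluded
-- before: anything below y is below x.
minimal : ∀ (lt : A → A → Bool) → (∀ x → lt x x ≢ true) → (∀ {x y z} → lt x y ≡ true → lt y z ≡ true → lt x z ≡ true) →
          ∀ (p : A → Bool) (xs : List A) x₀ → p x₀ ≡ true →
          ∃ λ x → p x ≡ true × lt x₀ x ≢ true × (all (λ y → not (p y ∧ lt y x)) xs ≡ true)
minimal lt irr tr p [] x₀ px₀ = x₀ , px₀ , irr x₀ , refl
minimal lt irr tr p (y ∷ ys) x₀ px₀ with minimal lt irr tr p ys x₀ px₀
... | x , px , x₀≮x , h with p y in py | lt y x in yx
... | false | _     = x , px , x₀≮x , h
... | true  | false = x , px , x₀≮x , trans (cong (λ b → not b ∧ all (λ z → not (p z ∧ lt z x)) ys) yx) h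
... | true  | true  = y , py , (λ e → x₀≮x (tr e yx)) , cong₂ _∧_ (≢true⇒not (irr y)) (weaken ys h)
  where
  weaken : ∀ zs → all (λ z → not (p z ∧ lt z x)) zs ≡ true → all (λ z → not (p z ∧ lt z y)) zs ≡ true
  weaken []       _ = refl
  weaken (z ∷ zs) e = cong₂ _∧_ (≢true⇒not (λ q → not-≡true (∧-elimˡ {not (p z ∧ lt z x)} e)
    (cong₂ _∧_ (∧-elimˡ {p z} q) (tr (∧-elimʳ {p z} q) yx)))) (weaken zs (∧-elimʳ {not (p z ∧ lt z x)} e))

module LocalRing (R : FinCommRing) (loc : FinCommRing.IsLocal R)
                 (π : FinCommRing.Elt R) (unif : FinCommRing.IsUniformizer R π) where
  open FinCommRing R public using (N; Elt; elems; IsUnit; isUnitᵇ; _∈⟨_⟩; _∈⟨_⟩ᵇ; residueSize; Tup; allTups; dot; isUnimodularᵇ;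
      unimodular; scale; lexLt; unimodularModUnits; _^ᴿ_; isCommutativeRing)
    renaming (_+_ to infixl 6 _⊕_; _*_ to infixl 7 _⊗_; -_ to infix 8 ⊖_; 0# to 0ᴿ; 1# to 1ᴿ)
  open CRing isCommutativeRing public
  open Solver public
  open ≡-Reasoning

  E : Enum Elt
  E = enumFin N
  open Enum E public

  ∑-translate : ∀ x f → ∑ᴱ (λ y → f (y ⊕ x)) ≡ ∑ᴱ f
  ∑-translate x f = ∑-bij (_⊕ x) (_⊕ ⊖ x)
    (λ y → solve 2 (λ x y → (y :+ :- x) :+ x := y) refl x y)
    (λ y → solve 2 (λ x y → (y :+ x) :+ :- x := y) refl x y) f

  unit? : ∀ x → Dec (IsUnit x)
  unit? x = any? (λ y → x ⊗ y ≟ 1ᴿ)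

  isUnitᵇ-does : ∀ x → isUnitᵇ x ≡ does (unit? x)
  isUnitᵇ-does x = any-does E _ (unit? x) (λ y → does-true (x ⊗ y ≟ 1ᴿ)) (λ y → dec-true (x ⊗ y ≟ 1ᴿ))

  ∈⟨⟩? : ∀ x g → Dec (x ∈⟨ g ⟩)
  ∈⟨⟩? x g = any? (λ y → x ≟ g ⊗ y)

  ∈⟨⟩ᵇ-does : ∀ x g → x ∈⟨ g ⟩ᵇ ≡ does (∈⟨⟩? x g)
  ∈⟨⟩ᵇ-does x g = any-does E _ (∈⟨⟩? x g) (λ y → does-true (x ≟ g ⊗ y)) (λ y → dec-true (x ≟ g ⊗ y))

  ∈-0 : ∀ g → 0ᴿ ∈⟨ g ⟩
  ∈-0 g = 0ᴿ , sym (zeroʳ g)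

  ∈-+ : ∀ {g x y} → x ∈⟨ g ⟩ → y ∈⟨ g ⟩ → (x ⊕ y) ∈⟨ g ⟩
  ∈-+ {g} (a , refl) (b , refl) = a ⊕ b , sym (distribˡ g a b)

  ∈-neg : ∀ {g x} → x ∈⟨ g ⟩ → (⊖ x) ∈⟨ g ⟩
  ∈-neg {g} (a , refl) = ⊖ a , ⊖-distribʳ g a

  ∈-* : ∀ {g x} r → x ∈⟨ g ⟩ → (r ⊗ x) ∈⟨ g ⟩
  ∈-* {g} r (a , refl) = r ⊗ a , solve 3 (λ r g a → r :* (g :* a) := g :* (r :* a)) refl r g a

  M : Elt → Set
  M x = x ∈⟨ π ⟩

  M? : ∀ x → Dec (M x)
  M? x = ∈⟨⟩? x π

  M⇒¬unit : ∀ {x} → M x → ¬ IsUnit x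
  M⇒¬unit {x} = Equivalence.from (unif x)

  ¬M⇒unit : ∀ {x} → ¬ M x → IsUnit x
  ¬M⇒unit {x} h = decidable-stable (unit? x) (λ n → h (Equivalence.to (unif x) n))

  unit-1 : IsUnit 1ᴿ
  unit-1 = 1ᴿ , *-identityˡ 1ᴿ

  unit-* : ∀ {x y} → IsUnit x → IsUnit y → IsUnit (x ⊗ y)
  unit-* {x} {y} (a , p) (b , q) = a ⊗ b , (begin
    (x ⊗ y) ⊗ (a ⊗ b) ≡⟨ solve 4 (λ x y a b → (x :* y) :* (a :* b) := (x :* a) :* (y :* b)) refl x y a b ⟩
    (x ⊗ a) ⊗ (y ⊗ b) ≡⟨ cong₂ _⊗_ p q ⟩
    1ᴿ ⊗ 1ᴿ           ≡⟨ *-identityˡ 1ᴿ ⟩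
    1ᴿ ∎)

  m : Elt → ℤ
  m x = ⟦ does (M? x) ⟧

  ∣M∣ : ℤ
  ∣M∣ = ∑ᴱ m

  infix 4 _~_
  _~_ : Elt → Elt → Set
  x ~ y = M (x ⊕ ⊖ y)

  ~-refl : ∀ {x y} → x ≡ y → x ~ y
  ~-refl {x} refl = subst M (sym (⊖-inverseʳ x)) (∈-0 π)

  ~-sym : ∀ {x y} → x ~ y → y ~ x
  ~-sym {x} {y} p = subst M (solve 2 (λ x y → :- (x :+ :- y) := y :+ :- x) refl x y) (∈-neg p)

  ~-trans : ∀ {x y z} → x ~ y → y ~ z → x ~ z
  ~-trans {x} {y} {z} p q = subst M (solve 3 (λ x y z → (x :+ :- y) :+ (y :+ :- z) := x :+ :- z) refl x y z) (∈-+ p q)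

  ~-+ : ∀ {x x′ y y′} → x ~ x′ → y ~ y′ → x ⊕ y ~ x′ ⊕ y′
  ~-+ {x} {x′} {y} {y′} p q = subst M (solve 4 (λ x x′ y y′ → (x :+ :- x′) :+ (y :+ :- y′) := (x :+ y) :+ :- (x′ :+ y′)) refl x x′ y y′) (∈-+ p q)

  ~-* : ∀ {x x′ y y′} → x ~ x′ → y ~ y′ → x ⊗ y ~ x′ ⊗ y′
  ~-* {x} {x′} {y} {y′} p q = subst M (solve 4 (λ x x′ y y′ → y :* (x :+ :- x′) :+ x′ :* (y :+ :- y′) := x :* y :+ :- (x′ :* y′)) refl x x′ y y′) (∈-+ (∈-* y p) (∈-* x′ q))

  M⇒~0 : ∀ {x} → M x → x ~ 0ᴿ
  M⇒~0 {x} = subst M (sym (trans (cong (x ⊕_) ⊖0≡0) (+-identityʳ x)))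

  ~0⇒M : ∀ {x} → x ~ 0ᴿ → M x
  ~0⇒M {x} = subst M (trans (cong (x ⊕_) ⊖0≡0) (+-identityʳ x))

  -- The predicate that `residueSize` counts, so that the residue field has q elements by
  -- construction.
  isRep : Elt → Bool
  isRep x = all (λ y → not ((y <ᵇ x) ∧ ((x ⊕ ⊖ y) ∈⟨ π ⟩ᵇ))) elems

  open Sub E isRep public using (enumSub; sub-≡; length-subset; ∑-subset) renaming (B′ to Res)

  <ᵇ⇒< : ∀ {x y : Elt} → (x <ᵇ y) ≡ true → toℕ x ℕ.< toℕ y
  <ᵇ⇒< {x} {y} e = ℕP.<ᵇ⇒< (toℕ x) (toℕ y) (subst T (sym e) _)

  <⇒<ᵇ : ∀ {x y : Elt} → toℕ x ℕ.< toℕ y → (x <ᵇ y) ≡ true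
  <⇒<ᵇ {x} {y} p = T⇒≡ (ℕP.<⇒<ᵇ p)
    where
    T⇒≡ : ∀ {b} → T b → b ≡ true
    T⇒≡ {true} _ = refl

  findRep : ∀ x → ∃ λ r → isRep r ≡ true × r ~ x
  findRep x with minimal _<ᵇ_ (λ y e → ℕP.<-irrefl refl (<ᵇ⇒< {y} {y} e))
                   (λ {a} {b} {c} p q → <⇒<ᵇ {a} {c} (ℕP.<-trans (<ᵇ⇒< {a} {b} p) (<ᵇ⇒< {b} {c} q)))
                   (λ y → does (M? (y ⊕ ⊖ x))) elems x (dec-true (M? (x ⊕ ⊖ x)) (~-refl refl))
  ... | r , pr , _ , h = r , all-intro _ elems rep , r~x
    where
    r~x : r ~ x
    r~x = does-true (M? (r ⊕ ⊖ x)) pr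
    rep : ∀ y → not ((y <ᵇ r) ∧ ((r ⊕ ⊖ y) ∈⟨ π ⟩ᵇ)) ≡ true
    rep y = ≢true⇒not λ e → not-≡true (all-elim E _ h y) (cong₂ _∧_
      (dec-true (M? (y ⊕ ⊖ x)) (~-trans (~-sym (does-true (∈⟨⟩? (r ⊕ ⊖ y) π) (trans (sym (∈⟨⟩ᵇ-does _ π)) (∧-elimʳ {y <ᵇ r} e)))) r~x))
      (∧-elimˡ {y <ᵇ r} e))

  rep-unique : ∀ {x y} → isRep x ≡ true → isRep y ≡ true → x ~ y → x ≡ y
  rep-unique {x} {y} rx ry p = FinP.toℕ-injective (ℕP.≤-antisym (ℕP.≮⇒≥ (noless rx p)) (ℕP.≮⇒≥ (noless ry (~-sym p))))
    where
    noless : ∀ {x y} → isRep x ≡ true → x ~ y → ¬ (toℕ y ℕ.< toℕ x)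
    noless {x} {y} rx p l = not-≡true (all-elim E _ rx y) (cong₂ _∧_ (<⇒<ᵇ {y} {x} l)
      (trans (∈⟨⟩ᵇ-does (x ⊕ ⊖ y) π) (dec-true (∈⟨⟩? (x ⊕ ⊖ y) π) p)))

  abstract
    red : Elt → Res
    red x = proj₁ (findRep x) , proj₁ (proj₂ (findRep x))

    val-red : ∀ x → proj₁ (red x) ~ x
    val-red x = proj₂ (proj₂ (findRep x))

  red-cong : ∀ {x y} → x ~ y → red x ≡ red y
  red-cong {x} {y} p = sub-≡ (rep-unique (proj₂ (red x)) (proj₂ (red y)) (~-trans (val-red x) (~-trans p (~-sym (val-red y)))))

  red-~ : ∀ {x y} → red x ≡ red y → x ~ y
  red-~ {x} {y} e = ~-trans (~-sym (val-red x)) (subst (λ r → proj₁ r ~ y) (sym e) (val-red y))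

  red-val : ∀ (r : Res) → red (proj₁ r) ≡ r
  red-val r = sub-≡ (rep-unique (proj₂ (red (proj₁ r))) (proj₂ r) (val-red (proj₁ r)))

  private
    v : Res → Elt
    v = proj₁

  infixl 6 _+ᶠ_
  infixl 7 _*ᶠ_
  _+ᶠ_ _*ᶠ_ : Res → Res → Res
  a +ᶠ b = red (v a ⊕ v b)
  a *ᶠ b = red (v a ⊗ v b)

  -ᶠ_ : Res → Res
  -ᶠ a = red (⊖ v a)

  red-+ : ∀ x y → red (x ⊕ y) ≡ red x +ᶠ red y
  red-+ x y = red-cong (~-+ (~-sym (val-red x)) (~-sym (val-red y)))

  red-* : ∀ x y → red (x ⊗ y) ≡ red x *ᶠ red y
  red-* x y = red-cong (~-* (~-sym (val-red x)) (~-sym (val-red y)))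

  residueCR : IsCommutativeRing _≡_ _+ᶠ_ _*ᶠ_ -ᶠ_ (red 0ᴿ) (red 1ᴿ)
  residueCR = record
    { isRing = record
      { +-isAbelianGroup = record
        { isGroup = record
          { isMonoid = record
            { isSemigroup = record
              { isMagma = record { isEquivalence = isEquivalence ; ∙-cong = cong₂ _+ᶠ_ }
              ; assoc = λ a b c → red-cong (~-trans (~-+ (val-red _) (~-refl refl)) (~-trans (~-refl (+-assoc (v a) (v b) (v c))) (~-+ (~-refl refl) (~-sym (val-red _))))) }
            ; identity = (λ a → trans (red-cong (~-trans (~-+ (val-red 0ᴿ) (~-refl refl)) (~-refl (+-identityˡ (v a))))) (red-val a))
                       , (λ a → trans (red-cong (~-trans (~-+ (~-refl refl) (val-red 0ᴿ)) (~-refl (+-identityʳ (v a))))) (red-val a)) }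
          ; inverse = (λ a → red-cong (~-trans (~-+ (val-red _) (~-refl refl)) (~-refl (⊖-inverseˡ (v a)))))
                    , (λ a → red-cong (~-trans (~-+ (~-refl refl) (val-red _)) (~-refl (⊖-inverseʳ (v a)))))
          ; ⁻¹-cong = cong -ᶠ_ }
        ; comm = λ a b → cong red (+-comm (v a) (v b)) }
      ; *-cong = cong₂ _*ᶠ_
      ; *-assoc = λ a b c → red-cong (~-trans (~-* (val-red _) (~-refl refl)) (~-trans (~-refl (*-assoc (v a) (v b) (v c))) (~-* (~-refl refl) (~-sym (val-red _)))))
      ; *-identity = (λ a → trans (red-cong (~-trans (~-* (val-red 1ᴿ) (~-refl refl)) (~-refl (*-identityˡ (v a))))) (red-val a))
                   , (λ a → trans (red-cong (~-trans (~-* (~-refl refl) (val-red 1ᴿ)) (~-refl (*-identityʳ (v a))))) (red-val a))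
      ; distrib = (λ a b c → red-cong (~-trans (~-* (~-refl refl) (val-red _)) (~-trans (~-refl (distribˡ (v a) (v b) (v c))) (~-+ (~-sym (val-red _)) (~-sym (val-red _))))))
                , (λ a b c → red-cong (~-trans (~-* (val-red _) (~-refl refl)) (~-trans (~-refl (distribʳ (v a) (v b) (v c))) (~-+ (~-sym (val-red _)) (~-sym (val-red _)))))) }
    ; *-comm = λ a b → cong red (*-comm (v a) (v b)) }

  residueField : FiniteField
  residueField = record
    { Carrier = Res ; _⊕_ = _+ᶠ_ ; _⊗_ = _*ᶠ_ ; ⊖_ = -ᶠ_ ; 0F = red 0ᴿ ; 1F = red 1ᴿ
    ; isCommutativeRing = residueCR
    ; 0≢1 = λ e → M⇒¬unit (~0⇒M (red-~ (sym e))) unit-1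
    ; inverse = λ a a≢0 → let y , p = ¬M⇒unit {v a} (λ h → a≢0 (trans (sym (red-val a)) (red-cong (M⇒~0 h)))) in
        red y , trans (cong (_*ᶠ red y) (sym (red-val a))) (trans (sym (red-* (v a) y)) (cong red p))
    ; enum = enumSub }

  module F = FiniteField residueField

  q : ℕ
  q = residueSize π

  size≡q : F.size ≡ q
  size≡q = length-subset elems

  red≡0⇒M : ∀ {x} → red x ≡ F.0F → M x
  red≡0⇒M e = ~0⇒M (red-~ e)

  M⇒red≡0 : ∀ {x} → M x → red x ≡ F.0F
  M⇒red≡0 h = red-cong (M⇒~0 h)

  -- The fibres of reduction are translates of the maximal ideal, all of size ∣M∣.
  ∑-red : ∀ (G : Res → ℤ) → ∑ᴱ (λ x → G (red x)) ≡ ∣M∣ * F.∑ᴱ G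
  ∑-red G = begin
    ∑ᴱ (λ x → G (red x))
      ≡⟨ ∑-cong list (λ x → sym (F.∑-δ (red x) G)) ⟩
    ∑ᴱ (λ x → F.∑ᴱ (λ r → F.δ (red x) r * G r))
      ≡⟨ ∑-swap list F.list _ ⟩
    F.∑ᴱ (λ r → ∑ᴱ (λ x → F.δ (red x) r * G r))
      ≡⟨ ∑-cong F.list (λ r → trans (∑-*ʳ list (G r) (λ x → F.δ (red x) r)) (cong (_* G r) (fibre r))) ⟩
    F.∑ᴱ (λ r → ∣M∣ * G r)
      ≡⟨ ∑-*ˡ F.list ∣M∣ G ⟩
    ∣M∣ * F.∑ᴱ G ∎
    where
    fibre : ∀ r → ∑ᴱ (λ x → F.δ (red x) r) ≡ ∣M∣
    fibre r = trans (∑-cong list (λ x → cong ⟦_⟧ (does-cong (F._≟_ (red x) r) (M? (x ⊕ ⊖ v r))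
        (λ e → red-~ (trans e (sym (red-val r)))) (λ p → trans (red-cong p) (red-val r)))))
      (∑-translate (⊖ v r) m)

  ∣R∣ : ℤ
  ∣R∣ = ∑ᴱ (λ _ → 1ℤ)

  ∣R∣≡ : ∣R∣ ≡ ∣M∣ * pos q
  ∣R∣≡ = trans (∑-red (λ _ → 1ℤ)) (cong (∣M∣ *_) (trans F.∑-1 (cong pos size≡q)))

  -- ⟨π^i⟩ is a disjoint union of q translates of ⟨π^{i+1}⟩, for i < ℓ.
  module Order (ℓ : ℕ) (nil : FinCommRing.IsNilpotencyDegree R π ℓ) where

    ideal : ℕ → ℤ
    ideal i = ∑ᴱ (λ x → ⟦ does (∈⟨⟩? x (π ^ᴿ i)) ⟧)

    π^i≢0 : ∀ i → i ℕ.< ℓ → π ^ᴿ i ≢ 0ᴿ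
    π^i≢0 zero    _ e = proj₁ loc (sym e)
    π^i≢0 (suc i) p e = proj₂ (proj₂ nil) (suc i) (s≤s z≤n) p e

    -- If π^i = π^(i+1) z, then π^i (1 - π z) = 0. Since 1 - π z is a unit, π^i would vanish below
    -- the nilpotency degree.
    strict : ∀ i → i ℕ.< ℓ → ¬ ((π ^ᴿ i) ∈⟨ π ^ᴿ suc i ⟩)
    strict i i<ℓ (z , e) = π^i≢0 i i<ℓ (begin
      π ^ᴿ i                                 ≡⟨ sym (*-identityʳ (π ^ᴿ i)) ⟩
      π ^ᴿ i ⊗ 1ᴿ                            ≡⟨ cong (π ^ᴿ i ⊗_) (sym (proj₂ inv)) ⟩
      π ^ᴿ i ⊗ (w ⊗ proj₁ inv)               ≡⟨ sym (*-assoc (π ^ᴿ i) w (proj₁ inv)) ⟩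
      π ^ᴿ i ⊗ w ⊗ proj₁ inv                 ≡⟨ cong (_⊗ proj₁ inv) killed ⟩
      0ᴿ ⊗ proj₁ inv                         ≡⟨ zeroˡ (proj₁ inv) ⟩
      0ᴿ ∎)
      where
      w : Elt
      w = 1ᴿ ⊕ ⊖ (π ⊗ z)
      inv : IsUnit w
      inv = ¬M⇒unit λ h → M⇒¬unit (subst M (solve 2 (λ o a → (o :+ :- a) :+ a := o) refl 1ᴿ (π ⊗ z)) (∈-+ h (z , refl))) unit-1
      killed : π ^ᴿ i ⊗ w ≡ 0ᴿ
      killed = begin
        π ^ᴿ i ⊗ (1ᴿ ⊕ ⊖ (π ⊗ z))            ≡⟨ solve 4 (λ p o π z → p :* (o :+ :- (π :* z)) := p :* o :+ :- (π :* p :* z)) refl (π ^ᴿ i) 1ᴿ π z ⟩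
        π ^ᴿ i ⊗ 1ᴿ ⊕ ⊖ (π ⊗ π ^ᴿ i ⊗ z)     ≡⟨ cong₂ (λ a b → a ⊕ ⊖ b) (*-identityʳ (π ^ᴿ i)) (sym e) ⟩
        π ^ᴿ i ⊕ ⊖ (π ^ᴿ i)                  ≡⟨ ⊖-inverseʳ (π ^ᴿ i) ⟩
        0ᴿ ∎

    ideal-suc : ∀ i → i ℕ.< ℓ → ideal i ≡ pos q * ideal (suc i)
    ideal-suc i i<ℓ = begin
      ideal i
        ≡⟨ ∑-cong list (λ x → split x (∈⟨⟩? x (π ^ᴿ i))) ⟩
      ∑ᴱ (λ x → F.∑ᴱ (λ r → ⟦ does (∈⟨⟩? (x ⊕ ⊖ (π ^ᴿ i ⊗ v r)) (π ^ᴿ suc i)) ⟧))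
        ≡⟨ ∑-swap list F.list _ ⟩
      F.∑ᴱ (λ r → ∑ᴱ (λ x → ⟦ does (∈⟨⟩? (x ⊕ ⊖ (π ^ᴿ i ⊗ v r)) (π ^ᴿ suc i)) ⟧))
        ≡⟨ ∑-cong F.list (λ r → ∑-translate (⊖ (π ^ᴿ i ⊗ v r)) (λ x → ⟦ does (∈⟨⟩? x (π ^ᴿ suc i)) ⟧)) ⟩
      F.∑ᴱ (λ _ → ideal (suc i))
        ≡⟨ trans (∑-const F.list (ideal (suc i))) (cong (λ k → pos k * ideal (suc i)) size≡q) ⟩
      pos q * ideal (suc i) ∎
      where
      -- π^i y lies in the translate by π^i r exactly when y reduces to r; outside ⟨π^i⟩ no
      -- translate contains x.
      split : ∀ x (d : Dec (x ∈⟨ π ^ᴿ i ⟩)) → ⟦ does d ⟧ ≡ F.∑ᴱ (λ r → ⟦ does (∈⟨⟩? (x ⊕ ⊖ (π ^ᴿ i ⊗ v r)) (π ^ᴿ suc i)) ⟧)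
      split x (yes (y , refl)) = sym (trans (∑-cong F.list (λ r → cong ⟦_⟧ (does-cong (∈⟨⟩? (π ^ᴿ i ⊗ y ⊕ ⊖ (π ^ᴿ i ⊗ v r)) (π ^ᴿ suc i)) (F._≟_ (red y) r) (to r) (from r)))) (F.once (red y)))
        where
        factor : ∀ r → π ^ᴿ i ⊗ y ⊕ ⊖ (π ^ᴿ i ⊗ v r) ≡ π ^ᴿ i ⊗ (y ⊕ ⊖ v r)
        factor r = solve 3 (λ p y r → p :* y :+ :- (p :* r) := p :* (y :+ :- r)) refl (π ^ᴿ i) y (v r)
        to : ∀ r → (π ^ᴿ i ⊗ y ⊕ ⊖ (π ^ᴿ i ⊗ v r)) ∈⟨ π ^ᴿ suc i ⟩ → red y ≡ r
        to r h = trans (red-cong (decidable-stable (M? (y ⊕ ⊖ v r)) λ n → absurd (¬M⇒unit n))) (red-val r)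
          where
          absurd : ¬ IsUnit (y ⊕ ⊖ v r)
          absurd (u , yu≡1) = strict i i<ℓ (subst (_∈⟨ π ^ᴿ suc i ⟩) (begin
            u ⊗ (π ^ᴿ i ⊗ y ⊕ ⊖ (π ^ᴿ i ⊗ v r))  ≡⟨ cong (u ⊗_) (factor r) ⟩
            u ⊗ (π ^ᴿ i ⊗ (y ⊕ ⊖ v r))           ≡⟨ solve 3 (λ u p y → u :* (p :* y) := p :* (y :* u)) refl u (π ^ᴿ i) (y ⊕ ⊖ v r) ⟩
            π ^ᴿ i ⊗ ((y ⊕ ⊖ v r) ⊗ u)           ≡⟨ cong (π ^ᴿ i ⊗_) yu≡1 ⟩
            π ^ᴿ i ⊗ 1ᴿ                          ≡⟨ *-identityʳ (π ^ᴿ i) ⟩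
            π ^ᴿ i ∎) (∈-* u h))
        from : ∀ r → red y ≡ r → (π ^ᴿ i ⊗ y ⊕ ⊖ (π ^ᴿ i ⊗ v r)) ∈⟨ π ^ᴿ suc i ⟩
        from r e with red-~ (trans e (sym (red-val r)))
        ... | z , p = z , trans (factor r) (trans (cong (π ^ᴿ i ⊗_) p) (solve 3 (λ p π z → p :* (π :* z) := π :* p :* z) refl (π ^ᴿ i) π z))
      split x (no n) = sym (trans (∑-cong F.list (λ r → cong ⟦_⟧ (dec-false (∈⟨⟩? (x ⊕ ⊖ (π ^ᴿ i ⊗ v r)) (π ^ᴿ suc i)) (bad r)))) (∑-0 F.list))
        where
        bad : ∀ r → ¬ ((x ⊕ ⊖ (π ^ᴿ i ⊗ v r)) ∈⟨ π ^ᴿ suc i ⟩)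
        bad r (z , e) = n (v r ⊕ π ⊗ z , (begin
          x                                                       ≡⟨ solve 2 (λ x a → x := (x :+ :- a) :+ a) refl x (π ^ᴿ i ⊗ v r) ⟩
          (x ⊕ ⊖ (π ^ᴿ i ⊗ v r)) ⊕ π ^ᴿ i ⊗ v r                   ≡⟨ cong (_⊕ π ^ᴿ i ⊗ v r) e ⟩
          π ⊗ π ^ᴿ i ⊗ z ⊕ π ^ᴿ i ⊗ v r                           ≡⟨ solve 4 (λ π p z r → π :* p :* z :+ p :* r := p :* (r :+ π :* z)) refl π (π ^ᴿ i) z (v r) ⟩
          π ^ᴿ i ⊗ (v r ⊕ π ⊗ z) ∎))

    ideal-ℓ : ideal ℓ ≡ 1ℤ
    ideal-ℓ = trans (∑-cong list (λ x → cong ⟦_⟧ (does-cong (∈⟨⟩? x (π ^ᴿ ℓ)) (0ᴿ ≟ x)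
        (λ { (y , e) → sym (trans e (trans (cong (_⊗ y) (proj₁ (proj₂ nil))) (zeroˡ y))) }) (λ { refl → ∈-0 (π ^ᴿ ℓ) }))))
      (once 0ᴿ)

    ideal-power : ∀ k i → k ℕ.+ i ≡ ℓ → ideal i ≡ pos (q ℕ.^ k)
    ideal-power zero    i refl = ideal-ℓ
    ideal-power (suc k) i e = trans (ideal-suc i (subst (i ℕ.<_) e (s≤s (ℕP.m≤n+m i k))))
      (trans (cong (pos q *_) (ideal-power k (suc i) (trans (ℕP.+-suc k i) e))) (sym (ℤP.pos-* q (q ℕ.^ k))))

    ∣M∣≡ : ∣M∣ ≡ pos (q ℕ.^ (ℓ ℕ.∸ 1))
    ∣M∣≡ = trans (∑-cong list (λ x → cong (λ g → ⟦ does (∈⟨⟩? x g) ⟧) (sym (*-identityʳ π))))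
      (ideal-power (ℓ ℕ.∸ 1) 1 (ℕP.m∸n+n≡m (proj₁ nil)))

module Tuples (R : FinCommRing) (loc : FinCommRing.IsLocal R)
              (π : FinCommRing.Elt R) (unif : FinCommRing.IsUniformizer R π) where
  open LocalRing R loc π unif public
  open VectorSpace residueField public
  open Projective residueField public
  open Parallels residueField public
  open ≡-Reasoning

  private
    variable
      n : ℕ

  -- Tuples are functions without extensionality, so invariance of a sum under substitution holds
  -- for functions that respect pointwise equality.
  Ext : {B : Set} → (Tup n → B) → Set
  Ext f = ∀ {v w} → v ≗ w → f v ≡ f w

  ∑T : ∀ n → (Tup n → ℤ) → ℤ
  ∑T n = ∑ (allTups n)

  ∑T-suc : ∀ n (f : Tup (suc n) → ℤ) → ∑T (suc n) f ≡ ∑ᴱ (λ a → ∑T n (λ v → f (a ∷ᶠ v)))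
  ∑T-suc n f = trans (∑-concatMap _ list f) (∑-cong list (λ a → ∑-map (a ∷ᶠ_) (allTups n) f))

  ∷ᶠ-cong : ∀ a {v w : Tup n} → v ≗ w → a ∷ᶠ v ≗ a ∷ᶠ w
  ∷ᶠ-cong a e Fin.zero    = refl
  ∷ᶠ-cong a e (Fin.suc i) = e i

  infixl 6 _⊞_
  _⊞_ : Tup n → Tup n → Tup n
  (v ⊞ w) i = v i ⊕ w i

  ∑T-translate : ∀ n (c : Tup n) f → Ext f → ∑T n (λ v → f (v ⊞ c)) ≡ ∑T n f
  ∑T-translate zero    c f ext = cong (_+ 0ℤ) (ext λ ())
  ∑T-translate (suc n) c f ext = begin
    ∑T (suc n) (λ v → f (v ⊞ c))
      ≡⟨ ∑T-suc n _ ⟩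
    ∑ᴱ (λ a → ∑T n (λ v → f ((a ∷ᶠ v) ⊞ c)))
      ≡⟨ ∑-cong list (λ a → ∑-cong (allTups n) (λ v → ext λ { Fin.zero → refl ; (Fin.suc i) → refl })) ⟩
    ∑ᴱ (λ a → ∑T n (λ v → f ((a ⊕ c Fin.zero) ∷ᶠ (v ⊞ VF.tail c))))
      ≡⟨ ∑-cong list (λ a → ∑T-translate n (VF.tail c) (λ v → f ((a ⊕ c Fin.zero) ∷ᶠ v)) (λ e → ext (∷ᶠ-cong _ e))) ⟩
    ∑ᴱ (λ a → ∑T n (λ v → f ((a ⊕ c Fin.zero) ∷ᶠ v)))
      ≡⟨ ∑-translate (c Fin.zero) (λ a → ∑T n (λ v → f (a ∷ᶠ v))) ⟩
    ∑ᴱ (λ a → ∑T n (λ v → f (a ∷ᶠ v)))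
      ≡⟨ sym (∑T-suc n f) ⟩
    ∑T (suc n) f ∎

  ∑-unit : ∀ {u} → IsUnit u → ∀ f → ∑ᴱ (λ x → f (u ⊗ x)) ≡ ∑ᴱ f
  ∑-unit {u} (w , e) f = ∑-bij (u ⊗_) (w ⊗_) (cancel u w e) (cancel w u (trans (*-comm w u) e)) f
    where
    cancel : ∀ a b → a ⊗ b ≡ 1ᴿ → ∀ y → a ⊗ (b ⊗ y) ≡ y
    cancel a b e y = trans (sym (*-assoc a b y)) (trans (cong (_⊗ y) e) (*-identityˡ y))

  ∑T-scale : ∀ n {u} → IsUnit u → ∀ f → Ext f → ∑T n (λ v → f (scale u v)) ≡ ∑T n f
  ∑T-scale zero    iu f ext = cong (_+ 0ℤ) (ext λ ())
  ∑T-scale (suc n) {u} iu f ext = begin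
    ∑T (suc n) (λ v → f (scale u v))
      ≡⟨ ∑T-suc n _ ⟩
    ∑ᴱ (λ a → ∑T n (λ v → f (scale u (a ∷ᶠ v))))
      ≡⟨ ∑-cong list (λ a → ∑-cong (allTups n) (λ v → ext λ { Fin.zero → refl ; (Fin.suc i) → refl })) ⟩
    ∑ᴱ (λ a → ∑T n (λ v → f ((u ⊗ a) ∷ᶠ scale u v)))
      ≡⟨ ∑-cong list (λ a → ∑T-scale n iu (λ v → f ((u ⊗ a) ∷ᶠ v)) (λ e → ext (∷ᶠ-cong _ e))) ⟩
    ∑ᴱ (λ a → ∑T n (λ v → f ((u ⊗ a) ∷ᶠ v)))
      ≡⟨ ∑-unit iu (λ a → ∑T n (λ v → f (a ∷ᶠ v))) ⟩
    ∑ᴱ (λ a → ∑T n (λ v → f (a ∷ᶠ v)))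
      ≡⟨ sym (∑T-suc n f) ⟩
    ∑T (suc n) f ∎

  redⱽ : Tup n → Vec Res n
  redⱽ {zero}  a = []
  redⱽ {suc n} a = red (a Fin.zero) ∷ redⱽ (VF.tail a)

  redⱽ-ext : Ext {n} redⱽ
  redⱽ-ext {zero}  e = refl
  redⱽ-ext {suc n} e = cong₂ _∷_ (cong red (e Fin.zero)) (redⱽ-ext (e ∘ Fin.suc))

  ∑T-red : ∀ n (G : Vec Res n → ℤ) → ∑T n (λ a → G (redⱽ a)) ≡ ∣M∣ ℤ.^ n * ∑ (vecs enumSub n) G
  ∑T-red zero    G = sym (ℤP.*-identityˡ _)
  ∑T-red (suc n) G = begin
    ∑T (suc n) (λ a → G (redⱽ a))
      ≡⟨ ∑T-suc n _ ⟩
    ∑ᴱ (λ a → ∑T n (λ v → G (red a ∷ redⱽ v)))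
      ≡⟨ ∑-cong list (λ a → ∑T-red n (λ w → G (red a ∷ w))) ⟩
    ∑ᴱ (λ a → ∣M∣ ℤ.^ n * ∑ (vecs enumSub n) (λ w → G (red a ∷ w)))
      ≡⟨ ∑-*ˡ list (∣M∣ ℤ.^ n) (λ a → ∑ (vecs enumSub n) (λ w → G (red a ∷ w))) ⟩
    ∣M∣ ℤ.^ n * ∑ᴱ (λ a → ∑ (vecs enumSub n) (λ w → G (red a ∷ w)))
      ≡⟨ cong (∣M∣ ℤ.^ n *_) (∑-red (λ r → ∑ (vecs enumSub n) (λ w → G (r ∷ w)))) ⟩
    ∣M∣ ℤ.^ n * (∣M∣ * F.∑ᴱ (λ r → ∑ (vecs enumSub n) (λ w → G (r ∷ w))))
      ≡⟨ lem (∣M∣ ℤ.^ n) ∣M∣ (F.∑ᴱ (λ r → ∑ (vecs enumSub n) (λ w → G (r ∷ w)))) ⟩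
    ∣M∣ * ∣M∣ ℤ.^ n * F.∑ᴱ (λ r → ∑ (vecs enumSub n) (λ w → G (r ∷ w)))
      ≡⟨ cong (∣M∣ * ∣M∣ ℤ.^ n *_) (sym (∑-vecs enumSub n G)) ⟩
    ∣M∣ ℤ.^ suc n * ∑ (vecs enumSub (suc n)) G ∎
    where
    lem : ∀ a b c → a * (b * c) ≡ b * a * c
    lem = solve-∀

  ∑T-1 : ∀ n → ∑T n (λ _ → 1ℤ) ≡ ∣R∣ ℤ.^ n
  ∑T-1 zero    = refl
  ∑T-1 (suc n) = trans (∑T-suc n _) (trans (∑-cong list (λ _ → trans (∑T-1 n) (sym (ℤP.*-identityˡ _)))) (∑-*ʳ list (∣R∣ ℤ.^ n) (λ _ → 1ℤ)))

  dot-cong : {a a′ b b′ : Tup n} → a ≗ a′ → b ≗ b′ → dot a b ≡ dot a′ b′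
  dot-cong {zero}  e f = refl
  dot-cong {suc n} e f = cong₂ _⊕_ (cong₂ _⊗_ (e Fin.zero) (f Fin.zero)) (dot-cong (e ∘ Fin.suc) (f ∘ Fin.suc))

  dot-congˡ : ∀ (b : Tup n) {a a′} → a ≗ a′ → dot a b ≡ dot a′ b
  dot-congˡ b e = dot-cong {b = b} e (λ _ → refl)

  dot-comm : (a b : Tup n) → dot a b ≡ dot b a
  dot-comm {zero}  a b = refl
  dot-comm {suc n} a b = cong₂ _⊕_ (*-comm (a Fin.zero) (b Fin.zero)) (dot-comm (VF.tail a) (VF.tail b))

  dot-⊞ : (a a′ b : Tup n) → dot (a ⊞ a′) b ≡ dot a b ⊕ dot a′ b
  dot-⊞ {zero}  a a′ b = sym (+-identityˡ 0ᴿ)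
  dot-⊞ {suc n} a a′ b = trans (cong ((a Fin.zero ⊕ a′ Fin.zero) ⊗ b Fin.zero ⊕_) (dot-⊞ (VF.tail a) (VF.tail a′) (VF.tail b)))
    (solve 5 (λ x y z p q → (x :+ y) :* z :+ (p :+ q) := (x :* z :+ p) :+ (y :* z :+ q)) refl
      (a Fin.zero) (a′ Fin.zero) (b Fin.zero) (dot (VF.tail a) (VF.tail b)) (dot (VF.tail a′) (VF.tail b)))

  dot-scale : ∀ u (a b : Tup n) → dot (scale u a) b ≡ u ⊗ dot a b
  dot-scale {zero}  u a b = sym (zeroʳ u)
  dot-scale {suc n} u a b = trans (cong (u ⊗ a Fin.zero ⊗ b Fin.zero ⊕_) (dot-scale u (VF.tail a) (VF.tail b)))
    (solve 4 (λ u x y p → u :* x :* y :+ u :* p := u :* (x :* y :+ p)) refl u (a Fin.zero) (b Fin.zero) (dot (VF.tail a) (VF.tail b)))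

  dot-scaleʳ : ∀ u (a b : Tup n) → dot a (scale u b) ≡ u ⊗ dot a b
  dot-scaleʳ u a b = trans (dot-comm a (scale u b)) (trans (dot-scale u b a) (cong (u ⊗_) (dot-comm b a)))

  dot-0 : (b : Tup n) → dot (λ _ → 0ᴿ) b ≡ 0ᴿ
  dot-0 {zero}  b = refl
  dot-0 {suc n} b = trans (cong₂ _⊕_ (zeroˡ (b Fin.zero)) (dot-0 (VF.tail b))) (+-identityˡ 0ᴿ)

  single : Fin n → Elt → Tup n
  single Fin.zero    x = x ∷ᶠ λ _ → 0ᴿ
  single (Fin.suc i) x = 0ᴿ ∷ᶠ single i x

  dot-single : ∀ (i : Fin n) x b → dot (single i x) b ≡ x ⊗ b i
  dot-single Fin.zero    x b = trans (cong (x ⊗ b Fin.zero ⊕_) (dot-0 (VF.tail b))) (+-identityʳ _)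
  dot-single (Fin.suc i) x b = trans (cong₂ _⊕_ (zeroˡ (b Fin.zero)) (dot-single i x (VF.tail b))) (+-identityˡ _)

  red-dot : (a b : Tup n) → red (dot a b) ≡ dotF (redⱽ a) (redⱽ b)
  red-dot {zero}  a b = refl
  red-dot {suc n} a b = trans (red-+ (a Fin.zero ⊗ b Fin.zero) (dot (VF.tail a) (VF.tail b)))
    (cong₂ _+ᶠ_ (red-* (a Fin.zero) (b Fin.zero)) (red-dot (VF.tail a) (VF.tail b)))

  redⱽ-⊞ : (a b : Tup n) → redⱽ (a ⊞ b) ≡ redⱽ a ⊕ⱽ redⱽ b
  redⱽ-⊞ {zero}  a b = refl
  redⱽ-⊞ {suc n} a b = cong₂ _∷_ (red-+ (a Fin.zero) (b Fin.zero)) (redⱽ-⊞ (VF.tail a) (VF.tail b))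

  redⱽ-scale : ∀ u (a : Tup n) → redⱽ (scale u a) ≡ red u ·ⱽ redⱽ a
  redⱽ-scale {zero}  u a = refl
  redⱽ-scale {suc n} u a = cong₂ _∷_ (red-* u (a Fin.zero)) (redⱽ-scale u (VF.tail a))

  redⱽ≡0 : (a : Tup n) → (∀ i → M (a i)) → redⱽ a ≡ 0ⱽ
  redⱽ≡0 {zero}  a h = refl
  redⱽ≡0 {suc n} a h = cong₂ _∷_ (M⇒red≡0 (h Fin.zero)) (redⱽ≡0 (VF.tail a) (h ∘ Fin.suc))

  dotF-0ˡ : ∀ {n} (v : Vec Res n) → dotF 0ⱽ v ≡ F.0F
  dotF-0ˡ []      = refl
  dotF-0ˡ (x ∷ v) = trans (cong₂ _+ᶠ_ (F.zeroˡ x) (dotF-0ˡ v)) (F.+-identityˡ F.0F)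

  zero? : (a : Tup n) → Dec (0ⱽ ≡ redⱽ a)
  zero? a = vec≟ enumSub 0ⱽ (redⱽ a)

  findUnit : (a : Tup n) → redⱽ a ≢ 0ⱽ → ∃ λ i → IsUnit (a i)
  findUnit a n0 with FinP.any? (λ i → ¬? (M? (a i)))
  ... | yes (i , ¬m) = i , ¬M⇒unit ¬m
  ... | no none = contradiction (redⱽ≡0 a λ i → decidable-stable (M? (a i)) λ ¬m → none (i , ¬m)) n0

  anyT-intro : ∀ n (p : Tup n → Bool) → Ext p → ∀ c → p c ≡ true → any p (allTups n) ≡ true
  anyT-intro n p ext c pc = T⇒true (AnyP.any⁺ p (complete n c (λ w → T (p w)) λ e → subst T (trans (sym pc) (sym (ext e))) _))
    where
    T⇒true : ∀ {b} → T b → b ≡ true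
    T⇒true {true} _ = refl
    complete : ∀ n (c : Tup n) (Q : Tup n → Set) → (∀ {w} → w ≗ c → Q w) → Any Q (allTups n)
    complete zero    c Q h = here (h λ ())
    complete (suc n) c Q h = AnyP.concatMap⁺ (λ a → map (a ∷ᶠ_) (allTups n)) (Any.map (λ { {a} refl → AnyP.map⁺
        (complete n (VF.tail c) (λ w → Q (a ∷ᶠ w)) λ e → h λ { Fin.zero → refl ; (Fin.suc i) → e i }) })
      (AnyP.tabulate⁺ {P = c Fin.zero ≡_} {f = id} (c Fin.zero) refl))

  -- A relation c·a = 1 survives reduction, so a is nonzero modulo π. Conversely, an entry outside
  -- (π) is a unit, and its inverse placed at that coordinate gives c.
  unimodular-nz : (a : Tup n) → isUnimodularᵇ a ≡ not (does (zero? a))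
  unimodular-nz {n} a = iff⇒≡ to from
    where
    to : isUnimodularᵇ a ≡ true → not (does (zero? a)) ≡ true
    to e with any-elim (λ c → does (dot c a ≟ 1ᴿ)) (allTups n) e
    ... | c , p = ≢true⇒not λ z → F.0≢1 (begin
      F.0F                        ≡⟨ sym (dotF-0ˡ (redⱽ c)) ⟩
      dotF 0ⱽ (redⱽ c)            ≡⟨ cong (λ w → dotF w (redⱽ c)) (does-true (zero? a) z) ⟩
      dotF (redⱽ a) (redⱽ c)      ≡⟨ sym (red-dot a c) ⟩
      red (dot a c)               ≡⟨ cong red (trans (dot-comm a c) (does-true (dot c a ≟ 1ᴿ) p)) ⟩
      F.1F ∎)
    from : not (does (zero? a)) ≡ true → isUnimodularᵇ a ≡ true
    from e with findUnit a (λ z → not-≡true e (dec-true (zero? a) (sym z)))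
    ... | i , y , p = anyT-intro n (λ c → does (dot c a ≟ 1ᴿ)) (λ e → cong (λ z → does (z ≟ 1ᴿ)) (dot-congˡ a e))
          (single i y) (dec-true (dot (single i y) a ≟ 1ᴿ) (trans (dot-single i y a) (trans (*-comm y (a i)) p)))

  um : Tup n → ℤ
  um a = nzⱽ (redⱽ a)

  um-ext : Ext {n} um
  um-ext e = cong nzⱽ (redⱽ-ext e)

  ⟦unimodular⟧ : (a : Tup n) → ⟦ isUnimodularᵇ a ⟧ ≡ um a
  ⟦unimodular⟧ a = trans (cong ⟦_⟧ (unimodular-nz a)) (⟦⟧-not (does (zero? a)))

  ∑-unimodular : ∀ n f → ∑ (unimodular n) f ≡ ∑T n (λ a → um a * f a)
  ∑-unimodular n f = trans (∑-filter isUnimodularᵇ (allTups n) f) (∑-cong (allTups n) (λ a → cong (_* f a) (⟦unimodular⟧ a)))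

  unimodular⇒≢0 : (a : Tup n) → isUnimodularᵇ a ≡ true → redⱽ a ≢ 0ⱽ
  unimodular⇒≢0 a e z = not-≡true (trans (sym (unimodular-nz a)) e) (dec-true (zero? a) (sym z))

  um≡1 : (a : Tup n) → redⱽ a ≢ 0ⱽ → um a ≡ 1ℤ
  um≡1 a h = cong (λ b → 1ℤ - ⟦ b ⟧) (dec-false (zero? a) (h ∘ sym))

  dot≡unit⇒≢0 : (a b : Tup n) → dot a b ≡ 1ᴿ → redⱽ a ≢ 0ⱽ
  dot≡unit⇒≢0 a b e z = F.0≢1 (trans (sym (dotF-0ˡ (redⱽ b))) (trans (cong (λ w → dotF w (redⱽ b)) (sym z))
    (trans (sym (red-dot a b)) (cong red e))))

  -- The sum does not change when a is translated by z c; average over z with weight w.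
  average : ∀ n (b c : Tup n) → dot c b ≡ 1ᴿ → ∀ x (w : Elt → ℤ) (G : Tup n → ℤ) → Ext G →
            (∀ z a → w z * G (a ⊞ scale z c) ≡ w z * G a) →
            ∑ᴱ w * ∑T n (λ a → δ (dot a b) x * G a) ≡ ∑T n (λ a → w (x ⊕ ⊖ dot a b) * G a)
  average n b c cb≡1 x w G ext inv = begin
    ∑ᴱ w * ∑T n (λ a → δ (dot a b) x * G a)
      ≡⟨ sym (∑-*ʳ list _ w) ⟩
    ∑ᴱ (λ z → w z * ∑T n (λ a → δ (dot a b) x * G a))
      ≡⟨ ∑-cong list (λ z → trans (cong (w z *_) (sym (∑T-translate n (scale z c) (λ a → δ (dot a b) x * G a)
           (λ e → cong₂ (λ d g → δ d x * g) (dot-congˡ b e) (ext e))))) (sym (∑-*ˡ (allTups n) (w z) _))) ⟩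
    ∑ᴱ (λ z → ∑T n (λ a → w z * (δ (dot (a ⊞ scale z c) b) x * G (a ⊞ scale z c))))
      ≡⟨ ∑-swap list (allTups n) _ ⟩
    ∑T n (λ a → ∑ᴱ (λ z → w z * (δ (dot (a ⊞ scale z c) b) x * G (a ⊞ scale z c))))
      ≡⟨ ∑-cong (allTups n) (λ a → trans (∑-cong list (λ z → term a z)) (∑-δ (x ⊕ ⊖ dot a b) (λ z → w z * G a))) ⟩
    ∑T n (λ a → w (x ⊕ ⊖ dot a b) * G a) ∎
    where
    lem : ∀ a b c → a * (b * c) ≡ b * (a * c)
    lem = solve-∀
    dot-shift : ∀ a z → dot (a ⊞ scale z c) b ≡ dot a b ⊕ z
    dot-shift a z = trans (dot-⊞ a (scale z c) b) (cong (dot a b ⊕_) (trans (dot-scale z c b) (trans (cong (z ⊗_) cb≡1) (*-identityʳ z))))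
    term : ∀ a z → w z * (δ (dot (a ⊞ scale z c) b) x * G (a ⊞ scale z c)) ≡ δ (x ⊕ ⊖ dot a b) z * (w z * G a)
    term a z = trans (lem (w z) (δ (dot (a ⊞ scale z c) b) x) (G (a ⊞ scale z c))) (cong₂ _*_ (cong ⟦_⟧ (does-cong (dot (a ⊞ scale z c) b ≟ x) (x ⊕ ⊖ dot a b ≟ z)
        (λ e → trans (cong (_⊕ ⊖ dot a b) (trans (sym e) (dot-shift a z))) (solve 2 (λ d z → (d :+ z) :+ :- d := z) refl (dot a b) z))
        (λ { refl → trans (dot-shift a z) (solve 2 (λ d x → d :+ (x :+ :- d) := x) refl (dot a b) x) })))
      (inv z a))

  μ⁰ : Tup n → ℤ
  μ⁰ a = ⟦ does (zero? a) ⟧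

  μ⁰-ext : Ext {n} μ⁰
  μ⁰-ext e = cong (λ v → ⟦ does (vec≟ enumSub 0ⱽ v) ⟧) (redⱽ-ext e)

  redⱽ-shift : (a c : Tup n) → ∀ {z} → M z → redⱽ (a ⊞ scale z c) ≡ redⱽ a
  redⱽ-shift a c {z} mz = trans (redⱽ-⊞ a (scale z c)) (trans (cong (redⱽ a ⊕ⱽ_) (trans (redⱽ-scale z c)
    (trans (cong (_·ⱽ redⱽ c) (M⇒red≡0 mz)) (·ⱽ-zeroˡ (redⱽ c))))) (⊕ⱽ-identityʳ (redⱽ a)))
    where
    ⊕ⱽ-identityʳ : ∀ {k} (v : Vec Res k) → v ⊕ⱽ 0ⱽ ≡ v
    ⊕ⱽ-identityʳ []      = refl
    ⊕ⱽ-identityʳ (x ∷ v) = cong₂ _∷_ (F.+-identityʳ x) (⊕ⱽ-identityʳ v)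

  m-cong : ∀ z {x y} → (M z → x ≡ y) → m z * x ≡ m z * y
  m-cong z h = ⟦⟧*-cong (does (M? z)) (λ e → h (does-true (M? z) e))

  m-δ : ∀ x y → m (y ⊕ ⊖ x) ≡ F.δ (red x) (red y)
  m-δ x y = cong ⟦_⟧ (does-cong (M? (y ⊕ ⊖ x)) (F._≟_ (red x) (red y)) (λ p → sym (red-cong p)) (λ e → red-~ (sym e)))

  ∣M∣≢0 : ∣M∣ ≢ 0ℤ
  ∣M∣≢0 e = contradiction (trans (sym (cong ⟦_⟧ (dec-true (M? 0ᴿ) (∈-0 π)))) (∑≡0⇒ m (λ x → ⟦⟧-nonneg _) e 0ᴿ)) λ ()

  ∣R∣≢0 : ∣R∣ ≢ 0ℤ
  ∣R∣≢0 e = contradiction (∑≡0⇒ (λ _ → 1ℤ) (λ _ → ℤ.+≤+ z≤n) e 0ᴿ) λ ()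

  -- Shifts by multiples of π do not change the reduction of a. Averaging over them weakens a·b = x
  -- to the same equation modulo π, after which everything is a sum over the residue field.
  ∑-reduce : ∀ n (b c : Tup n) → dot c b ≡ 1ᴿ → ∀ x (G : Vec Res n → ℤ) →
             ∣M∣ * ∑T n (λ a → δ (dot a b) x * G (redⱽ a)) ≡
             ∣M∣ ℤ.^ n * ∑ (vecs enumSub n) (λ α → F.δ (dotF (redⱽ b) α) (red x) * G α)
  ∑-reduce n b c cb x G = trans (average n b c cb x m (G ∘ redⱽ) (λ e → cong G (redⱽ-ext e))
      (λ z a → m-cong z (λ mz → cong G (redⱽ-shift a c mz))))
    (trans (∑-cong (allTups n) (λ a → cong (_* G (redⱽ a)) (trans (m-δ (dot a b) x)
      (cong (λ r → F.δ r (red x)) (trans (cong red (dot-comm a b)) (red-dot b a))))))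
      (∑T-red n (λ α → F.δ (dotF (redⱽ b) α) (red x) * G α)))

  count₁ : ∀ k (b c : Tup (suc k)) → dot c b ≡ 1ᴿ → ∀ x → ∑T (suc k) (λ a → δ (dot a b) x) ≡ ∣R∣ ℤ.^ k
  count₁ k b c cb x = cancel-≢0 ∣R∣≢0 (begin
    ∣R∣ * ∑T (suc k) (λ a → δ (dot a b) x)           ≡⟨ cong (∣R∣ *_) (∑-cong (allTups (suc k)) (λ a → sym (ℤP.*-identityʳ _))) ⟩
    ∣R∣ * ∑T (suc k) (λ a → δ (dot a b) x * 1ℤ)      ≡⟨ average (suc k) b c cb x (λ _ → 1ℤ) (λ _ → 1ℤ) (λ _ → refl) (λ _ _ → refl) ⟩
    ∑T (suc k) (λ a → 1ℤ)                            ≡⟨ ∑T-1 (suc k) ⟩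
    ∣R∣ ℤ.^ suc k ∎)

  -- Translation by a multiple of a₁ moves a·b and leaves a·b′ alone, and a₂ does the opposite. Two
  -- averages therefore remove the two linear conditions independently.
  record Dual (b b′ : Tup n) : Set where
    field
      a₁ a₂ : Tup n
      a₁b   : dot a₁ b ≡ 1ᴿ
      a₁b′  : dot a₁ b′ ≡ 0ᴿ
      a₂b   : dot a₂ b ≡ 0ᴿ
      a₂b′  : dot a₂ b′ ≡ 1ᴿ

  dot-stable : (a c b : Tup n) → dot c b ≡ 0ᴿ → ∀ z → dot (a ⊞ scale z c) b ≡ dot a b
  dot-stable a c b e z = trans (dot-⊞ a (scale z c) b) (trans (cong (dot a b ⊕_) (trans (dot-scale z c b) (trans (cong (z ⊗_) e) (zeroʳ z)))) (+-identityʳ _))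

  count₂ : ∀ k (b b′ : Tup (suc (suc k))) → Dual b b′ → ∀ x y →
           ∑T (suc (suc k)) (λ a → δ (dot a b) x * δ (dot a b′) y) ≡ ∣R∣ ℤ.^ k
  count₂ k b b′ D x y = cancel-≢0 ∣R∣≢0 (begin
    ∣R∣ * ∑T (suc (suc k)) (λ a → δ (dot a b) x * δ (dot a b′) y)
      ≡⟨ average (suc (suc k)) b a₁ a₁b x (λ _ → 1ℤ) (λ a → δ (dot a b′) y) (λ e → cong (λ d → δ d y) (dot-congˡ b′ e))
           (λ z a → cong (λ d → 1ℤ * δ d y) (dot-stable a a₁ b′ a₁b′ z)) ⟩
    ∑T (suc (suc k)) (λ a → 1ℤ * δ (dot a b′) y)
      ≡⟨ trans (∑-cong (allTups (suc (suc k))) (λ a → ℤP.*-identityˡ _)) (count₁ (suc k) b′ a₂ a₂b′ y) ⟩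
    ∣R∣ ℤ.^ suc k ∎)
    where open Dual D

  m*μ⁰ : (a b : Tup n) → ∀ g → m (0ᴿ ⊕ ⊖ dot a b) * (μ⁰ a * g) ≡ μ⁰ a * g
  m*μ⁰ a b g with zero? a
  ... | no _  = ℤP.*-zeroʳ (m (0ᴿ ⊕ ⊖ dot a b))
  ... | yes z = trans (cong (λ t → ⟦ t ⟧ * (1ℤ * g)) (dec-true (M? (0ᴿ ⊕ ⊖ dot a b))
                  (red-~ (sym (trans (red-dot a b) (trans (cong (λ v → dotF v (redⱽ b)) (sym z)) (dotF-0ˡ (redⱽ b)))))))) (ℤP.*-identityˡ _)

  μ⁰-shift : (a c : Tup n) → ∀ {z} → M z → μ⁰ (a ⊞ scale z c) ≡ μ⁰ a
  μ⁰-shift a c mz = cong (λ v → ⟦ does (vec≟ enumSub 0ⱽ v) ⟧) (redⱽ-shift a c mz)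

  ∑μ⁰ : ∀ n → ∑T n μ⁰ ≡ ∣M∣ ℤ.^ n
  ∑μ⁰ n = trans (∑T-red n (λ v → ⟦ does (vec≟ enumSub 0ⱽ v) ⟧)) (trans (cong (∣M∣ ℤ.^ n *_) (Enum.once (enumVec enumSub n) 0ⱽ)) (ℤP.*-identityʳ _))

  -- Only shifts by multiples of π keep a in the kernel of reduction, hence the weight `m`. The
  -- averaged condition that a·b lies in (π) holds for every such a.
  countM₁ : ∀ k (b c : Tup (suc k)) → dot c b ≡ 1ᴿ → ∑T (suc k) (λ a → δ (dot a b) 0ᴿ * μ⁰ a) ≡ ∣M∣ ℤ.^ k
  countM₁ k b c cb = cancel-≢0 ∣M∣≢0 (begin
    ∣M∣ * ∑T (suc k) (λ a → δ (dot a b) 0ᴿ * μ⁰ a)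
      ≡⟨ average (suc k) b c cb 0ᴿ m μ⁰ μ⁰-ext (λ z a → m-cong z (μ⁰-shift a c)) ⟩
    ∑T (suc k) (λ a → m (0ᴿ ⊕ ⊖ dot a b) * μ⁰ a)
      ≡⟨ ∑-cong (allTups (suc k)) (λ a → trans (cong (m (0ᴿ ⊕ ⊖ dot a b) *_) (sym (ℤP.*-identityʳ (μ⁰ a)))) (trans (m*μ⁰ a b 1ℤ) (ℤP.*-identityʳ (μ⁰ a)))) ⟩
    ∑T (suc k) μ⁰
      ≡⟨ ∑μ⁰ (suc k) ⟩
    ∣M∣ ℤ.^ suc k ∎)

  countM₂ : ∀ k (b b′ : Tup (suc (suc k))) → Dual b b′ →
            ∑T (suc (suc k)) (λ a → δ (dot a b) 0ᴿ * (μ⁰ a * δ (dot a b′) 0ᴿ)) ≡ ∣M∣ ℤ.^ k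
  countM₂ k b b′ D = cancel-≢0 ∣M∣≢0 (begin
    ∣M∣ * ∑T (suc (suc k)) (λ a → δ (dot a b) 0ᴿ * (μ⁰ a * δ (dot a b′) 0ᴿ))
      ≡⟨ average (suc (suc k)) b a₁ a₁b 0ᴿ m (λ a → μ⁰ a * δ (dot a b′) 0ᴿ)
           (λ e → cong₂ (λ g d → g * δ d 0ᴿ) (μ⁰-ext e) (dot-congˡ b′ e))
           (λ z a → m-cong z (λ mz → cong₂ (λ g d → g * δ d 0ᴿ) (μ⁰-shift a a₁ mz) (dot-stable a a₁ b′ a₁b′ z))) ⟩
    ∑T (suc (suc k)) (λ a → m (0ᴿ ⊕ ⊖ dot a b) * (μ⁰ a * δ (dot a b′) 0ᴿ))
      ≡⟨ ∑-cong (allTups (suc (suc k))) (λ a → trans (m*μ⁰ a b (δ (dot a b′) 0ᴿ)) (ℤP.*-comm (μ⁰ a) (δ (dot a b′) 0ᴿ))) ⟩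
    ∑T (suc (suc k)) (λ a → δ (dot a b′) 0ᴿ * μ⁰ a)
      ≡⟨ countM₁ (suc k) b′ a₂ a₂b′ ⟩
    ∣M∣ ℤ.^ suc k ∎)
    where open Dual D

  -- Elimination on an invertible 2 × 2 minor of b and w in the coordinates i and k: a₂ combines
  -- them so that b gives 0 and w gives 1, and a₁ starts from y at coordinate i, where b gives 1,
  -- and subtracts the multiple of a₂ that clears w.
  minor⇒Dual : ∀ (b w : Tup n) i k y s → b i ⊗ y ≡ 1ᴿ → (w k ⊕ ⊖ (b k ⊗ y ⊗ w i)) ⊗ s ≡ 1ᴿ → Dual b w
  minor⇒Dual b w i k y s by minor = record { a₁ = a₁ ; a₂ = a₂ ; a₁b = a₁b ; a₁b′ = a₁w ; a₂b = a₂b ; a₂b′ = a₂w }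
    where
    a₂ = scale s (single k 1ᴿ ⊞ single i (⊖ (b k ⊗ y)))
    a₁ = single i y ⊞ scale (⊖ (y ⊗ w i)) a₂
    dot-a₂ : ∀ v → dot a₂ v ≡ s ⊗ (1ᴿ ⊗ v k ⊕ ⊖ (b k ⊗ y) ⊗ v i)
    dot-a₂ v = trans (dot-scale s _ v) (cong (s ⊗_) (trans (dot-⊞ (single k 1ᴿ) (single i (⊖ (b k ⊗ y))) v) (cong₂ _⊕_ (dot-single k 1ᴿ v) (dot-single i _ v))))
    dot-a₁ : ∀ v → dot a₁ v ≡ y ⊗ v i ⊕ ⊖ (y ⊗ w i) ⊗ dot a₂ v
    dot-a₁ v = trans (dot-⊞ (single i y) (scale (⊖ (y ⊗ w i)) a₂) v) (cong₂ _⊕_ (dot-single i y v) (dot-scale _ a₂ v))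
    a₂b : dot a₂ b ≡ 0ᴿ
    a₂b = begin
      dot a₂ b                                    ≡⟨ dot-a₂ b ⟩
      s ⊗ (1ᴿ ⊗ b k ⊕ ⊖ (b k ⊗ y) ⊗ b i)          ≡⟨ solve 5 (λ s o bk y bi → s :* (o :* bk :+ :- (bk :* y) :* bi) := s :* (o :* bk :+ :- (bk :* (bi :* y)))) refl s 1ᴿ (b k) y (b i) ⟩
      s ⊗ (1ᴿ ⊗ b k ⊕ ⊖ (b k ⊗ (b i ⊗ y)))        ≡⟨ cong (λ z → s ⊗ (1ᴿ ⊗ b k ⊕ ⊖ (b k ⊗ z))) by ⟩
      s ⊗ (1ᴿ ⊗ b k ⊕ ⊖ (b k ⊗ 1ᴿ))               ≡⟨ solve 3 (λ s o bk → s :* (o :* bk :+ :- (bk :* o)) := con 0ℤ) refl s 1ᴿ (b k) ⟩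
      0ᴿ ∎
    a₂w : dot a₂ w ≡ 1ᴿ
    a₂w = begin
      dot a₂ w                                    ≡⟨ dot-a₂ w ⟩
      s ⊗ (1ᴿ ⊗ w k ⊕ ⊖ (b k ⊗ y) ⊗ w i)          ≡⟨ cong (λ z → s ⊗ (z ⊕ ⊖ (b k ⊗ y) ⊗ w i)) (*-identityˡ (w k)) ⟩
      s ⊗ (w k ⊕ ⊖ (b k ⊗ y) ⊗ w i)               ≡⟨ solve 5 (λ s wk bk y wi → s :* (wk :+ :- (bk :* y) :* wi) := (wk :+ :- (bk :* y :* wi)) :* s) refl s (w k) (b k) y (w i) ⟩
      (w k ⊕ ⊖ (b k ⊗ y ⊗ w i)) ⊗ s               ≡⟨ minor ⟩
      1ᴿ ∎
    a₁b : dot a₁ b ≡ 1ᴿ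
    a₁b = trans (dot-a₁ b) (trans (cong₂ _⊕_ (trans (*-comm y (b i)) by) (trans (cong (⊖ (y ⊗ w i) ⊗_) a₂b) (zeroʳ _))) (+-identityʳ 1ᴿ))
    a₁w : dot a₁ w ≡ 0ᴿ
    a₁w = trans (dot-a₁ w) (trans (cong (λ z → y ⊗ w i ⊕ ⊖ (y ⊗ w i) ⊗ z) a₂w) (trans (cong (y ⊗ w i ⊕_) (*-identityʳ _)) (⊖-inverseʳ _)))

  -- With the unit entry b_i as pivot, if no minor against another row were a unit, b′ would agree
  -- modulo π with b′_i b_i⁻¹ b and be parallel to b.
  independent⇒Dual : (b b′ : Tup n) → redⱽ b ≢ 0ⱽ → redⱽ b′ ≢ 0ⱽ → ¬ Parallel (redⱽ b) (redⱽ b′) → Dual b b′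
  independent⇒Dual {n} b b′ nb nb′ ¬par with findUnit b nb
  ... | i , y , by with FinP.any? (λ k → ¬? (M? (b′ k ⊕ ⊖ (b k ⊗ y ⊗ b′ i))))
  ... | yes (k , ¬m) = minor⇒Dual b b′ i k y (proj₁ (¬M⇒unit ¬m)) by (proj₂ (¬M⇒unit ¬m))
  ... | no none = contradiction (red (y ⊗ b′ i) , u≢0 , eq) ¬par
    where
    close : ∀ k → y ⊗ b′ i ⊗ b k ~ b′ k
    close k = ~-sym (subst (λ z → M (b′ k ⊕ ⊖ z)) (solve 3 (λ bk y bi → bk :* y :* bi := y :* bi :* bk) refl (b k) y (b′ i))
      (decidable-stable (M? _) λ ¬m → none (k , ¬m)))
    redⱽ-close : ∀ {n} (a c : Tup n) → (∀ k → a k ~ c k) → redⱽ a ≡ redⱽ c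
    redⱽ-close {zero}  a c h = refl
    redⱽ-close {suc n} a c h = cong₂ _∷_ (red-cong (h Fin.zero)) (redⱽ-close (VF.tail a) (VF.tail c) (h ∘ Fin.suc))
    eq : red (y ⊗ b′ i) ·ⱽ redⱽ b ≡ redⱽ b′
    eq = trans (sym (redⱽ-scale (y ⊗ b′ i) b)) (redⱽ-close (scale (y ⊗ b′ i) b) b′ close)
    u≢0 : red (y ⊗ b′ i) ≢ F.0F
    u≢0 z = nb′ (trans (sym eq) (trans (cong (_·ⱽ redⱽ b) z) (·ⱽ-zeroˡ (redⱽ b))))

-- Divisibility is total in a finite valuation ring

module Chain (R : FinCommRing) (loc : FinCommRing.IsLocal R) (prin : FinCommRing.IsPrincipal R)
             (π : FinCommRing.Elt R) (unif : FinCommRing.IsUniformizer R π) where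
  open Tuples R loc π unif
  open FinCommRing R using (IsIdeal)
  open ≡-Reasoning

  infix 4 _∣ᴿ_
  _∣ᴿ_ : Elt → Elt → Set
  x ∣ᴿ y = y ∈⟨ x ⟩

  ∣ᴿ-refl : ∀ x → x ∣ᴿ x
  ∣ᴿ-refl x = 1ᴿ , sym (*-identityʳ x)

  ∣ᴿ-trans : ∀ {x y z} → x ∣ᴿ y → y ∣ᴿ z → x ∣ᴿ z
  ∣ᴿ-trans {x} (a , refl) (b , refl) = a ⊗ b , *-assoc x a b

  unit-∣ : ∀ g {x′} y′ → IsUnit x′ → g ⊗ x′ ∣ᴿ g ⊗ y′
  unit-∣ g {x′} y′ (u , e) = u ⊗ y′ , sym (begin
    g ⊗ x′ ⊗ (u ⊗ y′)   ≡⟨ solve 4 (λ g x u y → g :* x :* (u :* y) := g :* (x :* u :* y)) refl g x′ u y′ ⟩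
    g ⊗ (x′ ⊗ u ⊗ y′)   ≡⟨ cong (λ z → g ⊗ (z ⊗ y′)) e ⟩
    g ⊗ (1ᴿ ⊗ y′)       ≡⟨ cong (g ⊗_) (*-identityˡ y′) ⟩
    g ⊗ y′ ∎)

  -- If (x, y) = (g) with x = g x′ and y = g y′, then x′ or y′ is a unit unless g = 0.
  ∣ᴿ-total : ∀ x y → x ∣ᴿ y ⊎ y ∣ᴿ x
  ∣ᴿ-total x y = conclude (prin I ideal)
    where
    I : Elt → Set
    I z = ∃ λ a → ∃ λ b → z ≡ a ⊗ x ⊕ b ⊗ y
    ideal : IsIdeal I
    ideal = record
      { zero∈    = 0ᴿ , 0ᴿ , sym (trans (cong₂ _⊕_ (zeroˡ x) (zeroˡ y)) (+-identityˡ 0ᴿ))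
      ; +-closed = λ { (a , b , refl) (a′ , b′ , refl) → a ⊕ a′ , b ⊕ b′ ,
          solve 6 (λ a b a′ b′ x y → (a :* x :+ b :* y) :+ (a′ :* x :+ b′ :* y) := (a :+ a′) :* x :+ (b :+ b′) :* y) refl a b a′ b′ x y }
      ; *-closed = λ { r (a , b , refl) → r ⊗ a , r ⊗ b ,
          solve 5 (λ r a b x y → r :* (a :* x :+ b :* y) := r :* a :* x :+ r :* b :* y) refl r a b x y } }
    conclude : (∃ λ g → ∀ z → I z ⇔ (z ∈⟨ g ⟩)) → x ∣ᴿ y ⊎ y ∣ᴿ x
    conclude (g , eq) with Equivalence.to (eq x) (1ᴿ , 0ᴿ , sym (trans (cong₂ _⊕_ (*-identityˡ x) (zeroˡ y)) (+-identityʳ x)))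
                         | Equivalence.to (eq y) (0ᴿ , 1ᴿ , sym (trans (cong₂ _⊕_ (zeroˡ x) (*-identityˡ y)) (+-identityˡ y)))
                         | Equivalence.from (eq g) (∣ᴿ-refl g)
    ... | x′ , ex | y′ , ey | a , b , eg with M? x′ | M? y′
    ... | no ¬m  | _      = inj₁ (subst₂′ (unit-∣ g y′ (¬M⇒unit ¬m)))
      where
      subst₂′ : g ⊗ x′ ∣ᴿ g ⊗ y′ → x ∣ᴿ y
      subst₂′ h = subst (_∣ᴿ y) (sym ex) (subst (g ⊗ x′ ∣ᴿ_) (sym ey) h)
    ... | yes _  | no ¬m  = inj₂ (subst (_∣ᴿ x) (sym ey) (subst (g ⊗ y′ ∣ᴿ_) (sym ex) (unit-∣ g x′ (¬M⇒unit ¬m))))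
    ... | yes mx | yes my = inj₁ (0ᴿ , trans ey (trans (cong (_⊗ y′) g≡0) (trans (zeroˡ y′) (sym (zeroʳ x)))))
      where
      t : Elt
      t = 1ᴿ ⊕ ⊖ (a ⊗ x′ ⊕ b ⊗ y′)
      ut : IsUnit t
      ut = ¬M⇒unit λ h → M⇒¬unit (subst M (solve 2 (λ o s → (o :+ :- s) :+ s := o) refl 1ᴿ (a ⊗ x′ ⊕ b ⊗ y′)) (∈-+ h (∈-+ (∈-* a mx) (∈-* b my)))) unit-1
      gt≡0 : g ⊗ t ≡ 0ᴿ
      gt≡0 = begin
        g ⊗ (1ᴿ ⊕ ⊖ (a ⊗ x′ ⊕ b ⊗ y′))                 ≡⟨ solve 6 (λ g o a x b y → g :* (o :+ :- (a :* x :+ b :* y)) := g :* o :+ :- (a :* (g :* x) :+ b :* (g :* y))) refl g 1ᴿ a x′ b y′ ⟩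
        g ⊗ 1ᴿ ⊕ ⊖ (a ⊗ (g ⊗ x′) ⊕ b ⊗ (g ⊗ y′))       ≡⟨ cong₂ (λ p q → p ⊕ ⊖ q) (*-identityʳ g) (trans (cong₂ (λ p q → a ⊗ p ⊕ b ⊗ q) (sym ex) (sym ey)) (sym eg)) ⟩
        g ⊕ ⊖ g                                        ≡⟨ ⊖-inverseʳ g ⟩
        0ᴿ ∎
      g≡0 : g ≡ 0ᴿ
      g≡0 = begin
        g                  ≡⟨ sym (*-identityʳ g) ⟩
        g ⊗ 1ᴿ             ≡⟨ cong (g ⊗_) (sym (proj₂ ut)) ⟩
        g ⊗ (t ⊗ proj₁ ut) ≡⟨ sym (*-assoc g t (proj₁ ut)) ⟩
        g ⊗ t ⊗ proj₁ ut   ≡⟨ cong (_⊗ proj₁ ut) gt≡0 ⟩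
        0ᴿ ⊗ proj₁ ut      ≡⟨ zeroˡ (proj₁ ut) ⟩
        0ᴿ ∎

  leastDivisor : ∀ n (v : Tup (suc n)) → ∃ λ k → ∀ j → v k ∣ᴿ v j
  leastDivisor zero    v = Fin.zero , λ { Fin.zero → ∣ᴿ-refl (v Fin.zero) }
  leastDivisor (suc n) v with leastDivisor n (VF.tail v)
  ... | k , h with ∣ᴿ-total (v Fin.zero) (v (Fin.suc k))
  ...   | inj₁ d = Fin.zero , λ { Fin.zero → ∣ᴿ-refl (v Fin.zero) ; (Fin.suc j) → ∣ᴿ-trans d (h j) }
  ...   | inj₂ d = Fin.suc k , λ { Fin.zero → d ; (Fin.suc j) → h j }

  InSpan : ∀ {n} → Tup n → Tup n → Tup n → Set
  InSpan b w b′ = ∃ λ c → ∃ λ r → b′ ≗ scale c b ⊞ scale r w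

  span-dot : ∀ {n} {b w b′ : Tup n} → InSpan b w b′ → ∀ a → dot a b ≡ 0ᴿ → dot a w ≡ 0ᴿ → dot a b′ ≡ 0ᴿ
  span-dot {b = b} {w} {b′} (c , r , e) a ab aw = begin
    dot a b′                            ≡⟨ dot-cong {a = a} (λ _ → refl) e ⟩
    dot a (scale c b ⊞ scale r w)       ≡⟨ trans (dot-comm a _) (dot-⊞ (scale c b) (scale r w) a) ⟩
    dot (scale c b) a ⊕ dot (scale r w) a ≡⟨ cong₂ _⊕_ (trans (dot-scale c b a) (cong (c ⊗_) (trans (dot-comm b a) ab)))
                                               (trans (dot-scale r w a) (cong (r ⊗_) (trans (dot-comm w a) aw))) ⟩
    c ⊗ 0ᴿ ⊕ r ⊗ 0ᴿ                     ≡⟨ trans (cong₂ _⊕_ (zeroʳ c) (zeroʳ r)) (+-identityˡ 0ᴿ) ⟩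
    0ᴿ ∎

  -- Subtracting a multiple of b from b′ clears the pivot coordinate i and leaves v. Divisibility
  -- being total, some entry v_k divides all the others, so v = v_k w with w_k = 1 and w_i = 0, and
  -- coordinates i, k give an invertible minor. Thus even vectors parallel modulo π lie in the span
  -- of a dual pair.
  span : ∀ {m} (b b′ : Tup (suc (suc m))) → redⱽ b ≢ 0ⱽ → ∃ λ w → Dual b w × InSpan b w b′
  span {m} b b′ nb with findUnit b nb
  ... | i , y , by = conclude (leastDivisor (suc m) v)
    where
    v : Tup (suc (suc m))
    v j = b′ j ⊕ ⊖ (b j ⊗ y ⊗ b′ i)
    vi≡0 : v i ≡ 0ᴿ
    vi≡0 = trans (cong (λ z → b′ i ⊕ ⊖ (z ⊗ b′ i)) by) (trans (cong (λ z → b′ i ⊕ ⊖ z) (*-identityˡ (b′ i))) (⊖-inverseʳ (b′ i)))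
    expand : ∀ j → b′ j ≡ y ⊗ b′ i ⊗ b j ⊕ v j
    expand j = solve 4 (λ bj′ bj y bi → bj′ := y :* bi :* bj :+ (bj′ :+ :- (bj :* y :* bi))) refl (b′ j) (b j) y (b′ i)
    dual : ∀ (w : Tup (suc (suc m))) k → w k ≡ 1ᴿ → w i ≡ 0ᴿ → Dual b w
    dual w k wk wi = minor⇒Dual b w i k y 1ᴿ by (trans (*-identityʳ _) (trans (cong₂ (λ p q → p ⊕ ⊖ (b k ⊗ y ⊗ q)) wk wi)
      (trans (cong (λ z → 1ᴿ ⊕ ⊖ z) (zeroʳ (b k ⊗ y))) (trans (cong (1ᴿ ⊕_) ⊖0≡0) (+-identityʳ 1ᴿ)))))
    otherThan : (i : Fin (suc (suc m))) → ∃ λ k → k ≢ i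
    otherThan Fin.zero    = Fin.suc Fin.zero , λ ()
    otherThan (Fin.suc _) = Fin.zero , λ ()
    other = otherThan i
    pick : Fin (suc (suc m)) → Tup (suc (suc m)) → Tup (suc (suc m))
    pick k z j with k FinP.≟ j | i FinP.≟ j
    ... | yes _ | _     = 1ᴿ
    ... | no _  | yes _ = 0ᴿ
    ... | no _  | no _  = z j
    pick-k : ∀ k z → pick k z k ≡ 1ᴿ
    pick-k k z with k FinP.≟ k | i FinP.≟ k
    ... | yes _ | _ = refl
    ... | no n  | _ = contradiction refl n
    pick-i : ∀ k z → k ≢ i → pick k z i ≡ 0ᴿ
    pick-i k z k≢i with k FinP.≟ i | i FinP.≟ i
    ... | yes e | _     = contradiction e k≢i
    ... | no _  | yes _ = refl
    ... | no _  | no n  = contradiction refl n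
    pick-v : ∀ k r z → (∀ j → v j ≡ r ⊗ z j) → v k ≡ r → ∀ j → v j ≡ r ⊗ pick k z j
    pick-v k r z h vk j with k FinP.≟ j | i FinP.≟ j
    ... | yes refl | _        = trans vk (sym (*-identityʳ r))
    ... | no _     | yes refl = trans vi≡0 (sym (zeroʳ r))
    ... | no _     | no _     = h j
    build : ∀ k r z → k ≢ i → (∀ j → v j ≡ r ⊗ z j) → v k ≡ r → ∃ λ w → Dual b w × InSpan b w b′
    build k r z k≢i h vk = pick k z , dual (pick k z) k (pick-k k z) (pick-i k z k≢i) ,
      y ⊗ b′ i , r , λ j → trans (expand j) (cong (y ⊗ b′ i ⊗ b j ⊕_) (pick-v k r z h vk j))
    conclude : (∃ λ k → ∀ j → v k ∣ᴿ v j) → ∃ λ w → Dual b w × InSpan b w b′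
    conclude (k , h) with v k ≟ 0ᴿ
    -- Here v_k ≠ 0 = v_i shows that k is not the pivot.
    ... | no vk≢0 = build k (v k) (λ j → proj₁ (h j)) (λ { refl → vk≢0 vi≡0 }) (λ j → proj₂ (h j)) refl
    -- All of v vanishes and b′ is a multiple of b; w may be the unit vector at any coordinate other
    -- than i, taken with coefficient 0.
    ... | yes vk≡0 = build (proj₁ other) 0ᴿ (λ _ → 0ᴿ) (proj₂ other) (λ j → trans (all0 j) (sym (zeroˡ 0ᴿ))) (all0 (proj₁ other))
      where
      all0 : ∀ j → v j ≡ 0ᴿ
      all0 j = trans (proj₂ (h j)) (trans (cong (_⊗ proj₁ (h j)) vk≡0) (zeroˡ _))

-- Lexicographically least representatives of unit orbits

module Orbits (R : FinCommRing) (loc : FinCommRing.IsLocal R)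
              (π : FinCommRing.Elt R) (unif : FinCommRing.IsUniformizer R π) where
  open Tuples R loc π unif
  open ≡-Reasoning

  private
    variable
      n : ℕ

  lexLt-ext : {a a′ b b′ : Tup n} → a ≗ a′ → b ≗ b′ → lexLt a b ≡ lexLt a′ b′
  lexLt-ext {zero}  e f = refl
  lexLt-ext {suc n} e f = cong₂ _∨_ (cong₂ _<ᵇ_ (e Fin.zero) (f Fin.zero))
    (cong₂ _∧_ (cong₂ (λ x y → does (x ≟ y)) (e Fin.zero) (f Fin.zero)) (lexLt-ext (e ∘ Fin.suc) (f ∘ Fin.suc)))

  lexLt-elim : (a b : Tup (suc n)) → lexLt a b ≡ true →
               (a Fin.zero <ᵇ b Fin.zero) ≡ true ⊎ (a Fin.zero ≡ b Fin.zero × lexLt (VF.tail a) (VF.tail b) ≡ true)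
  lexLt-elim a b e with a Fin.zero <ᵇ b Fin.zero
  ... | true  = inj₁ refl
  ... | false = inj₂ (does-true (a Fin.zero ≟ b Fin.zero) (∧-elimˡ e) , ∧-elimʳ {does (a Fin.zero ≟ b Fin.zero)} e)

  lexLt-<  : (a b : Tup (suc n)) → (a Fin.zero <ᵇ b Fin.zero) ≡ true → lexLt a b ≡ true
  lexLt-< a b e = cong (_∨ (does (a Fin.zero ≟ b Fin.zero) ∧ lexLt (VF.tail a) (VF.tail b))) e

  lexLt-≡ : (a b : Tup (suc n)) → a Fin.zero ≡ b Fin.zero → lexLt (VF.tail a) (VF.tail b) ≡ true → lexLt a b ≡ true
  lexLt-≡ a b e f = trans (cong ((a Fin.zero <ᵇ b Fin.zero) ∨_) (cong₂ _∧_ (dec-true (a Fin.zero ≟ b Fin.zero) e) f)) (∨-true (a Fin.zero <ᵇ b Fin.zero))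
    where
    ∨-true : ∀ x → x ∨ true ≡ true
    ∨-true true  = refl
    ∨-true false = refl

  <ᵇ-irrefl : ∀ (x : Elt) → (x <ᵇ x) ≢ true
  <ᵇ-irrefl x e = ℕP.<-irrefl refl (<ᵇ⇒< {x} {x} e)

  lexLt-irrefl : (a : Tup n) → lexLt a a ≢ true
  lexLt-irrefl {zero}  a ()
  lexLt-irrefl {suc n} a e with lexLt-elim a a e
  ... | inj₁ p       = <ᵇ-irrefl (a Fin.zero) p
  ... | inj₂ (_ , p) = lexLt-irrefl (VF.tail a) p

  lexLt-trans : (a b c : Tup n) → lexLt a b ≡ true → lexLt b c ≡ true → lexLt a c ≡ true
  lexLt-trans {zero}  a b c ()
  lexLt-trans {suc n} a b c e f with lexLt-elim a b e | lexLt-elim b c f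
  ... | inj₁ p       | inj₁ q       = lexLt-< a c (<⇒<ᵇ {a Fin.zero} {c Fin.zero} (ℕP.<-trans (<ᵇ⇒< {a Fin.zero} p) (<ᵇ⇒< {b Fin.zero} q)))
  ... | inj₁ p       | inj₂ (r , _) = lexLt-< a c (subst (λ z → (a Fin.zero <ᵇ z) ≡ true) r p)
  ... | inj₂ (r , _) | inj₁ q       = lexLt-< a c (subst (λ z → (z <ᵇ c Fin.zero) ≡ true) (sym r) q)
  ... | inj₂ (r , p) | inj₂ (s , q) = lexLt-≡ a c (trans r s) (lexLt-trans (VF.tail a) (VF.tail b) (VF.tail c) p q)

  lexLt-total : (a b : Tup n) → lexLt a b ≢ true → lexLt b a ≢ true → a ≗ b
  lexLt-total {suc n} a b ¬p ¬q Fin.zero = FinP.toℕ-injective (ℕP.≤-antisym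
    (ℕP.≮⇒≥ (λ l → ¬q (lexLt-< b a (<⇒<ᵇ {b Fin.zero} {a Fin.zero} l)))) (ℕP.≮⇒≥ (λ l → ¬p (lexLt-< a b (<⇒<ᵇ {a Fin.zero} {b Fin.zero} l)))))
  lexLt-total {suc n} a b ¬p ¬q (Fin.suc i) = lexLt-total (VF.tail a) (VF.tail b)
    (λ e → ¬p (lexLt-≡ a b (lexLt-total a b ¬p ¬q Fin.zero) e)) (λ e → ¬q (lexLt-≡ b a (sym (lexLt-total a b ¬p ¬q Fin.zero)) e)) i

  least : Tup n → Bool
  least a = all (λ u → not (isUnitᵇ u ∧ lexLt (scale u a) a)) elems

  all-cong : ∀ (p p′ : A → Bool) xs → (∀ x → p x ≡ p′ x) → all p xs ≡ all p′ xs
  all-cong p p′ []       h = refl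
  all-cong p p′ (x ∷ xs) h = cong₂ _∧_ (h x) (all-cong p p′ xs h)

  least-ext : Ext {n} least
  least-ext e = all-cong _ _ elems (λ u → cong (λ b → not (isUnitᵇ u ∧ b)) (lexLt-ext (λ i → cong (u ⊗_) (e i)) e))

  unit⇒ᵇ : ∀ {u} → IsUnit u → isUnitᵇ u ≡ true
  unit⇒ᵇ {u} p = trans (isUnitᵇ-does u) (dec-true (unit? u) p)

  ᵇ⇒unit : ∀ {u} → isUnitᵇ u ≡ true → IsUnit u
  ᵇ⇒unit {u} e = does-true (unit? u) (trans (sym (isUnitᵇ-does u)) e)

  least-elim : (a : Tup n) → least a ≡ true → ∀ u → IsUnit u → lexLt (scale u a) a ≢ true
  least-elim a e u p l = not-≡true (all-elim E _ e u) (cong₂ _∧_ (unit⇒ᵇ p) l)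

  least-intro : (a : Tup n) → (∀ u → IsUnit u → lexLt (scale u a) a ≢ true) → least a ≡ true
  least-intro a h = all-intro _ elems (λ u → ≢true⇒not λ e → h u (ᵇ⇒unit (∧-elimˡ e)) (∧-elimʳ {isUnitᵇ u} e))

  scale-scale : ∀ u w (a : Tup n) → scale u (scale w a) ≗ scale (u ⊗ w) a
  scale-scale u w a i = sym (*-assoc u w (a i))

  scale-free : (a c : Tup n) → dot c a ≡ 1ᴿ → ∀ {u w} → scale u a ≗ scale w a → u ≡ w
  scale-free a c ca {u} {w} e = begin
    u                ≡⟨ sym (trans (cong (u ⊗_) ca) (*-identityʳ u)) ⟩
    u ⊗ dot c a      ≡⟨ sym (dot-scaleʳ u c a) ⟩
    dot c (scale u a) ≡⟨ dot-cong {a = c} (λ _ → refl) e ⟩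
    dot c (scale w a) ≡⟨ dot-scaleʳ w c a ⟩
    w ⊗ dot c a      ≡⟨ trans (cong (w ⊗_) ca) (*-identityʳ w) ⟩
    w ∎

  -- Units act freely on a unimodular tuple, and the lexicographic order is total up to pointwise
  -- equality, so exactly one unit multiple of a is least.
  onceInOrbit : (a : Tup n) → redⱽ a ≢ 0ⱽ → ∑ᴱ (λ u → ⟦ isUnitᵇ u ⟧ * ⟦ least (scale u a) ⟧) ≡ 1ℤ
  onceInOrbit {n} a na = conclude (findUnit a na) (minimal (λ u w → lexLt (scale u a) (scale w a)) (λ u → lexLt-irrefl (scale u a))
      (λ {u} {w} {x} → lexLt-trans (scale u a) (scale w a) (scale x a)) isUnitᵇ elems 1ᴿ (unit⇒ᵇ unit-1))
    where
    conclude : (∃ λ i → IsUnit (a i)) → (∃ λ u₀ → isUnitᵇ u₀ ≡ true × lexLt (scale 1ᴿ a) (scale u₀ a) ≢ true ×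
      all (λ u → not (isUnitᵇ u ∧ lexLt (scale u a) (scale u₀ a))) elems ≡ true) → ∑ᴱ (λ u → ⟦ isUnitᵇ u ⟧ * ⟦ least (scale u a) ⟧) ≡ 1ℤ
    conclude (i , y , e) (u₀ , p₀ , _ , h) = trans (∑-cong list (λ u → trans (sym (⟦⟧-∧ (isUnitᵇ u) (least (scale u a))))
        (cong ⟦_⟧ (iff⇒≡ (to u) (from u))))) (once u₀)
      where
      minimal-u₀ : ∀ u → IsUnit u → lexLt (scale u a) (scale u₀ a) ≢ true
      minimal-u₀ u iu l = not-≡true (all-elim E _ h u) (cong₂ _∧_ (unit⇒ᵇ iu) l)
      least-u₀ : least (scale u₀ a) ≡ true
      least-u₀ = least-intro (scale u₀ a) λ u iu l → minimal-u₀ (u ⊗ u₀) (unit-* iu (ᵇ⇒unit p₀))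
        (trans (lexLt-ext (λ i → sym (scale-scale u u₀ a i)) (λ _ → refl)) l)
      to : ∀ u → isUnitᵇ u ∧ least (scale u a) ≡ true → does (u₀ ≟ u) ≡ true
      to u q = dec-true (u₀ ≟ u) (scale-free a (single i y) (trans (dot-single i y a) (trans (*-comm y (a i)) e))
          (lexLt-total (scale u₀ a) (scale u a) below (minimal-u₀ u iu)))
        where
        iu : IsUnit u
        iu = ᵇ⇒unit (∧-elimˡ q)
        below : lexLt (scale u₀ a) (scale u a) ≢ true
        below l with iu
        ... | w , uw≡1 = least-elim (scale u a) (∧-elimʳ {isUnitᵇ u} q) (u₀ ⊗ w) (unit-* (ᵇ⇒unit p₀) (u , trans (*-comm w u) uw≡1))
          (trans (lexLt-ext (λ j → trans (scale-scale (u₀ ⊗ w) u a j) (cong (_⊗ a j) (trans (*-assoc u₀ w u) (trans (cong (u₀ ⊗_) (trans (*-comm w u) uw≡1)) (*-identityʳ u₀))))) (λ _ → refl)) l)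
      from : ∀ u → does (u₀ ≟ u) ≡ true → isUnitᵇ u ∧ least (scale u a) ≡ true
      from u q with does-true (u₀ ≟ u) q
      ... | refl = cong₂ _∧_ p₀ least-u₀

  ∣U∣ : ℤ
  ∣U∣ = ∑ᴱ (λ u → ⟦ isUnitᵇ u ⟧)

  ∣U∣≡ : ∣U∣ ≡ ∣R∣ - ∣M∣
  ∣U∣≡ = trans (∑-cong list (λ u → trans (cong ⟦_⟧ (trans (isUnitᵇ-does u) (unit-not u))) (⟦⟧-not (does (M? u))))) (∑-- list (λ _ → 1ℤ) m)
    where
    unit-not : ∀ u → does (unit? u) ≡ not (does (M? u))
    unit-not u = iff⇒≡ (λ e → ≢true⇒not λ f → M⇒¬unit (does-true (M? u) f) (does-true (unit? u) e))
      (λ e → dec-true (unit? u) (¬M⇒unit λ f → not-≡true e (dec-true (M? u) f)))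

  um*-cong : (a : Tup n) → ∀ {x y} → (redⱽ a ≢ 0ⱽ → x ≡ y) → um a * x ≡ um a * y
  um*-cong a h with zero? a
  ... | yes _ = refl
  ... | no z  = cong (1ℤ *_) (h (z ∘ sym))

  um-scale : ∀ {u} → IsUnit u → (a : Tup n) → um (scale u a) ≡ um a
  um-scale {n} {u} (w , e) a = cong (λ b → 1ℤ - ⟦ b ⟧) (does-cong (zero? (scale u a)) (zero? a)
      (λ z → trans (sym (·ⱽ-zeroʳ n (red w))) (trans (cong (red w ·ⱽ_) (trans z (redⱽ-scale u a))) (·ⱽ-cancel (red w) (red u) (redⱽ a) wu)))
      (λ z → trans (sym (·ⱽ-zeroʳ n (red u))) (trans (cong (red u ·ⱽ_) z) (sym (redⱽ-scale u a)))))
    where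
    wu : red w *ᶠ red u ≡ red 1ᴿ
    wu = trans (sym (red-* w u)) (cong red (trans (*-comm w u) e))

  -- The 1 of `onceInOrbit` is inserted into the sum over unimodular tuples. For each unit u the
  -- substitution a ↦ u a then leaves the sum over representatives, once for every unit.
  ∑-orbits : ∀ n (G : Tup n → ℤ) → Ext G → (∀ u a → IsUnit u → G (scale u a) ≡ G a) →
             ∣U∣ * ∑ (unimodularModUnits n) G ≡ ∑ (unimodular n) G
  ∑-orbits n G ext inv = sym (begin
    ∑ (unimodular n) G
      ≡⟨ ∑-unimodular n G ⟩
    ∑T n (λ a → um a * G a)
      ≡⟨ ∑-cong (allTups n) (λ a → trans (um*-cong a λ na → sym (trans (cong (_* G a) (onceInOrbit a na)) (ℤP.*-identityˡ (G a))))
           (trans (cong (um a *_) (sym (∑-*ʳ list (G a) _))) (sym (∑-*ˡ list (um a) _)))) ⟩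
    ∑T n (λ a → ∑ᴱ (λ u → um a * (⟦ isUnitᵇ u ⟧ * ⟦ least (scale u a) ⟧ * G a)))
      ≡⟨ ∑-swap (allTups n) list _ ⟩
    ∑ᴱ (λ u → ∑T n (λ a → um a * (⟦ isUnitᵇ u ⟧ * ⟦ least (scale u a) ⟧ * G a)))
      ≡⟨ ∑-cong list (λ u → trans (∑-cong (allTups n) (λ a → lem (um a) ⟦ isUnitᵇ u ⟧ ⟦ least (scale u a) ⟧ (G a)))
           (trans (∑-*ˡ (allTups n) ⟦ isUnitᵇ u ⟧ (λ a → um a * (⟦ least (scale u a) ⟧ * G a))) (⟦⟧*-cong (isUnitᵇ u) (perUnit u)))) ⟩
    ∑ᴱ (λ u → ⟦ isUnitᵇ u ⟧ * ∑ (unimodularModUnits n) G)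
      ≡⟨ ∑-*ʳ list (∑ (unimodularModUnits n) G) (λ u → ⟦ isUnitᵇ u ⟧) ⟩
    ∣U∣ * ∑ (unimodularModUnits n) G ∎)
    where
    lem : ∀ a b c d → a * (b * c * d) ≡ b * (a * (c * d))
    lem = solve-∀
    H : Tup n → ℤ
    H a = um a * (⟦ least a ⟧ * G a)
    perUnit : ∀ u → isUnitᵇ u ≡ true → ∑T n (λ a → um a * (⟦ least (scale u a) ⟧ * G a)) ≡ ∑ (unimodularModUnits n) G
    perUnit u pu = begin
      ∑T n (λ a → um a * (⟦ least (scale u a) ⟧ * G a))
        ≡⟨ ∑-cong (allTups n) (λ a → cong₂ (λ x g → x * (⟦ least (scale u a) ⟧ * g)) (sym (um-scale (ᵇ⇒unit pu) a)) (sym (inv u a (ᵇ⇒unit pu)))) ⟩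
      ∑T n (λ a → H (scale u a))
        ≡⟨ ∑T-scale n (ᵇ⇒unit pu) H (λ e → cong₂ _*_ (um-ext e) (cong₂ (λ b g → ⟦ b ⟧ * g) (least-ext e) (ext e))) ⟩
      ∑T n H
        ≡⟨ sym (∑-unimodular n (λ a → ⟦ least a ⟧ * G a)) ⟩
      ∑ (unimodular n) (λ a → ⟦ least a ⟧ * G a)
        ≡⟨ sym (∑-filter least (unimodular n) G) ⟩
      ∑ (unimodularModUnits n) G ∎

-- Cuts of regular bipartite graphs

∑-cong-All : ∀ {P : A → Set} {xs : List A} → All P xs → ∀ {f g : A → ℤ} → (∀ x → P x → f x ≡ g x) → ∑ xs f ≡ ∑ xs g
∑-cong-All []        h = refl
∑-cong-All (p ∷ ps)  h = cong₂ _+_ (h _ p) (∑-cong-All ps h)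

∑-mono-All : ∀ {P : A → Set} {xs : List A} → All P xs → ∀ {f g : A → ℤ} → (∀ x → P x → f x ℤ.≤ g x) → ∑ xs f ℤ.≤ ∑ xs g
∑-mono-All []       h = ℤP.≤-refl
∑-mono-All (p ∷ ps) h = ℤP.+-mono-≤ (h _ p) (∑-mono-All ps h)

∑-lin₂ : ∀ (xs : List A) c F d G → ∑ xs (λ x → c * F x + d * G x) ≡ c * ∑ xs F + d * ∑ xs G
∑-lin₂ xs c F d G = trans (∑-+ xs (λ x → c * F x) (λ x → d * G x)) (cong₂ _+_ (∑-*ˡ xs c F) (∑-*ˡ xs d G))

∑-zip₁ : ∀ (p : List Bool) (V : List A) → length p ≡ length V → ∀ (f : Bool → ℤ) → ∑ (zip p V) (f ∘ proj₁) ≡ ∑ p f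
∑-zip₁ []       []      e f = refl
∑-zip₁ (b ∷ p) (v ∷ V) e f = cong (f b +_) (∑-zip₁ p V (ℕP.suc-injective e) f)

zip₂ : ∀ (p : List B) (V : List A) → length p ≡ length V → map proj₂ (zip p V) ≡ V
zip₂ []       []      e = refl
zip₂ (b ∷ p) (v ∷ V) e = cong (v ∷_) (zip₂ p V (ℕP.suc-injective e))

∑-zip₂ : ∀ (p : List B) (V : List A) → length p ≡ length V → ∀ (f : A → ℤ) → ∑ (zip p V) (f ∘ proj₂) ≡ ∑ V f
∑-zip₂ p V e f = trans (sym (∑-map proj₂ (zip p V) f)) (cong (λ xs → ∑ xs f) (zip₂ p V e))

∑-zip-map : ∀ {C : Set} (p : List B) (h : A → C) V (f : B × C → ℤ) → ∑ (zip p (map h V)) f ≡ ∑ (zip p V) (λ x → f (proj₁ x , h (proj₂ x)))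
∑-zip-map []      h V       f = refl
∑-zip-map (b ∷ p) h []      f = refl
∑-zip-map (b ∷ p) h (v ∷ V) f = cong (f (b , h v) +_) (∑-zip-map p h V f)

zip-++ : ∀ (p p′ : List B) (V V′ : List A) → length p ≡ length V → zip (p ++ p′) (V ++ V′) ≡ zip p V ++ zip p′ V′
zip-++ []      p′ []      V′ e = refl
zip-++ (b ∷ p) p′ (v ∷ V) V′ e = cong ((b , v) ∷_) (zip-++ p p′ V V′ (ℕP.suc-injective e))

All-zip₂ : ∀ {P : A → Set} (p : List B) {V : List A} → All P V → All (P ∘ proj₂) (zip p V)
All-zip₂ []      _        = []
All-zip₂ (b ∷ p) []       = []
All-zip₂ (b ∷ p) (h ∷ hs) = h ∷ All-zip₂ p hs

module QuadraticForms {T : Set} (V : List T) (good : T → Set) (allGood : All good V) where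
  open ≡-Reasoning

  -- A function on V as a list of weights in the order of V. This is the form in which a labelling,
  -- a list of Booleans along V, arrives, and it involves no equality test on vertices.
  Weighted : Set
  Weighted = Σ (List (ℤ × T)) (λ L → map proj₂ L ≡ V)

  ∑W : Weighted → (ℤ → T → ℤ) → ℤ
  ∑W (L , _) f = ∑ L (λ x → f (proj₁ x) (proj₂ x))

  goodW : ∀ (L : Weighted) → All (good ∘ proj₂) (proj₁ L)
  goodW (L , e) = AllP.map⁻ (subst (All good) (sym e) allGood)

  ∑W-vertex : ∀ L (f : T → ℤ) → ∑W L (λ _ t → f t) ≡ ∑ V f
  ∑W-vertex (L , e) f = trans (sym (∑-map proj₂ L f)) (cong (λ xs → ∑ xs f) e)

  form : Weighted → (T → T → ℤ) → ℤ
  form L K = ∑W L (λ g t → ∑W L (λ g′ t′ → g * g′ * K t t′))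

  form-cong : ∀ L {K K′} → (∀ t t′ → good t → good t′ → K t t′ ≡ K′ t t′) → form L K ≡ form L K′
  form-cong L h = ∑-cong-All (goodW L) (λ x gx → ∑-cong-All (goodW L) (λ y gy → cong (proj₁ x * proj₁ y *_) (h (proj₂ x) (proj₂ y) gx gy)))

  form-lin : ∀ L K K′ c → form L (λ t t′ → K t t′ + c * K′ t t′) ≡ form L K + c * form L K′
  form-lin L@(l , _) K K′ c = begin
    form L (λ t t′ → K t t′ + c * K′ t t′)
      ≡⟨ ∑-cong l (λ x → trans (∑-cong l (λ y → lem (proj₁ x * proj₁ y) (K (proj₂ x) (proj₂ y)) c (K′ (proj₂ x) (proj₂ y))))
           (∑-lin₂ l 1ℤ _ c _)) ⟩
    ∑ l (λ x → 1ℤ * ∑ l (λ y → proj₁ x * proj₁ y * K (proj₂ x) (proj₂ y)) + c * ∑ l (λ y → proj₁ x * proj₁ y * K′ (proj₂ x) (proj₂ y)))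
      ≡⟨ trans (∑-lin₂ l 1ℤ _ c _) (cong (_+ c * form L K′) (ℤP.*-identityˡ (form L K))) ⟩
    form L K + c * form L K′ ∎
    where
    lem : ∀ g a c b → g * (a + c * b) ≡ 1ℤ * (g * a) + c * (g * b)
    lem = solve-∀

  form-1 : ∀ L → form L (λ _ _ → 1ℤ) ≡ ∑W L (λ g _ → g) * ∑W L (λ g _ → g)
  form-1 (l , _) = trans (∑-cong l (λ x → ∑-cong l (λ y → ℤP.*-identityʳ _))) (sym (∑-*∑ l l proj₁ proj₁))

  form-square : ∀ L {B : Set} (xs : List B) (k : B → T → ℤ) →
    form L (λ t t′ → ∑ xs (λ x → k x t * k x t′)) ≡ ∑ xs (λ x → ∑W L (λ g t → g * k x t) * ∑W L (λ g t → g * k x t))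
  form-square L@(l , _) xs k = sym (begin
    ∑ xs (λ x → ∑W L (λ g t → g * k x t) * ∑W L (λ g t → g * k x t))
      ≡⟨ ∑-cong xs (λ x → ∑-*∑ l l _ _) ⟩
    ∑ xs (λ x → ∑ l (λ y → ∑ l (λ z → proj₁ y * k x (proj₂ y) * (proj₁ z * k x (proj₂ z)))))
      ≡⟨ ∑-swap xs l _ ⟩
    ∑ l (λ y → ∑ xs (λ x → ∑ l (λ z → proj₁ y * k x (proj₂ y) * (proj₁ z * k x (proj₂ z)))))
      ≡⟨ ∑-cong l (λ y → trans (∑-swap xs l _) (∑-cong l (λ z → trans (∑-cong xs (λ x → lem (proj₁ y) (k x (proj₂ y)) (proj₁ z) (k x (proj₂ z))))
           (∑-*ˡ xs (proj₁ y * proj₁ z) _)))) ⟩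
    form L (λ t t′ → ∑ xs (λ x → k x t * k x t′)) ∎)
    where
    lem : ∀ a b c d → a * b * (c * d) ≡ a * c * (b * d)
    lem = solve-∀

  square-form≥0 : ∀ L {B : Set} (xs : List B) (k : B → T → ℤ) → 0ℤ ℤ.≤ form L (λ t t′ → ∑ xs (λ x → k x t * k x t′))
  square-form≥0 L xs k = subst (0ℤ ℤ.≤_) (sym (form-square L xs k)) (∑-nonneg xs (λ x → i²≥0 (∑W L (λ g t → g * k x t))))

  -- Schur test, from 2gg′ ≤ g² + g′².
  schur : ∀ L (K : T → T → ℤ) μ → (∀ t t′ → good t → good t′ → 0ℤ ℤ.≤ K t t′) → (∀ t t′ → K t t′ ≡ K t′ t) →
          (∀ t → good t → ∑ V (K t) ≡ μ) → form L K ℤ.≤ μ * ∑W L (λ g _ → g * g)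
  schur L@(l , _) K μ K≥0 K-sym rows = ℤP.*-cancelˡ-≤-pos (form L K) (μ * ∑W L (λ g _ → g * g)) (pos 2)
      (subst₂ ℤ._≤_ (lemˡ (form L K)) (lemʳ μ (∑W L (λ g _ → g * g))) (ℤP.0≤i-j⇒j≤i (subst (0ℤ ℤ.≤_) total nonneg)))
    where
    lemˡ : ∀ a → a + a ≡ pos 2 * a
    lemˡ = solve-∀
    lemʳ : ∀ μ a → μ * a + μ * a ≡ pos 2 * (μ * a)
    lemʳ = solve-∀
    Q : ℤ × T → ℤ × T → ℤ
    Q x y = (proj₁ x - proj₁ y) * (proj₁ x - proj₁ y) * K (proj₂ x) (proj₂ y)
    nonneg : 0ℤ ℤ.≤ ∑ l (λ x → ∑ l (Q x))
    nonneg = subst (ℤ._≤ ∑ l (λ x → ∑ l (Q x))) (∑-0 l) (∑-mono-All (goodW L) (λ x gx →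
      subst (ℤ._≤ ∑ l (Q x)) (∑-0 l) (∑-mono-All (goodW L) (λ y gy → i*j≥0 {(proj₁ x - proj₁ y) * (proj₁ x - proj₁ y)} (i²≥0 (proj₁ x - proj₁ y)) (K≥0 (proj₂ x) (proj₂ y) gx gy)))))
    expand : ∀ g h k → (g - h) * (g - h) * k ≡ (g * g * k + h * h * k) - (g * h * k + g * h * k)
    expand = solve-∀
    S : ℤ
    S = ∑W L (λ g _ → g * g)
    rowForm : ∑ l (λ x → ∑ l (λ y → proj₁ x * proj₁ x * K (proj₂ x) (proj₂ y))) ≡ μ * S
    rowForm = trans (∑-cong-All (goodW L) (λ x gx → trans (∑-*ˡ l (proj₁ x * proj₁ x) (λ y → K (proj₂ x) (proj₂ y)))
        (trans (cong (proj₁ x * proj₁ x *_) (trans (∑W-vertex L (K (proj₂ x))) (rows (proj₂ x) gx))) (ℤP.*-comm (proj₁ x * proj₁ x) μ))))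
      (∑-*ˡ l μ (λ x → proj₁ x * proj₁ x))
    colForm : ∑ l (λ x → ∑ l (λ y → proj₁ y * proj₁ y * K (proj₂ x) (proj₂ y))) ≡ μ * S
    colForm = trans (∑-swap l l _) (trans (∑-cong l (λ y → ∑-cong l (λ x → cong (proj₁ y * proj₁ y *_) (K-sym (proj₂ x) (proj₂ y))))) rowForm)
    total : ∑ l (λ x → ∑ l (Q x)) ≡ (μ * S + μ * S) - (form L K + form L K)
    total = begin
      ∑ l (λ x → ∑ l (Q x))
        ≡⟨ ∑-cong l (λ x → trans (∑-cong l (λ y → expand (proj₁ x) (proj₁ y) (K (proj₂ x) (proj₂ y))))
             (trans (∑-- l _ _) (cong₂ _-_ (∑-+ l _ _) (∑-+ l _ _)))) ⟩
      ∑ l (λ x → (a x + b x) - (c x + c x))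
        ≡⟨ trans (∑-- l _ _) (cong₂ _-_ (∑-+ l a b) (∑-+ l c c)) ⟩
      (∑ l a + ∑ l b) - (∑ l c + ∑ l c)
        ≡⟨ cong₂ (λ p q → (p + q) - (form L K + form L K)) rowForm colForm ⟩
      (μ * S + μ * S) - (form L K + form L K) ∎
      where
      a b c : ℤ × T → ℤ
      a x = ∑ l (λ y → proj₁ x * proj₁ x * K (proj₂ x) (proj₂ y))
      b x = ∑ l (λ y → proj₁ y * proj₁ y * K (proj₂ x) (proj₂ y))
      c x = ∑ l (λ y → proj₁ x * proj₁ y * K (proj₂ x) (proj₂ y))

module Bipartite {T : Set} (V : List T) (good : T → Set) (allGood : All good V)
                 (adj : T → T → Bool) (adj-sym : ∀ t t′ → adj t t′ ≡ adj t′ t)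
                 (d : ℤ) (regular : ∀ t → good t → ∑ V (λ t′ → ⟦ adj t t′ ⟧) ≡ d) where
  open QuadraticForms V good allGood
  open ≡-Reasoning

  a : T → T → ℤ
  a t t′ = ⟦ adj t t′ ⟧

  a-sym : ∀ t t′ → a t t′ ≡ a t′ t
  a-sym t t′ = cong ⟦_⟧ (adj-sym t t′)

  N : ℤ
  N = ∑ V (λ _ → 1ℤ)

  C : T → T → ℤ
  C t t′ = ∑ V (λ x → a x t * a x t′)

  C-sym : ∀ t t′ → C t t′ ≡ C t′ t
  C-sym t t′ = ∑-cong V (λ x → ℤP.*-comm (a x t) (a x t′))

  C≥0 : ∀ t t′ → 0ℤ ℤ.≤ C t t′
  C≥0 t t′ = ∑-nonneg V (λ x → i*j≥0 (⟦⟧-nonneg (adj x t)) (⟦⟧-nonneg (adj x t′)))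

  C-row : ∀ t → good t → ∑ V (C t) ≡ d * d
  C-row t gt = trans (∑-swap V V _) (trans (∑-cong-All allGood (λ x gx → trans (∑-*ˡ V (a x t) (a x)) (trans (cong (a x t *_) (regular x gx)) (cong (_* d) (a-sym x t)))))
    (trans (∑-*ʳ V d (a t)) (cong (_* d) (regular t gt))))

  -- U consists of the vertices labelled true; cut is e(U,W).
  module Labelling (p₁ p₂ : List Bool) (len₁ : length p₁ ≡ length V) (len₂ : length p₂ ≡ length V) where

    L₁ L₂ : List (Bool × T)
    L₁ = zip p₁ V
    L₂ = zip p₂ V

    x : Bool × T → ℤ
    x z = ⟦ proj₁ z ⟧

    u₁ u₂ e₁₁ : ℤ
    u₁ = ∑ L₁ x
    u₂ = ∑ L₂ x
    e₁₁ = ∑ L₁ (λ y → ∑ L₂ (λ z → x y * (x z * a (proj₂ y) (proj₂ z))))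

    β : T → ℤ
    β t = ∑ L₂ (λ z → x z * a t (proj₂ z))

    cut : ℤ
    cut = ∑ L₁ (λ y → x y * ∑ L₂ (λ z → (1ℤ - x z) * a (proj₂ y) (proj₂ z)))
        + ∑ L₂ (λ z → x z * ∑ L₁ (λ y → (1ℤ - x y) * a (proj₂ y) (proj₂ z)))

    ∑L₁β : ∑ L₁ (λ y → β (proj₂ y)) ≡ d * u₂
    ∑L₁β = trans (∑-zip₂ p₁ V len₁ β) (trans (∑-swap V L₂ _) (trans (∑-cong-All (All-zip₂ p₂ allGood) (λ z gz →
        trans (∑-*ˡ V (x z) (λ t → a t (proj₂ z))) (trans (cong (x z *_) (trans (∑-cong V (λ t → a-sym t (proj₂ z))) (regular (proj₂ z) gz))) (ℤP.*-comm (x z) d))))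
      (∑-*ˡ L₂ d x)))

    ∑xβ : ∑ L₁ (λ y → x y * β (proj₂ y)) ≡ e₁₁
    ∑xβ = ∑-cong L₁ (λ y → sym (∑-*ˡ L₂ (x y) _))

    complement : ∀ (L : List (Bool × T)) (g : T → ℤ) → ∑ L (λ z → (1ℤ - x z) * g (proj₂ z)) ≡ ∑ L (g ∘ proj₂) - ∑ L (λ z → x z * g (proj₂ z))
    complement L g = trans (∑-cong L (λ z → lem (x z) (g (proj₂ z)))) (∑-- L _ _)
      where
      lem : ∀ x g → (1ℤ - x) * g ≡ g - x * g
      lem = solve-∀

    -- Every vertex of U has d edges, and the `e₁₁` edges inside U are met from both ends.
    cut-formula : cut ≡ d * (u₁ + u₂) - (e₁₁ + e₁₁)
    cut-formula = begin
      cut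
        ≡⟨ cong₂ _+_ left right ⟩
      (d * u₁ - e₁₁) + (d * u₂ - e₁₁)
        ≡⟨ lem d u₁ u₂ e₁₁ ⟩
      d * (u₁ + u₂) - (e₁₁ + e₁₁) ∎
      where
      lem : ∀ d u v e → (d * u - e) + (d * v - e) ≡ d * (u + v) - (e + e)
      lem = solve-∀
      lem₂ : ∀ x d b → x * (d - b) ≡ d * x - x * b
      lem₂ = solve-∀
      left : ∑ L₁ (λ y → x y * ∑ L₂ (λ z → (1ℤ - x z) * a (proj₂ y) (proj₂ z))) ≡ d * u₁ - e₁₁
      left = trans (∑-cong-All (All-zip₂ p₁ allGood) (λ y gy → trans (cong (x y *_) (trans (complement L₂ (a (proj₂ y)))
            (cong (_- β (proj₂ y)) (trans (∑-zip₂ p₂ V len₂ (a (proj₂ y))) (regular (proj₂ y) gy))))) (lem₂ (x y) d (β (proj₂ y)))))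
          (trans (∑-- L₁ _ _) (cong₂ _-_ (∑-*ˡ L₁ d x) ∑xβ))
      right : ∑ L₂ (λ z → x z * ∑ L₁ (λ y → (1ℤ - x y) * a (proj₂ y) (proj₂ z))) ≡ d * u₂ - e₁₁
      right = trans (∑-cong-All (All-zip₂ p₂ allGood) (λ z gz → trans (cong (x z *_) (trans (complement L₁ (λ t → a t (proj₂ z)))
            (cong (_- ∑ L₁ (λ y → x y * a (proj₂ y) (proj₂ z))) (trans (∑-zip₂ p₁ V len₁ (λ t → a t (proj₂ z))) (trans (∑-cong V (λ t → a-sym t (proj₂ z))) (regular (proj₂ z) gz))))))
            (lem₂ (x z) d (∑ L₁ (λ y → x y * a (proj₂ y) (proj₂ z))))))
          (trans (∑-- L₂ _ _) (cong₂ _-_ (∑-*ˡ L₂ d x) (trans (∑-cong L₂ (λ z → trans (sym (∑-*ˡ L₁ (x z) _))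
            (∑-cong L₁ (λ y → lem₃ (x z) (x y) (a (proj₂ y) (proj₂ z)))))) (∑-swap L₂ L₁ _))))
        where
        lem₃ : ∀ a b c → a * (b * c) ≡ b * (a * c)
        lem₃ = solve-∀

    cut≥0 : 0ℤ ℤ.≤ cut
    cut≥0 = ℤP.+-mono-≤ (∑-nonneg L₁ (λ y → i*j≥0 (⟦⟧-nonneg (proj₁ y)) (∑-nonneg L₂ (λ z → i*j≥0 (nn z) (⟦⟧-nonneg _)))))
                        (∑-nonneg L₂ (λ z → i*j≥0 (⟦⟧-nonneg (proj₁ z)) (∑-nonneg L₁ (λ y → i*j≥0 (nn y) (⟦⟧-nonneg _)))))
      where
      nn : ∀ z → 0ℤ ℤ.≤ 1ℤ - x z
      nn (true  , _) = ℤP.≤-refl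
      nn (false , _) = ℤ.+≤+ z≤n

    -- r/s is a rational upper bound for √μ, kept as a pair of integers.
    module Lower (μ : ℤ) (spectral : ∀ (L : Weighted) → ∑W L (λ g _ → g) ≡ 0ℤ →
                    ∑ V (λ t → ∑W L (λ g t′ → g * a t t′) * ∑W L (λ g t′ → g * a t t′)) ℤ.≤ μ * ∑W L (λ g _ → g * g))
                 (r s : ℤ) (r>0 : 0ℤ ℤ.< r) (s≥0 : 0ℤ ℤ.≤ s) (N>0 : 0ℤ ℤ.< N) (μ≤ : s * s * μ ℤ.≤ r * r) where

      -- The indicator of U on the second side minus its mean, scaled by N to remain integral.
      G₂ : Weighted
      G₂ = map (λ z → N * x z - u₂ , proj₂ z) L₂ , trans (sym (ListP.map-∘ L₂)) (zip₂ p₂ V len₂)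

      ∑L₁1 : ∑ L₁ (λ _ → 1ℤ) ≡ N
      ∑L₁1 = ∑-zip₂ p₁ V len₁ (λ _ → 1ℤ)

      ∑L₂1 : ∑ L₂ (λ _ → 1ℤ) ≡ N
      ∑L₂1 = ∑-zip₂ p₂ V len₂ (λ _ → 1ℤ)

      ∑W-G₂ : ∀ f → ∑W G₂ f ≡ ∑ L₂ (λ z → f (N * x z - u₂) (proj₂ z))
      ∑W-G₂ f = ∑-map _ L₂ (λ y → f (proj₁ y) (proj₂ y))

      affine : ∀ (L : List (Bool × T)) c F e → ∑ L (λ _ → 1ℤ) ≡ N → ∑ L (λ z → c * F z - e) ≡ c * ∑ L F - e * N
      affine L c F e h = trans (∑-cong L (λ z → lem c (F z) e)) (trans (∑-lin₂ L c F (- e) (λ _ → 1ℤ)) (trans (cong (λ n → c * ∑ L F + - e * n) h) (lem′ (c * ∑ L F) e N)))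
        where
        lem : ∀ c f e → c * f - e ≡ c * f + - e * 1ℤ
        lem = solve-∀
        lem′ : ∀ a e n → a + - e * n ≡ a - e * n
        lem′ = solve-∀

      centred : ∑W G₂ (λ g _ → g) ≡ 0ℤ
      centred = trans (∑W-G₂ (λ g _ → g)) (trans (affine L₂ N x u₂ ∑L₂1) (lem N u₂))
        where
        lem : ∀ n u → n * u - u * n ≡ 0ℤ
        lem = solve-∀

      squares : ∀ (L : List (Bool × T)) u → u ≡ ∑ L x → ∑ L (λ _ → 1ℤ) ≡ N → ∑ L (λ z → (N * x z - u) * (N * x z - u)) ≡ N * (u * (N - u))
      squares L u refl h = begin
        ∑ L (λ z → (N * x z - u) * (N * x z - u))
          ≡⟨ ∑-cong L (λ z → trans (lem N (x z) u) (cong (λ w → (N * N) * w + (u * u - (N * u + N * u) * x z)) (⟦⟧-idem (proj₁ z)))) ⟩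
        ∑ L (λ z → (N * N) * x z + (u * u - (N * u + N * u) * x z))
          ≡⟨ ∑-cong L (λ z → lem₂ N (x z) u) ⟩
        ∑ L (λ z → (N * N - (N * u + N * u)) * x z + (u * u) * 1ℤ)
          ≡⟨ trans (∑-lin₂ L (N * N - (N * u + N * u)) x (u * u) (λ _ → 1ℤ)) (cong (λ n → (N * N - (N * u + N * u)) * u + (u * u) * n) h) ⟩
        (N * N - (N * u + N * u)) * u + (u * u) * N
          ≡⟨ lem₃ N u ⟩
        N * (u * (N - u)) ∎
        where
        lem : ∀ n x u → (n * x - u) * (n * x - u) ≡ (n * n) * (x * x) + (u * u - (n * u + n * u) * x)
        lem = solve-∀
        lem₂ : ∀ n x u → (n * n) * x + (u * u - (n * u + n * u) * x) ≡ (n * n - (n * u + n * u)) * x + (u * u) * 1ℤ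
        lem₂ = solve-∀
        lem₃ : ∀ n u → (n * n - (n * u + n * u)) * u + (u * u) * n ≡ n * (u * (n - u))
        lem₃ = solve-∀

      h : T → ℤ
      h t = N * β t - u₂ * d

      h-eq : ∀ t → good t → ∑W G₂ (λ g t′ → g * a t t′) ≡ h t
      h-eq t gt = trans (∑W-G₂ (λ g t′ → g * a t t′)) (trans (∑-cong L₂ (λ z → lem N (x z) u₂ (a t (proj₂ z))))
        (trans (∑-lin₂ L₂ N _ (- u₂) (λ z → a t (proj₂ z))) (trans (cong (λ w → N * β t + - u₂ * w) (trans (∑-zip₂ p₂ V len₂ (a t)) (regular t gt))) (lem′ (N * β t) u₂ d))))
        where
        lem : ∀ n x u a → (n * x - u) * a ≡ n * (x * a) + - u * a
        lem = solve-∀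
        lem′ : ∀ a u d → a + - u * d ≡ a - u * d
        lem′ = solve-∀

      Sff Sgg Shh Sfh : ℤ
      Sff = N * (u₁ * (N - u₁))
      Sgg = N * (u₂ * (N - u₂))
      Shh = ∑ V (λ t → h t * h t)
      Sfh = ∑ L₁ (λ y → (N * x y - u₁) * h (proj₂ y))

      Sgg-eq : ∑W G₂ (λ g _ → g * g) ≡ Sgg
      Sgg-eq = trans (∑W-G₂ (λ g _ → g * g)) (squares L₂ u₂ refl ∑L₂1)

      Sgg≥0 : 0ℤ ℤ.≤ Sgg
      Sgg≥0 = subst (0ℤ ℤ.≤_) (squares L₂ u₂ refl ∑L₂1) (∑-nonneg L₂ (λ z → i²≥0 (N * x z - u₂)))

      Shh≤ : Shh ℤ.≤ μ * Sgg
      Shh≤ = subst₂ ℤ._≤_ (∑-cong-All allGood (λ t gt → cong₂ _*_ (h-eq t gt) (h-eq t gt))) (cong (μ *_) Sgg-eq) (spectral G₂ centred)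

      Sfh-eq : Sfh ≡ N * (N * e₁₁ - d * (u₁ * u₂))
      Sfh-eq = begin
        ∑ L₁ (λ y → (N * x y - u₁) * (N * β (proj₂ y) - u₂ * d))
          ≡⟨ ∑-cong L₁ (λ y → lem N (x y) u₁ (β (proj₂ y)) (u₂ * d)) ⟩
        ∑ L₁ (λ y → 1ℤ * ((N * N) * (x y * β (proj₂ y)) + (- (u₁ * N)) * β (proj₂ y)) + 1ℤ * ((- (N * (u₂ * d))) * x y + (u₁ * (u₂ * d)) * 1ℤ))
          ≡⟨ ∑-lin₂ L₁ 1ℤ _ 1ℤ _ ⟩
        1ℤ * ∑ L₁ (λ y → (N * N) * (x y * β (proj₂ y)) + (- (u₁ * N)) * β (proj₂ y)) + 1ℤ * ∑ L₁ (λ y → (- (N * (u₂ * d))) * x y + (u₁ * (u₂ * d)) * 1ℤ)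
          ≡⟨ cong₂ (λ p q → 1ℤ * p + 1ℤ * q) (∑-lin₂ L₁ (N * N) _ (- (u₁ * N)) _) (∑-lin₂ L₁ (- (N * (u₂ * d))) x (u₁ * (u₂ * d)) (λ _ → 1ℤ)) ⟩
        1ℤ * ((N * N) * ∑ L₁ (λ y → x y * β (proj₂ y)) + (- (u₁ * N)) * ∑ L₁ (λ y → β (proj₂ y))) + 1ℤ * ((- (N * (u₂ * d))) * u₁ + (u₁ * (u₂ * d)) * ∑ L₁ (λ _ → 1ℤ))
          ≡⟨ cong₂ (λ p q → 1ℤ * p + 1ℤ * q) (cong₂ (λ p q → (N * N) * p + (- (u₁ * N)) * q) ∑xβ ∑L₁β) (cong (λ n → (- (N * (u₂ * d))) * u₁ + (u₁ * (u₂ * d)) * n) ∑L₁1) ⟩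
        1ℤ * ((N * N) * e₁₁ + (- (u₁ * N)) * (d * u₂)) + 1ℤ * ((- (N * (u₂ * d))) * u₁ + (u₁ * (u₂ * d)) * N)
          ≡⟨ lem₂ N e₁₁ u₁ u₂ d ⟩
        N * (N * e₁₁ - d * (u₁ * u₂)) ∎
        where
        lem : ∀ n x u b w → (n * x - u) * (n * b - w) ≡ 1ℤ * ((n * n) * (x * b) + (- (u * n)) * b) + 1ℤ * ((- (n * w)) * x + (u * w) * 1ℤ)
        lem = solve-∀
        lem₂ : ∀ n e u v d → 1ℤ * ((n * n) * e + (- (u * n)) * (d * v)) + 1ℤ * ((- (n * (v * d))) * u + (u * (v * d)) * n) ≡ n * (n * e - d * (u * v))
        lem₂ = solve-∀

      -- With f and g the centred indicators on the two sides and h = A g, nonnegativity of |r f - s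
      -- h|² gives 2rs⟨f, h⟩ ≤ r²|f|² + s²|h|². As s²|h|² ≤ s²μ|g|² ≤ r²|g|², a factor r cancels and
      -- the inner product is bounded without a square root.
      expansion : ∑ L₁ (λ y → (r * (N * x y - u₁) - s * h (proj₂ y)) * (r * (N * x y - u₁) - s * h (proj₂ y)))
                  ≡ (r * r * Sff + s * s * Shh) - (r * s * Sfh + r * s * Sfh)
      expansion = begin
        ∑ L₁ (λ y → (r * f y - s * h (proj₂ y)) * (r * f y - s * h (proj₂ y)))
          ≡⟨ ∑-cong L₁ (λ y → lem r s (f y) (h (proj₂ y))) ⟩
        ∑ L₁ (λ y → (r * r * (f y * f y) + s * s * (h (proj₂ y) * h (proj₂ y))) - (r * s * (f y * h (proj₂ y)) + r * s * (f y * h (proj₂ y))))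
          ≡⟨ trans (∑-- L₁ _ _) (cong₂ _-_ (∑-lin₂ L₁ (r * r) _ (s * s) _) (∑-lin₂ L₁ (r * s) _ (r * s) _)) ⟩
        (r * r * ∑ L₁ (λ y → f y * f y) + s * s * ∑ L₁ (λ y → h (proj₂ y) * h (proj₂ y))) - (r * s * Sfh + r * s * Sfh)
          ≡⟨ cong₂ (λ p q → (r * r * p + s * s * q) - (r * s * Sfh + r * s * Sfh)) (squares L₁ u₁ refl ∑L₁1) (∑-zip₂ p₁ V len₁ (λ t → h t * h t)) ⟩
        (r * r * Sff + s * s * Shh) - (r * s * Sfh + r * s * Sfh) ∎
        where
        f : Bool × T → ℤ
        f y = N * x y - u₁
        lem : ∀ r s f h → (r * f - s * h) * (r * f - s * h) ≡ (r * r * (f * f) + s * s * (h * h)) - (r * s * (f * h) + r * s * (f * h))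
        lem = solve-∀

      step₁ : r * s * Sfh + r * s * Sfh ℤ.≤ r * r * Sff + s * s * Shh
      step₁ = ℤP.0≤i-j⇒j≤i (subst (0ℤ ℤ.≤_) expansion (∑-nonneg L₁ (λ y → i²≥0 (r * (N * x y - u₁) - s * h (proj₂ y)))))

      step₂ : s * s * Shh ℤ.≤ r * r * Sgg
      step₂ = ℤP.≤-trans (ℤP.*-monoˡ-≤-nonNeg (s * s) ⦃ ℤ.nonNegative (i²≥0 s) ⦄ Shh≤)
        (subst (ℤ._≤ r * r * Sgg) (ℤP.*-assoc (s * s) μ Sgg) (ℤP.*-monoʳ-≤-nonNeg Sgg ⦃ ℤ.nonNegative Sgg≥0 ⦄ μ≤))

      step₃ : s * Sfh + s * Sfh ℤ.≤ r * (Sff + Sgg)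
      step₃ = ℤP.*-cancelˡ-≤-pos (s * Sfh + s * Sfh) (r * (Sff + Sgg)) r ⦃ ℤ.positive r>0 ⦄
        (subst₂ ℤ._≤_ (lem r s Sfh) (lem′ r Sff Sgg) (ℤP.≤-trans step₁ (ℤP.+-monoʳ-≤ (r * r * Sff) step₂)))
        where
        lem : ∀ r s f → r * s * f + r * s * f ≡ r * (s * f + s * f)
        lem = solve-∀
        lem′ : ∀ r a b → r * r * a + r * r * b ≡ r * (r * (a + b))
        lem′ = solve-∀

      step₄ : s * (N * e₁₁ - d * (u₁ * u₂)) + s * (N * e₁₁ - d * (u₁ * u₂)) ℤ.≤ r * (u₁ * (N - u₁) + u₂ * (N - u₂))
      step₄ = ℤP.*-cancelˡ-≤-pos _ _ N ⦃ ℤ.positive N>0 ⦄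
        (subst₂ ℤ._≤_ (trans (cong (λ z → s * z + s * z) Sfh-eq) (lem N s (N * e₁₁ - d * (u₁ * u₂)))) (lem′ N r (u₁ * (N - u₁)) (u₂ * (N - u₂))) step₃)
        where
        lem : ∀ n s z → s * (n * z) + s * (n * z) ≡ n * (s * z + s * z)
        lem = solve-∀
        lem′ : ∀ n r a b → r * (n * a + n * b) ≡ n * (r * (a + b))
        lem′ = solve-∀

      u w : ℤ
      u = u₁ + u₂
      w = (N + N) - u

      -- Twice `step₄`, with `e₁₁` eliminated through `cut-formula`. The sizes u and w of the two
      -- parts separate from the imbalance u₁ - u₂, whose square can only help when s d ≥ r.
      cut-bound : (s * d - r) * (u * w) + (s * d + r) * ((u₁ - u₂) * (u₁ - u₂)) ℤ.≤ pos 2 * s * cut * N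
      cut-bound = subst₂ ℤ._≤_ (lem s d r N u₁ u₂) (trans (lem′ s d N u₁ u₂ e₁₁) (cong (λ c → pos 2 * s * c * N) (sym cut-formula)))
        (ℤP.+-monoʳ-≤ (pos 2 * s * N * d * (u₁ + u₂) - pos 4 * s * d * (u₁ * u₂)) (ℤP.neg-mono-≤ (ℤP.+-mono-≤ step₄ step₄)))
        where
        lem : ∀ s d r n u v → (pos 2 * s * n * d * (u + v) - pos 4 * s * d * (u * v)) + - (r * (u * (n - u) + v * (n - v)) + r * (u * (n - u) + v * (n - v)))
              ≡ (s * d - r) * ((u + v) * ((n + n) - (u + v))) + (s * d + r) * ((u - v) * (u - v))
        lem = solve-∀
        lem′ : ∀ s d n u v e → (pos 2 * s * n * d * (u + v) - pos 4 * s * d * (u * v)) + - ((s * (n * e - d * (u * v)) + s * (n * e - d * (u * v))) + (s * (n * e - d * (u * v)) + s * (n * e - d * (u * v))))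
              ≡ pos 2 * s * (d * (u + v) - (e + e)) * n
        lem′ = solve-∀

      -- Here k is the size of the smaller part. For s d < r the left side is not positive;
      -- otherwise it remains to compare k N with u w.
      bound : ∀ k → 0ℤ ℤ.≤ k → k ℤ.≤ u → k ℤ.≤ w → (s * d - r) * k ℤ.≤ pos 2 * s * cut
      bound k k≥0 k≤u k≤w with ℤP.≤-total 0ℤ (s * d - r)
      ... | inj₂ neg = ℤP.≤-trans (subst₂ ℤ._≤_ (ℤP.*-comm k (s * d - r)) (ℤP.*-zeroʳ k) (ℤP.*-monoˡ-≤-nonNeg k ⦃ ℤ.nonNegative k≥0 ⦄ neg))
                         (i*j≥0 {pos 2 * s} (i*j≥0 {pos 2} {s} (ℤ.+≤+ z≤n) s≥0) cut≥0)
      ... | inj₁ nn = ℤP.*-cancelʳ-≤-pos ((s * d - r) * k) (pos 2 * s * cut) N ⦃ ℤ.positive N>0 ⦄ (ℤP.≤-trans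
            (ℤP.≤-trans (subst (ℤ._≤ (s * d - r) * (u * w)) (sym (ℤP.*-assoc (s * d - r) k N)) (ℤP.*-monoˡ-≤-nonNeg (s * d - r) ⦃ ℤ.nonNegative nn ⦄ kN≤uw))
              (subst (ℤ._≤ (s * d - r) * (u * w) + (s * d + r) * ((u₁ - u₂) * (u₁ - u₂))) (ℤP.+-identityʳ _)
                (ℤP.+-monoʳ-≤ ((s * d - r) * (u * w)) (i*j≥0 {s * d + r} sd+r≥0 (i²≥0 (u₁ - u₂))))))
            cut-bound)
        where
        sd+r≥0 : 0ℤ ℤ.≤ s * d + r
        sd+r≥0 = subst (0ℤ ℤ.≤_) (lem (s * d) r) (ℤP.+-mono-≤ nn (ℤP.+-mono-≤ (ℤP.<⇒≤ r>0) (ℤP.<⇒≤ r>0)))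
          where
          lem : ∀ a r → (a - r) + (r + r) ≡ a + r
          lem = solve-∀
        k≤N : k ℤ.≤ N
        k≤N = ℤP.*-cancelˡ-≤-pos k N (pos 2) (subst₂ ℤ._≤_ (lem k) (lem′ u N) (ℤP.+-mono-≤ k≤u k≤w))
          where
          lem : ∀ k → k + k ≡ pos 2 * k
          lem = solve-∀
          lem′ : ∀ u n → u + ((n + n) - u) ≡ pos 2 * n
          lem′ = solve-∀
        -- Because u + w = 2N, the difference u w - k N equals (u - k)(w - k) + k (N - k).
        kN≤uw : k * N ℤ.≤ u * w
        kN≤uw = ℤP.0≤i-j⇒j≤i (subst (0ℤ ℤ.≤_) (lem u k N) (ℤP.+-mono-≤ (i*j≥0 {u - k} {w - k} (ℤP.i≤j⇒0≤j-i k≤u) (ℤP.i≤j⇒0≤j-i k≤w)) (i*j≥0 {k} {N - k} k≥0 (ℤP.i≤j⇒0≤j-i k≤N))))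
          where
          lem : ∀ u k n → (u - k) * (((n + n) - u) - k) + k * (n - k) ≡ u * ((n + n) - u) - k * n
          lem = solve-∀

  -- C = Ek + tc (J - Pk), where the entry `1ℤ` stands for J. On functions of sum zero J drops out,
  -- and a positive semidefinite Pk only lowers the form, so the Schur bound for Ek is a bound for
  -- C.
  module Kernel (Ek Pk : T → T → ℤ) (tc μ : ℤ) (tc≥0 : 0ℤ ℤ.≤ tc)
                (decomp : ∀ t t′ → good t → good t′ → C t t′ ≡ Ek t t′ + tc * (1ℤ + -1ℤ * Pk t t′))
                (Ek≥0 : ∀ t t′ → good t → good t′ → 0ℤ ℤ.≤ Ek t t′) (Ek-sym : ∀ t t′ → Ek t t′ ≡ Ek t′ t)
                (rows : ∀ t → good t → ∑ V (Ek t) ≡ μ) where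

    spectral : (∀ L → 0ℤ ℤ.≤ form L Pk) → ∀ (L : Weighted) → ∑W L (λ g _ → g) ≡ 0ℤ →
      ∑ V (λ t → ∑W L (λ g t′ → g * a t t′) * ∑W L (λ g t′ → g * a t t′)) ℤ.≤ μ * ∑W L (λ g _ → g * g)
    spectral psd L centred = ℤP.≤-trans (ℤP.≤-reflexive expand) (ℤP.≤-trans
        (ℤP.≤-trans (ℤP.+-monoʳ-≤ (form L Ek) (subst (- (tc * form L Pk) ℤ.≤_) refl (ℤP.neg-mono-≤ (i*j≥0 {tc} tc≥0 (psd L))))) (ℤP.≤-reflexive (ℤP.+-identityʳ (form L Ek))))
        (schur L Ek μ Ek≥0 Ek-sym rows))
      where
      lem : ∀ e t p → e + t * (0ℤ * 0ℤ + -1ℤ * p) ≡ e + - (t * p)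
      lem = solve-∀
      expand : ∑ V (λ t → ∑W L (λ g t′ → g * a t t′) * ∑W L (λ g t′ → g * a t t′)) ≡ form L Ek + - (tc * form L Pk)
      expand = begin
        ∑ V (λ t → ∑W L (λ g t′ → g * a t t′) * ∑W L (λ g t′ → g * a t t′))
          ≡⟨ sym (form-square L V a) ⟩
        form L C
          ≡⟨ form-cong L decomp ⟩
        form L (λ t t′ → Ek t t′ + tc * (1ℤ + -1ℤ * Pk t t′))
          ≡⟨ form-lin L Ek (λ t t′ → 1ℤ + -1ℤ * Pk t t′) tc ⟩
        form L Ek + tc * form L (λ t t′ → 1ℤ + -1ℤ * Pk t t′)
          ≡⟨ cong (λ z → form L Ek + tc * z) (trans (form-lin L (λ _ _ → 1ℤ) Pk -1ℤ) (cong (_+ -1ℤ * form L Pk) (trans (form-1 L) (cong₂ _*_ centred centred)))) ⟩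
        form L Ek + tc * (0ℤ * 0ℤ + -1ℤ * form L Pk)
          ≡⟨ lem (form L Ek) tc (form L Pk) ⟩
        form L Ek + - (tc * form L Pk) ∎

    -- `Ek-f` says that f is constant on the support of each row of Ek, so Ek f = μ f. With Pk f = ρ
    -- f and J f = 0, the eigenvalue of C at f is μ - tc ρ.
    module Eigen (f : T → ℤ) (f² : ∀ t → good t → f t * f t ≡ 1ℤ) (∑f≡0 : ∑ V f ≡ 0ℤ)
                 (Ek-f : ∀ t t′ → good t → good t′ → Ek t t′ * f t′ ≡ Ek t t′ * f t)
                 (ρ : ℤ) (Pk-f : ∀ t → good t → ∑ V (λ t′ → Pk t t′ * f t′) ≡ ρ * f t) where

      S : T → ℤ
      S t = ∑ V (λ t′ → f t′ * a t t′)

      C-f : ∀ t → good t → ∑ V (λ t′ → C t t′ * f t′) ≡ (μ - tc * ρ) * f t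
      C-f t gt = begin
        ∑ V (λ t′ → C t t′ * f t′)
          ≡⟨ ∑-cong-All allGood (λ t′ gt′ → trans (cong (_* f t′) (decomp t t′ gt gt′)) (trans (lem (Ek t t′) tc (Pk t t′) (f t′)) (cong (_+ tc * (1ℤ * f t′ + -1ℤ * (Pk t t′ * f t′))) (Ek-f t t′ gt gt′)))) ⟩
        ∑ V (λ t′ → Ek t t′ * f t + tc * (1ℤ * f t′ + -1ℤ * (Pk t t′ * f t′)))
          ≡⟨ trans (∑-+ V _ _) (cong₂ _+_ (trans (∑-*ʳ V (f t) (Ek t)) (cong (_* f t) (rows t gt)))
               (trans (∑-*ˡ V tc _) (cong (tc *_) (trans (∑-lin₂ V 1ℤ f -1ℤ (λ t′ → Pk t t′ * f t′)) (cong₂ (λ p q → 1ℤ * p + -1ℤ * q) ∑f≡0 (Pk-f t gt)))))) ⟩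
        μ * f t + tc * (1ℤ * 0ℤ + -1ℤ * (ρ * f t))
          ≡⟨ lem′ μ (f t) tc ρ ⟩
        (μ - tc * ρ) * f t ∎
        where
        lem : ∀ e c p f → (e + c * (1ℤ + -1ℤ * p)) * f ≡ e * f + c * (1ℤ * f + -1ℤ * (p * f))
        lem = solve-∀
        lem′ : ∀ μ f c ρ → μ * f + c * (1ℤ * 0ℤ + -1ℤ * (ρ * f)) ≡ (μ - c * ρ) * f
        lem′ = solve-∀

      ∑S² : ∑ V (λ t → S t * S t) ≡ (μ - tc * ρ) * N
      ∑S² = begin
        ∑ V (λ t → S t * S t)
          ≡⟨ ∑-cong V (λ t → cong (λ z → z * z) (sym (∑-map (λ t → f t , t) V (λ x → proj₁ x * a t (proj₂ x))))) ⟩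
        ∑ V (λ t → ∑W L (λ g t′ → g * a t t′) * ∑W L (λ g t′ → g * a t t′))
          ≡⟨ sym (form-square L V a) ⟩
        form L C
          ≡⟨ trans (∑-map (λ t → f t , t) V _) (∑-cong V (λ t → ∑-map (λ t → f t , t) V _)) ⟩
        ∑ V (λ t → ∑ V (λ t′ → f t * f t′ * C t t′))
          ≡⟨ ∑-cong-All allGood (λ t gt → trans (∑-cong V (λ t′ → lem (f t) (f t′) (C t t′))) (trans (∑-*ˡ V (f t) _) (trans (cong (f t *_) (C-f t gt))
               (trans (lem″ (f t) (μ - tc * ρ)) (cong ((μ - tc * ρ) *_) (f² t gt)))))) ⟩
        ∑ V (λ t → (μ - tc * ρ) * 1ℤ)
          ≡⟨ ∑-*ˡ V (μ - tc * ρ) (λ _ → 1ℤ) ⟩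
        (μ - tc * ρ) * N ∎
        where
        L : Weighted
        L = map (λ t → f t , t) V , trans (sym (ListP.map-∘ V)) (ListP.map-id V)
        lem : ∀ a b c → a * b * c ≡ a * (c * b)
        lem = solve-∀
        lem″ : ∀ f m → f * (m * f) ≡ m * (f * f)
        lem″ = solve-∀

      -- Multiplicativity gives S = A f only up to an unknown constant: c S = g s with g = ±1. The
      -- second moment `∑S²` fixes s² = (c λ′)², and G absorbs the remaining sign.
      signs : ∀ c g s λ′ → c ≢ 0ℤ → N ≢ 0ℤ → (∀ t → good t → g t ≡ 1ℤ ⊎ g t ≡ -1ℤ) → (∀ t → good t → c * S t ≡ g t * s) →
              λ′ * λ′ ≡ μ - tc * ρ →
              ∃ λ (G : T → ℤ) → (∀ t → good t → G t ≡ 1ℤ ⊎ G t ≡ -1ℤ) × (∀ t → good t → S t ≡ G t * λ′)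
      signs c g s λ′ c≢0 N≢0 g± cS λ² = conclude (ℤP.i*j≡0⇒i≡0∨j≡0 (s - c * λ′) prod)
        where
        total : N * (s * s) ≡ N * ((c * λ′) * (c * λ′))
        total = begin
          N * (s * s)                               ≡⟨ ℤP.*-comm N (s * s) ⟩
          (s * s) * N                               ≡⟨ sym (∑-*ˡ V (s * s) (λ _ → 1ℤ)) ⟩
          ∑ V (λ t → s * s * 1ℤ)                    ≡⟨ ∑-cong-All allGood (λ t gt → sym (trans (cong₂ _*_ (cS t gt) (cS t gt)) (trans (lem₁ (g t) s) (cong (s * s *_) (±1² (g± t gt)))))) ⟩
          ∑ V (λ t → (c * S t) * (c * S t))         ≡⟨ trans (∑-cong V (λ t → lem₂ c (S t))) (∑-*ˡ V (c * c) (λ t → S t * S t)) ⟩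
          c * c * ∑ V (λ t → S t * S t)             ≡⟨ cong (c * c *_) (trans ∑S² (cong (_* N) (sym λ²))) ⟩
          c * c * (λ′ * λ′ * N)                     ≡⟨ lem₃ c λ′ N ⟩
          N * ((c * λ′) * (c * λ′)) ∎
          where
          lem₁ : ∀ g s → g * s * (g * s) ≡ s * s * (g * g)
          lem₁ = solve-∀
          lem₂ : ∀ c s → c * s * (c * s) ≡ c * c * (s * s)
          lem₂ = solve-∀
          lem₃ : ∀ c l n → c * c * (l * l * n) ≡ n * ((c * l) * (c * l))
          lem₃ = solve-∀
        lem₀ : ∀ a b → (a - b) * (a + b) ≡ a * a - b * b
        lem₀ = solve-∀
        prod : (s - c * λ′) * (s + c * λ′) ≡ 0ℤ
        prod = trans (lem₀ s (c * λ′)) (trans (cong (_- (c * λ′) * (c * λ′)) (cancel-≢0 N≢0 total)) (ℤP.+-inverseʳ ((c * λ′) * (c * λ′))))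
        lem₊ : ∀ g c l → g * (c * l) ≡ c * (g * l)
        lem₊ = solve-∀
        lem₋ : ∀ g c l → g * (- (c * l)) ≡ c * (- g * l)
        lem₋ = solve-∀
        lem₁ : ∀ s b → s ≡ (s + b) - b
        lem₁ = solve-∀
        conclude : s - c * λ′ ≡ 0ℤ ⊎ s + c * λ′ ≡ 0ℤ →
                   ∃ λ (G : T → ℤ) → (∀ t → good t → G t ≡ 1ℤ ⊎ G t ≡ -1ℤ) × (∀ t → good t → S t ≡ G t * λ′)
        conclude (inj₁ z) = g , g± , λ t gt → cancel-≢0 c≢0 (trans (cS t gt) (trans (cong (g t *_) (ℤP.i-j≡0⇒i≡j s (c * λ′) z)) (lem₊ (g t) c λ′)))
        conclude (inj₂ z) = (λ t → - g t) , (λ t gt → Sum.swap (Sum.map (cong (λ z → - z)) (cong (λ z → - z)) (g± t gt))) ,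
            λ t gt → cancel-≢0 c≢0 (trans (cS t gt) (trans (cong (g t *_) s≡) (lem₋ (g t) c λ′)))
          where
          s≡ : s ≡ - (c * λ′)
          s≡ = trans (lem₁ s (c * λ′)) (trans (cong (_- c * λ′) z) (ℤP.+-identityˡ (- (c * λ′))))

      module Extremal (λ′ : ℤ) (λ≢0 : λ′ ≢ 0ℤ) (f± : ∀ t → good t → f t ≡ 1ℤ ⊎ f t ≡ -1ℤ)
                      (G : T → ℤ) (G± : ∀ t → good t → G t ≡ 1ℤ ⊎ G t ≡ -1ℤ) (SG : ∀ t → good t → S t ≡ G t * λ′) where

        label : (T → ℤ) → T → Bool
        label h t = does (h t ℤP.≟ 1ℤ)

        label-± : ∀ h t → h t ≡ 1ℤ ⊎ h t ≡ -1ℤ → pos 2 * ⟦ label h t ⟧ ≡ 1ℤ + h t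
        label-± h t (inj₁ e) = trans (cong (λ b → pos 2 * ⟦ b ⟧) (dec-true (h t ℤP.≟ 1ℤ) e)) (sym (cong (1ℤ +_) e))
        label-± h t (inj₂ e) = trans (cong (λ b → pos 2 * ⟦ b ⟧) (dec-false (h t ℤP.≟ 1ℤ) (λ e′ → contradiction (trans (sym e) e′) λ ()))) (sym (cong (1ℤ +_) e))

        p₁ p₂ : List Bool
        p₁ = map (label G) V
        p₂ = map (label f) V

        len₁ : length p₁ ≡ length V
        len₁ = ListP.length-map (label G) V

        len₂ : length p₂ ≡ length V
        len₂ = ListP.length-map (label f) V

        open Labelling p₁ p₂ len₁ len₂

        ∑-zip-label : ∀ h (F : Bool × T → ℤ) → ∑ (zip (map (label h) V) V) F ≡ ∑ V (λ t → F (label h t , t))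
        ∑-zip-label h F = go V
          where
          go : ∀ V → ∑ (zip (map (label h) V) V) F ≡ ∑ V (λ t → F (label h t , t))
          go []      = refl
          go (t ∷ V) = cong (F (label h t , t) +_) (go V)

        -- A f = λ′ G, and all column sums of A are d, so λ′ ∑ G = d ∑ f = 0.
        ∑G≡0 : ∑ V G ≡ 0ℤ
        ∑G≡0 = cancel-≢0 λ≢0 (begin
          λ′ * ∑ V G                               ≡⟨ sym (∑-*ˡ V λ′ G) ⟩
          ∑ V (λ t → λ′ * G t)                     ≡⟨ ∑-cong-All allGood (λ t gt → trans (ℤP.*-comm λ′ (G t)) (sym (SG t gt))) ⟩
          ∑ V S                                    ≡⟨ ∑-swap V V _ ⟩
          ∑ V (λ t′ → ∑ V (λ t → f t′ * a t t′))   ≡⟨ ∑-cong-All allGood (λ t gt → trans (∑-*ˡ V (f t) (λ t′ → a t′ t)) (cong (f t *_) (trans (∑-cong V (λ t′ → a-sym t′ t)) (regular t gt)))) ⟩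
          ∑ V (λ t → f t * d)                      ≡⟨ trans (∑-*ʳ V d f) (cong (_* d) ∑f≡0) ⟩
          0ℤ * d                                   ≡⟨ sym (ℤP.*-zeroʳ λ′) ⟩
          λ′ * 0ℤ ∎)

        half : ∀ h → (∀ t → good t → h t ≡ 1ℤ ⊎ h t ≡ -1ℤ) → ∑ V h ≡ 0ℤ → pos 2 * ∑ (zip (map (label h) V) V) x ≡ N
        half h h± ∑h = begin
          pos 2 * ∑ (zip (map (label h) V) V) x     ≡⟨ cong (pos 2 *_) (∑-zip-label h x) ⟩
          pos 2 * ∑ V (λ t → ⟦ label h t ⟧)         ≡⟨ sym (∑-*ˡ V (pos 2) _) ⟩
          ∑ V (λ t → pos 2 * ⟦ label h t ⟧)         ≡⟨ ∑-cong-All allGood (λ t gt → label-± h t (h± t gt)) ⟩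
          ∑ V (λ t → 1ℤ + h t)                      ≡⟨ trans (∑-+ V (λ _ → 1ℤ) h) (trans (cong (N +_) ∑h) (ℤP.+-identityʳ N)) ⟩
          N ∎

        2u₁ : pos 2 * u₁ ≡ N
        2u₁ = half G G± ∑G≡0

        2u₂ : pos 2 * u₂ ≡ N
        2u₂ = half f f± ∑f≡0

        u≡N : u₁ + u₂ ≡ N
        u≡N = ℤP.*-cancelˡ-≡ (pos 2) (u₁ + u₂) N (trans (ℤP.*-distribˡ-+ (pos 2) u₁ u₂) (trans (cong₂ _+_ 2u₁ 2u₂) (lem N)))
          where
          lem : ∀ n → n + n ≡ pos 2 * n
          lem = solve-∀

        -- Twice the labels are 1 + G and 1 + f. Applying A to the second gives d + λ′ G, and
        -- summing (1 + G)(d + λ′ G) leaves (d + λ′) N, as ∑ G = 0 and G² = 1.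
        4e₁₁ : pos 4 * e₁₁ ≡ (d + λ′) * N
        4e₁₁ = begin
          pos 4 * e₁₁
            ≡⟨ cong (pos 4 *_) (trans (∑-zip-label G _) (∑-cong V (λ t → ∑-zip-label f _))) ⟩
          pos 4 * ∑ V (λ t → ∑ V (λ t′ → ⟦ label G t ⟧ * (⟦ label f t′ ⟧ * a t t′)))
            ≡⟨ trans (sym (∑-*ˡ V (pos 4) _)) (∑-cong V (λ t → sym (∑-*ˡ V (pos 4) _))) ⟩
          ∑ V (λ t → ∑ V (λ t′ → pos 4 * (⟦ label G t ⟧ * (⟦ label f t′ ⟧ * a t t′))))
            ≡⟨ ∑-cong-All allGood row ⟩
          ∑ V (λ t → (d + λ′) * (1ℤ + G t))
            ≡⟨ trans (∑-*ˡ V (d + λ′) _) (cong ((d + λ′) *_) (trans (∑-+ V (λ _ → 1ℤ) G) (trans (cong (N +_) ∑G≡0) (ℤP.+-identityʳ N)))) ⟩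
          (d + λ′) * N ∎
          where
          lem₁ : ∀ x y a → pos 4 * (x * (y * a)) ≡ (pos 2 * x) * ((pos 2 * y) * a)
          lem₁ = solve-∀
          lem₂ : ∀ f a → (1ℤ + f) * a ≡ 1ℤ * a + 1ℤ * (f * a)
          lem₂ = solve-∀
          lem₃ : ∀ g d l → (1ℤ + g) * (1ℤ * d + 1ℤ * (g * l)) ≡ d + d * g + g * l + (g * g) * l
          lem₃ = solve-∀
          lem₄ : ∀ g d l → d + d * g + g * l + 1ℤ * l ≡ (d + l) * (1ℤ + g)
          lem₄ = solve-∀
          row : ∀ t → good t → ∑ V (λ t′ → pos 4 * (⟦ label G t ⟧ * (⟦ label f t′ ⟧ * a t t′))) ≡ (d + λ′) * (1ℤ + G t)
          row t gt = begin
            ∑ V (λ t′ → pos 4 * (⟦ label G t ⟧ * (⟦ label f t′ ⟧ * a t t′)))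
              ≡⟨ ∑-cong-All allGood (λ t′ gt′ → trans (lem₁ ⟦ label G t ⟧ ⟦ label f t′ ⟧ (a t t′)) (cong₂ (λ p q → p * (q * a t t′)) (label-± G t (G± t gt)) (label-± f t′ (f± t′ gt′)))) ⟩
            ∑ V (λ t′ → (1ℤ + G t) * ((1ℤ + f t′) * a t t′))
              ≡⟨ trans (∑-*ˡ V (1ℤ + G t) _) (cong ((1ℤ + G t) *_) (trans (∑-cong V (λ t′ → lem₂ (f t′) (a t t′))) (trans (∑-lin₂ V 1ℤ (a t) 1ℤ _) (cong₂ (λ p q → 1ℤ * p + 1ℤ * q) (regular t gt) (SG t gt))))) ⟩
            (1ℤ + G t) * (1ℤ * d + 1ℤ * (G t * λ′))
              ≡⟨ lem₃ (G t) d λ′ ⟩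
            d + d * G t + G t * λ′ + (G t * G t) * λ′
              ≡⟨ cong (λ z → d + d * G t + G t * λ′ + z * λ′) (±1² (G± t gt)) ⟩
            d + d * G t + G t * λ′ + 1ℤ * λ′
              ≡⟨ lem₄ (G t) d λ′ ⟩
            (d + λ′) * (1ℤ + G t) ∎

        2cut : pos 2 * cut ≡ (d - λ′) * N
        2cut = ℤP.*-cancelˡ-≡ (pos 2) (pos 2 * cut) ((d - λ′) * N) (begin
          pos 2 * (pos 2 * cut)                                    ≡⟨ cong (λ c → pos 2 * (pos 2 * c)) (trans cut-formula (cong (λ v → d * v - (e₁₁ + e₁₁)) u≡N)) ⟩
          pos 2 * (pos 2 * (d * N - (e₁₁ + e₁₁)))                  ≡⟨ lem d N e₁₁ ⟩
          pos 4 * (d * N) - pos 2 * (pos 4 * e₁₁)                  ≡⟨ cong (λ z → pos 4 * (d * N) - pos 2 * z) 4e₁₁ ⟩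
          pos 4 * (d * N) - pos 2 * ((d + λ′) * N)                 ≡⟨ lem′ d N λ′ ⟩
          pos 2 * ((d - λ′) * N) ∎)
          where
          lem : ∀ d n e → pos 2 * (pos 2 * (d * n - (e + e))) ≡ pos 4 * (d * n) - pos 2 * (pos 4 * e)
          lem = solve-∀
          lem′ : ∀ d n l → pos 4 * (d * n) - pos 2 * ((d + l) * n) ≡ pos 2 * ((d - l) * n)
          lem′ = solve-∀

-- x = a / D, not necessarily in lowest terms. Arithmetic then follows the schoolbook formulas, and
-- inequalities of rationals become inequalities of integers.
record Frac (x : ℚ) (a D : ℤ) : Set where
  constructor frac
  field
    D>0 : 0ℤ ℤ.< D
    eqn : ↥ x * D ≡ a * ↧ x

module _ where
  private
    0<↧ : ∀ x → 0ℤ ℤ.< ↧ x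
    0<↧ (mkℚ _ _ _) = ℤ.+<+ (s≤s z≤n)

  Frac-self : ∀ x → Frac x (↥ x) (↧ x)
  Frac-self x = frac (0<↧ x) refl

  Frac-/ᵣ : ∀ a d → Frac (a /ᵣ suc d) (pos a) (pos (suc d))
  Frac-/ᵣ a d = frac (ℤ.+<+ (s≤s z≤n)) (unwrap (pos a ℚ./ suc d) (ℚP.toℚᵘ-fromℚᵘ (mkℚᵘ (pos a) d)))
    where
    unwrap : ∀ x → toℚᵘ x ℚᵘ.≃ mkℚᵘ (pos a) d → ↥ x * pos (suc d) ≡ pos a * ↧ x
    unwrap (mkℚ _ _ _) (*≡* e) = e

  Frac-/ : ∀ a d → 0 ℕ.< d → Frac (a /ᵣ d) (pos a) (pos d)
  Frac-/ a (suc d) _ = Frac-/ᵣ a d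

  Frac-ℕ : ∀ a → Frac (ℕ→ℚ a) (pos a) 1ℤ
  Frac-ℕ a = Frac-/ᵣ a 0

  Frac-* : ∀ {x y a b D E} → Frac x a D → Frac y b E → Frac (x ℚ.* y) (a * b) (D * E)
  Frac-* {x} {y} {a} {b} {D} {E} (frac D>0 p) (frac E>0 q) = frac (*>0 D>0 E>0)
      (cancel-≢0 (>0⇒≢0 (*>0 (0<↧ x) (0<↧ y))) (begin
        (↧ x * ↧ y) * (↥ (x ℚ.* y) * (D * E))       ≡⟨ lem₁ (↧ x * ↧ y) (↥ (x ℚ.* y)) (D * E) ⟩
        (↥ (x ℚ.* y) * (↧ x * ↧ y)) * (D * E)       ≡⟨ cong (_* (D * E)) (unwrap x y (x ℚ.* y) (ℚP.toℚᵘ-homo-* x y)) ⟩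
        ((↥ x * ↥ y) * ↧ (x ℚ.* y)) * (D * E)       ≡⟨ lem₂ (↥ x) (↥ y) (↧ (x ℚ.* y)) D E ⟩
        ↧ (x ℚ.* y) * ((↥ x * D) * (↥ y * E))       ≡⟨ cong (↧ (x ℚ.* y) *_) (cong₂ _*_ p q) ⟩
        ↧ (x ℚ.* y) * ((a * ↧ x) * (b * ↧ y))       ≡⟨ lem₃ (↧ (x ℚ.* y)) a (↧ x) b (↧ y) ⟩
        (↧ x * ↧ y) * ((a * b) * ↧ (x ℚ.* y)) ∎))
    where
    open ≡-Reasoning
    unwrap : ∀ x y z → toℚᵘ z ℚᵘ.≃ toℚᵘ x ℚᵘ.* toℚᵘ y → ↥ z * (↧ x * ↧ y) ≡ (↥ x * ↥ y) * ↧ z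
    unwrap (mkℚ _ d _) (mkℚ _ e _) (mkℚ _ _ _) (*≡* p) = p
    lem₁ : ∀ d z e → d * (z * e) ≡ (z * d) * e
    lem₁ = solve-∀
    lem₂ : ∀ x y z D E → ((x * y) * z) * (D * E) ≡ z * ((x * D) * (y * E))
    lem₂ = solve-∀
    lem₃ : ∀ z a x b y → z * ((a * x) * (b * y)) ≡ (x * y) * ((a * b) * z)
    lem₃ = solve-∀

  Frac-+ : ∀ {x y a b D E} → Frac x a D → Frac y b E → Frac (x ℚ.+ y) (a * E + b * D) (D * E)
  Frac-+ {x} {y} {a} {b} {D} {E} (frac D>0 p) (frac E>0 q) = frac (*>0 D>0 E>0)
      (cancel-≢0 (>0⇒≢0 (*>0 (0<↧ x) (0<↧ y))) (begin
        (↧ x * ↧ y) * (↥ (x ℚ.+ y) * (D * E))                   ≡⟨ lem₁ (↧ x * ↧ y) (↥ (x ℚ.+ y)) (D * E) ⟩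
        (↥ (x ℚ.+ y) * (↧ x * ↧ y)) * (D * E)                   ≡⟨ cong (_* (D * E)) (unwrap x y (x ℚ.+ y) (ℚP.toℚᵘ-homo-+ x y)) ⟩
        ((↥ x * ↧ y + ↥ y * ↧ x) * ↧ (x ℚ.+ y)) * (D * E)       ≡⟨ lem₂ (↥ x) (↥ y) (↧ (x ℚ.+ y)) D E (↧ x) (↧ y) ⟩
        ↧ (x ℚ.+ y) * ((↥ x * D) * (↧ y * E) + (↥ y * E) * (↧ x * D)) ≡⟨ cong (↧ (x ℚ.+ y) *_) (cong₂ (λ s t → s * (↧ y * E) + t * (↧ x * D)) p q) ⟩
        ↧ (x ℚ.+ y) * ((a * ↧ x) * (↧ y * E) + (b * ↧ y) * (↧ x * D)) ≡⟨ lem₃ (↧ (x ℚ.+ y)) a (↧ x) b (↧ y) D E ⟩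
        (↧ x * ↧ y) * ((a * E + b * D) * ↧ (x ℚ.+ y)) ∎))
    where
    open ≡-Reasoning
    unwrap : ∀ x y z → toℚᵘ z ℚᵘ.≃ toℚᵘ x ℚᵘ.+ toℚᵘ y → ↥ z * (↧ x * ↧ y) ≡ (↥ x * ↧ y + ↥ y * ↧ x) * ↧ z
    unwrap (mkℚ _ d _) (mkℚ _ e _) (mkℚ _ _ _) (*≡* p) = p
    lem₁ : ∀ d z e → d * (z * e) ≡ (z * d) * e
    lem₁ = solve-∀
    lem₂ : ∀ x y z D E dx dy → ((x * dy + y * dx) * z) * (D * E) ≡ z * ((x * D) * (dy * E) + (y * E) * (dx * D))
    lem₂ = solve-∀
    lem₃ : ∀ z a x b y D E → z * ((a * x) * (y * E) + (b * y) * (x * D)) ≡ (x * y) * ((a * E + b * D) * z)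
    lem₃ = solve-∀

  Frac-neg : ∀ {x a D} → Frac x a D → Frac (ℚ.- x) (- a) D
  Frac-neg {x} {a} {D} (frac D>0 p) = frac D>0 (trans (cong (_* D) (proj₁ (unwrap x)))
      (trans (sym (ℤP.neg-distribˡ-* (↥ x) D)) (trans (cong (λ z → - z) p) (trans (ℤP.neg-distribˡ-* a (↧ x)) (cong (- a *_) (sym (proj₂ (unwrap x))))))))
    where
    unwrap : ∀ x → ↥ (ℚ.- x) ≡ - ↥ x × ↧ (ℚ.- x) ≡ ↧ x
    unwrap (mkℚ (pos zero)    _ _) = refl , refl
    unwrap (mkℚ (pos (suc _)) _ _) = refl , refl
    unwrap (mkℚ ℤ.-[1+ _ ]    _ _) = refl , refl

  Frac-- : ∀ {x y a b D E} → Frac x a D → Frac y b E → Frac (x ℚ.- y) (a * E + - b * D) (D * E)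
  Frac-- p q = Frac-+ p (Frac-neg q)

  Frac-≤ : ∀ {x y a b D E} → Frac x a D → Frac y b E → a * E ℤ.≤ b * D → x ℚ.≤ y
  Frac-≤ {x} {y} {a} {b} {D} {E} (frac D>0 p) (frac E>0 q) h = ℚ.*≤* (ℤP.*-cancelʳ-≤-pos (↥ x * ↧ y) (↥ y * ↧ x) (D * E) ⦃ ℤ.positive (*>0 D>0 E>0) ⦄
      (subst₂ ℤ._≤_ left right (ℤP.*-monoʳ-≤-nonNeg (↧ x * ↧ y) ⦃ ℤ.nonNegative (ℤP.<⇒≤ (*>0 (0<↧ x) (0<↧ y))) ⦄ h)))
    where
    lem₁ : ∀ a E x y → (a * E) * (x * y) ≡ (a * x) * (y * E)
    lem₁ = solve-∀
    lem₂ : ∀ x D y E → (x * D) * (y * E) ≡ x * y * (D * E)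
    lem₂ = solve-∀
    lem₃ : ∀ b D x y → (b * D) * (x * y) ≡ (b * y) * (x * D)
    lem₃ = solve-∀
    lem₄ : ∀ y E x D → (y * E) * (x * D) ≡ y * x * (D * E)
    lem₄ = solve-∀
    left : (a * E) * (↧ x * ↧ y) ≡ ↥ x * ↧ y * (D * E)
    left = trans (lem₁ a E (↧ x) (↧ y)) (trans (cong (_* (↧ y * E)) (sym p)) (lem₂ (↥ x) D (↧ y) E))
    right : (b * D) * (↧ x * ↧ y) ≡ ↥ y * ↧ x * (D * E)
    right = trans (lem₃ b D (↧ x) (↧ y)) (trans (cong (_* (↧ x * D)) (sym q)) (lem₄ (↥ y) E (↧ x) D))

  Frac-≤⁻ : ∀ {x y a b D E} → Frac x a D → Frac y b E → x ℚ.≤ y → a * E ℤ.≤ b * D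
  Frac-≤⁻ {x} {y} {a} {b} {D} {E} (frac D>0 p) (frac E>0 q) (ℚ.*≤* h) = ℤP.*-cancelʳ-≤-pos (a * E) (b * D) (↧ x * ↧ y) ⦃ ℤ.positive (*>0 (0<↧ x) (0<↧ y)) ⦄
      (subst₂ ℤ._≤_ left right (ℤP.*-monoʳ-≤-nonNeg (D * E) ⦃ ℤ.nonNegative (ℤP.<⇒≤ (*>0 D>0 E>0)) ⦄ h))
    where
    lem₁ : ∀ x y D E → x * y * (D * E) ≡ (x * D) * (y * E)
    lem₁ = solve-∀
    lem₂ : ∀ a x y E → (a * x) * (y * E) ≡ a * E * (x * y)
    lem₂ = solve-∀
    lem₃ : ∀ y x D E → y * x * (D * E) ≡ (y * E) * (x * D)
    lem₃ = solve-∀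
    lem₄ : ∀ b y x D → (b * y) * (x * D) ≡ b * D * (x * y)
    lem₄ = solve-∀
    left : ↥ x * ↧ y * (D * E) ≡ a * E * (↧ x * ↧ y)
    left = trans (lem₁ (↥ x) (↧ y) D E) (trans (cong (_* (↧ y * E)) p) (lem₂ a (↧ x) (↧ y) E))
    right : ↥ y * ↧ x * (D * E) ≡ b * D * (↧ x * ↧ y)
    right = trans (lem₃ (↥ y) (↧ x) D E) (trans (cong (_* (↧ x * D)) q) (lem₄ b (↧ y) (↧ x) D))

module _ {W : Set} (vs : List W) (adj : W → W → Bool) where

  foldr-⊓-≤ : ∀ x xs → foldr ℚ._⊓_ x xs ℚ.≤ x
  foldr-⊓-≤ x []       = ℚP.≤-refl
  foldr-⊓-≤ x (y ∷ ys) = ℚP.≤-trans (ℚP.p⊓q≤q y (foldr ℚ._⊓_ x ys)) (foldr-⊓-≤ x ys)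

  minList-≤ : ∀ {y} xs → y ∈ xs → minList vs adj xs ℚ.≤ y
  minList-≤ (x ∷ xs) (here refl) = foldr-⊓-≤ x xs
  minList-≤ (x ∷ xs) (there m)   = go xs m
    where
    go : ∀ {y} xs → y ∈ xs → foldr ℚ._⊓_ x xs ℚ.≤ y
    go (z ∷ zs) (here refl) = ℚP.p⊓q≤p z (foldr ℚ._⊓_ x zs)
    go (z ∷ zs) (there m)   = ℚP.≤-trans (ℚP.p⊓q≤q z (foldr ℚ._⊓_ x zs)) (go zs m)

  -- The member y excludes the empty list, on which `minList` takes the default value 0.
  ≤-minList : ∀ {c y} xs → y ∈ xs → All (c ℚ.≤_) xs → c ℚ.≤ minList vs adj xs
  ≤-minList {c} (x ∷ xs) _ (p ∷ ps) = go xs ps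
    where
    go : ∀ xs → All (c ℚ.≤_) xs → c ℚ.≤ foldr ℚ._⊓_ x xs
    go []       []       = p
    go (z ∷ zs) (q ∷ qs) = ℚP.⊓-glb q (go zs qs)

  allBools-length : ∀ m → All (λ p → length p ≡ m) (allBools m)
  allBools-length zero    = refl ∷ []
  allBools-length (suc m) = AllP.++⁺ (AllP.map⁺ (All.map (cong suc) (allBools-length m)))
    (AllP.++⁺ (AllP.map⁺ (All.map (cong suc) (allBools-length m))) [])

  allBools-complete : ∀ m p → length p ≡ m → p ∈ allBools m
  allBools-complete zero    []          e = here refl
  allBools-complete (suc m) (true  ∷ p) e = MemP.∈-++⁺ˡ (MemP.∈-map⁺ (true ∷_) (allBools-complete m p (ℕP.suc-injective e)))
  allBools-complete (suc m) (false ∷ p) e = MemP.∈-++⁺ʳ (map (true ∷_) (allBools m)) (MemP.∈-++⁺ˡ (MemP.∈-map⁺ (false ∷_) (allBools-complete m p (ℕP.suc-injective e))))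

  edges : List Bool → ℕ
  edges p = length (concatMap (λ u → filterᵇ (adj u) (map proj₂ (filterᵇ (λ t → not (proj₁ t)) (zip p vs)))) (map proj₂ (filterᵇ proj₁ (zip p vs))))

  small : List Bool → ℕ
  small p = count (λ x → x) p ℕ.⊓ count not p

  ratio-suc : ∀ p k → small p ≡ suc k → ratio vs adj p ≡ [ edges p /ᵣ suc k ]
  ratio-suc p k e with count (λ x → x) p ℕ.⊓ count not p
  ratio-suc p k refl | .(suc k) = refl

  ratio-zero : ∀ p → small p ≡ zero → ratio vs adj p ≡ []
  ratio-zero p e with count (λ x → x) p ℕ.⊓ count not p
  ratio-zero p refl | .zero = refl

  iso-≤ : ∀ p k → length p ≡ length vs → small p ≡ suc k → iso vs adj ℚ.≤ edges p /ᵣ suc k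
  iso-≤ p k len e = minList-≤ _ (MemP.∈-concatMap⁺ (ratio vs adj) (lose (allBools-complete (length vs) p len)
    (subst (edges p /ᵣ suc k ∈_) (sym (ratio-suc p k e)) (here refl))))

  ≤-iso : ∀ c p₀ k₀ → length p₀ ≡ length vs → small p₀ ≡ suc k₀ →
          (∀ p k → length p ≡ length vs → small p ≡ suc k → c ℚ.≤ edges p /ᵣ suc k) → c ℚ.≤ iso vs adj
  ≤-iso c p₀ k₀ len₀ e₀ h = ≤-minList _ (MemP.∈-concatMap⁺ (ratio vs adj) (lose (allBools-complete (length vs) p₀ len₀)
      (subst (edges p₀ /ᵣ suc k₀ ∈_) (sym (ratio-suc p₀ k₀ e₀)) (here refl))))
      (AllP.concat⁺ (AllP.map⁺ (All.map bound (allBools-length (length vs)))))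
    where
    bound : ∀ {p} → length p ≡ length vs → All (c ℚ.≤_) (ratio vs adj p)
    bound {p} len = by (small p) refl
      where
      by : ∀ s → small p ≡ s → All (c ℚ.≤_) (ratio vs adj p)
      by zero    e = subst (All (c ℚ.≤_)) (sym (ratio-zero p e)) []
      by (suc k) e = subst (All (c ℚ.≤_)) (sym (ratio-suc p k e)) (h p k len e ∷ [])

module Link {T : Set} (V : List T) (good : T → Set) (allGood : All good V)
            (adj : T → T → Bool) (adj-sym : ∀ t t′ → adj t t′ ≡ adj t′ t)
            (d : ℤ) (regular : ∀ t → good t → ∑ V (λ t′ → ⟦ adj t t′ ⟧) ≡ d)
            (A′ : Bool × T → Bool × T → Bool)
            (tf : ∀ s t → A′ (true , s) (false , t) ≡ adj s t) (ft : ∀ s t → A′ (false , t) (true , s) ≡ adj s t)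
            (tt : ∀ s t → A′ (true , s) (true , t) ≡ false) (ff : ∀ s t → A′ (false , s) (false , t) ≡ false) where
  open Bipartite V good allGood adj adj-sym d regular
  open ≡-Reasoning

  vs : List (Bool × T)
  vs = map (true ,_) V ++ map (false ,_) V

  length-vs : length vs ≡ length V ℕ.+ length V
  length-vs = trans (ListP.length-++ (map left V) {map right V}) (cong₂ ℕ._+_ (ListP.length-map left V) (ListP.length-map right V))
    where
    left right : T → Bool × T
    left  t = true , t
    right t = false , t

  module _ (p₁ p₂ : List Bool) (len₁ : length p₁ ≡ length V) (len₂ : length p₂ ≡ length V) where
    open Labelling p₁ p₂ len₁ len₂

    private
      L : List (Bool × (Bool × T))
      L = zip (p₁ ++ p₂) vs

    ∑L : ∀ f → ∑ L f ≡ ∑ L₁ (λ y → f (proj₁ y , (true , proj₂ y))) + ∑ L₂ (λ y → f (proj₁ y , (false , proj₂ y)))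
    ∑L f = trans (cong (λ l → ∑ l f) (zip-++ p₁ p₂ (map (true ,_) V) (map (false ,_) V) (trans len₁ (sym (ListP.length-map _ V)))))
      (trans (∑-++ (zip p₁ (map (true ,_) V)) (zip p₂ (map (false ,_) V)) f) (cong₂ _+_ (∑-zip-map p₁ (true ,_) V f) (∑-zip-map p₂ (false ,_) V f)))

    private
      inner : Bool × T → ℤ
      inner v = ∑ L (λ z → ⟦ not (proj₁ z) ⟧ * ⟦ A′ v (proj₂ z) ⟧)

      inner-t : ∀ s → inner (true , s) ≡ ∑ L₂ (λ z → (1ℤ - x z) * a s (proj₂ z))
      inner-t s = trans (∑L _) (trans (cong₂ _+_ (trans (∑-cong L₁ (λ y → trans (cong (λ b → ⟦ not (proj₁ y) ⟧ * ⟦ b ⟧) (tt s (proj₂ y))) (ℤP.*-zeroʳ ⟦ not (proj₁ y) ⟧))) (∑-0 L₁))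
        (∑-cong L₂ (λ z → cong₂ _*_ (⟦⟧-not (proj₁ z)) (cong ⟦_⟧ (tf s (proj₂ z)))))) (ℤP.+-identityˡ _))

      inner-f : ∀ t → inner (false , t) ≡ ∑ L₁ (λ y → (1ℤ - x y) * a (proj₂ y) t)
      inner-f t = trans (∑L _) (trans (cong₂ _+_ (∑-cong L₁ (λ z → cong₂ _*_ (⟦⟧-not (proj₁ z)) (cong ⟦_⟧ (ft (proj₂ z) t))))
        (trans (∑-cong L₂ (λ y → trans (cong (λ b → ⟦ not (proj₁ y) ⟧ * ⟦ b ⟧) (ff t (proj₂ y))) (ℤP.*-zeroʳ ⟦ not (proj₁ y) ⟧))) (∑-0 L₂))) (ℤP.+-identityʳ _))

    edges≡cut : pos (edges vs A′ (p₁ ++ p₂)) ≡ cut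
    edges≡cut = begin
      pos (edges vs A′ (p₁ ++ p₂))
        ≡⟨ ∑-length (concatMap (λ u → filterᵇ (A′ u) Ws) Us) ⟩
      ∑ (concatMap (λ u → filterᵇ (A′ u) Ws) Us) (λ _ → 1ℤ)
        ≡⟨ ∑-concatMap (λ u → filterᵇ (A′ u) Ws) Us (λ _ → 1ℤ) ⟩
      ∑ Us (λ u → ∑ (filterᵇ (A′ u) Ws) (λ _ → 1ℤ))
        ≡⟨ trans (∑-map proj₂ (filterᵇ proj₁ L) _) (∑-filter proj₁ L _) ⟩
      ∑ L (λ y → ⟦ proj₁ y ⟧ * ∑ (filterᵇ (A′ (proj₂ y)) Ws) (λ _ → 1ℤ))
        ≡⟨ ∑-cong L (λ y → cong (⟦ proj₁ y ⟧ *_) (trans (∑-filter (A′ (proj₂ y)) Ws (λ _ → 1ℤ))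
             (trans (∑-map proj₂ (filterᵇ (λ t → not (proj₁ t)) L) _) (trans (∑-filter (λ t → not (proj₁ t)) L _)
               (∑-cong L (λ z → cong (⟦ not (proj₁ z) ⟧ *_) (ℤP.*-identityʳ _))))))) ⟩
      ∑ L (λ y → ⟦ proj₁ y ⟧ * inner (proj₂ y))
        ≡⟨ ∑L (λ y → ⟦ proj₁ y ⟧ * inner (proj₂ y)) ⟩
      ∑ L₁ (λ y → x y * inner (true , proj₂ y)) + ∑ L₂ (λ z → x z * inner (false , proj₂ z))
        ≡⟨ cong₂ _+_ (∑-cong L₁ (λ y → cong (x y *_) (inner-t (proj₂ y)))) (∑-cong L₂ (λ z → cong (x z *_) (inner-f (proj₂ z)))) ⟩
      cut ∎
      where
      Us Ws : List (Bool × T)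
      Us = map proj₂ (filterᵇ proj₁ L)
      Ws = map proj₂ (filterᵇ (λ t → not (proj₁ t)) L)

    countU : pos (count (λ x → x) (p₁ ++ p₂)) ≡ u₁ + u₂
    countU = trans (∑-length (filterᵇ (λ x → x) (p₁ ++ p₂))) (trans (∑-filter (λ x → x) (p₁ ++ p₂) (λ _ → 1ℤ)) (trans (∑-cong (p₁ ++ p₂) (λ b → ℤP.*-identityʳ ⟦ b ⟧))
      (trans (∑-++ p₁ p₂ ⟦_⟧) (cong₂ _+_ (sym (∑-zip₁ p₁ V len₁ ⟦_⟧)) (sym (∑-zip₁ p₂ V len₂ ⟦_⟧))))))

    countW : pos (count not (p₁ ++ p₂)) ≡ (N + N) - (u₁ + u₂)
    countW = begin
      pos (count not (p₁ ++ p₂))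
        ≡⟨ trans (∑-length (filterᵇ not (p₁ ++ p₂))) (trans (∑-filter not (p₁ ++ p₂) (λ _ → 1ℤ)) (∑-cong (p₁ ++ p₂) (λ b → trans (ℤP.*-identityʳ ⟦ not b ⟧) (⟦⟧-not b)))) ⟩
      ∑ (p₁ ++ p₂) (λ b → 1ℤ - ⟦ b ⟧)
        ≡⟨ trans (∑-++ p₁ p₂ _) (cong₂ _+_ (part p₁ len₁) (part p₂ len₂)) ⟩
      (N - u₁) + (N - u₂)
        ≡⟨ lem N u₁ u₂ ⟩
      (N + N) - (u₁ + u₂) ∎
      where
      lem : ∀ n u v → (n - u) + (n - v) ≡ (n + n) - (u + v)
      lem = solve-∀
      part : ∀ p → length p ≡ length V → ∑ p (λ b → 1ℤ - ⟦ b ⟧) ≡ N - ∑ (zip p V) x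
      part p len = trans (∑-- p (λ _ → 1ℤ) ⟦_⟧) (cong₂ _-_ (trans (sym (∑-length p)) (trans (cong pos len) (∑-length V))) (sym (∑-zip₁ p V len ⟦_⟧)))

  split : ∀ (p : List Bool) → length p ≡ length vs → ∃ λ p₁ → ∃ λ (p₂ : List Bool) → length p₁ ≡ length V × length p₂ ≡ length V × p ≡ p₁ ++ p₂
  split p len = List.take (length V) p , List.drop (length V) p
    , trans (ListP.length-take (length V) p) (ℕP.m≤n⇒m⊓n≡m (subst (length V ≤_) (sym len′) (ℕP.m≤m+n _ _)))
    , trans (ListP.length-drop (length V) p) (trans (cong (ℕ._∸ length V) len′) (ℕP.m+n∸m≡n (length V) (length V)))
    , sym (ListP.take++drop≡id (length V) p)
    where
    len′ : length p ≡ length V ℕ.+ length V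
    len′ = trans len length-vs

  -- The integer inequality passed to the last argument is (d - r/s)/2 ≤ e/(k+1) cleared of
  -- denominators, with r/s at least √μ.
  isoLower : ∀ μ →
    (∀ (L : QuadraticForms.Weighted V good allGood) → QuadraticForms.∑W V good allGood L (λ g _ → g) ≡ 0ℤ →
      ∑ V (λ t → QuadraticForms.∑W V good allGood L (λ g t′ → g * a t t′) * QuadraticForms.∑W V good allGood L (λ g t′ → g * a t t′))
        ℤ.≤ μ * QuadraticForms.∑W V good allGood L (λ g _ → g * g)) →
    0ℤ ℤ.< N → ∀ r s → 0ℤ ℤ.< r → 0ℤ ℤ.≤ s → s * s * μ ℤ.≤ r * r →
    ∀ c → (∀ e k → (s * d - r) * pos (suc k) ℤ.≤ pos 2 * s * pos e → c ℚ.≤ e /ᵣ suc k) → c ℚ.≤ iso vs A′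
  -- The cut between the two sides of the graph has N > 0 vertices in each part, so at least one
  -- ratio exists.
  isoLower μ spectral N>0 r s r>0 s≥0 μ≤ c toℚ = ≤-iso vs A′ c (map (λ _ → true) V ++ map (λ _ → false) V) (length V ℕ.∸ 1)
      (trans (ListP.length-++ (map (λ _ → true) V)) (trans (cong₂ ℕ._+_ (ListP.length-map _ V) (ListP.length-map _ V)) (sym length-vs)))
      smallness
      (λ p k len e → let p₁ , p₂ , len₁ , len₂ , eq = split p len in step p₁ p₂ len₁ len₂ p eq k e)
    where
    ts fs : List Bool
    ts = map (λ _ → true) V
    fs = map (λ _ → false) V
    tlen : length ts ≡ length V
    tlen = ListP.length-map _ V
    flen : length fs ≡ length V
    flen = ListP.length-map _ V
    posN : pos (length V) ≡ N
    posN = ∑-length V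
    side : ∀ (b : Bool) → ∑ (zip (map (λ _ → b) V) V) (λ z → ⟦ proj₁ z ⟧) ≡ ⟦ b ⟧ * N
    side b = trans (∑-zip₁ (map (λ _ → b) V) V (ListP.length-map _ V) ⟦_⟧) (trans (∑-map (λ _ → b) V ⟦_⟧) (trans (∑-const V ⟦ b ⟧) (trans (cong (_* ⟦ b ⟧) posN) (ℤP.*-comm N ⟦ b ⟧))))
    cu : count (λ x → x) (map (λ _ → true) V ++ map (λ _ → false) V) ≡ length V
    cu = ℤP.+-injective (trans (countU ts fs tlen flen) (trans (cong₂ _+_ (side true) (side false)) (trans (lem N) (sym posN))))
      where
      lem : ∀ n → 1ℤ * n + 0ℤ * n ≡ n
      lem = solve-∀
    cw : count not (map (λ _ → true) V ++ map (λ _ → false) V) ≡ length V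
    cw = ℤP.+-injective (trans (countW ts fs tlen flen) (trans (cong₂ (λ a b → (N + N) - (a + b)) (side true) (side false)) (trans (lem N) (sym posN))))
      where
      lem : ∀ n → (n + n) - (1ℤ * n + 0ℤ * n) ≡ n
      lem = solve-∀
    smallness : small vs A′ (map (λ _ → true) V ++ map (λ _ → false) V) ≡ suc (length V ℕ.∸ 1)
    smallness = trans (cong₂ ℕ._⊓_ cu cw) (trans (ℕP.⊓-idem (length V)) (sym (ℕP.suc-pred (length V) ⦃ ℕ.≢-nonZero (λ e → ℤP.<-irrefl (trans (cong pos (sym e)) posN) N>0) ⦄)))
    step : ∀ p₁ p₂ (len₁ : length p₁ ≡ length V) (len₂ : length p₂ ≡ length V) p → p ≡ p₁ ++ p₂ → ∀ k → small vs A′ p ≡ suc k → c ℚ.≤ edges vs A′ p /ᵣ suc k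
    step p₁ p₂ len₁ len₂ p refl k e = toℚ (edges vs A′ (p₁ ++ p₂)) k (subst (λ z → (s * d - r) * pos (suc k) ℤ.≤ pos 2 * s * z) (sym (edges≡cut p₁ p₂ len₁ len₂))
      (Labelling.Lower.bound p₁ p₂ len₁ len₂ μ spectral r s r>0 s≥0 N>0 μ≤ (pos (suc k)) (ℤ.+≤+ z≤n)
        (subst (pos (suc k) ℤ.≤_) (countU p₁ p₂ len₁ len₂) (ℤ.+≤+ (subst (_≤ count (λ x → x) (p₁ ++ p₂)) e (ℕP.m⊓n≤m _ _))))
        (subst (pos (suc k) ℤ.≤_) (countW p₁ p₂ len₁ len₂) (ℤ.+≤+ (subst (_≤ count not (p₁ ++ p₂)) e (ℕP.m⊓n≤n _ _))))))

  -- U has N of the 2N vertices, so both parts have size N and this cut has the ratio (d - λ′)/2.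
  isoUpper : ∀ p₁ p₂ (len₁ : length p₁ ≡ length V) (len₂ : length p₂ ≡ length V) λ′ → 0ℤ ℤ.< N →
    Labelling.u₁ p₁ p₂ len₁ len₂ + Labelling.u₂ p₁ p₂ len₁ len₂ ≡ N → pos 2 * Labelling.cut p₁ p₂ len₁ len₂ ≡ (d - λ′) * N →
    ∀ c → (∀ e k → pos 2 * pos e ≡ (d - λ′) * pos (suc k) → e /ᵣ suc k ℚ.≤ c) → iso vs A′ ℚ.≤ c
  isoUpper p₁ p₂ len₁ len₂ λ′ N>0 u≡N 2cut c toℚ = ℚP.≤-trans
      (iso-≤ vs A′ (p₁ ++ p₂) (length V ℕ.∸ 1) (trans (ListP.length-++ p₁) (trans (cong₂ ℕ._+_ len₁ len₂) (sym length-vs))) (trans (cong₂ ℕ._⊓_ cu cw) (trans (ℕP.⊓-idem (length V)) sucpred)))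
      (toℚ (edges vs A′ (p₁ ++ p₂)) (length V ℕ.∸ 1) (trans (cong (pos 2 *_) (edges≡cut p₁ p₂ len₁ len₂)) (trans 2cut (cong ((d - λ′) *_) (trans (sym posN) (cong pos sucpred))))))
    where
    posN : pos (length V) ≡ N
    posN = ∑-length V
    sucpred : length V ≡ suc (length V ℕ.∸ 1)
    sucpred = sym (ℕP.suc-pred (length V) ⦃ ℕ.≢-nonZero (λ e → ℤP.<-irrefl (trans (cong pos (sym e)) posN) N>0) ⦄)
    cu : count (λ x → x) (p₁ ++ p₂) ≡ length V
    cu = ℤP.+-injective (trans (countU p₁ p₂ len₁ len₂) (trans u≡N (sym posN)))
    cw : count not (p₁ ++ p₂) ≡ length V
    cw = ℤP.+-injective (trans (countW p₁ p₂ len₁ len₂) (trans (cong (λ z → (N + N) - z) u≡N) (trans (lem N) (sym posN))))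
      where
      lem : ∀ n → (n + n) - n ≡ n
      lem = solve-∀

-- The graphs Um(R^n) and Um₀(R^n)

pow-* : ∀ a b n → (a * b) ℤ.^ n ≡ a ℤ.^ n * b ℤ.^ n
pow-* a b zero    = refl
pow-* a b (suc n) = trans (cong (a * b *_) (pow-* a b n)) (lem a b (a ℤ.^ n) (b ℤ.^ n))
  where
  lem : ∀ a b c d → a * b * (c * d) ≡ a * c * (b * d)
  lem = solve-∀

pow>0 : ∀ {a} → 0ℤ ℤ.< a → ∀ n → 0ℤ ℤ.< a ℤ.^ n
pow>0 p zero    = ℤ.+<+ (s≤s z≤n)
pow>0 {a} p (suc n) = subst (ℤ._< a * a ℤ.^ n) (ℤP.*-zeroʳ a) (ℤP.*-monoˡ-<-pos a ⦃ ℤ.positive p ⦄ (pow>0 p n))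

≥0∧≢0⇒>0 : ∀ {a} → 0ℤ ℤ.≤ a → a ≢ 0ℤ → 0ℤ ℤ.< a
≥0∧≢0⇒>0 p n = ℤP.≤∧≢⇒< p (n ∘ sym)

module Lines (R : FinCommRing) (loc : FinCommRing.IsLocal R)
             (π : FinCommRing.Elt R) (unif : FinCommRing.IsUniformizer R π) where
  open Tuples R loc π unif public
  open Orbits R loc π unif public
  open ≡-Reasoning

  Z : ℤ
  Z = pos q

  ∣M∣>0 : 0ℤ ℤ.< ∣M∣
  ∣M∣>0 = ≥0∧≢0⇒>0 (∑-nonneg list (λ x → ⟦⟧-nonneg _)) ∣M∣≢0

  Z-1≢0 : Z - 1ℤ ≢ 0ℤ
  Z-1≢0 = subst (λ n → pos n - 1ℤ ≢ 0ℤ) size≡q size-1≢0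

  Z-1>0 : 0ℤ ℤ.< Z - 1ℤ
  Z-1>0 = ≥0∧≢0⇒>0 (subst (λ n → 0ℤ ℤ.≤ pos n - 1ℤ) size≡q (subst (0ℤ ℤ.≤_) ∑nz (∑-nonneg F.list nz≥0))) Z-1≢0
    where
    nz≥0 : ∀ u → 0ℤ ℤ.≤ nz u
    nz≥0 u = by (F._≟_ F.0F u)
      where
      by : (d : Dec (F.0F ≡ u)) → 0ℤ ℤ.≤ 1ℤ - ⟦ does d ⟧
      by (yes _) = ℤP.≤-refl
      by (no _)  = ℤ.+≤+ z≤n

  Z>0 : 0ℤ ℤ.< Z
  Z>0 = subst (0ℤ ℤ.<_) (lem Z) (ℤP.+-mono-< Z-1>0 (ℤ.+<+ (s≤s z≤n)))
    where
    lem : ∀ z → (z - 1ℤ) + 1ℤ ≡ z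
    lem = solve-∀

  ∑nz′ : F.∑ᴱ nz ≡ Z - 1ℤ
  ∑nz′ = trans ∑nz (cong (λ n → pos n - 1ℤ) size≡q)

  module _ {n : ℕ} where

    ∑T-par : ∀ (t : Tup n) → redⱽ t ≢ 0ⱽ → ∀ (G : Vec Res n → ℤ) →
             ∑T n (λ t′ → par (redⱽ t) (redⱽ t′) * G (redⱽ t′)) ≡ ∣M∣ ℤ.^ n * F.∑ᴱ (λ u → nz u * G (u ·ⱽ redⱽ t))
    ∑T-par t nt G = trans (∑T-red n (λ β → par (redⱽ t) β * G β)) (cong (∣M∣ ℤ.^ n *_) (∑-line (redⱽ t) nt G))

  dual-of : ∀ {n} (t : Tup n) → redⱽ t ≢ 0ⱽ → ∃ λ c → dot c t ≡ 1ᴿ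
  dual-of t nt with findUnit t nt
  ... | i , y , e = single i y , trans (dot-single i y t) (trans (*-comm y (t i)) e)

  good : ∀ {n} → Tup n → Set
  good t = redⱽ t ≢ 0ⱽ

  allGood-unimodular : ∀ n → All good (unimodular n)
  allGood-unimodular n = All.map (λ {t} p → unimodular⇒≢0 t (T⇒true p)) (AllP.all-filter _ (allTups n))
    where
    T⇒true : ∀ {b} → T b → b ≡ true
    T⇒true {true} _ = refl

  allGood-modUnits : ∀ n → All good (unimodularModUnits n)
  allGood-modUnits n = AllP.filter⁺ _ (allGood-unimodular n)

  ∑um : ∀ n → ∑ (unimodular n) (λ _ → 1ℤ) ≡ ∣R∣ ℤ.^ n - ∣M∣ ℤ.^ n
  ∑um n = trans (∑-unimodular n (λ _ → 1ℤ)) (trans (∑-cong (allTups n) (λ a → ℤP.*-identityʳ (um a)))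
    (trans (∑-- (allTups n) (λ _ → 1ℤ) μ⁰) (cong₂ _-_ (∑T-1 n) (∑μ⁰ n))))

  ∣R∣^ : ∀ k → ∣R∣ ℤ.^ k ≡ ∣M∣ ℤ.^ k * Z ℤ.^ k
  ∣R∣^ k = trans (cong (ℤ._^ k) ∣R∣≡) (pow-* ∣M∣ Z k)

  ∣U∣≡′ : ∣U∣ ≡ ∣M∣ * (Z - 1ℤ)
  ∣U∣≡′ = trans ∣U∣≡ (trans (cong (_- ∣M∣) ∣R∣≡) (lem ∣M∣ Z))
    where
    lem : ∀ m z → m * z - m ≡ m * (z - 1ℤ)
    lem = solve-∀

  ∣U∣>0 : 0ℤ ℤ.< ∣U∣
  ∣U∣>0 = subst (0ℤ ℤ.<_) (sym ∣U∣≡′) (*>0 ∣M∣>0 Z-1>0)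

  -- The integer (q^j - 1)/(q - 1), the number of lines in a j-dimensional space over the residue
  -- field.
  θ : ℕ → ℤ
  θ zero    = 0ℤ
  θ (suc j) = 1ℤ + Z * θ j

  θ-geometric : ∀ j → (Z - 1ℤ) * θ j ≡ Z ℤ.^ j - 1ℤ
  θ-geometric zero    = ℤP.*-zeroʳ (Z - 1ℤ)
  θ-geometric (suc j) = trans (lem Z (θ j)) (trans (cong (λ w → (Z - 1ℤ) + Z * w) (θ-geometric j)) (lem′ Z (Z ℤ.^ j)))
    where
    lem : ∀ z t → (z - 1ℤ) * (1ℤ + z * t) ≡ (z - 1ℤ) + z * ((z - 1ℤ) * t)
    lem = solve-∀
    lem′ : ∀ z w → (z - 1ℤ) + z * (w - 1ℤ) ≡ z * w - 1ℤ
    lem′ = solve-∀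

  θ≥0 : ∀ j → 0ℤ ℤ.≤ θ j
  θ≥0 zero    = ℤP.≤-refl
  θ≥0 (suc j) = ℤP.+-mono-≤ {0ℤ} {1ℤ} (ℤ.+≤+ z≤n) (i*j≥0 {Z} (ℤP.<⇒≤ Z>0) (θ≥0 j))

  θ>0 : ∀ j → 0ℤ ℤ.< θ (suc j)
  θ>0 j = ℤP.+-mono-<-≤ {0ℤ} {1ℤ} (ℤ.+<+ (s≤s z≤n)) (i*j≥0 {Z} (ℤP.<⇒≤ Z>0) (θ≥0 j))

  ∑um>0 : ∀ n → 0ℤ ℤ.< ∑ (unimodular (suc n)) (λ _ → 1ℤ)
  ∑um>0 n = subst (0ℤ ℤ.<_) (sym (trans (∑um (suc n)) (trans (cong (_- ∣M∣ ℤ.^ suc n) (∣R∣^ (suc n)))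
      (trans (lem (∣M∣ ℤ.^ suc n) (Z ℤ.^ suc n)) (cong (∣M∣ ℤ.^ suc n *_) (sym (θ-geometric (suc n))))))))
    (*>0 (pow>0 ∣M∣>0 (suc n)) (*>0 Z-1>0 (θ>0 n)))
    where
    lem : ∀ m z → m * z - m ≡ m * (z - 1ℤ)
    lem = solve-∀

module UmGraph (R : FinCommRing) (loc : FinCommRing.IsLocal R)
               (π : FinCommRing.Elt R) (unif : FinCommRing.IsUniformizer R π) (k : ℕ) where
  open Lines R loc π unif public
  open FinCommRing R using (UmAdj)
  open ≡-Reasoning

  n : ℕ
  n = suc (suc k)

  V : List (Tup n)
  V = unimodular n

  adj : Tup n → Tup n → Bool
  adj a b = does (dot a b ≟ 1ᴿ)

  adj-sym : ∀ t t′ → adj t t′ ≡ adj t′ t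
  adj-sym t t′ = cong (λ z → does (z ≟ 1ᴿ)) (dot-comm t t′)

  d : ℤ
  d = ∣R∣ ℤ.^ suc k

  um-drop : ∀ (a b : Tup n) g → um a * (δ (dot a b) 1ᴿ * g) ≡ δ (dot a b) 1ᴿ * g
  um-drop a b g = trans (lem (um a) (δ (dot a b) 1ᴿ) g) (⟦⟧*-cong (does (dot a b ≟ 1ᴿ))
      (λ e → trans (cong (_* g) (um≡1 a (dot≡unit⇒≢0 a b (does-true (dot a b ≟ 1ᴿ) e)))) (ℤP.*-identityˡ g)))
    where
    lem : ∀ x y z → x * (y * z) ≡ y * (x * z)
    lem = solve-∀

  ∑V-δ : ∀ t (G : Tup n → ℤ) → ∑ V (λ x → δ (dot x t) 1ᴿ * G x) ≡ ∑T n (λ x → δ (dot x t) 1ᴿ * G x)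
  ∑V-δ t G = trans (∑-unimodular n (λ x → δ (dot x t) 1ᴿ * G x)) (∑-cong (allTups n) (λ x → um-drop x t (G x)))

  regular : ∀ t → good t → ∑ V (λ t′ → ⟦ adj t t′ ⟧) ≡ d
  regular t gt = begin
    ∑ V (λ t′ → ⟦ adj t t′ ⟧)              ≡⟨ ∑-cong V (λ t′ → trans (cong ⟦_⟧ (adj-sym t t′)) (sym (ℤP.*-identityʳ _))) ⟩
    ∑ V (λ t′ → δ (dot t′ t) 1ᴿ * 1ℤ)      ≡⟨ ∑V-δ t (λ _ → 1ℤ) ⟩
    ∑T n (λ t′ → δ (dot t′ t) 1ᴿ * 1ℤ)     ≡⟨ ∑-cong (allTups n) (λ t′ → ℤP.*-identityʳ _) ⟩
    ∑T n (λ t′ → δ (dot t′ t) 1ᴿ)          ≡⟨ count₁ (suc k) t (proj₁ (dual-of t gt)) (proj₂ (dual-of t gt)) 1ᴿ ⟩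
    d ∎

  open Link V good (allGood-unimodular n) adj adj-sym d regular UmAdj
    (λ _ _ → refl) (λ _ _ → refl) (λ _ _ → refl) (λ _ _ → refl) public using (isoLower; isoUpper)
  open Bipartite V good (allGood-unimodular n) adj adj-sym d regular public using (C; C-sym; C≥0; C-row; module Kernel) renaming (N to ∣V∣)
  open QuadraticForms V good (allGood-unimodular n) public using (form; form-cong; form-lin; square-form≥0)

  -- The number of common neighbours of two vectors that are independent modulo π: two linear
  -- conditions on n coordinates.
  tc : ℤ
  tc = ∣R∣ ℤ.^ k

  tc≥0 : 0ℤ ℤ.≤ tc
  tc≥0 = ℤP.<⇒≤ (pow>0 (≥0∧≢0⇒>0 (∑-nonneg list (λ _ → ℤ.+≤+ z≤n)) ∣R∣≢0) k)

  P : Tup n → Tup n → ℤ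
  P t t′ = par (redⱽ t) (redⱽ t′)

  -- Vectors that differ modulo π by a scalar other than 1 have no common neighbour, so C - tc J is
  -- negative there. Restricting the constant tc to pairs that are not parallel leaves a kernel
  -- equal to C on parallel pairs and to 0 elsewhere.
  Ek : Tup n → Tup n → ℤ
  Ek t t′ = C t t′ - tc * (1ℤ + -1ℤ * P t t′)

  decomp : ∀ t t′ → good t → good t′ → C t t′ ≡ Ek t t′ + tc * (1ℤ + -1ℤ * P t t′)
  decomp t t′ _ _ = lem (C t t′) (tc * (1ℤ + -1ℤ * P t t′))
    where
    lem : ∀ c x → c ≡ (c - x) + x
    lem = solve-∀

  C-generic : ∀ t t′ → good t → good t′ → ¬ Parallel (redⱽ t) (redⱽ t′) → C t t′ ≡ tc
  C-generic t t′ gt gt′ np = trans (∑V-δ t (λ x → δ (dot x t′) 1ᴿ)) (count₂ k t t′ (independent⇒Dual t t′ gt gt′ np) 1ᴿ 1ᴿ)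

  Ek-parallel : ∀ t t′ → Parallel (redⱽ t) (redⱽ t′) → Ek t t′ ≡ C t t′
  Ek-parallel t t′ p = trans (cong (λ b → C t t′ - tc * (1ℤ + -1ℤ * ⟦ b ⟧)) (dec-true (parallel? (redⱽ t) (redⱽ t′)) p)) (lem (C t t′) tc)
    where
    lem : ∀ c t → c - t * (1ℤ + -1ℤ * 1ℤ) ≡ c
    lem = solve-∀

  Ek-generic : ∀ t t′ → good t → good t′ → ¬ Parallel (redⱽ t) (redⱽ t′) → Ek t t′ ≡ 0ℤ
  Ek-generic t t′ gt gt′ np = trans (cong₂ (λ c b → c - tc * (1ℤ + -1ℤ * ⟦ b ⟧)) (C-generic t t′ gt gt′ np) (dec-false (parallel? (redⱽ t) (redⱽ t′)) np)) (lem tc)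
    where
    lem : ∀ t → t - t * (1ℤ + -1ℤ * 0ℤ) ≡ 0ℤ
    lem = solve-∀

  Ek≥0 : ∀ t t′ → good t → good t′ → 0ℤ ℤ.≤ Ek t t′
  Ek≥0 t t′ gt gt′ = by (parallel? (redⱽ t) (redⱽ t′))
    where
    by : Dec (Parallel (redⱽ t) (redⱽ t′)) → 0ℤ ℤ.≤ Ek t t′
    by (yes p) = subst (0ℤ ℤ.≤_) (sym (Ek-parallel t t′ p)) (C≥0 t t′)
    by (no np) = ℤP.≤-reflexive (sym (Ek-generic t t′ gt gt′ np))

  Ek-sym : ∀ t t′ → Ek t t′ ≡ Ek t′ t
  Ek-sym t t′ = cong₂ (λ c p → c - tc * (1ℤ + -1ℤ * p)) (C-sym t t′) (par-sym (redⱽ t) (redⱽ t′))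

  p : ℤ
  p = ∣M∣ ℤ.^ n * (Z - 1ℤ)

  ∑P : ∀ t → good t → ∑ V (P t) ≡ p
  ∑P t gt = begin
    ∑ V (P t)
      ≡⟨ ∑-unimodular n (P t) ⟩
    ∑T n (λ t′ → um t′ * P t t′)
      ≡⟨ ∑-cong (allTups n) (λ t′ → ℤP.*-comm (um t′) (P t t′)) ⟩
    ∑T n (λ t′ → par (redⱽ t) (redⱽ t′) * nzⱽ (redⱽ t′))
      ≡⟨ ∑T-par t gt nzⱽ ⟩
    ∣M∣ ℤ.^ n * F.∑ᴱ (λ u → nz u * nzⱽ (u ·ⱽ redⱽ t))
      ≡⟨ cong (∣M∣ ℤ.^ n *_) (trans (∑-cong F.list (λ u → trans (nz-* u (λ u≢0 → nzⱽ≡1 (·ⱽ-≢0 u (redⱽ t) u≢0 gt))) (ℤP.*-identityʳ (nz u)))) ∑nz′) ⟩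
    p ∎
    where
    nzⱽ≡1 : ∀ {v : Vec Res n} → v ≢ 0ⱽ → nzⱽ v ≡ 1ℤ
    nzⱽ≡1 {v} h = cong (λ b → 1ℤ - ⟦ b ⟧) (dec-false (vec≟ enumSub 0ⱽ v) (h ∘ sym))

  -- Equal to d² / q^(n-1), so that √μ = d q^(-(n-1)/2). It is the row sum d² of C less the row sum
  -- of tc (J - P).
  μ : ℤ
  μ = (∣M∣ ℤ.^ suc k * ∣M∣ ℤ.^ suc k) * Z ℤ.^ suc k

  rows : ∀ t → good t → ∑ V (Ek t) ≡ μ
  rows t gt = begin
    ∑ V (Ek t)
      ≡⟨ trans (∑-- V (C t) (λ t′ → tc * (1ℤ + -1ℤ * P t t′))) (cong₂ _-_ (C-row t gt) (trans (∑-*ˡ V tc (λ t′ → 1ℤ + -1ℤ * P t t′))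
           (cong (tc *_) (trans (∑-+ V (λ _ → 1ℤ) (λ t′ → -1ℤ * P t t′)) (cong₂ _+_ (∑um n) (trans (∑-*ˡ V -1ℤ (P t)) (cong (-1ℤ *_) (∑P t gt)))))))) ⟩
    d * d - tc * ((∣R∣ ℤ.^ n - ∣M∣ ℤ.^ n) + -1ℤ * p)
      ≡⟨ cong₂ (λ r Qk → (r * Qk) * (r * Qk) - Qk * ((r * (r * Qk) - ∣M∣ ℤ.^ n) + -1ℤ * p)) ∣R∣≡ (∣R∣^ k) ⟩
    (∣M∣ * Z * (x * y)) * (∣M∣ * Z * (x * y)) - x * y * ((∣M∣ * Z * (∣M∣ * Z * (x * y)) - ∣M∣ * (∣M∣ * x)) + -1ℤ * (∣M∣ * (∣M∣ * x) * (Z - 1ℤ)))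
      ≡⟨ lem ∣M∣ Z x y ⟩
    μ ∎
    where
    x y : ℤ
    x = ∣M∣ ℤ.^ k
    y = Z ℤ.^ k
    lem : ∀ m z x y → (m * z * (x * y)) * (m * z * (x * y)) - x * y * ((m * z * (m * z * (x * y)) - m * (m * x)) + -1ℤ * (m * (m * x) * (z - 1ℤ)))
          ≡ ((m * x) * (m * x)) * (z * y)
    lem = solve-∀

  psd : ∀ L → 0ℤ ℤ.≤ form L P
  psd L = ℤP.*-cancelˡ-≤-pos 0ℤ (form L P) (Z - 1ℤ) ⦃ ℤ.positive Z-1>0 ⦄ (subst₂ ℤ._≤_ (sym (ℤP.*-zeroʳ (Z - 1ℤ))) eq (square-form≥0 L (vecs enumSub n) (λ γ t → par γ (redⱽ t))))
    where
    eq : form L (λ t t′ → ∑ (vecs enumSub n) (λ γ → par γ (redⱽ t) * par γ (redⱽ t′))) ≡ (Z - 1ℤ) * form L P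
    eq = begin
      form L (λ t t′ → ∑ (vecs enumSub n) (λ γ → par γ (redⱽ t) * par γ (redⱽ t′)))
        ≡⟨ form-cong L (λ t t′ gt _ → trans (par-square (redⱽ t) (redⱽ t′) gt) (trans (cong (λ m → (pos m - 1ℤ) * P t t′) size≡q) (sym (ℤP.+-identityˡ ((Z - 1ℤ) * P t t′))))) ⟩
      form L (λ t t′ → 0ℤ + (Z - 1ℤ) * P t t′)
        ≡⟨ form-lin L (λ _ _ → 0ℤ) P (Z - 1ℤ) ⟩
      form L (λ _ _ → 0ℤ) + (Z - 1ℤ) * form L P
        ≡⟨ cong (_+ (Z - 1ℤ) * form L P) (trans (∑-cong (proj₁ L) (λ y → trans (∑-cong (proj₁ L) (λ z → ℤP.*-zeroʳ (proj₁ y * proj₁ z))) (∑-0 (proj₁ L)))) (∑-0 (proj₁ L))) ⟩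
      0ℤ + (Z - 1ℤ) * form L P
        ≡⟨ ℤP.+-identityˡ _ ⟩
      (Z - 1ℤ) * form L P ∎

  module Ker = Kernel Ek P tc μ tc≥0 decomp Ek≥0 Ek-sym rows

  ∣V∣>0 : 0ℤ ℤ.< ∣V∣
  ∣V∣>0 = ∑um>0 (suc k)

module UmExtremal (R : FinCommRing) (loc : FinCommRing.IsLocal R)
                  (π : FinCommRing.Elt R) (unif : FinCommRing.IsUniformizer R π) (k : ℕ)
                  (Π : ℕ → FiniteField.Carrier (LocalRing.residueField R loc π unif))
                  (Π-irr : Polynomials.Irreducible (LocalRing.residueField R loc π unif) (suc (suc k)) Π)
                  (odd : Projective.Odd (LocalRing.residueField R loc π unif) (pos (FiniteField.size (LocalRing.residueField R loc π unif)))) where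
  open UmGraph R loc π unif k
  open FinCommRing R using (UmAdj; bip)
  open Character residueField (suc k) Π Π-irr odd using (χ; χ-±1; ∑χ≡0; χ²; nzⱽ-χ; conj; conj≢0; hyperplaneSum)
  open ≡-Reasoning

  f : Tup n → ℤ
  f t = χ (redⱽ t)

  ∑f≡0 : ∑ V f ≡ 0ℤ
  ∑f≡0 = trans (∑-unimodular n f) (trans (∑-cong (allTups n) (λ t → nzⱽ-χ (redⱽ t)))
    (trans (∑T-red n χ) (trans (cong (∣M∣ ℤ.^ n *_) ∑χ≡0) (ℤP.*-zeroʳ (∣M∣ ℤ.^ n)))))

  -- If t′ = u t modulo π and x is a common neighbour, then 1 = x·t′ = u (x·t) = u modulo π, so t
  -- and t′ have the same reduction. Hence f agrees on parallel pairs with C ≠ 0 even if χ is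
  -- nontrivial on scalars.
  C-f : ∀ t t′ → Parallel (redⱽ t) (redⱽ t′) → C t t′ * f t′ ≡ C t t′ * f t
  C-f t t′ (u , u≢0 , e) = trans (sym (∑-*ʳ V (f t′) _)) (trans (∑-cong V term) (∑-*ʳ V (f t) _))
    where
    term : ∀ x → δ (dot x t) 1ᴿ * δ (dot x t′) 1ᴿ * f t′ ≡ δ (dot x t) 1ᴿ * δ (dot x t′) 1ᴿ * f t
    term x = trans (ℤP.*-assoc (δ (dot x t) 1ᴿ) (δ (dot x t′) 1ᴿ) (f t′)) (trans (⟦⟧*-cong (does (dot x t ≟ 1ᴿ)) (λ p →
        ⟦⟧*-cong (does (dot x t′ ≟ 1ᴿ)) (λ p′ → cong χ (same (does-true (dot x t ≟ 1ᴿ) p) (does-true (dot x t′ ≟ 1ᴿ) p′)))))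
        (sym (ℤP.*-assoc (δ (dot x t) 1ᴿ) (δ (dot x t′) 1ᴿ) (f t))))
      where
      same : dot x t ≡ 1ᴿ → dot x t′ ≡ 1ᴿ → redⱽ t′ ≡ redⱽ t
      same p p′ = trans (sym e) (trans (cong (_·ⱽ redⱽ t) u≡1) (·ⱽ-identity (redⱽ t)))
        where
        u≡1 : u ≡ F.1F
        u≡1 = begin
          u                                  ≡⟨ sym (F.*-identityʳ u) ⟩
          u *ᶠ F.1F                          ≡⟨ cong (u *ᶠ_) (trans (cong red (sym p)) (red-dot x t)) ⟩
          u *ᶠ dotF (redⱽ x) (redⱽ t)        ≡⟨ sym (dotF-·ʳ u (redⱽ x) (redⱽ t)) ⟩
          dotF (redⱽ x) (u ·ⱽ redⱽ t)        ≡⟨ cong (dotF (redⱽ x)) e ⟩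
          dotF (redⱽ x) (redⱽ t′)            ≡⟨ trans (sym (red-dot x t′)) (cong red p′) ⟩
          F.1F ∎

  Ek-f : ∀ t t′ → good t → good t′ → Ek t t′ * f t′ ≡ Ek t t′ * f t
  Ek-f t t′ gt gt′ = by (parallel? (redⱽ t) (redⱽ t′))
    where
    by : Dec (Parallel (redⱽ t) (redⱽ t′)) → Ek t t′ * f t′ ≡ Ek t t′ * f t
    by (yes p) = trans (cong (_* f t′) (Ek-parallel t t′ p)) (trans (C-f t t′ p) (cong (_* f t) (sym (Ek-parallel t t′ p))))
    by (no np) = trans (cong (_* f t′) z) (sym (cong (_* f t) z))
      where
      z : Ek t t′ ≡ 0ℤ
      z = Ek-generic t t′ gt gt′ np

  ∑Pf : ∀ t → good t → ∑ V (λ t′ → P t t′ * f t′) ≡ ∣M∣ ℤ.^ n * F.∑ᴱ (λ u → nz u * χ (u ·ⱽ redⱽ t))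
  ∑Pf t gt = trans (∑-unimodular n (λ t′ → P t t′ * f t′)) (trans (∑-cong (allTups n) (λ t′ →
      trans (lem (um t′) (P t t′) (f t′)) (cong (P t t′ *_) (nzⱽ-χ (redⱽ t′))))) (∑T-par t gt χ))
    where
    lem : ∀ x y z → x * (y * z) ≡ y * (x * z)
    lem = solve-∀

  s̄ : ℤ
  s̄ = ∑ (vecs enumSub n) (λ γ → F.δ (head γ) (red 1ᴿ) * χ γ)

  -- The factor ∣M∣ comes from `∑-reduce`; what remains is a hyperplane sum over the residue field,
  -- constant up to the sign χ(conj t).
  S-eq : ∀ t → good t → ∣M∣ * ∑ V (λ t′ → f t′ * ⟦ adj t t′ ⟧) ≡ χ (conj (redⱽ t)) * (∣M∣ ℤ.^ n * s̄)
  S-eq t gt = begin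
    ∣M∣ * ∑ V (λ t′ → f t′ * ⟦ adj t t′ ⟧)
      ≡⟨ cong (∣M∣ *_) (trans (∑-cong V (λ t′ → trans (ℤP.*-comm (f t′) _) (cong (λ b → ⟦ b ⟧ * f t′) (adj-sym t t′)))) (∑V-δ t f)) ⟩
    ∣M∣ * ∑T n (λ t′ → δ (dot t′ t) 1ᴿ * χ (redⱽ t′))
      ≡⟨ ∑-reduce n t (proj₁ (dual-of t gt)) (proj₂ (dual-of t gt)) 1ᴿ χ ⟩
    ∣M∣ ℤ.^ n * ∑ (vecs enumSub n) (λ α → F.δ (dotF (redⱽ t) α) (red 1ᴿ) * χ α)
      ≡⟨ cong (∣M∣ ℤ.^ n *_) (hyperplaneSum (red 1ᴿ) (redⱽ t) gt) ⟩
    ∣M∣ ℤ.^ n * (χ (conj (redⱽ t)) * s̄)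
      ≡⟨ lem (∣M∣ ℤ.^ n) (χ (conj (redⱽ t))) s̄ ⟩
    χ (conj (redⱽ t)) * (∣M∣ ℤ.^ n * s̄) ∎
    where
    lem : ∀ x y z → x * (y * z) ≡ y * (x * z)
    lem = solve-∀

  upper : ∀ ρ → (∀ t → good t → ∣M∣ ℤ.^ n * F.∑ᴱ (λ u → nz u * χ (u ·ⱽ redⱽ t)) ≡ ρ * f t) →
          ∀ λ′ → 0ℤ ℤ.< λ′ → λ′ * λ′ ≡ μ - tc * ρ →
          ∀ c → (∀ e j → pos 2 * pos e ≡ (d - λ′) * pos (suc j) → e /ᵣ suc j ℚ.≤ c) → iso (bip V) UmAdj ℚ.≤ c
  upper ρ hρ λ′ λ>0 λ² c toℚ = isoUpper X.p₁ X.p₂ X.len₁ X.len₂ λ′ ∣V∣>0 X.u≡N X.2cut c toℚ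
    where
    module Eig = Ker.Eigen f (λ t gt → χ² (redⱽ t) gt) ∑f≡0 Ek-f ρ (λ t gt → trans (∑Pf t gt) (hρ t gt))
    sg = Eig.signs ∣M∣ (λ t → χ (conj (redⱽ t))) (∣M∣ ℤ.^ n * s̄) λ′ ∣M∣≢0 (>0⇒≢0 ∣V∣>0)
      (λ t gt → χ-±1 (conj (redⱽ t)) (conj≢0 (redⱽ t) gt)) S-eq λ²
    module X = Eig.Extremal λ′ (>0⇒≢0 λ>0) (λ t gt → χ-±1 (redⱽ t) gt) (proj₁ sg) (proj₁ (proj₂ sg)) (proj₂ (proj₂ sg))

  module OddDegree (ν : Res) (ν≢0 : ν ≢ F.0F) (χ-ν : ∀ v → χ (ν ·ⱽ v) ≡ - χ v) where

    -- u ↦ ν u reverses the sign of the sum along a line. Thus P f = 0, ρ = 0, and the eigenvalue of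
    -- C at f is the full μ.
    line≡0 : ∀ t → F.∑ᴱ (λ u → nz u * χ (u ·ⱽ redⱽ t)) ≡ 0ℤ
    line≡0 t = self-neg _ (begin
      F.∑ᴱ (λ u → nz u * χ (u ·ⱽ redⱽ t))                ≡⟨ sym (F.∑-scale ν≢0 (λ u → nz u * χ (u ·ⱽ redⱽ t))) ⟩
      F.∑ᴱ (λ u → nz (ν *ᶠ u) * χ ((ν *ᶠ u) ·ⱽ redⱽ t))  ≡⟨ ∑-cong F.list (λ u → trans (cong₂ _*_ (nz-scale ν≢0 u) (trans (cong χ (·ⱽ-assoc ν u (redⱽ t))) (χ-ν (u ·ⱽ redⱽ t))))
                                                             (sym (ℤP.neg-distribʳ-* (nz u) (χ (u ·ⱽ redⱽ t))))) ⟩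
      F.∑ᴱ (λ u → - (nz u * χ (u ·ⱽ redⱽ t)))            ≡⟨ ∑-neg F.list (λ u → nz u * χ (u ·ⱽ redⱽ t)) ⟩
      - F.∑ᴱ (λ u → nz u * χ (u ·ⱽ redⱽ t)) ∎)

    hρ : ∀ t → good t → ∣M∣ ℤ.^ n * F.∑ᴱ (λ u → nz u * χ (u ·ⱽ redⱽ t)) ≡ 0ℤ * f t
    hρ t gt = trans (cong (∣M∣ ℤ.^ n *_) (line≡0 t)) (ℤP.*-zeroʳ (∣M∣ ℤ.^ n))

    λ′ : ℕ → ℤ
    λ′ j = ∣M∣ ℤ.^ suc k * Z ℤ.^ j

    λ² : ∀ j → suc k ≡ j ℕ.+ j → λ′ j * λ′ j ≡ μ - tc * 0ℤ
    λ² j e = trans (lem (∣M∣ ℤ.^ suc k) (Z ℤ.^ j) tc) (cong (λ z → (∣M∣ ℤ.^ suc k * ∣M∣ ℤ.^ suc k) * z - tc * 0ℤ)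
        (trans (sym (ℤP.^-distribˡ-+-* Z j j)) (cong (Z ℤ.^_) (sym e))))
      where
      lem : ∀ m z t → (m * z) * (m * z) ≡ (m * m) * (z * z) - t * 0ℤ
      lem = solve-∀

  module EvenDegree (χ-u : ∀ u v → u ≢ F.0F → χ (u ·ⱽ v) ≡ χ v) where

    hρ : ∀ t → good t → ∣M∣ ℤ.^ n * F.∑ᴱ (λ u → nz u * χ (u ·ⱽ redⱽ t)) ≡ p * f t
    hρ t gt = trans (cong (∣M∣ ℤ.^ n *_) (trans (∑-cong F.list (λ u → nz-* u (χ-u u (redⱽ t)))) (trans (∑-*ʳ F.list (f t) nz) (cong (_* f t) ∑nz′))))
      (sym (ℤP.*-assoc (∣M∣ ℤ.^ n) (Z - 1ℤ) (f t)))

    λ′ : ℕ → ℤ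
    λ′ j = ∣M∣ ℤ.^ suc k * Z ℤ.^ j

    -- Since f is constant on lines, ρ is the whole row sum p of P, and μ - tc p = μ/q. The missing
    -- factor √q is the gap between the two bounds for even n.
    λ² : ∀ j → k ≡ j ℕ.+ j → λ′ j * λ′ j ≡ μ - tc * p
    λ² j e = trans (lem (∣M∣ ℤ.^ suc k) (Z ℤ.^ j)) (trans (cong ((∣M∣ ℤ.^ suc k * ∣M∣ ℤ.^ suc k) *_) (trans (sym (ℤP.^-distribˡ-+-* Z j j)) (cong (Z ℤ.^_) (sym e))))
        (trans (lem₂ ∣M∣ Z (∣M∣ ℤ.^ k) (Z ℤ.^ k)) (cong (λ t → μ - t * p) (sym (∣R∣^ k)))))
      where
      lem : ∀ m z → (m * z) * (m * z) ≡ (m * m) * (z * z)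
      lem = solve-∀
      lem₂ : ∀ m z x y → ((m * x) * (m * x)) * y ≡ ((m * x) * (m * x)) * (z * y) - x * y * (m * (m * x) * (z - 1ℤ))
      lem₂ = solve-∀

module Um0Graph (R : FinCommRing) (loc : FinCommRing.IsLocal R) (prin : FinCommRing.IsPrincipal R)
                (π : FinCommRing.Elt R) (unif : FinCommRing.IsUniformizer R π) (k : ℕ) where
  open Lines R loc π unif public
  open Chain R loc prin π unif using (span; span-dot; InSpan)
  open FinCommRing R using (Um0Adj)
  open ≡-Reasoning

  n : ℕ
  n = suc (suc (suc k))

  V : List (Tup n)
  V = unimodularModUnits n

  adj : Tup n → Tup n → Bool
  adj a b = does (dot a b ≟ 0ᴿ)

  adj-sym : ∀ t t′ → adj t t′ ≡ adj t′ t
  adj-sym t t′ = cong (λ z → does (z ≟ 0ᴿ)) (dot-comm t t′)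

  δ-scale : ∀ {u} → IsUnit u → ∀ (a b : Tup n) → δ (dot (scale u a) b) 0ᴿ ≡ δ (dot a b) 0ᴿ
  δ-scale {u} (w , e) a b = cong ⟦_⟧ (does-cong (dot (scale u a) b ≟ 0ᴿ) (dot a b ≟ 0ᴿ)
    (λ z → begin
      dot a b                ≡⟨ sym (*-identityˡ (dot a b)) ⟩
      1ᴿ ⊗ dot a b           ≡⟨ cong (_⊗ dot a b) (trans (sym e) (*-comm u w)) ⟩
      w ⊗ u ⊗ dot a b        ≡⟨ *-assoc w u (dot a b) ⟩
      w ⊗ (u ⊗ dot a b)      ≡⟨ cong (w ⊗_) (trans (sym (dot-scale u a b)) z) ⟩
      w ⊗ 0ᴿ                 ≡⟨ zeroʳ w ⟩
      0ᴿ ∎)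
    (λ z → trans (dot-scale u a b) (trans (cong (u ⊗_) z) (zeroʳ u))))

  δ-ext : ∀ (b : Tup n) → Ext (λ a → δ (dot a b) 0ᴿ)
  δ-ext b e = cong (λ z → δ z 0ᴿ) (dot-congˡ b e)

  um-split : ∀ (a b : Tup n) g → um a * (δ (dot a b) 0ᴿ * g) ≡ δ (dot a b) 0ᴿ * g - δ (dot a b) 0ᴿ * (μ⁰ a * g)
  um-split a b g = lem (μ⁰ a) (δ (dot a b) 0ᴿ) g
    where
    lem : ∀ m x g → (1ℤ - m) * (x * g) ≡ x * g - x * (m * g)
    lem = solve-∀

  -- The left side counts unimodular tuples of length j + 1. Dividing by the freely acting units
  -- gives the number of points of a projective space over R, and both d and `tc` have this form.
  powerDifference : ∀ j → ∣R∣ ℤ.^ suc j - ∣M∣ ℤ.^ suc j ≡ ∣U∣ * (∣M∣ ℤ.^ j * θ (suc j))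
  powerDifference j = begin
    ∣R∣ ℤ.^ suc j - ∣M∣ ℤ.^ suc j                       ≡⟨ cong (_- ∣M∣ ℤ.^ suc j) (∣R∣^ (suc j)) ⟩
    ∣M∣ ℤ.^ suc j * Z ℤ.^ suc j - ∣M∣ ℤ.^ suc j         ≡⟨ lem (∣M∣ ℤ.^ suc j) (Z ℤ.^ suc j) ⟩
    ∣M∣ ℤ.^ suc j * (Z ℤ.^ suc j - 1ℤ)                  ≡⟨ cong (∣M∣ ℤ.^ suc j *_) (sym (θ-geometric (suc j))) ⟩
    ∣M∣ ℤ.^ suc j * ((Z - 1ℤ) * θ (suc j))              ≡⟨ lem′ ∣M∣ (∣M∣ ℤ.^ j) (Z - 1ℤ) (θ (suc j)) ⟩
    ∣M∣ * (Z - 1ℤ) * (∣M∣ ℤ.^ j * θ (suc j))            ≡⟨ cong (_* (∣M∣ ℤ.^ j * θ (suc j))) (sym ∣U∣≡′) ⟩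
    ∣U∣ * (∣M∣ ℤ.^ j * θ (suc j)) ∎
    where
    lem : ∀ m z → m * z - m ≡ m * (z - 1ℤ)
    lem = solve-∀
    lem′ : ∀ m x z t → m * x * (z * t) ≡ m * z * (x * t)
    lem′ = solve-∀

  ∣U∣≢0 : ∣U∣ ≢ 0ℤ
  ∣U∣≢0 = >0⇒≢0 ∣U∣>0

  d : ℤ
  d = ∣M∣ ℤ.^ suc k * θ (suc (suc k))

  U*d : ∀ t → good t → ∣U∣ * ∑ V (λ t′ → δ (dot t′ t) 0ᴿ) ≡ ∣R∣ ℤ.^ suc (suc k) - ∣M∣ ℤ.^ suc (suc k)
  U*d t gt = begin
    ∣U∣ * ∑ V (λ t′ → δ (dot t′ t) 0ᴿ)
      ≡⟨ ∑-orbits n (λ t′ → δ (dot t′ t) 0ᴿ) (δ-ext t) (λ u a iu → δ-scale iu a t) ⟩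
    ∑ (unimodular n) (λ t′ → δ (dot t′ t) 0ᴿ)
      ≡⟨ trans (∑-unimodular n (λ t′ → δ (dot t′ t) 0ᴿ)) (∑-cong (allTups n) (λ a → trans (cong (um a *_) (sym (ℤP.*-identityʳ (δ (dot a t) 0ᴿ)))) (um-split a t 1ℤ))) ⟩
    ∑T n (λ a → δ (dot a t) 0ᴿ * 1ℤ - δ (dot a t) 0ᴿ * (μ⁰ a * 1ℤ))
      ≡⟨ ∑-- (allTups n) (λ a → δ (dot a t) 0ᴿ * 1ℤ) (λ a → δ (dot a t) 0ᴿ * (μ⁰ a * 1ℤ)) ⟩
    ∑T n (λ a → δ (dot a t) 0ᴿ * 1ℤ) - ∑T n (λ a → δ (dot a t) 0ᴿ * (μ⁰ a * 1ℤ))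
      ≡⟨ cong₂ _-_ (∑-cong (allTups n) (λ a → ℤP.*-identityʳ (δ (dot a t) 0ᴿ))) (∑-cong (allTups n) (λ a → cong (δ (dot a t) 0ᴿ *_) (ℤP.*-identityʳ (μ⁰ a)))) ⟩
    ∑T n (λ a → δ (dot a t) 0ᴿ) - ∑T n (λ a → δ (dot a t) 0ᴿ * μ⁰ a)
      ≡⟨ cong₂ _-_ (count₁ (suc (suc k)) t (proj₁ (dual-of t gt)) (proj₂ (dual-of t gt)) 0ᴿ) (countM₁ (suc (suc k)) t (proj₁ (dual-of t gt)) (proj₂ (dual-of t gt))) ⟩
    ∣R∣ ℤ.^ suc (suc k) - ∣M∣ ℤ.^ suc (suc k) ∎

  regular : ∀ t → good t → ∑ V (λ t′ → ⟦ adj t t′ ⟧) ≡ d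
  regular t gt = cancel-≢0 ∣U∣≢0 (trans (cong (∣U∣ *_) (∑-cong V (λ t′ → cong ⟦_⟧ (adj-sym t t′)))) (trans (U*d t gt) (powerDifference (suc k))))

  open Link V good (allGood-modUnits n) adj adj-sym d regular Um0Adj
    (λ _ _ → refl) (λ _ _ → refl) (λ _ _ → refl) (λ _ _ → refl) public using (isoLower; isoUpper)
  open Bipartite V good (allGood-modUnits n) adj adj-sym d regular public using (C; C-sym; C≥0; C-row; module Kernel) renaming (N to ∣V∣)
  open QuadraticForms V good (allGood-modUnits n) public using (form)

  U*V : ∣U∣ * ∣V∣ ≡ ∣R∣ ℤ.^ n - ∣M∣ ℤ.^ n
  U*V = trans (∑-orbits n (λ _ → 1ℤ) (λ _ → refl) (λ _ _ _ → refl)) (∑um n)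

  ∣V∣>0 : 0ℤ ℤ.< ∣V∣
  ∣V∣>0 = ≥0∧≢0⇒>0 (∑-nonneg V (λ _ → ℤ.+≤+ z≤n)) (λ e → >0⇒≢0 (∑um>0 (suc (suc k))) (trans (sym (∑-orbits n (λ _ → 1ℤ) (λ _ → refl) (λ _ _ _ → refl)))
    (trans (cong (∣U∣ *_) e) (ℤP.*-zeroʳ ∣U∣))))

  tc : ℤ
  tc = ∣M∣ ℤ.^ k * θ (suc k)

  tc≥0 : 0ℤ ℤ.≤ tc
  tc≥0 = i*j≥0 {∣M∣ ℤ.^ k} (ℤP.<⇒≤ (pow>0 ∣M∣>0 k)) (θ≥0 (suc k))

  C-dual : ∀ t w → Dual t w → C t w ≡ tc
  C-dual t w D = cancel-≢0 ∣U∣≢0 (begin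
    ∣U∣ * C t w
      ≡⟨ ∑-orbits n (λ x → δ (dot x t) 0ᴿ * δ (dot x w) 0ᴿ) (λ e → cong₂ _*_ (δ-ext t e) (δ-ext w e)) (λ u a iu → cong₂ _*_ (δ-scale iu a t) (δ-scale iu a w)) ⟩
    ∑ (unimodular n) (λ x → δ (dot x t) 0ᴿ * δ (dot x w) 0ᴿ)
      ≡⟨ trans (∑-unimodular n (λ x → δ (dot x t) 0ᴿ * δ (dot x w) 0ᴿ)) (∑-cong (allTups n) (λ a → um-split a t (δ (dot a w) 0ᴿ))) ⟩
    ∑T n (λ a → δ (dot a t) 0ᴿ * δ (dot a w) 0ᴿ - δ (dot a t) 0ᴿ * (μ⁰ a * δ (dot a w) 0ᴿ))
      ≡⟨ ∑-- (allTups n) (λ a → δ (dot a t) 0ᴿ * δ (dot a w) 0ᴿ) (λ a → δ (dot a t) 0ᴿ * (μ⁰ a * δ (dot a w) 0ᴿ)) ⟩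
    ∑T n (λ a → δ (dot a t) 0ᴿ * δ (dot a w) 0ᴿ) - ∑T n (λ a → δ (dot a t) 0ᴿ * (μ⁰ a * δ (dot a w) 0ᴿ))
      ≡⟨ cong₂ _-_ (count₂ (suc k) t w D 0ᴿ 0ᴿ) (countM₂ (suc k) t w D) ⟩
    ∣R∣ ℤ.^ suc k - ∣M∣ ℤ.^ suc k
      ≡⟨ powerDifference k ⟩
    ∣U∣ * tc ∎)

  -- Vectors orthogonal to t and w are orthogonal to every t′ in the span of t and w.
  C≥tc : ∀ t t′ → good t → tc ℤ.≤ C t t′
  C≥tc t t′ gt = conclude (span t t′ gt)
    where
    conclude : (∃ λ w → Dual t w × InSpan t w t′) → tc ℤ.≤ C t t′
    conclude (w , D , sp) = subst (ℤ._≤ C t t′) (C-dual t w D) (∑-mono V le)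
      where
      le : ∀ x → δ (dot x t) 0ᴿ * δ (dot x w) 0ᴿ ℤ.≤ δ (dot x t) 0ᴿ * δ (dot x t′) 0ᴿ
      le x = by (dot x t ≟ 0ᴿ) (dot x w ≟ 0ᴿ) (dot x t′ ≟ 0ᴿ)
        where
        by : (p : Dec (dot x t ≡ 0ᴿ)) (q : Dec (dot x w ≡ 0ᴿ)) (r : Dec (dot x t′ ≡ 0ᴿ)) → ⟦ does p ⟧ * ⟦ does q ⟧ ℤ.≤ ⟦ does p ⟧ * ⟦ does r ⟧
        by (no _)  _       _       = ℤP.≤-refl
        by (yes _) (no _)  r       = subst (0ℤ ℤ.≤_) (sym (ℤP.*-identityˡ ⟦ does r ⟧)) (⟦⟧-nonneg (does r))
        by (yes _) (yes _) (yes _) = ℤP.≤-refl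
        by (yes p) (yes q) (no nr) = contradiction (span-dot sp x p q) nr

  -- Because C ≥ tc for all pairs, C - tc J is itself nonnegative, and the correction by P becomes
  -- the zero kernel.
  Ek 𝟘 : Tup n → Tup n → ℤ
  Ek t t′ = C t t′ - tc
  𝟘 _ _ = 0ℤ

  decomp : ∀ t t′ → good t → good t′ → C t t′ ≡ Ek t t′ + tc * (1ℤ + -1ℤ * 0ℤ)
  decomp t t′ _ _ = lem (C t t′) tc
    where
    lem : ∀ c t → c ≡ (c - t) + t * (1ℤ + -1ℤ * 0ℤ)
    lem = solve-∀

  Ek≥0 : ∀ t t′ → good t → good t′ → 0ℤ ℤ.≤ Ek t t′
  Ek≥0 t t′ gt _ = ℤP.i≤j⇒0≤j-i (C≥tc t t′ gt)

  Ek-sym : ∀ t t′ → Ek t t′ ≡ Ek t′ t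
  Ek-sym t t′ = cong (_- tc) (C-sym t t′)

  μ : ℤ
  μ = (∣M∣ ℤ.^ suc k * ∣M∣ ℤ.^ suc k) * Z ℤ.^ suc k

  rows : ∀ t → good t → ∑ V (Ek t) ≡ μ
  -- d, `tc` and ∣V∣ are quotients by ∣U∣ of differences of powers, so multiplying by ∣U∣ twice
  -- makes the identity polynomial.
  rows t gt = cancel-≢0 ∣U∣≢0 (cancel-≢0 ∣U∣≢0 (begin
    ∣U∣ * (∣U∣ * ∑ V (Ek t))
      ≡⟨ cong (λ z → ∣U∣ * (∣U∣ * z)) (trans (∑-- V (C t) (λ _ → tc)) (cong₂ _-_ (C-row t gt) (trans (∑-cong V (λ _ → sym (ℤP.*-identityʳ tc))) (∑-*ˡ V tc (λ _ → 1ℤ))))) ⟩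
    ∣U∣ * (∣U∣ * (d * d - tc * ∣V∣))
      ≡⟨ lem₁ ∣U∣ d tc ∣V∣ ⟩
    (∣U∣ * d) * (∣U∣ * d) - (∣U∣ * tc) * (∣U∣ * ∣V∣)
      ≡⟨ cong₂ _-_ (cong₂ _*_ Ud Ud) (cong₂ _*_ (sym (powerDifference k)) U*V) ⟩
    (∣R∣ ℤ.^ suc (suc k) - ∣M∣ ℤ.^ suc (suc k)) * (∣R∣ ℤ.^ suc (suc k) - ∣M∣ ℤ.^ suc (suc k)) - (∣R∣ ℤ.^ suc k - ∣M∣ ℤ.^ suc k) * (∣R∣ ℤ.^ n - ∣M∣ ℤ.^ n)
      ≡⟨ cong₂ (λ r Qk → (r * (r * Qk) - ∣M∣ ℤ.^ suc (suc k)) * (r * (r * Qk) - ∣M∣ ℤ.^ suc (suc k)) - (r * Qk - ∣M∣ ℤ.^ suc k) * (r * (r * (r * Qk)) - ∣M∣ ℤ.^ n)) ∣R∣≡ (∣R∣^ k) ⟩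
    (r * (r * (x * y)) - ∣M∣ * (∣M∣ * x)) * (r * (r * (x * y)) - ∣M∣ * (∣M∣ * x)) - (r * (x * y) - ∣M∣ * x) * (r * (r * (r * (x * y))) - ∣M∣ * (∣M∣ * (∣M∣ * x)))
      ≡⟨ lem₂ ∣M∣ Z x y ⟩
    ∣M∣ * (Z - 1ℤ) * (∣M∣ * (Z - 1ℤ) * (((∣M∣ * x) * (∣M∣ * x)) * (Z * y)))
      ≡⟨ cong₂ (λ u v → u * (v * μ)) (sym ∣U∣≡′) (sym ∣U∣≡′) ⟩
    ∣U∣ * (∣U∣ * μ) ∎))
    where
    x y r : ℤ
    x = ∣M∣ ℤ.^ k
    y = Z ℤ.^ k
    r = ∣M∣ * Z
    Ud : ∣U∣ * d ≡ ∣R∣ ℤ.^ suc (suc k) - ∣M∣ ℤ.^ suc (suc k)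
    Ud = sym (powerDifference (suc k))
    lem₁ : ∀ u d t v → u * (u * (d * d - t * v)) ≡ (u * d) * (u * d) - (u * t) * (u * v)
    lem₁ = solve-∀
    lem₂ : ∀ m z x y → ((m * z) * ((m * z) * (x * y)) - m * (m * x)) * ((m * z) * ((m * z) * (x * y)) - m * (m * x)) - ((m * z) * (x * y) - m * x) * ((m * z) * ((m * z) * ((m * z) * (x * y))) - m * (m * (m * x)))
           ≡ m * (z - 1ℤ) * (m * (z - 1ℤ) * (((m * x) * (m * x)) * (z * y)))
    lem₂ = solve-∀

  psd : ∀ L → 0ℤ ℤ.≤ form L 𝟘
  psd L = ℤP.≤-reflexive (sym (trans (∑-cong (proj₁ L) (λ y → trans (∑-cong (proj₁ L) (λ z → ℤP.*-zeroʳ (proj₁ y * proj₁ z))) (∑-0 (proj₁ L)))) (∑-0 (proj₁ L))))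

  module Ker = Kernel Ek 𝟘 tc μ tc≥0 decomp Ek≥0 Ek-sym rows

module Um0Extremal (R : FinCommRing) (loc : FinCommRing.IsLocal R) (prin : FinCommRing.IsPrincipal R)
                   (π : FinCommRing.Elt R) (unif : FinCommRing.IsUniformizer R π) (k : ℕ)
                   (Π : ℕ → FiniteField.Carrier (LocalRing.residueField R loc π unif))
                   (Π-irr : Polynomials.Irreducible (LocalRing.residueField R loc π unif) (suc (suc (suc k))) Π)
                   (odd : Projective.Odd (LocalRing.residueField R loc π unif) (pos (FiniteField.size (LocalRing.residueField R loc π unif))))
                   (χ-u : ∀ u v → u ≢ FiniteField.0F (LocalRing.residueField R loc π unif) →
                          Character.χ (LocalRing.residueField R loc π unif) (suc (suc k)) Π Π-irr odd (VectorSpace._·ⱽ_ (LocalRing.residueField R loc π unif) u v)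
                          ≡ Character.χ (LocalRing.residueField R loc π unif) (suc (suc k)) Π Π-irr odd v) where
  open Um0Graph R loc prin π unif k
  open FinCommRing R using (Um0Adj; bip)
  open Character residueField (suc (suc k)) Π Π-irr odd using (χ; χ-±1; ∑χ≡0; χ²; nzⱽ-χ; conj; conj≢0; hyperplaneSum)
  open ≡-Reasoning

  f : Tup n → ℤ
  f t = χ (redⱽ t)

  f-ext : Ext f
  f-ext e = cong χ (redⱽ-ext e)

  -- Triviality of χ on F^* is what makes f a function on orbits of units, and so on the vertices.
  f-scale : ∀ u a → IsUnit u → f (scale u a) ≡ f a
  f-scale u a iu = trans (cong χ (redⱽ-scale u a)) (χ-u (red u) (redⱽ a) (λ z → M⇒¬unit (red≡0⇒M z) iu))

  ∑f≡0 : ∑ V f ≡ 0ℤ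
  ∑f≡0 = cancel-≢0 ∣U∣≢0 (begin
    ∣U∣ * ∑ V f                                ≡⟨ ∑-orbits n f f-ext f-scale ⟩
    ∑ (unimodular n) f                         ≡⟨ trans (∑-unimodular n f) (∑-cong (allTups n) (λ t → nzⱽ-χ (redⱽ t))) ⟩
    ∑T n (λ t → χ (redⱽ t))                    ≡⟨ ∑T-red n χ ⟩
    ∣M∣ ℤ.^ n * ∑ (vecs enumSub n) χ           ≡⟨ cong (∣M∣ ℤ.^ n *_) ∑χ≡0 ⟩
    ∣M∣ ℤ.^ n * 0ℤ                             ≡⟨ trans (ℤP.*-zeroʳ (∣M∣ ℤ.^ n)) (sym (ℤP.*-zeroʳ ∣U∣)) ⟩
    ∣U∣ * 0ℤ ∎)

  -- f is constant on parallel pairs, and on all other pairs C equals `tc`, so Ek vanishes.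
  Ek-f : ∀ t t′ → good t → good t′ → Ek t t′ * f t′ ≡ Ek t t′ * f t
  Ek-f t t′ gt gt′ = by (parallel? (redⱽ t) (redⱽ t′))
    where
    by : Dec (Parallel (redⱽ t) (redⱽ t′)) → Ek t t′ * f t′ ≡ Ek t t′ * f t
    by (yes (u , u≢0 , e)) = cong (Ek t t′ *_) (trans (cong χ (sym e)) (χ-u u (redⱽ t) u≢0))
    by (no np) = trans (cong (_* f t′) z) (sym (cong (_* f t) z))
      where
      z : Ek t t′ ≡ 0ℤ
      z = trans (cong (_- tc) (C-dual t t′ (independent⇒Dual t t′ gt gt′ np))) (ℤP.+-inverseʳ tc)

  s̄ : ℤ
  s̄ = ∑ (vecs enumSub n) (λ γ → F.δ (head γ) (red 0ᴿ) * χ γ)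

  S-eq : ∀ t → good t → ∣M∣ * ∣U∣ * ∑ V (λ t′ → f t′ * ⟦ adj t t′ ⟧) ≡ χ (conj (redⱽ t)) * (∣M∣ ℤ.^ n * s̄)
  S-eq t gt = begin
    ∣M∣ * ∣U∣ * ∑ V (λ t′ → f t′ * ⟦ adj t t′ ⟧)
      ≡⟨ trans (ℤP.*-assoc ∣M∣ ∣U∣ _) (cong (λ z → ∣M∣ * (∣U∣ * z)) (∑-cong V (λ t′ → trans (ℤP.*-comm (f t′) _) (cong (λ b → ⟦ b ⟧ * f t′) (adj-sym t t′))))) ⟩
    ∣M∣ * (∣U∣ * ∑ V (λ t′ → δ (dot t′ t) 0ᴿ * f t′))
      ≡⟨ cong (∣M∣ *_) (∑-orbits n (λ t′ → δ (dot t′ t) 0ᴿ * f t′) (λ e → cong₂ _*_ (δ-ext t e) (f-ext e)) (λ u a iu → cong₂ _*_ (δ-scale iu a t) (f-scale u a iu))) ⟩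
    ∣M∣ * ∑ (unimodular n) (λ t′ → δ (dot t′ t) 0ᴿ * f t′)
      ≡⟨ cong (∣M∣ *_) (trans (∑-unimodular n (λ t′ → δ (dot t′ t) 0ᴿ * f t′)) (∑-cong (allTups n) (λ t′ →
           trans (lem (um t′) (δ (dot t′ t) 0ᴿ) (f t′)) (cong (δ (dot t′ t) 0ᴿ *_) (nzⱽ-χ (redⱽ t′)))))) ⟩
    ∣M∣ * ∑T n (λ t′ → δ (dot t′ t) 0ᴿ * χ (redⱽ t′))
      ≡⟨ ∑-reduce n t (proj₁ (dual-of t gt)) (proj₂ (dual-of t gt)) 0ᴿ χ ⟩
    ∣M∣ ℤ.^ n * ∑ (vecs enumSub n) (λ α → F.δ (dotF (redⱽ t) α) (red 0ᴿ) * χ α)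
      ≡⟨ cong (∣M∣ ℤ.^ n *_) (hyperplaneSum (red 0ᴿ) (redⱽ t) gt) ⟩
    ∣M∣ ℤ.^ n * (χ (conj (redⱽ t)) * s̄)
      ≡⟨ lem (∣M∣ ℤ.^ n) (χ (conj (redⱽ t))) s̄ ⟩
    χ (conj (redⱽ t)) * (∣M∣ ℤ.^ n * s̄) ∎
    where
    lem : ∀ x y z → x * (y * z) ≡ y * (x * z)
    lem = solve-∀

  λ′ : ℕ → ℤ
  λ′ j = ∣M∣ ℤ.^ suc k * Z ℤ.^ j

  λ² : ∀ j → suc k ≡ j ℕ.+ j → λ′ j * λ′ j ≡ μ - tc * 0ℤ
  λ² j e = trans (lem (∣M∣ ℤ.^ suc k) (Z ℤ.^ j) tc) (cong (λ z → (∣M∣ ℤ.^ suc k * ∣M∣ ℤ.^ suc k) * z - tc * 0ℤ)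
      (trans (sym (ℤP.^-distribˡ-+-* Z j j)) (cong (Z ℤ.^_) (sym e))))
    where
    lem : ∀ m z t → (m * z) * (m * z) ≡ (m * m) * (z * z) - t * 0ℤ
    lem = solve-∀

  upper : ∀ j → suc k ≡ j ℕ.+ j →
          ∀ c → (∀ e i → pos 2 * pos e ≡ (d - λ′ j) * pos (suc i) → e /ᵣ suc i ℚ.≤ c) → iso (bip V) Um0Adj ℚ.≤ c
  upper j ej c toℚ = isoUpper X.p₁ X.p₂ X.len₁ X.len₂ (λ′ j) ∣V∣>0 X.u≡N X.2cut c toℚ
    where
    module Eig = Ker.Eigen f (λ t gt → χ² (redⱽ t) gt) ∑f≡0 Ek-f 0ℤ (λ t gt → ∑-0 V)
    sg = Eig.signs (∣M∣ * ∣U∣) (λ t → χ (conj (redⱽ t))) (∣M∣ ℤ.^ n * s̄) (λ′ j) (>0⇒≢0 (*>0 ∣M∣>0 ∣U∣>0)) (>0⇒≢0 ∣V∣>0)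
      (λ t gt → χ-±1 (conj (redⱽ t)) (conj≢0 (redⱽ t) gt)) S-eq (λ² j ej)
    module X = Eig.Extremal (λ′ j) (>0⇒≢0 (*>0 (pow>0 ∣M∣>0 (suc k)) (pow>0 Z>0 j))) (λ t gt → χ-±1 (redⱽ t) gt) (proj₁ sg) (proj₁ (proj₂ sg)) (proj₂ (proj₂ sg))

-- Parities, exponents and the rational form of the bounds

pos-^ : ∀ a n → pos (a ^ n) ≡ pos a ℤ.^ n
pos-^ a zero    = refl
pos-^ a (suc n) = trans (ℤP.pos-* a (a ^ n)) (cong (pos a *_) (pos-^ a n))

*2 : ∀ j → j ℕ.* 2 ≡ j ℕ.+ j
*2 j = trans (ℕP.*-comm j 2) (cong (j ℕ.+_) (ℕP.+-identityʳ j))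

oddHalf : ∀ k → suc (suc k) % 2 ≡ 1 → ∃ λ j → suc k ≡ j ℕ.+ j × suc k / 2 ≡ j
oddHalf k e = j , trans eq (*2 j) , trans (cong (_/ 2) eq) (m*n/n≡m j 2)
  where
  j : ℕ
  j = suc (suc k) / 2
  eq : suc k ≡ j ℕ.* 2
  eq = ℕP.suc-injective (trans (m≡m%n+[m/n]*n (suc (suc k)) 2) (cong (ℕ._+ j ℕ.* 2) e))

evenHalf : ∀ k → suc (suc k) % 2 ≡ 0 → ∃ λ j → k ≡ j ℕ.+ j × suc (suc k) / 2 ≡ suc j
evenHalf k e = by (suc (suc k) / 2) refl (trans (m≡m%n+[m/n]*n (suc (suc k)) 2) (cong (ℕ._+ (suc (suc k) / 2) ℕ.* 2) e))
  where
  by : ∀ h → suc (suc k) / 2 ≡ h → suc (suc k) ≡ (suc (suc k) / 2) ℕ.* 2 → ∃ λ j → k ≡ j ℕ.+ j × suc (suc k) / 2 ≡ suc j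
  by zero    h eq = contradiction (trans eq (cong (ℕ._* 2) h)) λ ()
  by (suc j) h eq = j , trans (ℕP.suc-injective (ℕP.suc-injective (trans eq (cong (ℕ._* 2) h)))) (*2 j) , h

module Main (R : FinCommRing) (loc : FinCommRing.IsLocal R) (prin : FinCommRing.IsPrincipal R)
            (π : FinCommRing.Elt R) (unif : FinCommRing.IsUniformizer R π)
            (ℓ : ℕ) (nil : FinCommRing.IsNilpotencyDegree R π ℓ) (oddq : FinCommRing.residueSize R π % 2 ≡ 1) where
  open Lines R loc π unif using (q; Z; Z>0; Z-1>0; ∣M∣; ∣M∣>0; ∣R∣; ∣R∣^; size≡q; residueField; Res; θ; θ-geometric; module Order; Odd; Even; _·ⱽ_)
  open FinCommRing R using (bip; unimodular; unimodularModUnits; UmAdj; Um0Adj)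
  private
    module F = FiniteField residueField

  odd : Odd (pos F.size)
  odd = pos (q / 2) , trans (cong pos (trans size≡q (trans (m≡m%n+[m/n]*n q 2) (cong₂ ℕ._+_ oddq (*2 (q / 2))))))
    (trans (ℤP.pos-+ 1 (q / 2 ℕ.+ q / 2)) (cong (1ℤ +_) (ℤP.pos-+ (q / 2) (q / 2))))

  q^>0 : ∀ j → 0 ℕ.< q ^ j
  q^>0 j = ℤP.drop‿+<+ (subst (0ℤ ℤ.<_) (sym (pos-^ q j)) (pow>0 Z>0 j))

  pos-M : ∀ j → pos (q ^ (j ℕ.* (ℓ ∸ 1))) ≡ ∣M∣ ℤ.^ j
  pos-M j = trans (cong pos (trans (cong (q ^_) (ℕP.*-comm j (ℓ ∸ 1))) (sym (ℕP.^-*-assoc q (ℓ ∸ 1) j))))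
    (trans (pos-^ (q ^ (ℓ ∸ 1)) j) (cong (ℤ._^ j) (sym (Order.∣M∣≡ ℓ nil))))

  pos-R : ∀ j → pos (q ^ (j ℕ.* ℓ)) ≡ ∣M∣ ℤ.^ j * Z ℤ.^ j
  pos-R j = trans (cong pos (trans (cong (λ l → q ^ (j ℕ.* l)) ℓ≡) (trans (cong (q ^_) (ℕP.*-distribˡ-+ j (ℓ ∸ 1) 1)) (ℕP.^-distribˡ-+-* q (j ℕ.* (ℓ ∸ 1)) (j ℕ.* 1)))))
      (trans (ℤP.pos-* (q ^ (j ℕ.* (ℓ ∸ 1))) (q ^ (j ℕ.* 1))) (cong₂ _*_ (pos-M j) (trans (cong (λ i → pos (q ^ i)) (ℕP.*-identityʳ j)) (pos-^ q j))))
    where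
    ℓ≡ : ℓ ≡ ℓ ∸ 1 ℕ.+ 1
    ℓ≡ = sym (ℕP.m∸n+n≡m (proj₁ nil))

  irreducible : ∀ k → ∃ λ Π → Polynomials.Irreducible residueField (suc k) Π
  irreducible k = let v , irr = IrreducibleCount.irreducibleOfDegree residueField k in
    MonicPolynomials.mon residueField v , MonicPolynomials.Irr⇒Irreducible residueField (suc k , v) irr

  numerator>0 : ∀ σ D → 0ℚ ≤ℚ σ → 0ℤ ℤ.< D → D * (ℚ.↧ σ * ℚ.↧ σ) ℤ.≤ ℚ.↥ σ * ℚ.↥ σ → 0ℤ ℤ.< ℚ.↥ σ
  numerator>0 σ D σ≥0 D>0 h = ≥0∧≢0⇒>0 (subst₂ ℤ._≤_ refl (ℤP.*-identityʳ (ℚ.↥ σ)) (Frac-≤⁻ (Frac-self 0ℚ) (Frac-self σ) σ≥0))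
    (λ e → ℤP.<⇒≱ (*>0 D>0 (*>0 (Frac.D>0 (Frac-self σ)) (Frac.D>0 (Frac-self σ)))) (subst (D * (ℚ.↧ σ * ℚ.↧ σ) ℤ.≤_) (cong (λ z → z * z) e) h))

  module UmBounds (k : ℕ) where
    open UmGraph R loc π unif k using (n; V; d; μ; module Ker; psd; ∣V∣>0; isoLower)

    c : ℚ
    c = ½ *ℚ ℕ→ℚ (q ^ (suc k ℕ.* ℓ))

    D : ℤ
    D = pos (q ^ (suc k ℕ.* ℓ))

    D≡d : D ≡ d
    D≡d = trans (pos-R (suc k)) (sym (∣R∣^ (suc k)))

    d≡ : d ≡ ∣M∣ ℤ.^ suc k * Z ℤ.^ suc k
    d≡ = ∣R∣^ (suc k)

    Frac-c : Frac c (1ℤ * D) (pos 2 * 1ℤ)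
    Frac-c = Frac-* (Frac-self ½) (Frac-ℕ (q ^ (suc k ℕ.* ℓ)))

    lower : ∀ σ → 0ℚ ≤ℚ σ → 1 /ᵣ (q ^ suc k) ≤ℚ σ *ℚ σ → c *ℚ (1ℚ -ℚ σ) ≤ℚ iso (bip V) UmAdj
    -- As μ = d² / q^(n-1) and σ² ≥ q^(-(n-1)), the rational d σ is at least √μ; as a pair of
    -- integers it is (d r, s).
    lower σ σ≥0 hσ = isoLower μ (Ker.spectral psd) ∣V∣>0 (d * r) s (*>0 d>0 r>0) (ℤP.<⇒≤ s>0) μ≤ (c *ℚ (1ℚ -ℚ σ)) toℚ
      where
      r s y : ℤ
      r = ℚ.↥ σ
      s = ℚ.↧ σ
      y = Z ℤ.^ suc k
      s>0 : 0ℤ ℤ.< s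
      s>0 = Frac.D>0 (Frac-self σ)
      d>0 : 0ℤ ℤ.< d
      d>0 = subst (0ℤ ℤ.<_) (sym d≡) (*>0 (pow>0 ∣M∣>0 (suc k)) (pow>0 Z>0 (suc k)))
      h : 1ℤ * (s * s) ℤ.≤ (r * r) * y
      h = subst (λ z → 1ℤ * (s * s) ℤ.≤ (r * r) * z) (pos-^ q (suc k)) (Frac-≤⁻ (Frac-/ 1 (q ^ suc k) (q^>0 (suc k))) (Frac-* (Frac-self σ) (Frac-self σ)) hσ)
      r>0 : 0ℤ ℤ.< r
      r>0 = ≥0∧≢0⇒>0 (subst₂ ℤ._≤_ refl (ℤP.*-identityʳ r) (Frac-≤⁻ (Frac-self 0ℚ) (Frac-self σ) σ≥0))
        (λ e → ℤP.<⇒≱ (*>0 s>0 s>0) (subst₂ ℤ._≤_ (ℤP.*-identityˡ (s * s)) (cong (λ z → (z * z) * y) e) h))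
      μ≤ : s * s * μ ℤ.≤ (d * r) * (d * r)
      μ≤ = subst₂ ℤ._≤_ (lem₁ s μ) (trans (lem₂ r y (∣M∣ ℤ.^ suc k)) (cong (λ z → (z * r) * (z * r)) (sym d≡)))
        (ℤP.*-monoʳ-≤-nonNeg μ ⦃ ℤ.nonNegative (ℤP.<⇒≤ (*>0 (*>0 (pow>0 ∣M∣>0 (suc k)) (pow>0 ∣M∣>0 (suc k))) (pow>0 Z>0 (suc k)))) ⦄ h)
        where
        lem₁ : ∀ s m → 1ℤ * (s * s) * m ≡ s * s * m
        lem₁ = solve-∀
        lem₂ : ∀ r y m → (r * r) * y * ((m * m) * y) ≡ ((m * y) * r) * ((m * y) * r)
        lem₂ = solve-∀
      toℚ : ∀ e j → (s * d - d * r) * pos (suc j) ℤ.≤ pos 2 * s * pos e → c *ℚ (1ℚ -ℚ σ) ≤ℚ e /ᵣ suc j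
      toℚ e j b = Frac-≤ (Frac-* Frac-c (Frac-- (Frac-self 1ℚ) (Frac-self σ))) (Frac-/ᵣ e j)
        (subst₂ ℤ._≤_ (trans (lem₁ s d r (pos (suc j))) (cong (λ z → (1ℤ * z * (1ℤ * s + - r * 1ℤ)) * pos (suc j)) (sym D≡d))) (lem₂ s (pos e)) b)
        where
        lem₁ : ∀ s d r j → (s * d - d * r) * j ≡ (1ℤ * d * (1ℤ * s + - r * 1ℤ)) * j
        lem₁ = solve-∀
        lem₂ : ∀ s e → pos 2 * s * e ≡ e * ((pos 2 * 1ℤ) * (1ℤ * s))
        lem₂ = solve-∀

    -- With i + i′ = n - 1, the eigenvalue root ∣M∣^(n-1) q^i equals d q^(-i′), which turns (d -
    -- λ′)/2 into the stated constant.
    upperℚ : ∀ i i′ → suc k ≡ i ℕ.+ i′ → ∀ e j → pos 2 * pos e ≡ (d - ∣M∣ ℤ.^ suc k * Z ℤ.^ i) * pos (suc j) →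
             e /ᵣ suc j ≤ℚ c *ℚ (1ℚ -ℚ (1 /ᵣ (q ^ i′)))
    upperℚ i i′ ei e j h = Frac-≤ (Frac-/ᵣ e j) (Frac-* Frac-c (Frac-- (Frac-self 1ℚ) (Frac-/ 1 (q ^ i′) (q^>0 i′)))) (ℤP.≤-reflexive (begin
      pos e * ((pos 2 * 1ℤ) * (1ℤ * pos (q ^ i′)))                          ≡⟨ lem₁ (pos e) (pos (q ^ i′)) ⟩
      (pos 2 * pos e) * pos (q ^ i′)                                        ≡⟨ cong₂ _*_ h (pos-^ q i′) ⟩
      (d - ∣M∣ ℤ.^ suc k * Z ℤ.^ i) * pos (suc j) * Z ℤ.^ i′               ≡⟨ lem₂ d (∣M∣ ℤ.^ suc k) (Z ℤ.^ i) (pos (suc j)) (Z ℤ.^ i′) ⟩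
      (d * Z ℤ.^ i′ - ∣M∣ ℤ.^ suc k * (Z ℤ.^ i * Z ℤ.^ i′)) * pos (suc j)   ≡⟨ cong (λ z → (d * Z ℤ.^ i′ - z) * pos (suc j)) (trans (cong (∣M∣ ℤ.^ suc k *_) (trans (sym (ℤP.^-distribˡ-+-* Z i i′)) (cong (Z ℤ.^_) (sym ei)))) (sym d≡)) ⟩
      (d * Z ℤ.^ i′ - d) * pos (suc j)                                      ≡⟨ cong₂ (λ a b → (a * b - a) * pos (suc j)) (sym D≡d) (sym (pos-^ q i′)) ⟩
      (D * pos (q ^ i′) - D) * pos (suc j)                                  ≡⟨ lem₃ D (pos (q ^ i′)) (pos (suc j)) ⟩
      (1ℤ * D * (1ℤ * pos (q ^ i′) + - 1ℤ * 1ℤ)) * pos (suc j) ∎))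
      where
      open ≡-Reasoning
      lem₁ : ∀ e w → e * ((pos 2 * 1ℤ) * (1ℤ * w)) ≡ (pos 2 * e) * w
      lem₁ = solve-∀
      lem₂ : ∀ d m z j w → (d - m * z) * j * w ≡ (d * w - m * (z * w)) * j
      lem₂ = solve-∀
      lem₃ : ∀ d w j → (d * w - d) * j ≡ (1ℤ * d * (1ℤ * w + - 1ℤ * 1ℤ)) * j
      lem₃ = solve-∀

    Π : ℕ → Res
    Π = proj₁ (irreducible (suc k))

    module X = UmExtremal R loc π unif k Π (proj₂ (irreducible (suc k))) odd
    module Ch = Character residueField (suc k) Π (proj₂ (irreducible (suc k))) odd

    upper-odd : suc (suc k) % 2 ≡ 1 → iso (bip V) UmAdj ≤ℚ c *ℚ (1ℚ -ℚ (1 /ᵣ (q ^ (suc k / 2))))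
    upper-odd e = conclude (oddHalf k e) Ch.scalarCharacter
      where
      conclude : (∃ λ j → suc k ≡ j ℕ.+ j × suc k / 2 ≡ j) →
        (Odd (pos n) × ∃ λ ν → ν ≢ F.0F × (∀ v → Ch.χ (ν ·ⱽ v) ≡ - Ch.χ v)) ⊎ (Even (pos n) × (∀ u v → u ≢ F.0F → Ch.χ (u ·ⱽ v) ≡ Ch.χ v)) →
        iso (bip V) UmAdj ≤ℚ c *ℚ (1ℚ -ℚ (1 /ᵣ (q ^ (suc k / 2))))
      conclude (j , k≡ , half) (inj₁ (_ , ν , ν≢0 , χν)) = X.upper 0ℤ (X.OddDegree.hρ ν ν≢0 χν) (X.OddDegree.λ′ ν ν≢0 χν j) (*>0 (pow>0 ∣M∣>0 (suc k)) (pow>0 Z>0 j))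
        (X.OddDegree.λ² ν ν≢0 χν j k≡) (c *ℚ (1ℚ -ℚ (1 /ᵣ (q ^ (suc k / 2))))) (upperℚ j (suc k / 2) (trans k≡ (cong (j ℕ.+_) (sym half))))
      -- n = 2j + 1 is odd, so this case is excluded.
      conclude (j , k≡ , half) (inj₂ ((i , ei) , _)) = contradiction (trans (sym (trans (cong (λ z → pos (suc z)) k≡) (trans (ℤP.pos-+ 1 (j ℕ.+ j)) (cong (1ℤ +_) (ℤP.pos-+ j j))))) ei) (odd≢even (pos j) i)

    upper-even : suc (suc k) % 2 ≡ 0 → iso (bip V) UmAdj ≤ℚ c *ℚ (1ℚ -ℚ (1 /ᵣ (q ^ (suc (suc k) / 2))))
    upper-even e = conclude (evenHalf k e) Ch.scalarCharacter
      where
      conclude : (∃ λ j → k ≡ j ℕ.+ j × suc (suc k) / 2 ≡ suc j) →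
        (Odd (pos n) × ∃ λ ν → ν ≢ F.0F × (∀ v → Ch.χ (ν ·ⱽ v) ≡ - Ch.χ v)) ⊎ (Even (pos n) × (∀ u v → u ≢ F.0F → Ch.χ (u ·ⱽ v) ≡ Ch.χ v)) →
        iso (bip V) UmAdj ≤ℚ c *ℚ (1ℚ -ℚ (1 /ᵣ (q ^ (suc (suc k) / 2))))
      conclude (j , k≡ , half) (inj₁ ((i , ei) , _)) = contradiction (trans (sym ei) (trans (cong (λ z → pos (suc (suc z))) k≡)
        (trans (cong pos (cong suc (sym (ℕP.+-suc j j)))) (ℤP.pos-+ (suc j) (suc j))))) (odd≢even i (pos (suc j)))
      conclude (j , k≡ , half) (inj₂ (_ , χu)) = X.upper _ (X.EvenDegree.hρ χu) (X.EvenDegree.λ′ χu j) (*>0 (pow>0 ∣M∣>0 (suc k)) (pow>0 Z>0 j))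
        (X.EvenDegree.λ² χu j k≡) (c *ℚ (1ℚ -ℚ (1 /ᵣ (q ^ (suc (suc k) / 2))))) (upperℚ j (suc (suc k) / 2) (trans (cong suc k≡) (trans (sym (ℕP.+-suc j j)) (cong (j ℕ.+_) (sym half)))))

    -- For odd n the exponent (n-1)/2 is an integer, so √μ is rational and `lower` applies with σ
    -- equal to q^(-(n-1)/2) itself.
    equality-odd : suc (suc k) % 2 ≡ 1 → iso (bip V) UmAdj ≡ c *ℚ (1ℚ -ℚ (1 /ᵣ (q ^ (suc k / 2))))
    equality-odd e = ℚP.≤-antisym (upper-odd e) (lower (1 /ᵣ (q ^ i)) (Frac-≤ (Frac-self 0ℚ) Fσ (ℤ.+≤+ z≤n))
        (Frac-≤ (Frac-/ 1 (q ^ suc k) (q^>0 (suc k))) (Frac-* Fσ Fσ) (ℤP.≤-reflexive (trans (ℤP.*-identityˡ _) (trans square (sym (ℤP.*-identityˡ _)))))))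
      where
      i : ℕ
      i = suc k / 2
      Fσ : Frac (1 /ᵣ (q ^ i)) 1ℤ (pos (q ^ i))
      Fσ = Frac-/ 1 (q ^ i) (q^>0 i)
      square : pos (q ^ i) * pos (q ^ i) ≡ pos (q ^ suc k)
      square = trans (sym (ℤP.pos-* (q ^ i) (q ^ i))) (cong pos (trans (sym (ℕP.^-distribˡ-+-* q i i)) (cong (q ^_)
        (let j , k≡ , half = oddHalf k e in trans (cong₂ ℕ._+_ half half) (sym k≡)))))

  module Um0Bounds (k : ℕ) where
    open Um0Graph R loc prin π unif k using (n; V; d; μ; module Ker; psd; ∣V∣>0; isoLower)

    M′ : ℤ
    M′ = ∣M∣ ℤ.^ suc k

    c A₀ : ℚ
    c = ½ *ℚ ℕ→ℚ (q ^ (suc k ℕ.* (ℓ ∸ 1)))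
    A₀ = (q ^ suc (suc k) ∸ 1) /ᵣ (q ∸ 1)

    Frac-c : Frac c (1ℤ * M′) (pos 2 * 1ℤ)
    Frac-c = subst (λ z → Frac c (1ℤ * z) (pos 2 * 1ℤ)) (pos-M (suc k)) (Frac-* (Frac-self ½) (Frac-ℕ (q ^ (suc k ℕ.* (ℓ ∸ 1)))))

    pos-∸1 : ∀ a → 0 ℕ.< a → pos (a ∸ 1) ≡ pos a - 1ℤ
    pos-∸1 (suc a) _ = trans (lem (pos a)) (cong (_- 1ℤ) (sym (ℤP.pos-+ 1 a)))
      where
      lem : ∀ z → z ≡ (1ℤ + z) - 1ℤ
      lem = solve-∀

    q>0 : 0 ℕ.< q
    q>0 = ℤP.drop‿+<+ Z>0

    -- The common factor q - 1 is left in place, so that numerator and denominator match the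
    -- definition of A₀ while θ appears for comparison with d.
    Frac-A : Frac A₀ ((Z - 1ℤ) * θ (suc (suc k))) (Z - 1ℤ)
    Frac-A = subst₂ (Frac A₀) (trans (pos-∸1 (q ^ suc (suc k)) (q^>0 (suc (suc k)))) (trans (cong (_- 1ℤ) (pos-^ q (suc (suc k)))) (sym (θ-geometric (suc (suc k)))))) (pos-∸1 q q>0)
      (Frac-/ (q ^ suc (suc k) ∸ 1) (q ∸ 1) (ℤP.drop‿+<+ (subst (0ℤ ℤ.<_) (sym (pos-∸1 q q>0)) Z-1>0)))

    lower : ∀ σ → 0ℚ ≤ℚ σ → ℕ→ℚ (q ^ suc k) ≤ℚ σ *ℚ σ → c *ℚ (A₀ -ℚ σ) ≤ℚ iso (bip V) Um0Adj
    -- Here μ = M′² q^(n-2), so M′ σ is at least √μ.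
    lower σ σ≥0 hσ = isoLower μ (Ker.spectral psd) ∣V∣>0 (M′ * r) s (*>0 (pow>0 ∣M∣>0 (suc k)) r>0) (ℤP.<⇒≤ s>0) μ≤ (c *ℚ (A₀ -ℚ σ)) toℚ
      where
      r s y t : ℤ
      r = ℚ.↥ σ
      s = ℚ.↧ σ
      y = Z ℤ.^ suc k
      t = θ (suc (suc k))
      s>0 : 0ℤ ℤ.< s
      s>0 = Frac.D>0 (Frac-self σ)
      h : y * (s * s) ℤ.≤ (r * r) * 1ℤ
      h = subst (λ z → z * (s * s) ℤ.≤ (r * r) * 1ℤ) (pos-^ q (suc k)) (Frac-≤⁻ (Frac-ℕ (q ^ suc k)) (Frac-* (Frac-self σ) (Frac-self σ)) hσ)
      r>0 : 0ℤ ℤ.< r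
      r>0 = numerator>0 σ y σ≥0 (pow>0 Z>0 (suc k)) (subst (y * (s * s) ℤ.≤_) (ℤP.*-identityʳ (r * r)) h)
      μ≤ : s * s * μ ℤ.≤ (M′ * r) * (M′ * r)
      μ≤ = subst₂ ℤ._≤_ (lem₁ s y M′) (lem₂ r M′) (ℤP.*-monoʳ-≤-nonNeg (M′ * M′) ⦃ ℤ.nonNegative (i²≥0 M′) ⦄ h)
        where
        lem₁ : ∀ s y m → y * (s * s) * (m * m) ≡ s * s * ((m * m) * y)
        lem₁ = solve-∀
        lem₂ : ∀ r m → (r * r) * 1ℤ * (m * m) ≡ (m * r) * (m * r)
        lem₂ = solve-∀
      toℚ : ∀ e j → (s * d - M′ * r) * pos (suc j) ℤ.≤ pos 2 * s * pos e → c *ℚ (A₀ -ℚ σ) ≤ℚ e /ᵣ suc j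
      toℚ e j b = Frac-≤ (Frac-* Frac-c (Frac-- Frac-A (Frac-self σ))) (Frac-/ᵣ e j)
        (subst₂ ℤ._≤_ (lem₁ s M′ t r (pos (suc j)) (Z - 1ℤ)) (lem₂ s (pos e) (Z - 1ℤ)) (ℤP.*-monoʳ-≤-nonNeg (Z - 1ℤ) ⦃ ℤ.nonNegative (ℤP.<⇒≤ Z-1>0) ⦄ b))
        where
        lem₁ : ∀ s m t r j z → (s * (m * t) - m * r) * j * z ≡ (1ℤ * m * (z * t * s + - r * z)) * j
        lem₁ = solve-∀
        lem₂ : ∀ s e z → pos 2 * s * e * z ≡ e * ((pos 2 * 1ℤ) * (z * s))
        lem₂ = solve-∀

    Π : ℕ → Res
    Π = proj₁ (irreducible (suc (suc k)))

    module Ch = Character residueField (suc (suc k)) Π (proj₂ (irreducible (suc (suc k)))) odd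

    -- For even n the number q^(n/2-1) is an integer with square q^(n-2), so it may serve as σ in
    -- `lower`, and the cut given by χ has the same ratio.
    equality-even : suc (suc (suc k)) % 2 ≡ 0 → iso (bip V) Um0Adj ≡ c *ℚ (A₀ -ℚ ℕ→ℚ (q ^ (suc (suc (suc k)) / 2 ∸ 1)))
    equality-even e = conclude (evenHalf (suc k) e) Ch.scalarCharacter
      where
      conclude : (∃ λ j → suc k ≡ j ℕ.+ j × suc (suc (suc k)) / 2 ≡ suc j) →
        (Odd (pos n) × ∃ λ ν → ν ≢ F.0F × (∀ v → Ch.χ (ν ·ⱽ v) ≡ - Ch.χ v)) ⊎ (Even (pos n) × (∀ u v → u ≢ F.0F → Ch.χ (u ·ⱽ v) ≡ Ch.χ v)) →
        iso (bip V) Um0Adj ≡ c *ℚ (A₀ -ℚ ℕ→ℚ (q ^ (suc (suc (suc k)) / 2 ∸ 1)))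
      conclude (j , k≡ , half) (inj₁ ((i , ei) , _)) = contradiction (trans (sym ei) (trans (cong (λ z → pos (suc (suc z))) k≡)
        (trans (cong pos (cong suc (sym (ℕP.+-suc j j)))) (ℤP.pos-+ (suc j) (suc j))))) (odd≢even i (pos (suc j)))
      conclude (j , k≡ , half) (inj₂ (_ , χu)) = trans (ℚP.≤-antisym upperBound lowerBound) (cong (λ i → c *ℚ (A₀ -ℚ ℕ→ℚ (q ^ i))) (sym (cong (_∸ 1) half)))
        where
        module X = Um0Extremal R loc prin π unif k Π (proj₂ (irreducible (suc (suc k)))) odd χu
        w : ℤ
        w = pos (q ^ j)
        Fσ : Frac (ℕ→ℚ (q ^ j)) w 1ℤ
        Fσ = Frac-ℕ (q ^ j)
        square : w * w ≡ pos (q ^ suc k)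
        square = trans (sym (ℤP.pos-* (q ^ j) (q ^ j))) (cong pos (trans (sym (ℕP.^-distribˡ-+-* q j j)) (cong (q ^_) (sym k≡))))
        lowerBound : c *ℚ (A₀ -ℚ ℕ→ℚ (q ^ j)) ≤ℚ iso (bip V) Um0Adj
        lowerBound = lower (ℕ→ℚ (q ^ j)) (Frac-≤ (Frac-self 0ℚ) Fσ (subst₂ ℤ._≤_ refl (sym (ℤP.*-identityʳ w)) (ℤ.+≤+ z≤n)))
          (Frac-≤ (Frac-ℕ (q ^ suc k)) (Frac-* Fσ Fσ) (ℤP.≤-reflexive (trans (ℤP.*-identityʳ (pos (q ^ suc k))) (trans (sym square) (sym (ℤP.*-identityʳ (w * w)))))))
        upperBound : iso (bip V) Um0Adj ≤ℚ c *ℚ (A₀ -ℚ ℕ→ℚ (q ^ j))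
        upperBound = X.upper j k≡ (c *ℚ (A₀ -ℚ ℕ→ℚ (q ^ j))) λ e i h → Frac-≤ (Frac-/ᵣ e i) (Frac-* Frac-c (Frac-- Frac-A Fσ)) (ℤP.≤-reflexive (begin
            pos e * ((pos 2 * 1ℤ) * ((Z - 1ℤ) * 1ℤ))                                       ≡⟨ lem₁ (pos e) (Z - 1ℤ) ⟩
            (pos 2 * pos e) * (Z - 1ℤ)                                                     ≡⟨ cong (_* (Z - 1ℤ)) (trans h (cong (λ v → (d - M′ * v) * pos (suc i)) (sym (pos-^ q j)))) ⟩
            (M′ * θ (suc (suc k)) - M′ * w) * pos (suc i) * (Z - 1ℤ)                       ≡⟨ lem₂ M′ (θ (suc (suc k))) w (pos (suc i)) (Z - 1ℤ) ⟩
            (1ℤ * M′ * ((Z - 1ℤ) * θ (suc (suc k)) * 1ℤ + - w * (Z - 1ℤ))) * pos (suc i) ∎))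
          where
          open ≡-Reasoning
          lem₁ : ∀ e z → e * ((pos 2 * 1ℤ) * (z * 1ℤ)) ≡ (pos 2 * e) * z
          lem₁ = solve-∀
          lem₂ : ∀ m t w i z → (m * t - m * w) * i * z ≡ (1ℤ * m * (z * t * 1ℤ + - w * z)) * i
          lem₂ = solve-∀

theorem1p9 : (R : FinCommRing) → let open FinCommRing R in
    IsFiniteValuationRing → (π : Elt) → IsUniformizer π →
    (ℓ : ℕ) → IsNilpotencyDegree π ℓ →
    let q = residueSize π in
    q % 2 ≡ 1 →
    ((n : ℕ) → 2 ≤ n →
      let X = iso (bip (unimodular n)) UmAdj
          c = ½ *ℚ ℕ→ℚ (q ^ ((n ∸ 1) ℕ.* ℓ))
      in (n % 2 ≡ 1 → X ≡ c *ℚ (1ℚ -ℚ (1 /ᵣ (q ^ ((n ∸ 1) / 2)))))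
       × (n % 2 ≡ 0 →
            (X ≤ℚ c *ℚ (1ℚ -ℚ (1 /ᵣ (q ^ (n / 2)))))
          × ((s : ℚ) → 0ℚ ≤ℚ s → (1 /ᵣ (q ^ (n ∸ 1))) ≤ℚ (s *ℚ s) →
               c *ℚ (1ℚ -ℚ s) ≤ℚ X)))
    ×
    ((n : ℕ) → 3 ≤ n →
      let Y = iso (bip (unimodularModUnits n)) Um0Adj
          c = ½ *ℚ ℕ→ℚ (q ^ ((n ∸ 2) ℕ.* (ℓ ∸ 1)))
          A = (q ^ (n ∸ 1) ∸ 1) /ᵣ (q ∸ 1)
      in (n % 2 ≡ 1 →
            (s : ℚ) → 0ℚ ≤ℚ s → ℕ→ℚ (q ^ (n ∸ 2)) ≤ℚ (s *ℚ s) →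
              c *ℚ (A -ℚ s) ≤ℚ Y)
       × (n % 2 ≡ 0 → Y ≡ c *ℚ (A -ℚ ℕ→ℚ (q ^ (n / 2 ∸ 1)))))
theorem1p9 R (loc , prin) π unif ℓ nil oddq =
    (λ { (suc (suc k)) (s≤s (s≤s _)) → equality-odd k , λ e → upper-even k e , UmBounds.lower k })
  , (λ { (suc (suc (suc k))) (s≤s (s≤s (s≤s _))) → (λ _ → Um0Bounds.lower k) , Um0Bounds.equality-even k })
  where
  open Main R loc prin π unif ℓ nil oddq
  open UmBounds using (equality-odd; upper-even)
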